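{- Let $K$ be a quadratic field with embeddings into $\mathbb{R}$ and $\mathbb{Q}_2$, and let $\alpha\in K\setminus\mathbb{Q}$. With $p'_n,q'_n$ as defined in the context, there exist $\gamma,C,C'\in\mathbb{R}_{>0}$ with $0<\gamma<1$ such that for all $n\in\mathbb{Z}_{>0}$, $$\left|\alpha_\infty-\frac{p'_n}{q'_n}\right|\le\frac{C}{|q'_n|^{2-2\gamma}}\quad\text{and}\quad\left|\alpha_{\langle 2\rangle}-\frac{p'_n}{q'_n}\right|_2\le\frac{C'}{|q'_n|^{2\gamma}}.$$
   Context: $K$ is a quadratic field with fixed field embeddings $\sigma_\infty:K\to\mathbb{R}$ and $\sigma_2:K\to\mathbb{Q}_2$. For $\alpha\in K$ write $\alpha_\infty=\sigma_\infty(\alpha)$, $\alpha_{\langle 2\rangle}=\sigma_2(\alpha)$. $v_2$ is the $2$-adic valuation ($v_2(0)=+\infty$) and $|u|_2=2^{ -v_2(u)}$; $|\cdot|$ is the real absolute value. For $u=\sum_{n}c_n2^n\in\mathbb{Q}_2$ with digits $c_n\in\{0,1\}$ ($c_n=0$ for $n<v_2(u)$), put $\lfloor u\rfloor_2=\sum_{n\le 0}c_n2^n\in\mathbb{Z}[1/2]$. For $\alpha\in K$ let $b^{(0)}(\alpha)=2m+\lfloor\alpha_{\langle 2\rangle}\rfloor_2$, where $m$ is the smallest among the integers $i$ minimizing $|\alpha_\infty-2i-\lfloor\alpha_{\langle 2\rangle}\rfloor_2|$; let $b^{(1)}(\alpha)=m'+\lfloor\alpha_{\langle 2\rangle}\rfloor_2$,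 where $m'$ is the smallest among the integers $i$ minimizing $|\alpha_\infty-i-\lfloor\alpha_{\langle 2\rangle}\rfloor_2|$. For $\epsilon\in\{0,1\}$ let $F_{2,\epsilon}(\alpha)=\frac{1}{\alpha-b^{(\epsilon)}(\alpha)}$. Algorithm: $\alpha_0=\alpha$; for $n\ge0$ put $\epsilon=0$ if $n$ is even and $\epsilon=1$ if $n$ is odd, $b_n(\alpha)=b^{(\epsilon)}(\alpha_n)$ and $\alpha_{n+1}=F_{2,\epsilon}(\alpha_n)$ (for $\alpha\in K\setminus\mathbb{Q}$ the algorithm never halts). Convergents: $p_{ -1}=1$, $q_{ -1}=0$ and, for $n\ge0$, $$\begin{pmatrix} p_n & p_{n-1} \\ q_n & q_{n-1} \end{pmatrix}=\begin{pmatrix} b_0(\alpha) & 1 \\ 1 & 0 \end{pmatrix}\cdots\begin{pmatrix} b_n(\alpha) & 1 \\ 1 & 0 \end{pmatrix};$$ $q_n\ne0$ for $n\ge0$. Put $s_0=1$ if $v_2(b_0(\alpha))>0$ and $s_0=0$ if $v_2(b_0(\alpha))\le0$, and $p'_n=2^{ -\sum_{s=s_0}^n v_2(b_s(\alpha))}p_n$, $q'_n=2^{ -\sum_{s=s_0}^n v_2(b_s(\alpha))}q_n$; these are coprime integers with $p'_n/q'_n=p_n/q_n$. -}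

module Defs where

open import Algebra.Bundles using (CommutativeRing)
open import Algebra.Bundles.Raw using (RawRing)
open import Algebra.Morphism.Structures using (module RingMorphisms)
open import Data.Bool.Base using (if_then_else_)
open import Data.Fin.Base using (Fin; toℕ) renaming (zero to 0F; suc to sucF)
open import Data.Integer.Base as ℤ using (ℤ; +_; -[1+_]; 0ℤ)
import Data.Integer.Properties as ℤ
import Data.Integer.Solver as ℤSolver
open import Data.List.Base using (applyUpTo; drop; foldr)
open import Data.Nat.Base as ℕ using (ℕ; zero; suc)
open import Data.Nat.DivMod using (_mod_)
open import Data.Nat.Divisibility using (divides; _∣?_)
import Data.Nat.Properties as ℕ
import Data.Nat.Solver as ℕSolver
open import Data.Product using (_×_; _,_; proj₁; proj₂; Σ-syntax; ∃-syntax)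
open import Data.Rational.Base as ℚ using (ℚ; 0ℚ; 1ℚ; ½; ∣_∣; ↥_; ↧ₙ_; _≤_; _<_; _+_; _-_; _*_; -_)
import Data.Rational.Properties as ℚ
import Data.Rational.Unnormalised.Base as ℚᵘ
import Data.Rational.Unnormalised.Properties as ℚᵘ
open import Data.Rational.Solver using (module +-*-Solver)
open import Data.Sum.Base using (inj₁; inj₂)
open import Level using (0ℓ; _⊔_) renaming (suc to lsuc)
open import Relation.Binary.PropositionalEquality using (_≡_; refl; sym; trans; cong; cong₂; subst; subst₂)
open import Relation.Nullary using (¬_; yes; no; does)
open import Relation.Nullary.Construct.Add.Supremum using (_⁺; ⊤⁺; [_])
open import Relation.Unary using (Decidable)

module ℚ-Exp where
  open import Algebra.Properties.CommutativeSemiring.Exp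
    (CommutativeRing.commutativeSemiring ℚ.+-*-commutativeRing) public

open ℚ-Exp using (_^_)

module RationalLemmas where
  nn : ∀ {x} → 0ℚ ≤ x → ℚ.NonNegative x
  nn = ℚ.nonNegative

  *-mono-≤ : ∀ {a b c d} → 0ℚ ≤ a → 0ℚ ≤ c → a ≤ b → c ≤ d → a * c ≤ b * d
  *-mono-≤ {a} {b} {c} {d} 0≤a 0≤c a≤b c≤d = ℚ.≤-trans
    (ℚ.*-monoʳ-≤-nonNeg c {{nn 0≤c}} a≤b)
    (ℚ.*-monoˡ-≤-nonNeg b {{nn (ℚ.≤-trans 0≤a a≤b)}} c≤d)

  *-nonneg : ∀ {a b} → 0ℚ ≤ a → 0ℚ ≤ b → 0ℚ ≤ a * b
  *-nonneg {a} {b} p q = subst (_≤ a * b) (ℚ.*-zeroˡ 0ℚ) (*-mono-≤ ℚ.≤-refl ℚ.≤-refl p q)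

  *-pos : ∀ {a b} → 0ℚ < a → 0ℚ < b → 0ℚ < a * b
  *-pos {a} {b} p q = ℚ.positive⁻¹ (a * b) {{ℚ.pos*pos⇒pos a {{ℚ.positive p}} b {{ℚ.positive q}}}}

  *-mono-<-pos : ∀ {a b c d} → 0ℚ ≤ a → 0ℚ < d → a < b → c ≤ d → a * c < b * d
  *-mono-<-pos {a} {b} {c} {d} 0≤a 0<d a<b c≤d = ℚ.≤-<-trans
    (ℚ.*-monoˡ-≤-nonNeg a {{nn 0≤a}} c≤d)
    (ℚ.*-monoˡ-<-pos d {{ℚ.positive 0<d}} a<b)

  0<1 : 0ℚ < 1ℚ
  0<1 = ℚ.positive⁻¹ 1ℚ

  0≤1 : 0ℚ ≤ 1ℚ
  0≤1 = ℚ.<⇒≤ 0<1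

  0<½ : 0ℚ < ½
  0<½ = ℚ.positive⁻¹ ½

  half+half : ∀ x → ½ * x + ½ * x ≡ x
  half+half = solve 1 (λ x → con ½ :* x :+ con ½ :* x := x) refl
    where open +-*-Solver

  p≤∣p∣ : ∀ p → p ≤ ∣ p ∣
  p≤∣p∣ p with ℚ.≤-total 0ℚ p
  ... | inj₁ 0≤p = ℚ.≤-reflexive (sym (ℚ.0≤p⇒∣p∣≡p 0≤p))
  ... | inj₂ p≤0 = ℚ.≤-trans p≤0 (ℚ.0≤∣p∣ p)

  ∣p-q∣-sym : ∀ p q → ∣ p - q ∣ ≡ ∣ q - p ∣
  ∣p-q∣-sym p q = trans (sym (ℚ.∣-p∣≡∣p∣ (p - q))) (cong ∣_∣
    (solve 2 (λ p q → :- (p :- q) := q :- p) refl p q))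
    where open +-*-Solver

  ∣∣<⇒< : ∀ {x y ε} → ∣ x - y ∣ < ε → x < y + ε
  ∣∣<⇒< {x} {y} {ε} h = subst (_< y + ε)
    (solve 2 (λ x y → y :+ (x :- y) := x) refl x y)
    (ℚ.+-monoʳ-< y (ℚ.≤-<-trans (p≤∣p∣ _) h))
    where open +-*-Solver

  <⇒∣∣< : ∀ {x y ε} → x < y + ε → y < x + ε → ∣ x - y ∣ < ε
  <⇒∣∣< {x} {y} {ε} h k with ℚ.∣p∣≡p∨∣p∣≡-p (x - y)
  ... | inj₁ e = subst₂ _<_ (sym e)
        (solve 2 (λ y ε → y :+ ε :- y := ε) refl y ε) (ℚ.+-monoˡ-< (- y) h)
    where open +-*-Solver
  ... | inj₂ e = subst₂ _<_
        (trans (solve 2 (λ x y → y :- x := :- (x :- y)) refl x y) (sym e))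
        (solve 2 (λ y ε → y :+ ε :- y := ε) refl x ε) (ℚ.+-monoˡ-< (- x) k)
    where open +-*-Solver

  ∣∣p∣-∣q∣∣≤∣p-q∣ : ∀ p q {ε} → ∣ p - q ∣ < ε → ∣ ∣ p ∣ - ∣ q ∣ ∣ < ε
  ∣∣p∣-∣q∣∣≤∣p-q∣ p q {ε} h = <⇒∣∣< (go p q h) (go q p (subst (_< ε) (∣p-q∣-sym p q) h))
    where
    go : ∀ p q → ∣ p - q ∣ < ε → ∣ p ∣ < ∣ q ∣ + ε
    go p q h = ℚ.≤-<-trans
      (subst (λ z → ∣ z ∣ ≤ ∣ q ∣ + ∣ p - q ∣) (solve 2 (λ p q → q :+ (p :- q) := p) refl p q)
        (ℚ.∣p+q∣≤∣p∣+∣q∣ q (p - q)))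
      (ℚ.+-monoʳ-< ∣ q ∣ h)
      where open +-*-Solver

  arch : ∀ ε → 0ℚ < ε → ∃[ N ] ∀ n → N ℕ.≤ n → + 1 ℚ./ suc n < ε
  arch ε@(ℚ.mkℚ (+ zero) d c) (ℚ.*<* (ℤ.+<+ ()))
  arch ε@(ℚ.mkℚ (+ suc a) d c) _ = suc d , λ n d<n → ℚ.toℚᵘ-cancel-<
    (ℚᵘ.<-respˡ-≃ (ℚᵘ.≃-sym (ℚ.toℚᵘ-fromℚᵘ (ℚᵘ.mkℚᵘ (+ 1) n)))
      (ℚᵘ.*<* (ℤ.+<+ (ℕ.≤-trans (ℕ.s≤s (ℕ.≤-trans (ℕ.≤-reflexive (ℕ.*-identityˡ (suc d))) d<n))
        (ℕ.m≤m+n (suc n) (a ℕ.* suc n))))))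
  arch ε@(ℚ.mkℚ -[1+ a ] d c) (ℚ.*<* ())

  ≤numerator : ∀ x → x ≤ + ℤ.∣ ↥ x ∣ ℚ./ 1
  ≤numerator x@(ℚ.mkℚ a d c) = ℚ.toℚᵘ-cancel-≤
    (ℚᵘ.≤-respʳ-≃ (ℚᵘ.≃-sym (ℚ.toℚᵘ-fromℚᵘ (ℚᵘ.mkℚᵘ (+ ℤ.∣ a ∣) 0)))
      (ℚᵘ.*≤* (go a)))
    where
    go : ∀ a → a ℤ.* (+ 1) ℤ.≤ + ℤ.∣ a ∣ ℤ.* + suc d
    go (+ n) rewrite ℤ.*-identityʳ (+ n) = subst (+ n ℤ.≤_) (ℤ.pos-* n (suc d)) (ℤ.+≤+ (ℕ.m≤m*n n (suc d)))
    go -[1+ n ] rewrite ℤ.*-identityʳ -[1+ n ] = subst (-[1+ n ] ℤ.≤_) (ℤ.pos-* (suc n) (suc d)) ℤ.-≤+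

  module _ (ε M : ℚ) (0<ε : 0ℚ < ε) (0<M : 0ℚ < M) where
    abstract
      quot : ℚ
      quot = (ε ℚ.÷ M) {{ℚ.>-nonZero 0<M}}

      M*quot : M * quot ≡ ε
      M*quot = trans (solve 3 (λ M ε i → M :* (ε :* i) := ε :* (M :* i)) refl M ε _)
        (trans (cong (ε *_) (ℚ.*-inverseʳ M {{ℚ.>-nonZero 0<M}})) (ℚ.*-identityʳ ε))
        where open +-*-Solver

      quot>0 : 0ℚ < quot
      quot>0 = *-pos 0<ε (ℚ.positive⁻¹ _ {{ℚ.1/pos⇒pos M {{ℚ.positive 0<M}}}})

open RationalLemmas

IsCauchy : (ℕ → ℚ) → Set
IsCauchy x = ∀ ε → 0ℚ < ε → ∃[ N ] ∀ m n → N ℕ.≤ m → N ℕ.≤ n → ∣ x m - x n ∣ < ε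

record ℝ : Set where
  constructor mkℝ
  field
    seq    : ℕ → ℚ
    cauchy : IsCauchy seq

open ℝ public

infix 4 _≈ᴿ_ _≤ᴿ_ _<ᴿ_

_≈ᴿ_ : ℝ → ℝ → Set
x ≈ᴿ y = ∀ ε → 0ℚ < ε → ∃[ N ] ∀ n → N ℕ.≤ n → ∣ seq x n - seq y n ∣ < ε

_≤ᴿ_ : ℝ → ℝ → Set
x ≤ᴿ y = ∀ ε → 0ℚ < ε → ∃[ N ] ∀ n → N ℕ.≤ n → seq x n < seq y n + ε

_<ᴿ_ : ℝ → ℝ → Set
x <ᴿ y = ∃[ ε ] 0ℚ < ε × ∃[ N ] ∀ n → N ℕ.≤ n → seq x n + ε < seq y n

fromℚ : ℚ → ℝ
fromℚ q = mkℝ (λ _ → q) λ ε 0<ε → 0 , λ _ _ _ _ →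
  subst (λ z → ∣ z ∣ < ε) (sym (ℚ.+-inverseʳ q)) 0<ε

infixl 6 _+ᴿ_ _-ᴿ_
infixl 7 _*ᴿ_
infix  8 -ᴿ_

module CauchyLemmas where
  +-cauchy : ∀ x y → IsCauchy x → IsCauchy y → IsCauchy (λ n → x n + y n)
  +-cauchy x y cx cy ε 0<ε = N ℕ.⊔ N′ , λ m n p q →
    subst₂ _<_ (cong ∣_∣ refl) (half+half ε)
      (ℚ.≤-<-trans (subst (λ z → ∣ z ∣ ≤ ∣ x m - x n ∣ + ∣ y m - y n ∣)
          (solve 4 (λ a b c d → (a :- b) :+ (c :- d) := (a :+ c) :- (b :+ d)) refl (x m) (x n) (y m) (y n))
          (ℚ.∣p+q∣≤∣p∣+∣q∣ (x m - x n) (y m - y n)))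
        (ℚ.+-mono-<
          (f m n (ℕ.m⊔n≤o⇒m≤o N N′ p) (ℕ.m⊔n≤o⇒m≤o N N′ q))
          (g m n (ℕ.m⊔n≤o⇒n≤o N N′ p) (ℕ.m⊔n≤o⇒n≤o N N′ q))))
    where
    open +-*-Solver
    0<δ = *-pos 0<½ 0<ε
    N = proj₁ (cx (½ * ε) 0<δ)
    N′ = proj₁ (cy (½ * ε) 0<δ)
    f = proj₂ (cx (½ * ε) 0<δ)
    g = proj₂ (cy (½ * ε) 0<δ)

  neg-cauchy : ∀ x → IsCauchy x → IsCauchy (λ n → - x n)
  neg-cauchy x cx ε 0<ε with cx ε 0<ε
  ... | N , f = N , λ m n p q → subst (_< ε)
    (trans (sym (ℚ.∣-p∣≡∣p∣ (x m - x n)))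
      (cong ∣_∣ (solve 2 (λ a b → :- (a :- b) := :- a :- :- b) refl (x m) (x n))))
    (f m n p q)
    where open +-*-Solver

  abs-cauchy : ∀ x → IsCauchy x → IsCauchy (λ n → ∣ x n ∣)
  abs-cauchy x cx ε 0<ε with cx ε 0<ε
  ... | N , f = N , λ m n p q → ∣∣p∣-∣q∣∣≤∣p-q∣ (x m) (x n) (f m n p q)

  bounded : ∀ x → IsCauchy x → ∃[ B ] 0ℚ < B × ∃[ N ] ∀ n → N ℕ.≤ n → ∣ x n ∣ ≤ B
  bounded x cx with cx 1ℚ 0<1
  ... | N , f = ∣ x N ∣ + 1ℚ ,
    ℚ.+-mono-≤-< (ℚ.0≤∣p∣ (x N)) 0<1 ,
    N , λ n p → ℚ.<⇒≤ (∣∣<⇒< (∣∣p∣-∣q∣∣≤∣p-q∣ (x n) (x N) (f n N p ℕ.≤-refl)))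

  *-split : ∀ a b c d → a * (c - d) + d * (a - b) ≡ a * c - b * d
  *-split = solve 4 (λ a b c d → a :* (c :- d) :+ d :* (a :- b) := a :* c :- b :* d) refl
    where open +-*-Solver

  *-part : ∀ ε M (0<ε : 0ℚ < ε) (0<M : 0ℚ < M) u v →
           ∣ u ∣ ≤ M → ∣ v ∣ < quot ε M 0<ε 0<M → ∣ u * v ∣ < ε
  *-part ε M 0<ε 0<M u v ∣u∣≤M ∣v∣<δ = subst₂ _<_ (sym (ℚ.∣p*q∣≡∣p∣*∣q∣ u v)) (M*quot ε M 0<ε 0<M)
    (ℚ.≤-<-trans
      (ℚ.*-monoʳ-≤-nonNeg ∣ v ∣ {{nn (ℚ.0≤∣p∣ v)}} ∣u∣≤M)
      (ℚ.*-monoʳ-<-pos M {{ℚ.positive 0<M}} ∣v∣<δ))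

  *-close : ∀ {ε} a b c d → ∣ a * (c - d) ∣ < ½ * ε → ∣ d * (a - b) ∣ < ½ * ε → ∣ a * c - b * d ∣ < ε
  *-close {ε} a b c d h k = subst (_< ε) (cong ∣_∣ (*-split a b c d))
    (subst (∣ a * (c - d) + d * (a - b) ∣ <_) (half+half ε)
      (ℚ.≤-<-trans (ℚ.∣p+q∣≤∣p∣+∣q∣ (a * (c - d)) (d * (a - b))) (ℚ.+-mono-< h k)))

  *-cauchy : ∀ x y → IsCauchy x → IsCauchy y → IsCauchy (λ n → x n * y n)
  *-cauchy x y cx cy ε 0<ε = go (bounded x cx) (bounded y cy)
    where
    0<δ = *-pos 0<½ 0<ε
    go : (∃[ A ] 0ℚ < A × ∃[ N ] ∀ n → N ℕ.≤ n → ∣ x n ∣ ≤ A) →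
         (∃[ B ] 0ℚ < B × ∃[ N ] ∀ n → N ℕ.≤ n → ∣ y n ∣ ≤ B) →
         ∃[ N ] ∀ m n → N ℕ.≤ m → N ℕ.≤ n → ∣ x m * y m - x n * y n ∣ < ε
    go (A , 0<A , N₁ , fA) (B , 0<B , N₂ , fB)
      with cx (quot (½ * ε) B 0<δ 0<B) (quot>0 (½ * ε) B 0<δ 0<B)
         | cy (quot (½ * ε) A 0<δ 0<A) (quot>0 (½ * ε) A 0<δ 0<A)
    ... | N₃ , f | N₄ , g = (N₁ ℕ.⊔ N₂) ℕ.⊔ (N₃ ℕ.⊔ N₄) , λ m n p q →
      *-close (x m) (x n) (y m) (y n)
        (*-part (½ * ε) A 0<δ 0<A (x m) (y m - y n)
          (fA m (ℕ.m⊔n≤o⇒m≤o N₁ N₂ (ℕ.m⊔n≤o⇒m≤o _ (N₃ ℕ.⊔ N₄) p)))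
          (g m n (ℕ.m⊔n≤o⇒n≤o N₃ N₄ (ℕ.m⊔n≤o⇒n≤o (N₁ ℕ.⊔ N₂) _ p))
                 (ℕ.m⊔n≤o⇒n≤o N₃ N₄ (ℕ.m⊔n≤o⇒n≤o (N₁ ℕ.⊔ N₂) _ q))))
        (*-part (½ * ε) B 0<δ 0<B (y n) (x m - x n)
          (fB n (ℕ.m⊔n≤o⇒n≤o N₁ N₂ (ℕ.m⊔n≤o⇒m≤o _ (N₃ ℕ.⊔ N₄) q)))
          (f m n (ℕ.m⊔n≤o⇒m≤o N₃ N₄ (ℕ.m⊔n≤o⇒n≤o (N₁ ℕ.⊔ N₂) _ p))
                 (ℕ.m⊔n≤o⇒m≤o N₃ N₄ (ℕ.m⊔n≤o⇒n≤o (N₁ ℕ.⊔ N₂) _ q))))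

open CauchyLemmas

_+ᴿ_ : ℝ → ℝ → ℝ
mkℝ x cx +ᴿ mkℝ y cy = mkℝ (λ n → x n + y n) (+-cauchy x y cx cy)

-ᴿ_ : ℝ → ℝ
-ᴿ mkℝ x cx = mkℝ (λ n → - x n) (neg-cauchy x cx)

_-ᴿ_ : ℝ → ℝ → ℝ
x -ᴿ y = x +ᴿ (-ᴿ y)

_*ᴿ_ : ℝ → ℝ → ℝ
mkℝ x cx *ᴿ mkℝ y cy = mkℝ (λ n → x n * y n) (*-cauchy x y cx cy)

∣_∣ᴿ : ℝ → ℝ
∣ mkℝ x cx ∣ᴿ = mkℝ (λ n → ∣ x n ∣) (abs-cauchy x cx)

0ᴿ 1ᴿ 2ᴿ : ℝ
0ᴿ = fromℚ 0ℚ
1ᴿ = fromℚ 1ℚ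
2ᴿ = fromℚ (+ 2 ℚ./ 1)

ℝ-rawRing : RawRing 0ℓ 0ℓ
ℝ-rawRing = record
  { Carrier = ℝ
  ; _≈_     = _≈ᴿ_
  ; _+_     = _+ᴿ_
  ; _*_     = _*ᴿ_
  ; -_      = -ᴿ_
  ; 0#      = 0ᴿ
  ; 1#      = 1ᴿ
  }

module PowerLemmas where
  1+1/ : ∀ n j → + j ℚ./ suc n + + 1 ℚ./ suc n ≡ + suc j ℚ./ suc n
  1+1/ n j = ℚ.toℚᵘ-injective (begin
    ℚ.toℚᵘ (+ j ℚ./ suc n + + 1 ℚ./ suc n)
      ≈⟨ ℚ.toℚᵘ-homo-+ (+ j ℚ./ suc n) (+ 1 ℚ./ suc n) ⟩
    ℚ.toℚᵘ (+ j ℚ./ suc n) ℚᵘ.+ ℚ.toℚᵘ (+ 1 ℚ./ suc n)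
      ≈⟨ ℚᵘ.+-cong (ℚ.toℚᵘ-fromℚᵘ (ℚᵘ.mkℚᵘ (+ j) n)) (ℚ.toℚᵘ-fromℚᵘ (ℚᵘ.mkℚᵘ (+ 1) n)) ⟩
    ℚᵘ.mkℚᵘ (+ j) n ℚᵘ.+ ℚᵘ.mkℚᵘ (+ 1) n
      ≈⟨ ℚᵘ.*≡* (solve 2 (λ j d → (j :* d :+ con (+ 1) :* d) :* d := (con (+ 1) :+ j) :* (d :* d)) refl (+ j) (+ suc n)) ⟩
    ℚᵘ.mkℚᵘ (+ suc j) n
      ≈⟨ ℚᵘ.≃-sym (ℚ.toℚᵘ-fromℚᵘ (ℚᵘ.mkℚᵘ (+ suc j) n)) ⟩
    ℚ.toℚᵘ (+ suc j ℚ./ suc n) ∎)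
    where
    open ℤSolver.+-*-Solver
    open ℚᵘ.≃-Reasoning

  n*k/n : ∀ n k → + (suc n ℕ.* k) ℚ./ suc n ≡ + k ℚ./ 1
  n*k/n n k = ℚ.fromℚᵘ-cong {ℚᵘ.mkℚᵘ (+ (suc n ℕ.* k)) n} {ℚᵘ.mkℚᵘ (+ k) 0}
    (ℚᵘ.*≡* (trans (ℤ.*-identityʳ _) (trans (ℤ.pos-* (suc n) k) (ℤ.*-comm (+ suc n) (+ k)))))

  0≤/ : ∀ j n → 0ℚ ≤ + j ℚ./ suc n
  0≤/ j n = ℚ.nonNegative⁻¹ _ {{ℚ.normalize-nonNeg j (suc n)}}

  0</ : ∀ j n → 0ℚ < + suc j ℚ./ suc n
  0</ j n = ℚ.positive⁻¹ _ {{ℚ.normalize-pos (suc j) (suc n)}}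

  ^-nonneg : ∀ {x} n → 0ℚ ≤ x → 0ℚ ≤ x ^ n
  ^-nonneg zero    0≤x = 0≤1
  ^-nonneg (suc n) 0≤x = *-nonneg 0≤x (^-nonneg n 0≤x)

  ^-pos : ∀ {x} n → 0ℚ < x → 0ℚ < x ^ n
  ^-pos zero    0<x = 0<1
  ^-pos (suc n) 0<x = *-pos 0<x (^-pos n 0<x)

  ^-mono-≤ : ∀ {x y} n → 0ℚ ≤ x → x ≤ y → x ^ n ≤ y ^ n
  ^-mono-≤ zero    0≤x x≤y = ℚ.≤-refl
  ^-mono-≤ (suc n) 0≤x x≤y = *-mono-≤ 0≤x (^-nonneg n 0≤x) x≤y (^-mono-≤ n 0≤x x≤y)

  ^-mono-< : ∀ {x y} n → 1 ℕ.≤ n → 0ℚ ≤ x → x < y → x ^ n < y ^ n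
  ^-mono-< (suc n) _ 0≤x x<y =
    *-mono-<-pos 0≤x (^-pos n (ℚ.≤-<-trans 0≤x x<y)) x<y (^-mono-≤ n 0≤x (ℚ.<⇒≤ x<y))

  1≤^ : ∀ {q} n → 1ℚ ≤ q → 1ℚ ≤ q ^ n
  1≤^ zero    1≤q = ℚ.≤-refl
  1≤^ {q} (suc n) 1≤q = subst (_≤ q * q ^ n) (ℚ.*-identityˡ 1ℚ) (*-mono-≤ 0≤1 0≤1 1≤q (1≤^ n 1≤q))

  ^-monoʳ-≤ : ∀ {q m n} → 1ℚ ≤ q → m ℕ.≤ n → q ^ m ≤ q ^ n
  ^-monoʳ-≤ {q} {m} {n} 1≤q m≤n = subst₂ _≤_
    (ℚ.*-identityʳ (q ^ m))
    (trans (sym (ℚ-Exp.^-homo-* q m (n ℕ.∸ m))) (cong (q ^_) (ℕ.m+[n∸m]≡n m≤n)))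
    (*-mono-≤ (^-nonneg m (ℚ.≤-trans 0≤1 1≤q)) 0≤1 ℚ.≤-refl (1≤^ (n ℕ.∸ m) 1≤q))

  bernoulli : ∀ h n → 0ℚ ≤ h → 1ℚ + (+ n ℚ./ 1) * h ≤ (1ℚ + h) ^ n
  bernoulli h zero 0≤h = ℚ.≤-reflexive (trans (cong (λ z → 1ℚ + z) (ℚ.*-zeroˡ h)) (ℚ.+-identityʳ 1ℚ))
  bernoulli h (suc n) 0≤h = ℚ.≤-trans
    (subst (_≤ (1ℚ + h) * (1ℚ + N * h)) lhs
      (ℚ.≤-trans (ℚ.≤-reflexive (sym (ℚ.+-identityʳ _))) (subst (1ℚ + h + N * h + 0ℚ ≤_) rhs
        (ℚ.+-monoʳ-≤ (1ℚ + h + N * h) (*-nonneg (*-nonneg (0≤/ n 0) 0≤h) 0≤h)))))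
    (*-mono-≤ (ℚ.+-mono-≤ 0≤1 0≤h)
      (ℚ.+-mono-≤ 0≤1 (*-nonneg (0≤/ n 0) 0≤h)) ℚ.≤-refl (bernoulli h n 0≤h))
    where
    N = + n ℚ./ 1
    open +-*-Solver
    lhs : 1ℚ + h + N * h ≡ 1ℚ + (+ suc n ℚ./ 1) * h
    lhs = trans (solve 2 (λ h N → con 1ℚ :+ h :+ N :* h := con 1ℚ :+ (N :+ con 1ℚ) :* h) refl h N)
      (cong (λ z → 1ℚ + z * h) (1+1/ 0 n))
    rhs : 1ℚ + h + N * h + N * h * h ≡ (1ℚ + h) * (1ℚ + N * h)
    rhs = solve 2 (λ h N → con 1ℚ :+ h :+ N :* h :+ N :* h :* h := (con 1ℚ :+ h) :* (con 1ℚ :+ N :* h)) refl h N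

  -- q ^ (p - n)/b and q ^ (p′ - n′)/b′ lie below and above u and w, and the
  -- first exponent exceeds the second by at most 1/K
  close-powers : ∀ {q u w h} K b b′ p n p′ n′ →
    1ℚ ≤ q → 0ℚ ≤ u → 0ℚ ≤ w → 0ℚ ≤ h → q ≤ (1ℚ + h) ^ K →
    1 ℕ.≤ K ℕ.* (b ℕ.* b′) →
    u ^ b * q ^ n ≤ q ^ p → q ^ p′ < w ^ b′ * q ^ n′ →
    p ℕ.* (K ℕ.* b′) ℕ.+ n′ ℕ.* (K ℕ.* b) ℕ.≤ p′ ℕ.* (K ℕ.* b) ℕ.+ n ℕ.* (K ℕ.* b′) ℕ.+ b ℕ.* b′ →
    u ≤ w * (1ℚ + h)
  close-powers {q} {u} {w} {h} K b b′ p n p′ n′ 1≤q 0≤u 0≤w 0≤h q≤ 1≤L below above exps =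
    ℚ.≮⇒≥ λ lt → ℚ.<-irrefl refl (begin-strict
      q ^ (p ℕ.* β′) * q ^ (n′ ℕ.* β)
        ≡⟨ sym (ℚ-Exp.^-homo-* q (p ℕ.* β′) (n′ ℕ.* β)) ⟩
      q ^ (p ℕ.* β′ ℕ.+ n′ ℕ.* β)
        ≤⟨ ^-monoʳ-≤ 1≤q exps ⟩
      q ^ (p′ ℕ.* β ℕ.+ n ℕ.* β′ ℕ.+ b ℕ.* b′)
        ≡⟨ trans (ℚ-Exp.^-homo-* q (p′ ℕ.* β ℕ.+ n ℕ.* β′) (b ℕ.* b′))
                 (cong (_* Q) (ℚ-Exp.^-homo-* q (p′ ℕ.* β) (n ℕ.* β′))) ⟩
      q ^ (p′ ℕ.* β) * A * Q
        ≤⟨ *-mono-≤ (*-nonneg (0≤q^ (p′ ℕ.* β)) (0≤q^ (n ℕ.* β′))) (0≤q^ (b ℕ.* b′))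
             (*-mono-≤ (0≤q^ (p′ ℕ.* β)) (0≤q^ (n ℕ.* β′)) hi ℚ.≤-refl) ℚ.≤-refl ⟩
      w ^ L * B * A * Q
        ≡⟨ solve 4 (λ x b a c → x :* b :* a :* c := x :* c :* (a :* b)) refl (w ^ L) B A Q ⟩
      w ^ L * Q * (A * B)
        ≤⟨ ℚ.*-monoʳ-≤-nonNeg (A * B) {{nn (ℚ.<⇒≤ 0<AB)}} mid ⟩
      (w * (1ℚ + h)) ^ L * (A * B)
        <⟨ ℚ.*-monoˡ-<-pos (A * B) {{ℚ.positive 0<AB}}
             (^-mono-< L 1≤L (*-nonneg 0≤w (ℚ.≤-trans 0≤1 1≤1+h)) lt) ⟩
      u ^ L * (A * B)
        ≡⟨ sym (ℚ.*-assoc (u ^ L) A B) ⟩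
      u ^ L * A * B
        ≤⟨ ℚ.*-monoʳ-≤-nonNeg B {{nn (0≤q^ (n′ ℕ.* β))}} lo ⟩
      q ^ (p ℕ.* β′) * B ∎)
    where
    open ℚ.≤-Reasoning
    open +-*-Solver
    L = K ℕ.* (b ℕ.* b′)
    β = K ℕ.* b
    β′ = K ℕ.* b′
    A = q ^ (n ℕ.* β′)
    B = q ^ (n′ ℕ.* β)
    Q = q ^ (b ℕ.* b′)
    0<q : 0ℚ < q
    0<q = ℚ.<-≤-trans 0<1 1≤q
    0≤q^ : ∀ i → 0ℚ ≤ q ^ i
    0≤q^ i = ^-nonneg i (ℚ.<⇒≤ 0<q)
    0<AB = *-pos (^-pos (n ℕ.* β′) 0<q) (^-pos (n′ ℕ.* β) 0<q)
    1≤1+h : 1ℚ ≤ 1ℚ + h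
    1≤1+h = ℚ.+-monoʳ-≤ 1ℚ 0≤h
    power : ∀ x c m d → (x ^ c * q ^ m) ^ d ≡ x ^ (c ℕ.* d) * q ^ (m ℕ.* d)
    power x c m d = trans (ℚ-Exp.^-distrib-* (x ^ c) (q ^ m) d)
      (cong₂ _*_ (ℚ-Exp.^-assocʳ x c d) (ℚ-Exp.^-assocʳ q m d))
    L≡ : b ℕ.* β′ ≡ L
    L≡ = ℕSolver.+-*-Solver.solve 3 (λ K b c → b N:* (K N:* c) N:= K N:* (b N:* c)) refl K b b′
      where open ℕSolver.+-*-Solver using () renaming (_:*_ to _N:*_; _:=_ to _N:=_)
    L≡′ : b′ ℕ.* β ≡ L
    L≡′ = ℕSolver.+-*-Solver.solve 3 (λ K b c → c N:* (K N:* b) N:= K N:* (b N:* c)) refl K b b′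
      where open ℕSolver.+-*-Solver using () renaming (_:*_ to _N:*_; _:=_ to _N:=_)
    lo : u ^ L * A ≤ q ^ (p ℕ.* β′)
    lo = subst₂ _≤_
      (trans (power u b n β′) (cong (λ z → u ^ z * A) L≡))
      (ℚ-Exp.^-assocʳ q p β′)
      (^-mono-≤ β′ (*-nonneg (^-nonneg b 0≤u) (0≤q^ n)) below)
    hi : q ^ (p′ ℕ.* β) ≤ w ^ L * B
    hi = subst₂ _≤_
      (ℚ-Exp.^-assocʳ q p′ β)
      (trans (power w b′ n′ β) (cong (λ z → w ^ z * B) L≡′))
      (^-mono-≤ β (0≤q^ p′) (ℚ.<⇒≤ above))
    mid : w ^ L * Q ≤ (w * (1ℚ + h)) ^ L
    mid = subst (w ^ L * Q ≤_) (sym (ℚ-Exp.^-distrib-* w (1ℚ + h) L))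
      (*-mono-≤ (^-nonneg L 0≤w) (0≤q^ (b ℕ.* b′)) ℚ.≤-refl
        (subst (Q ≤_) (ℚ-Exp.^-assocʳ (1ℚ + h) K (b ℕ.* b′))
          (^-mono-≤ (b ℕ.* b′) (ℚ.<⇒≤ 0<q) q≤)))

open PowerLemmas

pos-part neg-part : ℤ → ℕ
pos-part (+ n)    = n
pos-part -[1+ n ] = 0
neg-part (+ n)    = 0
neg-part -[1+ n ] = suc n

-- x ≤ q ^ (a / b), for r = a / b in lowest terms, written without roots or
-- negative exponents
Below : ℚ → ℚ → ℚ → Set
Below q r x = x ^ ↧ₙ r * q ^ neg-part (↥ r) ≤ q ^ pos-part (↥ r)

Below? : ∀ q r → Decidable (Below q r)
Below? q r x = x ^ ↧ₙ r * q ^ neg-part (↥ r) ℚ.≤? q ^ pos-part (↥ r)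

-- the largest positive j ≤ k satisfying P, or 0 if there is none
largest≤ : ∀ {P : ℕ → Set} → Decidable P → ℕ → ℕ
largest≤ P? zero    = zero
largest≤ P? (suc k) = if does (P? (suc k)) then suc k else largest≤ P? k

-- an upper bound for (n+1) q ^ r, for q ≥ 1
root-bound : ℚ → ℚ → ℕ → ℕ
root-bound q r n = suc n ℕ.* suc ℤ.∣ ↥ (q ^ pos-part (↥ r)) ∣

root-index : ℚ → ℚ → ℕ → ℕ
root-index q r n = largest≤ (λ j → Below? q r (+ j ℚ./ suc n)) (root-bound q r n)

opaque
  -- the largest multiple of 1/(n+1) that is at most q ^ r, for q ≥ 1
  root : ℚ → ℚ → ℕ → ℚ
  root q r n = + root-index q r n ℚ./ suc n

module RootLemmas where
  largest≤-holds : ∀ {P : ℕ → Set} (P? : Decidable P) k → P 0 → P (largest≤ P? k)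
  largest≤-holds P? zero    p0 = p0
  largest≤-holds P? (suc k) p0 with P? (suc k)
  ... | yes p = p
  ... | no  _ = largest≤-holds P? k p0

  largest≤-fails : ∀ {P : ℕ → Set} (P? : Decidable P) k → ¬ P (suc k) → ¬ P (suc (largest≤ P? k))
  largest≤-fails P? zero    ¬p = ¬p
  largest≤-fails P? (suc k) ¬p with P? (suc k)
  ... | yes _  = ¬p
  ... | no ¬p′ = largest≤-fails P? k ¬p′

  zero-below : ∀ q r → 1ℚ ≤ q → Below q r 0ℚ
  zero-below q (ℚ.mkℚ a d _) 1≤q = ℚ.≤-trans (ℚ.≤-reflexive (trans
    (cong (_* q ^ neg-part a) (ℚ.*-zeroˡ (0ℚ ^ d))) (ℚ.*-zeroˡ (q ^ neg-part a))))
    (^-nonneg (pos-part a) (ℚ.≤-trans 0≤1 1≤q))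

  big-above : ∀ q r x → 1ℚ ≤ q → q ^ pos-part (↥ r) < x → ¬ Below q r x
  big-above q (ℚ.mkℚ a d _) x 1≤q big below = ℚ.<-irrefl refl (begin-strict
    q ^ pos-part a <⟨ big ⟩
    x ≡⟨ sym (ℚ.*-identityʳ x) ⟩
    x * 1ℚ ≤⟨ *-mono-≤ 0≤x 0≤1 ℚ.≤-refl (1≤^ d 1≤x) ⟩
    x ^ suc d ≡⟨ sym (ℚ.*-identityʳ (x ^ suc d)) ⟩
    x ^ suc d * 1ℚ ≤⟨ *-mono-≤ (^-nonneg (suc d) 0≤x) 0≤1 ℚ.≤-refl (1≤^ (neg-part a) 1≤q) ⟩
    x ^ suc d * q ^ neg-part a ≤⟨ below ⟩
    q ^ pos-part a ∎)
    where
    open ℚ.≤-Reasoning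
    1≤x = ℚ.≤-trans (1≤^ (pos-part a) 1≤q) (ℚ.<⇒≤ big)
    0≤x = ℚ.≤-trans 0≤1 1≤x

  above-bound : ∀ n k → + k ℚ./ 1 < + suc (suc n ℕ.* suc k) ℚ./ suc n
  above-bound n k = begin-strict
    + k ℚ./ 1 <⟨ <+ (+ k ℚ./ 1) 1ℚ 0<1 ⟩
    + k ℚ./ 1 + 1ℚ ≡⟨ 1+1/ 0 k ⟩
    + suc k ℚ./ 1 ≡⟨ sym (n*k/n n (suc k)) ⟩
    + (suc n ℕ.* suc k) ℚ./ suc n <⟨ <+ (+ (suc n ℕ.* suc k) ℚ./ suc n) (+ 1 ℚ./ suc n) (0</ 0 n) ⟩
    + (suc n ℕ.* suc k) ℚ./ suc n + + 1 ℚ./ suc n ≡⟨ 1+1/ n (suc n ℕ.* suc k) ⟩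
    + suc (suc n ℕ.* suc k) ℚ./ suc n ∎
    where
    open ℚ.≤-Reasoning
    <+ : ∀ x y → 0ℚ < y → x < x + y
    <+ x y 0<y = subst (_< x + y) (ℚ.+-identityʳ x) (ℚ.+-monoʳ-< x 0<y)

  -- clearing denominators in r ≤ r′ + 1/(k+1)
  clear : ∀ k r r′ → r < r′ + + 1 ℚ./ suc k →
    pos-part (↥ r) ℕ.* (suc k ℕ.* ↧ₙ r′) ℕ.+ neg-part (↥ r′) ℕ.* (suc k ℕ.* ↧ₙ r) ℕ.≤
    pos-part (↥ r′) ℕ.* (suc k ℕ.* ↧ₙ r) ℕ.+ neg-part (↥ r) ℕ.* (suc k ℕ.* ↧ₙ r′) ℕ.+ ↧ₙ r ℕ.* ↧ₙ r′
  clear k r@(ℚ.mkℚ a d _) r′@(ℚ.mkℚ a′ d′ _) lt = ℤ.drop‿+≤+ (begin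
    + (p ℕ.* (K ℕ.* b′) ℕ.+ n′ ℕ.* (K ℕ.* b))
      ≡⟨ cong₂ ℤ._+_ (pos³ p K b′) (pos³ n′ K b) ⟩
    + p ℤ.* (+ K ℤ.* + b′) ℤ.+ + n′ ℤ.* (+ K ℤ.* + b)
      ≡⟨ solve 6 (λ p n n′ K b b′ → p :* (K :* b′) :+ n′ :* (K :* b)
           := (p :- n) :* (b′ :* K) :+ (n :* (K :* b′) :+ n′ :* (K :* b)))
           refl (+ p) (+ n) (+ n′) (+ K) (+ b) (+ b′) ⟩
    (+ p ℤ.- + n) ℤ.* (+ b′ ℤ.* + K) ℤ.+ S
      ≡⟨ cong (λ z → z ℤ.* (+ b′ ℤ.* + K) ℤ.+ S) (parts a) ⟩
    a ℤ.* (+ b′ ℤ.* + K) ℤ.+ S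
      ≤⟨ ℤ.+-monoˡ-≤ S (ℤ.<⇒≤ (ℚᵘ.drop-*<* lt′)) ⟩
    (a′ ℤ.* + K ℤ.+ + 1 ℤ.* + b′) ℤ.* + b ℤ.+ S
      ≡⟨ cong (λ z → (z ℤ.* + K ℤ.+ + 1 ℤ.* + b′) ℤ.* + b ℤ.+ S) (sym (parts a′)) ⟩
    ((+ p′ ℤ.- + n′) ℤ.* + K ℤ.+ + 1 ℤ.* + b′) ℤ.* + b ℤ.+ S
      ≡⟨ solve 6 (λ p′ n n′ K b b′ → ((p′ :- n′) :* K :+ con (+ 1) :* b′) :* b :+ (n :* (K :* b′) :+ n′ :* (K :* b))
           := p′ :* (K :* b) :+ n :* (K :* b′) :+ b :* b′)
           refl (+ p′) (+ n) (+ n′) (+ K) (+ b) (+ b′) ⟩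
    + p′ ℤ.* (+ K ℤ.* + b) ℤ.+ + n ℤ.* (+ K ℤ.* + b′) ℤ.+ + b ℤ.* + b′
      ≡⟨ sym (cong₂ ℤ._+_ (cong₂ ℤ._+_ (pos³ p′ K b) (pos³ n K b′)) (ℤ.pos-* b b′)) ⟩
    + (p′ ℕ.* (K ℕ.* b) ℕ.+ n ℕ.* (K ℕ.* b′) ℕ.+ b ℕ.* b′) ∎)
    where
    open ℤ.≤-Reasoning
    open ℤSolver.+-*-Solver
    K = suc k
    b = suc d
    b′ = suc d′
    p = pos-part a
    n = neg-part a
    p′ = pos-part a′
    n′ = neg-part a′
    S = + n ℤ.* (+ K ℤ.* + b′) ℤ.+ + n′ ℤ.* (+ K ℤ.* + b)
    pos³ : ∀ x y z → + (x ℕ.* (y ℕ.* z)) ≡ + x ℤ.* (+ y ℤ.* + z)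
    pos³ x y z = trans (ℤ.pos-* x (y ℕ.* z)) (cong (+ x ℤ.*_) (ℤ.pos-* y z))
    parts : ∀ a → + pos-part a ℤ.- + neg-part a ≡ a
    parts (+ n) = ℤ.+-identityʳ (+ n)
    parts -[1+ n ] = refl
    lt′ : ℚᵘ.mkℚᵘ a d ℚᵘ.< ℚᵘ.mkℚᵘ a′ d′ ℚᵘ.+ ℚᵘ.mkℚᵘ (+ 1) k
    lt′ = ℚᵘ.<-respʳ-≃
      (ℚᵘ.≃-trans (ℚ.toℚᵘ-homo-+ r′ (+ 1 ℚ./ suc k))
        (ℚᵘ.+-congʳ (ℚᵘ.mkℚᵘ a′ d′) (ℚ.toℚᵘ-fromℚᵘ (ℚᵘ.mkℚᵘ (+ 1) k))))
      (ℚ.toℚᵘ-mono-< lt)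

  below-close : ∀ q r r′ u w k h → 1ℚ ≤ q → 0ℚ ≤ u → 0ℚ ≤ w → 0ℚ ≤ h → q ≤ (1ℚ + h) ^ suc k →
    Below q r u → ¬ Below q r′ w → r < r′ + + 1 ℚ./ suc k → u ≤ w * (1ℚ + h)
  below-close q r@record{} r′@record{} u w k h 1≤q 0≤u 0≤w 0≤h q≤ below above lt =
    close-powers (suc k) (↧ₙ r) (↧ₙ r′) (pos-part (↥ r)) (neg-part (↥ r)) (pos-part (↥ r′)) (neg-part (↥ r′))
      1≤q 0≤u 0≤w 0≤h q≤ (ℕ.s≤s ℕ.z≤n) below (ℚ.≰⇒> above) (clear k r r′ lt)

  1/n≤1 : ∀ n → + 1 ℚ./ suc n ≤ 1ℚ
  1/n≤1 n = ℚ.toℚᵘ-cancel-≤ (ℚᵘ.≤-respˡ-≃ (ℚᵘ.≃-sym (ℚ.toℚᵘ-fromℚᵘ (ℚᵘ.mkℚᵘ (+ 1) n)))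
    (ℚᵘ.*≤* (ℤ.+≤+ (ℕ.s≤s ℕ.z≤n))))

  power-large : ∀ q h (1≤q : 1ℚ ≤ q) (0<h : 0ℚ < h) →
    q ≤ (1ℚ + h) ^ suc ℤ.∣ ↥ quot q h (ℚ.<-≤-trans 0<1 1≤q) 0<h ∣
  power-large q h 1≤q 0<h = begin
    q ≡⟨ sym (M*quot q h 0<q 0<h) ⟩
    h * Q ≡⟨ ℚ.*-comm h Q ⟩
    Q * h ≤⟨ ℚ.*-monoʳ-≤-nonNeg h {{nn 0≤h}} (≤numerator Q) ⟩
    (+ k ℚ./ 1) * h ≡⟨ sym (ℚ.+-identityˡ ((+ k ℚ./ 1) * h)) ⟩
    0ℚ + (+ k ℚ./ 1) * h ≤⟨ ℚ.+-monoˡ-≤ ((+ k ℚ./ 1) * h) 0≤1 ⟩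
    1ℚ + (+ k ℚ./ 1) * h ≤⟨ bernoulli h k 0≤h ⟩
    (1ℚ + h) ^ k ≤⟨ ^-monoʳ-≤ {1ℚ + h} {k} {suc k} (ℚ.+-monoʳ-≤ 1ℚ 0≤h) (ℕ.n≤1+n k) ⟩
    (1ℚ + h) ^ suc k ∎
    where
    open ℚ.≤-Reasoning
    0<q = ℚ.<-≤-trans 0<1 1≤q
    0≤h = ℚ.<⇒≤ 0<h
    Q = quot q h 0<q 0<h
    k = ℤ.∣ ↥ Q ∣

  module Approx (q : ℚ) (1≤q : 1ℚ ≤ q) (s : ℕ → ℚ) (cs : IsCauchy s) (U : ℕ → ℚ)
    (U-nonneg : ∀ n → 0ℚ ≤ U n) (U-below : ∀ n → Below q (s n) (U n))
    (U-above : ∀ n → ¬ Below q (s n) (U n + + 1 ℚ./ suc n))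
    where

    0≤q = ℚ.≤-trans 0≤1 1≤q

    W : ℕ → ℚ
    W n = U n + + 1 ℚ./ suc n

    0<W : ∀ n → 0ℚ < W n
    0<W n = ℚ.+-mono-≤-< (U-nonneg n) (0</ 0 n)

    approx-close : ∀ m n k h → 0ℚ ≤ h → q ≤ (1ℚ + h) ^ suc k →
      s m < s n + + 1 ℚ./ suc k → U m ≤ W n * (1ℚ + h)
    approx-close m n k h 0≤h q≤ lt = below-close q (s m) (s n) (U m) (W n) k h 1≤q (U-nonneg m) (ℚ.<⇒≤ (0<W n))
      0≤h q≤ (U-below m) (U-above n) lt

    q≤[1+q]^1 : q ≤ (1ℚ + q) ^ 1
    q≤[1+q]^1 = subst (q ≤_) (sym (ℚ.*-identityʳ (1ℚ + q)))
      (subst (_≤ 1ℚ + q) (ℚ.+-identityˡ q) (ℚ.+-monoˡ-≤ q 0≤1))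

    approx-bounded : ∃[ M ] 0ℚ < M × ∃[ N ] ∀ n → N ℕ.≤ n → W n ≤ M
    approx-bounded = go (cs (+ 1 ℚ./ 1) (0</ 0 0))
      where
      go : (∃[ N ] ∀ m n → N ℕ.≤ m → N ℕ.≤ n → ∣ s m - s n ∣ < + 1 ℚ./ 1) →
           ∃[ M ] 0ℚ < M × ∃[ N ] ∀ n → N ℕ.≤ n → W n ≤ M
      go (N , f) = W N * (1ℚ + q) + 1ℚ ,
        ℚ.+-mono-< (*-pos (0<W N) (ℚ.+-mono-<-≤ 0<1 0≤q)) 0<1 ,
        N , λ n N≤n → ℚ.+-mono-≤
          (approx-close n N 0 q 0≤q q≤[1+q]^1 (∣∣<⇒< (f n N N≤n ℕ.≤-refl)))
          (1/n≤1 n)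

    approx-side : ∀ ε M h k m n → 0ℚ < h → M * h ≡ ½ * ε → q ≤ (1ℚ + h) ^ suc k →
      ∣ s m - s n ∣ < + 1 ℚ./ suc k → W n ≤ M → + 1 ℚ./ suc n < ½ * ε → U m < U n + ε
    approx-side ε M h k m n 0<h M*h q≤ close bd small = begin-strict
      U m ≤⟨ approx-close m n k h (ℚ.<⇒≤ 0<h) q≤ (∣∣<⇒< close) ⟩
      W n * (1ℚ + h) ≡⟨ trans (ℚ.*-distribˡ-+ (W n) 1ℚ h) (cong (_+ W n * h) (ℚ.*-identityʳ (W n))) ⟩
      W n + W n * h ≤⟨ ℚ.+-monoʳ-≤ (W n) (ℚ.*-monoʳ-≤-nonNeg h {{nn (ℚ.<⇒≤ 0<h)}} bd) ⟩
      W n + M * h ≡⟨ cong (λ z → W n + z) M*h ⟩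
      W n + ½ * ε <⟨ ℚ.+-monoˡ-< (½ * ε) (ℚ.+-monoʳ-< (U n) small) ⟩
      U n + ½ * ε + ½ * ε ≡⟨ ℚ.+-assoc (U n) (½ * ε) (½ * ε) ⟩
      U n + (½ * ε + ½ * ε) ≡⟨ cong (λ z → U n + z) (half+half ε) ⟩
      U n + ε ∎
      where open ℚ.≤-Reasoning

    approx-cauchy : IsCauchy U
    approx-cauchy ε 0<ε = go approx-bounded
      where
      0<δ = *-pos 0<½ 0<ε
      go₂ : ∀ M h k N → 0ℚ < h → M * h ≡ ½ * ε → q ≤ (1ℚ + h) ^ suc k →
            (∀ n → N ℕ.≤ n → W n ≤ M) →
            (∃[ N ] ∀ m n → N ℕ.≤ m → N ℕ.≤ n → ∣ s m - s n ∣ < + 1 ℚ./ suc k) →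
            (∃[ N ] ∀ n → N ℕ.≤ n → + 1 ℚ./ suc n < ½ * ε) →
            ∃[ N ] ∀ m n → N ℕ.≤ m → N ℕ.≤ n → ∣ U m - U n ∣ < ε
      go₂ M h k N 0<h M*h q≤ bd (N₁ , f) (N₂ , g) = N ℕ.⊔ (N₁ ℕ.⊔ N₂) , λ m n p r →
        <⇒∣∣< (side m n p r) (side n m r p)
        where
        side : ∀ m n → N ℕ.⊔ (N₁ ℕ.⊔ N₂) ℕ.≤ m → N ℕ.⊔ (N₁ ℕ.⊔ N₂) ℕ.≤ n → U m < U n + ε
        side m n p r = approx-side ε M h k m n 0<h M*h q≤
          (f m n (ℕ.m⊔n≤o⇒m≤o N₁ N₂ (ℕ.m⊔n≤o⇒n≤o N (N₁ ℕ.⊔ N₂) p))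
                 (ℕ.m⊔n≤o⇒m≤o N₁ N₂ (ℕ.m⊔n≤o⇒n≤o N (N₁ ℕ.⊔ N₂) r)))
          (bd n (ℕ.m⊔n≤o⇒m≤o N (N₁ ℕ.⊔ N₂) r))
          (g n (ℕ.m⊔n≤o⇒n≤o N₁ N₂ (ℕ.m⊔n≤o⇒n≤o N (N₁ ℕ.⊔ N₂) r)))
      go : (∃[ M ] 0ℚ < M × ∃[ N ] ∀ n → N ℕ.≤ n → W n ≤ M) →
           ∃[ N ] ∀ m n → N ℕ.≤ m → N ℕ.≤ n → ∣ U m - U n ∣ < ε
      go (M , 0<M , N , bd) =
        go₂ M h k N 0<h (M*quot (½ * ε) M 0<δ 0<M) (power-large q h 1≤q 0<h) bd
          (cs (+ 1 ℚ./ suc k) (0</ 0 k)) (arch (½ * ε) 0<δ)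
        where
        h = quot (½ * ε) M 0<δ 0<M
        0<h = quot>0 (½ * ε) M 0<δ 0<M
        k = ℤ.∣ ↥ quot q h (ℚ.<-≤-trans 0<1 1≤q) 0<h ∣

  1≤1/ : ∀ q .{{_ : ℚ.Positive q}} → ¬ 1ℚ ≤ q → 1ℚ ≤ (ℚ.1/ q) {{ℚ.pos⇒nonZero q}}
  1≤1/ q 1≰q = ℚ.≮⇒≥ λ lt → ℚ.<-irrefl (ℚ.*-inverseʳ q {{ℚ.pos⇒nonZero q}})
    (subst (q * q⁻¹ <_) (ℚ.*-identityˡ 1ℚ)
      (*-mono-<-pos (ℚ.<⇒≤ (ℚ.positive⁻¹ q)) 0<1 (ℚ.≰⇒> 1≰q) (ℚ.<⇒≤ lt)))
    where q⁻¹ = (ℚ.1/ q) {{ℚ.pos⇒nonZero q}}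

open RootLemmas

opaque
  unfolding root

  root-nonneg : ∀ q r n → 0ℚ ≤ root q r n
  root-nonneg q r n = 0≤/ (root-index q r n) n

  root-below : ∀ q r n → 1ℚ ≤ q → Below q r (root q r n)
  root-below q r n 1≤q = largest≤-holds {λ j → Below q r (+ j ℚ./ suc n)}
    (λ j → Below? q r (+ j ℚ./ suc n)) (root-bound q r n)
    (subst (Below q r) (sym (ℚ.0/n≡0 (suc n))) (zero-below q r 1≤q))

  root-above : ∀ q r n → 1ℚ ≤ q → ¬ Below q r (root q r n + + 1 ℚ./ suc n)
  root-above q r n 1≤q = subst (λ z → ¬ Below q r z) (sym (1+1/ n (root-index q r n)))
    (largest≤-fails {λ j → Below q r (+ j ℚ./ suc n)}
      (λ j → Below? q r (+ j ℚ./ suc n)) (root-bound q r n)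
      (big-above q r (+ suc (root-bound q r n) ℚ./ suc n) 1≤q
        (ℚ.≤-<-trans (≤numerator (q ^ pos-part (↥ r)))
                     (above-bound n ℤ.∣ ↥ (q ^ pos-part (↥ r)) ∣))))

abstract
  root-cauchy : ∀ q → 1ℚ ≤ q → (s : ℕ → ℚ) → IsCauchy s → IsCauchy (λ n → root q (s n) n)
  root-cauchy q 1≤q s cs = Approx.approx-cauchy q 1≤q s cs (λ n → root q (s n) n)
    (λ n → root-nonneg q (s n) n) (λ n → root-below q (s n) n 1≤q) (λ n → root-above q (s n) n 1≤q)

infixr 9 _^ᴿ_

-- the limit of q ^ sₙ as rationals sₙ → s, each q ^ sₙ being replaced by an
-- approximation within 1/(n+1); a base below 1 is inverted first
_^ᴿ_ : (q : ℚ) .{{_ : ℚ.Positive q}} → ℝ → ℝ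
q ^ᴿ s with 1ℚ ℚ.≤? q
... | yes 1≤q = mkℝ (λ n → root q (seq s n) n) (root-cauchy q 1≤q (seq s) (cauchy s))
... | no  1≰q = mkℝ (λ n → root q⁻¹ (- seq s n) n)
                    (root-cauchy q⁻¹ (1≤1/ q 1≰q) (λ n → - seq s n) (neg-cauchy (seq s) (cauchy s)))
  where q⁻¹ = (ℚ.1/ q) {{ℚ.pos⇒nonZero q}}

∣∣-positive : ∀ q .{{_ : ℚ.NonZero q}} → ℚ.Positive ∣ q ∣
∣∣-positive (ℚ.mkℚ (+ zero)  d c) {{()}}
∣∣-positive (ℚ.mkℚ (+ suc n) d c) = _
∣∣-positive (ℚ.mkℚ -[1+ n ]  d c) = _

infix 7 _/∣_∣^_

-- C / |q| ^ s, as C |q| ^ (- s)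
_/∣_∣^_ : ℝ → (q : ℚ) .{{_ : ℚ.NonZero q}} → ℝ → ℝ
C /∣ q ∣^ s = C *ᴿ _^ᴿ_ ∣ q ∣ {{∣∣-positive q}} (-ᴿ s)

Digits : Set
Digits = ℕ → Fin 2

truncate : Digits → ℕ → ℕ
truncate c zero    = 0
truncate c (suc n) = truncate c n ℕ.+ toℕ (c n) ℕ.* 2 ℕ.^ n

-- the 2-adic integer congruent to f n modulo 2 ^ n for every n, where
-- f (n+1) ≡ f n modulo 2 ^ n
fromResidues : (ℕ → ℕ) → Digits
fromResidues f n = ((f (suc n)) ℕ./ (2 ℕ.^ n)) {{ℕ.m^n≢0 2 n}} mod 2

_+ᶻ_ _*ᶻ_ : Digits → Digits → Digits
c +ᶻ d = fromResidues (λ n → truncate c n ℕ.+ truncate d n)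
c *ᶻ d = fromResidues (λ n → truncate c n ℕ.* truncate d n)

-ᶻ_ : Digits → Digits
-ᶻ c = fromResidues (λ n → 2 ℕ.^ n ℕ.∸ truncate c n)

2^_*ᶻ_ : ℕ → Digits → Digits
(2^ zero  *ᶻ c) n       = c n
(2^ suc k *ᶻ c) zero    = 0F
(2^ suc k *ᶻ c) (suc n) = (2^ k *ᶻ c) n

-- 2 ^ (- shift) times the 2-adic integer with the given digits
record ℚ₂ : Set where
  constructor mkℚ₂
  field
    shift  : ℕ
    digits : Digits

-- the coefficient of 2 ^ n in the 2-adic expansion
coeff : ℚ₂ → ℤ → Fin 2
coeff (mkℚ₂ k c) n with n ℤ.+ + k
... | + j      = c j
... | -[1+ _ ] = 0F

infix 4 _≈₂_

_≈₂_ : ℚ₂ → ℚ₂ → Set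
x ≈₂ y = ∀ n → coeff x n ≡ coeff y n

infixl 6 _+₂_ _-₂_
infixl 7 _*₂_
infix  8 -₂_

_+₂_ : ℚ₂ → ℚ₂ → ℚ₂
mkℚ₂ k c +₂ mkℚ₂ l d = mkℚ₂ (k ℕ.+ l) ((2^ l *ᶻ c) +ᶻ (2^ k *ᶻ d))

-₂_ : ℚ₂ → ℚ₂
-₂ mkℚ₂ k c = mkℚ₂ k (-ᶻ c)

_-₂_ : ℚ₂ → ℚ₂ → ℚ₂
x -₂ y = x +₂ (-₂ y)

_*₂_ : ℚ₂ → ℚ₂ → ℚ₂
mkℚ₂ k c *₂ mkℚ₂ l d = mkℚ₂ (k ℕ.+ l) (c *ᶻ d)

0₂ 1₂ : ℚ₂
0₂ = mkℚ₂ 0 (λ _ → 0F)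
1₂ = mkℚ₂ 0 λ { zero → sucF 0F ; (suc _) → 0F }

ℚ₂-rawRing : RawRing 0ℓ 0ℓ
ℚ₂-rawRing = record
  { Carrier = ℚ₂
  ; _≈_     = _≈₂_
  ; _+_     = _+₂_
  ; _*_     = _*₂_
  ; -_      = -₂_
  ; 0#      = 0₂
  ; 1#      = 1₂
  }

-- the sum of the terms of the expansion with exponent at most 0
⌊_⌋₂ : ℚ₂ → ℚ
⌊ mkℚ₂ k c ⌋₂ = (+ truncate c (suc k) ℚ./ 2 ℕ.^ k) {{ℕ.m^n≢0 2 k}}

-- 2 ^ (- v) for the least position v < n of a nonzero digit, and 0 if there
-- is none
leading : Digits → ℕ → ℚ
leading c zero    = 0ℚ
leading c (suc n) with c 0
... | 0F     = ½ * leading (λ i → c (suc i)) n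
... | sucF _ = 1ℚ

module NormLemmas where
  leading≥0 : ∀ c n → 0ℚ ≤ leading c n
  leading≥0 c zero = ℚ.≤-refl
  leading≥0 c (suc n) with c 0
  ... | 0F     = *-nonneg (ℚ.<⇒≤ 0<½) (leading≥0 (λ i → c (suc i)) n)
  ... | sucF _ = 0≤1

  leading≤1 : ∀ c n → leading c n ≤ 1ℚ
  leading≤1 c zero = 0≤1
  leading≤1 c (suc n) with c 0
  ... | 0F     = ℚ.≤-trans
        (*-mono-≤ (ℚ.<⇒≤ 0<½) (leading≥0 (λ i → c (suc i)) n) (ℚ.<⇒≤ ½<1) (leading≤1 (λ i → c (suc i)) n))
        (ℚ.≤-reflexive (ℚ.*-identityʳ 1ℚ))
    where
    ½<1 : ½ < 1ℚ
    ½<1 = subst₂ _<_ (ℚ.+-identityʳ ½) refl (ℚ.+-monoʳ-< ½ 0<½)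
  ... | sucF _ = ℚ.≤-refl

  leading-close : ∀ c N m n → N ℕ.≤ m → N ℕ.≤ n → leading c m ≤ leading c n + ½ ^ N
  leading-close c zero m n _ _ = ℚ.≤-trans (leading≤1 c m)
    (subst (_≤ leading c n + 1ℚ) (ℚ.+-identityˡ 1ℚ) (ℚ.+-monoˡ-≤ 1ℚ (leading≥0 c n)))
  leading-close c (suc N) (suc m) (suc n) (ℕ.s≤s p) (ℕ.s≤s q) with c 0
  ... | 0F     = subst (½ * leading c′ m ≤_) (ℚ.*-distribˡ-+ ½ (leading c′ n) (½ ^ N))
        (ℚ.*-monoˡ-≤-nonNeg ½ (leading-close c′ N m n p q))
    where c′ = λ i → c (suc i)
  ... | sucF _ = subst (_≤ 1ℚ + ½ ^ suc N) (ℚ.+-identityʳ 1ℚ)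
        (ℚ.+-monoʳ-≤ 1ℚ (^-nonneg (suc N) (ℚ.<⇒≤ 0<½)))

  ½^n*[n+1]≤1 : ∀ n → ½ ^ n * (+ suc n ℚ./ 1) ≤ 1ℚ
  ½^n*[n+1]≤1 zero    = ℚ.≤-refl
  ½^n*[n+1]≤1 (suc n) = begin
    ½ * x * (+ suc (suc n) ℚ./ 1) ≡⟨ cong (½ * x *_) (sym (1+1/ 0 (suc n))) ⟩
    ½ * x * (k + 1ℚ) ≡⟨ solve 3 (λ h x k → h :* x :* (k :+ con 1ℚ) := h :* (x :* k) :+ h :* x) refl ½ x k ⟩
    ½ * (x * k) + ½ * x ≤⟨ ℚ.+-mono-≤ (ℚ.*-monoˡ-≤-nonNeg ½ (½^n*[n+1]≤1 n)) (ℚ.*-monoˡ-≤-nonNeg ½ (½^n≤1 n)) ⟩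
    ½ * 1ℚ + ½ * 1ℚ ≡⟨ half+half 1ℚ ⟩
    1ℚ ∎
    where
    open ℚ.≤-Reasoning
    open +-*-Solver
    x = ½ ^ n
    k = + suc n ℚ./ 1
    ½^n≤1 : ∀ n → ½ ^ n ≤ 1ℚ
    ½^n≤1 zero    = ℚ.≤-refl
    ½^n≤1 (suc n) = begin
      ½ * ½ ^ n ≤⟨ ℚ.*-monoˡ-≤-nonNeg ½ (½^n≤1 n) ⟩
      ½ * 1ℚ ≡⟨ sym (ℚ.+-identityʳ (½ * 1ℚ)) ⟩
      ½ * 1ℚ + 0ℚ ≤⟨ ℚ.+-monoʳ-≤ (½ * 1ℚ) (*-nonneg (ℚ.<⇒≤ 0<½) 0≤1) ⟩
      ½ * 1ℚ + ½ * 1ℚ ≡⟨ half+half 1ℚ ⟩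
      1ℚ ∎

  ½^n<1/n : ∀ n → ½ ^ n ≤ + 1 ℚ./ suc n
  ½^n<1/n n = begin
    ½ ^ n ≡⟨ sym (ℚ.*-identityʳ (½ ^ n)) ⟩
    ½ ^ n * 1ℚ ≡⟨ cong (½ ^ n *_) (sym inv) ⟩
    ½ ^ n * ((+ suc n ℚ./ 1) * (+ 1 ℚ./ suc n)) ≡⟨ sym (ℚ.*-assoc (½ ^ n) (+ suc n ℚ./ 1) (+ 1 ℚ./ suc n)) ⟩
    ½ ^ n * (+ suc n ℚ./ 1) * (+ 1 ℚ./ suc n)
      ≤⟨ ℚ.*-monoʳ-≤-nonNeg (+ 1 ℚ./ suc n) {{nn (0≤/ 1 n)}} (½^n*[n+1]≤1 n) ⟩
    1ℚ * (+ 1 ℚ./ suc n) ≡⟨ ℚ.*-identityˡ (+ 1 ℚ./ suc n) ⟩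
    + 1 ℚ./ suc n ∎
    where
    open ℚ.≤-Reasoning
    inv : (+ suc n ℚ./ 1) * (+ 1 ℚ./ suc n) ≡ 1ℚ
    inv = ℚ.toℚᵘ-injective (ℚᵘ.≃-trans (ℚ.toℚᵘ-homo-* (+ suc n ℚ./ 1) (+ 1 ℚ./ suc n))
      (ℚᵘ.≃-trans (ℚᵘ.*-cong (ℚ.toℚᵘ-fromℚᵘ (ℚᵘ.mkℚᵘ (+ suc n) 0)) (ℚ.toℚᵘ-fromℚᵘ (ℚᵘ.mkℚᵘ (+ 1) n)))
        (ℚᵘ.*≡* (cong +_ (solve 1 (λ n → (n :* con 1) :* con 1 := con 1 :* (con 1 :* n)) refl (suc n))))))
      where open ℕSolver.+-*-Solver

  leading-cauchy : ∀ c → IsCauchy (leading c)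
  leading-cauchy c ε 0<ε = go (arch ε 0<ε)
    where
    go : (∃[ N ] ∀ n → N ℕ.≤ n → + 1 ℚ./ suc n < ε) →
         ∃[ N ] ∀ m n → N ℕ.≤ m → N ℕ.≤ n → ∣ leading c m - leading c n ∣ < ε
    go (N , f) = N , λ m n p q → <⇒∣∣< (side m n p q) (side n m q p)
      where
      side : ∀ m n → N ℕ.≤ m → N ℕ.≤ n → leading c m < leading c n + ε
      side m n p q = ℚ.≤-<-trans (leading-close c N m n p q)
        (ℚ.+-monoʳ-< (leading c n) (ℚ.≤-<-trans (½^n<1/n N) (f N ℕ.≤-refl)))

open NormLemmas

-- the limit of ∣ c ∣₂ over the truncations of c
∣_∣₂ : ℚ₂ → ℝ
∣ mkℚ₂ k c ∣₂ = fromℚ ((+ 2 ℚ./ 1) ^ k) *ᴿ mkℝ (leading c) (leading-cauchy c)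

-- counts factors of 2 in n up to the fuel, so exponent₂ n n is the exponent of
-- 2 in n for n > 0
exponent₂ : ℕ → ℕ → ℕ
exponent₂ zero       n = 0
exponent₂ (suc fuel) n with 2 ∣? n
... | yes (divides m _) = suc (exponent₂ fuel m)
... | no  _             = 0

v₂ : ℚ → ℤ ⁺
v₂ r with ↥ r ℤ.≟ 0ℤ
... | yes _ = ⊤⁺
... | no  _ = [ + exponent₂ ℤ.∣ ↥ r ∣ ℤ.∣ ↥ r ∣ ℤ.- + exponent₂ (↧ₙ r) (↧ₙ r) ]

_+⁺_ : ℤ ⁺ → ℤ ⁺ → ℤ ⁺
[ x ] +⁺ [ y ] = [ x ℤ.+ y ]
[ x ] +⁺ ⊤⁺    = ⊤⁺
⊤⁺    +⁺ y     = ⊤⁺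

2^-_ : ℤ ⁺ → ℚ
2^- [ + n ]      = ½ ^ n
2^- [ -[1+ n ] ] = (+ 2 ℚ./ 1) ^ suc n
2^- ⊤⁺           = 0ℚ

record QuadraticField c ℓ : Set (lsuc (c ⊔ ℓ)) where
  field
    commutativeRing : CommutativeRing c ℓ

  open CommutativeRing commutativeRing public
    using (Carrier; _≈_; 0#; 1#; rawRing)
    renaming (_+_ to _+ᴷ_; _-_ to _-ᴷ_; _*_ to _*ᴷ_)

  field
    inverse : ∀ x → ¬ x ≈ 0# → ∃[ y ] x *ᴷ y ≈ 1#

    ι                    : ℚ → Carrier
    ι-isRingHomomorphism : RingMorphisms.IsRingHomomorphism ℚ.+-*-rawRing rawRing ι

    -- 1 and θ form a basis over ℚ
    θ           : Carrier
    spanning    : ∀ x → ∃[ a ] ∃[ b ] x ≈ ι a +ᴷ ι b *ᴷ θ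
    independent : ∀ a b → ι a +ᴷ ι b *ᴷ θ ≈ 0# → a ≡ 0ℚ × b ≡ 0ℚ

record Matrix₂ : Set where
  constructor ⟦_,_∣_,_⟧
  field
    e₁₁ e₁₂ e₂₁ e₂₂ : ℚ

open Matrix₂

_·_ : Matrix₂ → Matrix₂ → Matrix₂
⟦ a , b ∣ c , d ⟧ · ⟦ a′ , b′ ∣ c′ , d′ ⟧ =
  ⟦ a * a′ + b * c′ , a * b′ + b * d′ ∣ c * a′ + d * c′ , c * b′ + d * d′ ⟧

module Convergents (b : ℕ → ℚ) where

  factor : ℕ → Matrix₂
  factor n = ⟦ b n , 1ℚ ∣ 1ℚ , 0ℚ ⟧

  matrix : ℕ → Matrix₂
  matrix zero    = factor 0
  matrix (suc n) = matrix n · factor (suc n)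

  p q : ℕ → ℚ
  p n = e₁₁ (matrix n)
  q n = e₂₁ (matrix n)

  s₀ : ℕ
  s₀ with v₂ (b 0)
  ... | ⊤⁺    = 1
  ... | [ v ] = if does (0ℤ ℤ.<? v) then 1 else 0

  valuation-sum : ℕ → ℤ ⁺
  valuation-sum n = foldr _+⁺_ [ 0ℤ ] (drop s₀ (applyUpTo (λ s → v₂ (b s)) (suc n)))

  p′ q′ : ℕ → ℚ
  p′ n = 2^- valuation-sum n * p n
  q′ n = 2^- valuation-sum n * q n

IsMinimizer : (ℤ → ℝ) → ℤ → Set
IsMinimizer f i = ∀ j → f i ≤ᴿ f j

IsLeastMinimizer : (ℤ → ℝ) → ℤ → Set
IsLeastMinimizer f m = IsMinimizer f m × (∀ i → IsMinimizer f i → m ℤ.≤ i)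

module Algorithm {c ℓ} (K : QuadraticField c ℓ)
  (σ∞ : QuadraticField.Carrier K → ℝ) (σ₂ : QuadraticField.Carrier K → ℚ₂) where

  open QuadraticField K

  spacing : Fin 2 → ℤ
  spacing 0F        = + 2
  spacing (sucF 0F) = + 1

  distance : Fin 2 → Carrier → ℤ → ℝ
  distance ε x i = ∣ σ∞ x -ᴿ fromℚ ((spacing ε ℤ.* i) ℚ./ 1) -ᴿ fromℚ ⌊ σ₂ x ⌋₂ ∣ᴿ

  IsPartialQuotient : Fin 2 → Carrier → ℚ → Set
  IsPartialQuotient ε x b = ∃[ m ] IsLeastMinimizer (distance ε x) m ×
    b ≡ (spacing ε ℤ.* m) ℚ./ 1 + ⌊ σ₂ x ⌋₂

  -- complete is (αₙ) and partial is (bₙ); step says αₙ₊₁ = 1 / (αₙ - bₙ)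
  record Expansion (α : Carrier) : Set (c ⊔ ℓ) where
    field
      complete : ℕ → Carrier
      partial  : ℕ → ℚ

      start    : complete 0 ≈ α
      quotient : ∀ n → IsPartialQuotient (n mod 2) (complete n) (partial n)
      step     : ∀ n → complete (suc n) *ᴷ (complete n -ᴷ ι (partial n)) ≈ 1#

    open Convergents partial public

{-# OPTIONS --safe #-}
module Submission where

-- Put βₙ = αₙ - bₙ = 1/αₙ₊₁. By the choice of bₙ, βₙ is small at both places: ∣βₙ∣ ≤ 1 and
-- ∣βₙ∣₂ ≤ 1/2 for even n, ∣βₙ∣ ≤ 1/2 and ∣βₙ∣₂ ≤ 1 for odd n. Hence Lagrange's argument applies:
-- αₙ = (α + Pₙ)/Qₙ where Pₙ, Qₙ lie in (1/M) ℤ[1/2] for a fixed M and are bounded at both places,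
-- so only finitely many αₙ (n even) occur and the expansion is eventually periodic.
-- Let Sₙ = - (v₂ b₁ + … + v₂ bₙ). Then 2^Sₙ qₙ is an odd integer, α - pₙ/qₙ = ± β₀ ⋯ βₙ / qₙ lies in
-- 4^Sₙ ℤ₂, and it is at most 2/qₙ² at the real place, because qₙ β₀ ⋯ βₙ₋₁ stays bounded (also away
-- from 0). One period multiplies 2^Sₙ by some 2ᵉ and ∣β₀ ⋯ βₙ∣⁻¹ by some Λ > 1, so after k periods
-- 2^Sₙ ≍ 2^(e k), ∣qₙ∣ ≍ Λᵏ and ∣q′ₙ∣ ≍ (2ᵉ Λ)ᵏ. Both estimates follow with γ = log 2ᵉ / log (2ᵉ Λ).

open import Defs
open import Algebra.Bundles using (CommutativeRing)
open import Algebra.Morphism.Structures using (module RingMorphisms)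
import Algebra.Solver.Ring
import Algebra.Solver.Ring.AlmostCommutativeRing as ACR
open import Data.Empty using (⊥-elim)
import Data.Fin.Base as Fin
open import Data.Fin.Base using (Fin; toℕ; fromℕ<; combine) renaming (zero to 0F; suc to sucF)
open import Data.Fin.Properties using (toℕ<n; toℕ-fromℕ<; pigeonhole; combine-injective; fromℕ<-injective)
open import Data.Integer.Base as ℤ using (ℤ; +_; -[1+_]; 0ℤ; 1ℤ)
import Data.Integer.Properties as ℤ
open import Data.Integer.Solver using () renaming (module +-*-Solver to ℤS)
open import Data.List.Base using (applyUpTo; foldr)
open import Data.Maybe.Base using (Maybe; just; nothing)
open import Data.Nat.Base as ℕ using (ℕ; zero; suc; _>_)
import Data.Nat.Coprimality as ℕ
import Data.Nat.Divisibility as ℕ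
import Data.Nat.DivMod as ℕ
open import Data.Nat.DivMod using (_mod_)
import Data.Nat.Properties as ℕ
open import Data.Nat.Solver using () renaming (module +-*-Solver to ℕS)
open import Data.Product using (_×_; _,_; proj₁; proj₂; Σ-syntax; ∃-syntax)
open import Data.Rational.Base as ℚ using (ℚ; 0ℚ; 1ℚ; ½; ∣_∣; ↥_; ↧ₙ_; _≤_; _<_; _+_; _-_; _*_; -_; NonZero;
    _÷_)
import Data.Rational.Properties as ℚ
open import Data.Rational.Solver using () renaming (module +-*-Solver to ℚS)
import Data.Rational.Unnormalised.Base as ℚᵘ
import Data.Rational.Unnormalised.Properties as ℚᵘ
open import Data.Sum.Base using (_⊎_; inj₁; inj₂)
open import Relation.Binary.PropositionalEquality
  using (_≡_; _≢_; refl; sym; trans; cong; cong₂; subst; subst₂; module ≡-Reasoning)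
open import Relation.Nullary using (¬_; Dec; yes; no)
open import Relation.Nullary.Construct.Add.Supremum using (_⁺; ⊤⁺; [_])

open ℚ-Exp using (_^_; ^-homo-*; ^-assocʳ; ^-distrib-*)
open RationalLemmas
open PowerLemmas
open ℚS using () renaming (_:*_ to _⊗_; _:+_ to _⊞_; _:-_ to _⊟_; :-_ to ⊖_; _:=_ to _⊜_)

-- Congruences modulo powers of 2 and 2-adic digits

-- Boundedness of Qₙ comes from Qₙ₊₁ = βₙ (2α - t) - βₙ² Qₙ, with t the trace of α: two steps
-- contract by 1/4 at the real place, and integrality of βₙ at 2 keeps the denominators there
-- bounded. The product rₙ = qₙ β₀ ⋯ βₙ₋₁ satisfies rₙ₊₁ = 1 - βₙ βₙ₊₁ rₙ. From ∣βₙ βₙ₊₁∣ ≤ 1/2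
-- alone one gets ∣rₙ∣ ≤ 2, but rₙ₊₁ could vanish; a bound ∣βₙ∣ ≤ κ < 1 is needed. It holds for each
-- n because βₙ = ±1 would make αₙ rational, and periodicity makes κ uniform. The order of Cauchy
-- reals cannot be decided. Sizes are therefore stated as upper bounds on an element of K and on its
-- inverse, and log Λ enters only through integers aᵢ with 2^aᵢ ≤ Λⁱ ≤ 2^(2 + aᵢ), found by a finite
-- search between overlapping alternatives. The exponent γ is the limit of the rationals e i / (e i
-- + aᵢ), and an estimate c ≤ q^((p - n)/w) is handled as c^w q^n ≤ q^p, without roots.

pow2 : ℕ → ℤ
pow2 n = + (2 ℕ.^ n)

pow2-+ : ∀ m n → pow2 (m ℕ.+ n) ≡ pow2 m ℤ.* pow2 n
pow2-+ m n = trans (cong +_ (ℕ.^-distribˡ-+-* 2 m n)) (ℤ.pos-* (2 ℕ.^ m) (2 ℕ.^ n))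

pow2-suc : ∀ n → pow2 (suc n) ≡ + 2 ℤ.* pow2 n
pow2-suc n = ℤ.pos-* 2 (2 ℕ.^ n)

pow2-nonZero : ∀ n → ℤ.NonZero (pow2 n)
pow2-nonZero n = ℕ.m^n≢0 2 n

infix 4 _∼_mod2^_

record _∼_mod2^_ (x y : ℤ) (n : ℕ) : Set where
  constructor congruent
  field
    multiple : ℤ
    equation : x ≡ y ℤ.+ multiple ℤ.* pow2 n

module _ where
  open ℤS

  ∼-refl : ∀ {x n} → x ∼ x mod2^ n
  ∼-refl {x} {n} = congruent 0ℤ (solve 2 (λ x p → x := x :+ con 0ℤ :* p) refl x (pow2 n))

  ∼-reflexive : ∀ {x y n} → x ≡ y → x ∼ y mod2^ n
  ∼-reflexive refl = ∼-refl

  ∼-sym : ∀ {x y n} → x ∼ y mod2^ n → y ∼ x mod2^ n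
  ∼-sym {y = y} {n} (congruent t refl) = congruent (ℤ.- t)
    (solve 3 (λ y t p → y := y :+ t :* p :+ (:- t) :* p) refl y t (pow2 n))

  ∼-trans : ∀ {x y z n} → x ∼ y mod2^ n → y ∼ z mod2^ n → x ∼ z mod2^ n
  ∼-trans {z = z} {n} (congruent t refl) (congruent s refl) = congruent (s ℤ.+ t)
    (solve 4 (λ z s t p → z :+ s :* p :+ t :* p := z :+ (s :+ t) :* p) refl z s t (pow2 n))

  ∼-+ : ∀ {x y x′ y′ n} → x ∼ y mod2^ n → x′ ∼ y′ mod2^ n → x ℤ.+ x′ ∼ y ℤ.+ y′ mod2^ n
  ∼-+ {y = y} {y′ = y′} {n} (congruent t refl) (congruent s refl) = congruent (t ℤ.+ s)
    (solve 5 (λ y y′ s t p → (y :+ t :* p) :+ (y′ :+ s :* p) := (y :+ y′) :+ (t :+ s) :* p)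
      refl y y′ s t (pow2 n))

  ∼-neg : ∀ {x y n} → x ∼ y mod2^ n → ℤ.- x ∼ ℤ.- y mod2^ n
  ∼-neg {y = y} {n} (congruent t refl) = congruent (ℤ.- t)
    (solve 3 (λ y t p → :- (y :+ t :* p) := :- y :+ (:- t) :* p) refl y t (pow2 n))

  ∼-* : ∀ {x y x′ y′ n} → x ∼ y mod2^ n → x′ ∼ y′ mod2^ n → x ℤ.* x′ ∼ y ℤ.* y′ mod2^ n
  ∼-* {y = y} {y′ = y′} {n} (congruent t refl) (congruent s refl) =
    congruent (t ℤ.* y′ ℤ.+ y ℤ.* s ℤ.+ t ℤ.* s ℤ.* pow2 n)
    (solve 5 (λ y y′ s t p → (y :+ t :* p) :* (y′ :+ s :* p)
        := (y :* y′) :+ (t :* y′ :+ y :* s :+ t :* s :* p) :* p)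
      refl y y′ s t (pow2 n))

  ∼-weaken : ∀ {x y} m {n} → x ∼ y mod2^ (m ℕ.+ n) → x ∼ y mod2^ n
  ∼-weaken {y = y} m {n} (congruent t refl) = congruent (t ℤ.* pow2 m)
    (cong (λ z → y ℤ.+ z) (trans (cong (t ℤ.*_) (pow2-+ m n)) (sym (ℤ.*-assoc t (pow2 m) (pow2 n)))))

  ∼-scale : ∀ {x y} m {n} → x ∼ y mod2^ n → pow2 m ℤ.* x ∼ pow2 m ℤ.* y mod2^ (m ℕ.+ n)
  ∼-scale {y = y} m {n} (congruent t refl) = congruent t
    (trans (solve 4 (λ y t p q → q :* (y :+ t :* p) := q :* y :+ t :* (q :* p)) refl y t (pow2 n) (pow2 m))
      (cong (λ z → pow2 m ℤ.* y ℤ.+ t ℤ.* z) (sym (pow2-+ m n))))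

  ∼-cancel : ∀ {x y} m {n} → pow2 m ℤ.* x ∼ pow2 m ℤ.* y mod2^ (m ℕ.+ n) → x ∼ y mod2^ n
  ∼-cancel {x} {y} m {n} (congruent t eq) = congruent t
    (ℤ.*-cancelˡ-≡ (pow2 m) x _ {{pow2-nonZero m}}
      (trans eq (trans (cong (λ z → pow2 m ℤ.* y ℤ.+ t ℤ.* z) (pow2-+ m n))
        (solve 4 (λ y t p q → q :* y :+ t :* (q :* p) := q :* (y :+ t :* p)) refl y t (pow2 n) (pow2 m)))))

∼-resp : ∀ {x x′ y y′ n n′} → x ≡ x′ → y ≡ y′ → n ≡ n′ → x ∼ y mod2^ n → x′ ∼ y′ mod2^ n′
∼-resp refl refl refl h = h

private
  bigger : ∀ m x t → + x ≡ 0ℤ ℤ.+ t ℤ.* + m → x ℕ.< m → x ≡ 0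
  bigger m x (+ zero) eq lt = ℤ.+-injective eq
  bigger m x (+ suc t) eq lt = ⊥-elim (ℕ.<⇒≱ lt (subst (m ℕ.≤_)
    (sym (ℤ.+-injective (trans eq (trans (ℤ.+-identityˡ _) (sym (ℤ.pos-* (suc t) m))))))
        (ℕ.m≤m+n m (t ℕ.* m))))
  bigger m x -[1+ t ] eq lt = go m lt eq
    where
    go : ∀ m → x ℕ.< m → + x ≡ 0ℤ ℤ.+ -[1+ t ] ℤ.* + m → x ≡ 0
    go (suc m) _ ()

∼0⇒≡0 : ∀ {x n} → x ℕ.< 2 ℕ.^ n → + x ∼ 0ℤ mod2^ n → x ≡ 0
∼0⇒≡0 {x} {n} lt (congruent t eq) = bigger (2 ℕ.^ n) x t eq lt

1≁0 : ¬ 1ℤ ∼ 0ℤ mod2^ 1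
1≁0 h with () ← ∼0⇒≡0 {1} {1} (ℕ.s≤s (ℕ.s≤s ℕ.z≤n)) h

trunc : Digits → ℕ → ℤ
trunc c n = + truncate c n

truncate<2^ : ∀ c n → truncate c n ℕ.< 2 ℕ.^ n
truncate<2^ c zero = ℕ.s≤s ℕ.z≤n
truncate<2^ c (suc n) = begin-strict
  truncate c n ℕ.+ toℕ (c n) ℕ.* 2 ℕ.^ n <⟨ ℕ.+-mono-<-≤ (truncate<2^ c n)
     (ℕ.*-monoˡ-≤ (2 ℕ.^ n) (ℕ.s≤s⁻¹ (toℕ<n (c n)))) ⟩
  2 ℕ.^ n ℕ.+ 1 ℕ.* 2 ℕ.^ n ≡⟨ cong (2 ℕ.^ n ℕ.+_) refl ⟩
  2 ℕ.^ suc n ∎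
  where open ℕ.≤-Reasoning

trunc-suc : ∀ c n → trunc c (suc n) ∼ trunc c n mod2^ n
trunc-suc c n = congruent (+ toℕ (c n))
  (trans (ℤ.pos-+ (truncate c n) _) (cong (λ z → trunc c n ℤ.+ z) (ℤ.pos-* (toℕ (c n)) (2 ℕ.^ n))))

trunc-+ : ∀ c m n → trunc c (m ℕ.+ n) ∼ trunc c n mod2^ n
trunc-+ c zero n = ∼-refl
trunc-+ c (suc m) n = ∼-trans (∼-weaken m (trunc-suc c (m ℕ.+ n))) (trunc-+ c m n)

Coherent : (ℕ → ℕ) → Set
Coherent f = ∀ n → + f (suc n) ∼ + f n mod2^ n

private
  %-unique : ∀ {a b n} → a ℕ.< 2 ℕ.^ n → + a ∼ + b mod2^ n →
    a ≡ (b ℕ.% 2 ℕ.^ n) {{ℕ.m^n≢0 2 n}}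
  %-unique {a} {b} {n} lt h = close a r lt (ℕ.m%n<n b (2 ℕ.^ n) {{nz}}) (∼-trans h b∼r)
    where
    nz : ℕ.NonZero (2 ℕ.^ n)
    nz = ℕ.m^n≢0 2 n
    r d : ℕ
    r = (b ℕ.% 2 ℕ.^ n) {{nz}}
    d = (b ℕ./ 2 ℕ.^ n) {{nz}}
    b∼r : + b ∼ + r mod2^ n
    b∼r = congruent (+ d) (trans (cong +_ (ℕ.m≡m%n+[m/n]*n b (2 ℕ.^ n) {{nz}}))
      (trans (ℤ.pos-+ r _) (cong (λ z → + r ℤ.+ z) (ℤ.pos-* d (2 ℕ.^ n)))))
    half : ∀ a r → r ℕ.≤ a → a ℕ.< 2 ℕ.^ n → + a ∼ + r mod2^ n → a ≡ r
    half a r r≤a lt h = ℕ.≤-antisym (ℕ.m∸n≡0⇒m≤n (∼0⇒≡0 {n = n} (ℕ.≤-<-trans (ℕ.m∸n≤m a r) lt)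
      (∼-resp (trans (ℤ.m-n≡m⊖n a r) (ℤ.⊖-≥ r≤a)) (ℤ.+-inverseʳ (+ r)) refl (∼-+ h (∼-neg {+ r} ∼-refl)))))
          r≤a
    close : ∀ a r → a ℕ.< 2 ℕ.^ n → r ℕ.< 2 ℕ.^ n → + a ∼ + r mod2^ n → a ≡ r
    close a r a< r< h with ℕ.≤-total a r
    ... | inj₁ a≤r = sym (half r a a≤r r< (∼-sym h))
    ... | inj₂ r≤a = half a r r≤a a< h

-- Digit n is bit n of f (n+1). By induction and coherence the first n digits already form the
-- remainder of f (n+1) modulo 2^n, so appending this bit gives its remainder modulo 2^(n+1).
trunc-fromResidues : ∀ f → Coherent f → ∀ n → trunc (fromResidues f) n ∼ + f n mod2^ n
trunc-fromResidues f co zero = congruent (ℤ.- + f 0)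
  (solve 1 (λ x → con 0ℤ := x :+ (:- x) :* con 1ℤ) refl (+ f 0))
  where open ℤS
trunc-fromResidues f co (suc n) = ∼-sym (congruent (+ (q ℕ./ 2)) (begin
  + F ≡⟨ cong +_ (ℕ.m≡m%n+[m/n]*n F N {{nz}}) ⟩
  + ((F ℕ.% N) {{nz}} ℕ.+ q ℕ.* N) ≡⟨ cong₂ (λ x y → + (x ℕ.+ y ℕ.* N)) (sym T≡) (ℕ.m≡m%n+[m/n]*n q 2) ⟩
  + (T ℕ.+ (q ℕ.% 2 ℕ.+ q ℕ./ 2 ℕ.* 2) ℕ.* N)
    ≡⟨ cong +_ (ℕS.solve 4 (λ t r s n → t S.:+ (r S.:+ s S.:* S.con 2) S.:* n
         S.:= (t S.:+ r S.:* n) S.:+ s S.:* (n S.:+ (n S.:+ S.con 0))) refl T (q ℕ.% 2) (q ℕ./ 2) N) ⟩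
  + ((T ℕ.+ q ℕ.% 2 ℕ.* N) ℕ.+ q ℕ./ 2 ℕ.* 2 ℕ.^ suc n)
    ≡⟨ cong (λ z → + ((T ℕ.+ z ℕ.* N) ℕ.+ q ℕ./ 2 ℕ.* 2 ℕ.^ suc n)) (sym (toℕ-fromℕ< (ℕ.m%n<n q 2))) ⟩
  + (truncate (fromResidues f) (suc n) ℕ.+ q ℕ./ 2 ℕ.* 2 ℕ.^ suc n)
    ≡⟨ trans (ℤ.pos-+ (truncate (fromResidues f) (suc n)) _)
         (cong (λ z → trunc (fromResidues f) (suc n) ℤ.+ z) (ℤ.pos-* (q ℕ./ 2) (2 ℕ.^ suc n))) ⟩
  trunc (fromResidues f) (suc n) ℤ.+ + (q ℕ./ 2) ℤ.* pow2 (suc n) ∎))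
  where
  open ≡-Reasoning
  module S = ℕS
  nz : ℕ.NonZero (2 ℕ.^ n)
  nz = ℕ.m^n≢0 2 n
  F N q T : ℕ
  F = f (suc n)
  N = 2 ℕ.^ n
  q = (F ℕ./ N) {{nz}}
  T = truncate (fromResidues f) n
  T≡ : T ≡ (F ℕ.% N) {{nz}}
  T≡ = %-unique {n = n} (truncate<2^ (fromResidues f) n)
    (∼-trans (trunc-fromResidues f co n) (∼-sym (co n)))

trunc-+ᶻ : ∀ c d n → trunc (c +ᶻ d) n ∼ trunc c n ℤ.+ trunc d n mod2^ n
trunc-+ᶻ c d n = ∼-trans (trunc-fromResidues _ co n) (∼-reflexive (ℤ.pos-+ (truncate c n) _))
  where
  co : Coherent (λ n → truncate c n ℕ.+ truncate d n)
  co n = ∼-resp (sym (ℤ.pos-+ (truncate c (suc n)) _)) (sym (ℤ.pos-+ (truncate c n) _)) refl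
    (∼-+ (trunc-suc c n) (trunc-suc d n))

trunc-*ᶻ : ∀ c d n → trunc (c *ᶻ d) n ∼ trunc c n ℤ.* trunc d n mod2^ n
trunc-*ᶻ c d n = ∼-trans (trunc-fromResidues _ co n) (∼-reflexive (ℤ.pos-* (truncate c n) _))
  where
  co : Coherent (λ n → truncate c n ℕ.* truncate d n)
  co n = ∼-resp (sym (ℤ.pos-* (truncate c (suc n)) _)) (sym (ℤ.pos-* (truncate c n) _)) refl
    (∼-* (trunc-suc c n) (trunc-suc d n))

trunc-negᶻ : ∀ c n → trunc (-ᶻ c) n ∼ ℤ.- trunc c n mod2^ n
trunc-negᶻ c n = ∼-trans (trunc-fromResidues _ co n) (res n)
  where
  res : ∀ n → + (2 ℕ.^ n ℕ.∸ truncate c n) ∼ ℤ.- trunc c n mod2^ n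
  res n = congruent 1ℤ (trans (sym (trans (ℤ.m-n≡m⊖n (2 ℕ.^ n) (truncate c n))
      (ℤ.⊖-≥ (ℕ.<⇒≤ (truncate<2^ c n)))))
    (solve 2 (λ p t → p :- t := :- t :+ con 1ℤ :* p) refl (pow2 n) (trunc c n)))
    where open ℤS
  co : Coherent (λ n → 2 ℕ.^ n ℕ.∸ truncate c n)
  co n = ∼-trans (∼-weaken 1 (res (suc n))) (∼-trans (∼-neg (trunc-suc c n)) (∼-sym (res n)))

trunc-2^*ᶻ : ∀ k c n → trunc (2^ k *ᶻ c) (k ℕ.+ n) ≡ pow2 k ℤ.* trunc c n
trunc-2^*ᶻ k c n = trans (cong +_ (go k n)) (ℤ.pos-* (2 ℕ.^ k) (truncate c n))
  where
  zeros : ∀ k → truncate (2^ k *ᶻ c) k ≡ 0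
  zeros′ : ∀ k m → m ℕ.≤ k → truncate (2^ k *ᶻ c) m ≡ 0
  digit0 : ∀ k m → m ℕ.< k → (2^ k *ᶻ c) m ≡ 0F
  digit0 (suc k) zero _ = refl
  digit0 (suc k) (suc m) (ℕ.s≤s lt) = digit0 k m lt
  zeros′ k zero _ = refl
  zeros′ k (suc m) lt = trans (cong₂ (λ x y → x ℕ.+ toℕ y ℕ.* 2 ℕ.^ m)
    (zeros′ k m (ℕ.<⇒≤ lt)) (digit0 k m lt)) refl
  zeros k = zeros′ k k ℕ.≤-refl
  digit+ : ∀ k n → (2^ k *ᶻ c) (k ℕ.+ n) ≡ c n
  digit+ zero n = refl
  digit+ (suc k) n = digit+ k n
  go : ∀ k n → truncate (2^ k *ᶻ c) (k ℕ.+ n) ≡ 2 ℕ.^ k ℕ.* truncate c n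
  go k zero = trans (cong (truncate (2^ k *ᶻ c)) (ℕ.+-identityʳ k))
      (trans (zeros k) (sym (ℕ.*-zeroʳ (2 ℕ.^ k))))
  go k (suc n) = begin
    truncate (2^ k *ᶻ c) (k ℕ.+ suc n) ≡⟨ cong (truncate (2^ k *ᶻ c)) (ℕ.+-suc k n) ⟩
    truncate (2^ k *ᶻ c) (k ℕ.+ n) ℕ.+ toℕ ((2^ k *ᶻ c) (k ℕ.+ n)) ℕ.* 2 ℕ.^ (k ℕ.+ n)
      ≡⟨ cong₂ ℕ._+_ (go k n) (cong₂ (λ x y → toℕ x ℕ.* y) (digit+ k n) (ℕ.^-distribˡ-+-* 2 k n)) ⟩
    2 ℕ.^ k ℕ.* truncate c n ℕ.+ toℕ (c n) ℕ.* (2 ℕ.^ k ℕ.* 2 ℕ.^ n)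
      ≡⟨ solve 4 (λ p t x q → p :* t :+ x :* (p :* q) := p :* (t :+ x :* q)) refl (2 ℕ.^ k) (truncate c n)
          (toℕ (c n)) (2 ℕ.^ n) ⟩
    2 ℕ.^ k ℕ.* truncate c (suc n) ∎
    where
    open ≡-Reasoning
    open ℕS

digit : Digits → ℤ → Fin 2
digit c (+ j)    = c j
digit c -[1+ _ ] = 0F

coeff-digit : ∀ k c n → coeff (mkℚ₂ k c) n ≡ digit c (n ℤ.+ + k)
coeff-digit k c n with n ℤ.+ + k
... | + j      = refl
... | -[1+ _ ] = refl

2^*ᶻ-digit : ∀ l c i → (2^ l *ᶻ c) i ≡ digit c (i ℤ.⊖ l)
2^*ᶻ-digit zero c i = refl
2^*ᶻ-digit (suc l) c zero = refl
2^*ᶻ-digit (suc l) c (suc i) = trans (2^*ᶻ-digit l c i) (cong (digit c) (sym (ℤ.[1+m]⊖[1+n]≡m⊖n i l)))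

truncate-ext : ∀ {c d} → (∀ i → c i ≡ d i) → ∀ n → truncate c n ≡ truncate d n
truncate-ext h zero = refl
truncate-ext h (suc n) = cong₂ (λ x y → x ℕ.+ toℕ y ℕ.* 2 ℕ.^ n) (truncate-ext h n) (h n)

-- Both sides are truncations, at the same length, of the two digit sequences moved to the common
-- denominator 2^(k+l). There digit i is the coefficient of 2^(i-k-l), which the two numbers share.
≈₂⇒trunc : ∀ {k c l d} → mkℚ₂ k c ≈₂ mkℚ₂ l d → ∀ n →
  pow2 l ℤ.* trunc c (k ℕ.+ n) ≡ pow2 k ℤ.* trunc d (l ℕ.+ n)
≈₂⇒trunc {k} {c} {l} {d} h n = begin
  pow2 l ℤ.* trunc c (k ℕ.+ n) ≡⟨ sym (trunc-2^*ᶻ l c (k ℕ.+ n)) ⟩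
  trunc (2^ l *ᶻ c) (l ℕ.+ (k ℕ.+ n)) ≡⟨ cong +_ (truncate-ext same (l ℕ.+ (k ℕ.+ n))) ⟩
  trunc (2^ k *ᶻ d) (l ℕ.+ (k ℕ.+ n)) ≡⟨ cong (trunc (2^ k *ᶻ d))
    (solve 3 (λ l k n → l :+ (k :+ n) := k :+ (l :+ n)) refl l k n) ⟩
  trunc (2^ k *ᶻ d) (k ℕ.+ (l ℕ.+ n)) ≡⟨ trunc-2^*ᶻ k d (l ℕ.+ n) ⟩
  pow2 k ℤ.* trunc d (l ℕ.+ n) ∎
  where
  open ≡-Reasoning
  open ℕS
  shift : ∀ k l c i → digit c (i ℤ.⊖ l) ≡ coeff (mkℚ₂ k c) (+ i ℤ.- + (k ℕ.+ l))
  shift k l c i = trans (cong (digit c) (trans (sym (ℤ.m-n≡m⊖n i l))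
    (trans (ℤS.solve 3 (λ i l k → i ℤS.:- l ℤS.:= i ℤS.:- (k ℤS.:+ l) ℤS.:+ k) refl (+ i) (+ l) (+ k))
      (cong (λ z → + i ℤ.- z ℤ.+ + k) (sym (ℤ.pos-+ k l))))))
    (sym (coeff-digit k c (+ i ℤ.- + (k ℕ.+ l))))
  same : ∀ i → (2^ l *ᶻ c) i ≡ (2^ k *ᶻ d) i
  same i = begin
    (2^ l *ᶻ c) i ≡⟨ trans (2^*ᶻ-digit l c i) (shift k l c i) ⟩
    coeff (mkℚ₂ k c) (+ i ℤ.- + (k ℕ.+ l)) ≡⟨ h (+ i ℤ.- + (k ℕ.+ l)) ⟩
    coeff (mkℚ₂ l d) (+ i ℤ.- + (k ℕ.+ l)) ≡⟨ cong (λ z → coeff (mkℚ₂ l d) (+ i ℤ.- + z)) (ℕ.+-comm k l) ⟩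
    coeff (mkℚ₂ l d) (+ i ℤ.- + (l ℕ.+ k)) ≡⟨ sym (shift l k d i) ⟩
    digit d (i ℤ.⊖ k) ≡⟨ sym (2^*ᶻ-digit k d i) ⟩
    (2^ k *ᶻ d) i ∎

open ℤS using () renaming (_:*_ to _⊛_; _:+_ to _⊕_; _:=_ to _≐_; :-_ to ⊝_)

opaque
  -- x ≡ a / 2ᵏ modulo 2ᵐ
  Near : ℚ₂ → ℤ → ℕ → ℕ → Set
  Near (mkℚ₂ l d) a k m = pow2 k ℤ.* trunc d (l ℕ.+ (k ℕ.+ m)) ∼ pow2 l ℤ.* a mod2^ (l ℕ.+ (k ℕ.+ m))

DivisibleBy2^ : ℕ → ℚ₂ → Set
DivisibleBy2^ m x = Near x 0ℤ 0 m

opaque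
  unfolding Near

  Near-≈ : ∀ {x y a k m} → x ≈₂ y → Near x a k m → Near y a k m
  Near-≈ {mkℚ₂ l c} {mkℚ₂ l′ d} {a} {k} {m} x≈y h = ∼-cancel l
    (∼-resp
      (begin
        pow2 l′ ℤ.* (pow2 k ℤ.* trunc c (l ℕ.+ (k ℕ.+ m)))
          ≡⟨ ℤS.solve 3 (λ x y z → x ⊛ (y ⊛ z) ≐ y ⊛ (x ⊛ z)) refl (pow2 l′) (pow2 k) _ ⟩
        pow2 k ℤ.* (pow2 l′ ℤ.* trunc c (l ℕ.+ (k ℕ.+ m)))
          ≡⟨ cong (pow2 k ℤ.*_) (≈₂⇒trunc {l} {c} {l′} {d} x≈y (k ℕ.+ m)) ⟩
        pow2 k ℤ.* (pow2 l ℤ.* trunc d (l′ ℕ.+ (k ℕ.+ m)))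
          ≡⟨ ℤS.solve 3 (λ x y z → x ⊛ (y ⊛ z) ≐ y ⊛ (x ⊛ z)) refl (pow2 k) (pow2 l) _ ⟩
        pow2 l ℤ.* (pow2 k ℤ.* trunc d (l′ ℕ.+ (k ℕ.+ m))) ∎)
      (ℤS.solve 3 (λ x y z → x ⊛ (y ⊛ z) ≐ y ⊛ (x ⊛ z)) refl (pow2 l′) (pow2 l) a)
      (solve 3 (λ l k n → l :+ (k :+ n) := k :+ (l :+ n)) refl l′ l (k ℕ.+ m))
      (∼-scale l′ h))
    where
    open ≡-Reasoning
    open ℕS

  private
    trunc-sum : ∀ l l′ c d n → trunc ((2^ l′ *ᶻ c) +ᶻ (2^ l *ᶻ d)) (l ℕ.+ l′ ℕ.+ n)
      ∼ pow2 l′ ℤ.* trunc c (l ℕ.+ n) ℤ.+ pow2 l ℤ.* trunc d (l′ ℕ.+ n) mod2^ (l ℕ.+ l′ ℕ.+ n)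
    trunc-sum l l′ c d n = ∼-trans (trunc-+ᶻ (2^ l′ *ᶻ c) (2^ l *ᶻ d) (l ℕ.+ l′ ℕ.+ n))
      (∼-reflexive (cong₂ ℤ._+_
        (trans (cong (trunc (2^ l′ *ᶻ c)) (solve 3 (λ l k n → l :+ k :+ n := k :+ (l :+ n)) refl l l′ n))
          (trunc-2^*ᶻ l′ c (l ℕ.+ n)))
        (trans (cong (trunc (2^ l *ᶻ d)) (ℕ.+-assoc l l′ n)) (trunc-2^*ᶻ l d (l′ ℕ.+ n)))))
      where open ℕS

  Near-+ : ∀ {x y a b k m} → Near x a k m → Near y b k m → Near (x +₂ y) (a ℤ.+ b) k m
  Near-+ {mkℚ₂ l c} {mkℚ₂ l′ d} {a} {b} {k} {m} h h′ =
    ∼-trans (∼-* (∼-refl {pow2 k}) (trunc-sum l l′ c d (k ℕ.+ m)))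
    (∼-trans (∼-reflexive (ℤS.solve 5 (λ p q r s t → p ⊛ (q ⊛ r ⊕ s ⊛ t) ≐ q ⊛ (p ⊛ r) ⊕ s ⊛ (p ⊛ t)) refl
         (pow2 k) (pow2 l′) (trunc c (l ℕ.+ (k ℕ.+ m))) (pow2 l) (trunc d (l′ ℕ.+ (k ℕ.+ m)))))
    (∼-trans (∼-+ (∼-resp refl refl (solve 3 (λ l k n → k :+ (l :+ n) := l :+ k :+ n) refl l l′ (k ℕ.+ m))
        (∼-scale l′ h))
                  (∼-resp refl refl (sym (ℕ.+-assoc l l′ (k ℕ.+ m))) (∼-scale l h′)))
      (∼-reflexive (trans (ℤS.solve 4 (λ p q a b → q ⊛ (p ⊛ a) ⊕ p ⊛ (q ⊛ b) ≐ (p ⊛ q) ⊛ (a ⊕ b))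
          refl (pow2 l) (pow2 l′) a b)
         (cong (ℤ._* (a ℤ.+ b)) (sym (pow2-+ l l′)))))))
    where open ℕS

  Near-neg : ∀ {x a k m} → Near x a k m → Near (-₂ x) (ℤ.- a) k m
  Near-neg {mkℚ₂ l c} {a} {k} {m} h =
    ∼-trans (∼-* (∼-refl {pow2 k}) (trunc-negᶻ c (l ℕ.+ (k ℕ.+ m))))
    (∼-trans (∼-reflexive (ℤS.solve 2 (λ p t → p ⊛ (⊝ t) ≐ ⊝ (p ⊛ t)) refl (pow2 k)
        (trunc c (l ℕ.+ (k ℕ.+ m)))))
    (∼-trans (∼-neg h) (∼-reflexive (ℤS.solve 2 (λ p t → ⊝ (p ⊛ t) ≐ p ⊛ (⊝ t)) refl (pow2 l) a))))

  Near-halve : ∀ {x a k m} → Near (x +₂ x) a k (suc m) → Near x a (suc k) m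
  Near-halve {mkℚ₂ l c} {a} {k} {m} h = ∼-cancel l (∼-resp refl
    (trans (cong (ℤ._* a) (pow2-+ l l)) (ℤ.*-assoc (pow2 l) (pow2 l) a)) index
    (∼-trans (∼-sym (∼-trans (∼-* (∼-refl {pow2 k}) (trunc-sum l l c c (k ℕ.+ suc m)))
      (∼-reflexive (begin
        pow2 k ℤ.* (pow2 l ℤ.* trunc c (l ℕ.+ (k ℕ.+ suc m)) ℤ.+ pow2 l ℤ.* trunc c (l ℕ.+ (k ℕ.+ suc m)))
          ≡⟨ ℤS.solve 3 (λ p q t → p ⊛ (q ⊛ t ⊕ q ⊛ t) ≐ q ⊛ ((ℤS.con (+ 2) ⊛ p) ⊛ t)) refl
               (pow2 k) (pow2 l) (trunc c (l ℕ.+ (k ℕ.+ suc m))) ⟩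
        pow2 l ℤ.* ((+ 2 ℤ.* pow2 k) ℤ.* trunc c (l ℕ.+ (k ℕ.+ suc m)))
          ≡⟨ cong₂ (λ x y → pow2 l ℤ.* (x ℤ.* trunc c (l ℕ.+ y))) (sym (pow2-suc k)) (ℕ.+-suc k m) ⟩
        pow2 l ℤ.* (pow2 (suc k) ℤ.* trunc c (l ℕ.+ (suc k ℕ.+ m))) ∎))))
      h))
    where
    open ≡-Reasoning
    index : l ℕ.+ l ℕ.+ (k ℕ.+ suc m) ≡ l ℕ.+ (l ℕ.+ (suc k ℕ.+ m))
    index = solve 3 (λ l k m → l :+ l :+ (k :+ (con 1 :+ m)) := l :+ (l :+ (con 1 :+ k :+ m))) refl l k m
      where open ℕS

  Near-unique : ∀ {x a b k m} → Near x a k m → Near x b k m → a ∼ b mod2^ (k ℕ.+ m)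
  Near-unique {mkℚ₂ l c} h h′ = ∼-cancel l (∼-trans (∼-sym h) h′)

  Near-self : ∀ k c m → Near (mkℚ₂ k c) (trunc c (k ℕ.+ m)) k m
  Near-self k c m = ∼-scale k (trunc-+ c k (k ℕ.+ m))

  Near-rescale : ∀ {x a m} k → Near x a 0 m → Near x (pow2 k ℤ.* a) k m
  Near-rescale {mkℚ₂ l c} {a} {m} k h = ∼-resp refl
    (ℤS.solve 3 (λ p q a → p ⊛ (q ⊛ a) ≐ q ⊛ (p ⊛ a)) refl (pow2 k) (pow2 l) a)
    (solve 3 (λ k l m → k :+ (l :+ m) := l :+ (k :+ m)) refl k l m)
    (∼-scale k (∼-trans
      (∼-resp (cong (trunc c) (solve 3 (λ k l m → k :+ (l :+ m) := l :+ (k :+ m)) refl k l m)) refl refl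
        (trunc-+ c k (l ℕ.+ m)))
      (∼-trans (∼-reflexive (sym (ℤ.*-identityˡ (trunc c (l ℕ.+ m))))) h)))
    where open ℕS

  Near-0⇒divisible : ∀ {x m} k → Near x 0ℤ k m → DivisibleBy2^ m x
  Near-0⇒divisible {mkℚ₂ l c} {m} k h = ∼-trans
    (∼-reflexive (ℤ.*-identityˡ _))
    (∼-trans (∼-sym (trunc-+ c k (l ℕ.+ m)))
      (∼-resp (cong (trunc c) index) (sym (ℤ.*-zeroʳ (pow2 l))) refl
        (∼-cancel k (∼-resp refl (trans (ℤ.*-zeroʳ (pow2 l)) (sym (ℤ.*-zeroʳ (pow2 k)))) index h))))
    where
    open ℕS
    index : l ℕ.+ (k ℕ.+ m) ≡ k ℕ.+ (l ℕ.+ m)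
    index = solve 3 (λ k l m → l :+ (k :+ m) := k :+ (l :+ m)) refl k l m

  divisible-trunc : ∀ {l c m} n → DivisibleBy2^ m (mkℚ₂ l c) → trunc c (n ℕ.+ (l ℕ.+ m)) ∼ 0ℤ mod2^
      (l ℕ.+ m)
  divisible-trunc {l} {c} {m} n h = ∼-trans (trunc-+ c n (l ℕ.+ m))
    (∼-trans (∼-reflexive (sym (ℤ.*-identityˡ _))) (∼-trans h (∼-reflexive (ℤ.*-zeroʳ (pow2 l)))))

  ∼0-* : ∀ {x y} m n → x ∼ 0ℤ mod2^ m → y ∼ 0ℤ mod2^ n → x ℤ.* y ∼ 0ℤ mod2^ (m ℕ.+ n)
  ∼0-* m n (congruent t refl) (congruent s refl) = congruent (t ℤ.* s)
    (trans (ℤS.solve 4 (λ t p s q → (ℤS.con 0ℤ ⊕ t ⊛ p) ⊛ (ℤS.con 0ℤ ⊕ s ⊛ q) ≐ ℤS.con 0ℤ ⊕ (t ⊛ s) ⊛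
        (p ⊛ q)) refl
       t (pow2 m) s (pow2 n))
     (cong (λ z → 0ℤ ℤ.+ t ℤ.* s ℤ.* z) (sym (pow2-+ m n))))

  divisible-* : ∀ {x y m n} → DivisibleBy2^ m x → DivisibleBy2^ n y → DivisibleBy2^ (m ℕ.+ n) (x *₂ y)
  divisible-* {mkℚ₂ l c} {mkℚ₂ l′ d} {m} {n} h h′ = ∼-trans (∼-reflexive (ℤ.*-identityˡ _))
    (∼-trans (trunc-*ᶻ c d (l ℕ.+ l′ ℕ.+ (m ℕ.+ n)))
      (∼-resp (cong₂ ℤ._*_ (cong (trunc c) (solve 4
          (λ l l′ m n → l′ :+ n :+ (l :+ m) := l :+ l′ :+ (m :+ n)) refl l l′ m n))
                           (cong (trunc d) (solve 4 (λ l l′ m n → l :+ m :+ (l′ :+ n) := l :+ l′ :+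
                               (m :+ n)) refl l l′ m n)))
        (sym (ℤ.*-zeroʳ (pow2 (l ℕ.+ l′))))
        (solve 4 (λ l l′ m n → l :+ m :+ (l′ :+ n) := l :+ l′ :+ (m :+ n)) refl l l′ m n)
        (∼0-* (l ℕ.+ m) (l′ ℕ.+ n) (divisible-trunc {l} {c} {m} (l′ ℕ.+ n) h)
            (divisible-trunc {l′} {d} {n} (l ℕ.+ m) h′))))
    where open ℕS

  private
    truncate-zero : ∀ c n → truncate c n ≡ 0 → ∀ i → i ℕ.< n → c i ≡ 0F
    truncate-zero c (suc n) h i (ℕ.s≤s i≤n) with ℕ.m≤n⇒m<n∨m≡n i≤n
    ... | inj₁ i<n = truncate-zero c n (ℕ.m+n≡0⇒m≡0 (truncate c n) h) i i<n
    ... | inj₂ refl with c n | ℕ.m+n≡0⇒n≡0 (truncate c n) h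
    ...   | 0F | _ = refl
    ...   | sucF 0F | e = ⊥-elim (ℕ.≢-nonZero⁻¹ (2 ℕ.^ n) {{ℕ.m^n≢0 2 n}}
        (trans (sym (ℕ.*-identityˡ (2 ℕ.^ n))) e))

leading≤½^ : ∀ c j n → (∀ i → i ℕ.< j → c i ≡ 0F) → leading c n ≤ ½ ^ j
leading≤½^ c zero n h = NormLemmas.leading≤1 c n
leading≤½^ c (suc j) zero h = ^-nonneg (suc j) (ℚ.<⇒≤ RationalLemmas.0<½)
leading≤½^ c (suc j) (suc n) h with c 0 | h 0 (ℕ.s≤s ℕ.z≤n)
... | 0F | _ = ℚ.*-monoˡ-≤-nonNeg ½ (leading≤½^ (λ i → c (suc i)) j n (λ i lt → h (suc i) (ℕ.s≤s lt)))

2^*½^ : ∀ l → (+ 2 ℚ./ 1) ^ l * ½ ^ l ≡ 1ℚ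
2^*½^ zero = refl
2^*½^ (suc l) = trans (ℚS.solve 4 (λ a b c d → (a ⊗ b) ⊗ (c ⊗ d) ⊜ (a ⊗ c) ⊗ (b ⊗ d)) refl
    (+ 2 ℚ./ 1) ((+ 2 ℚ./ 1) ^ l) ½ (½ ^ l))
  (trans (cong ((+ 2 ℚ./ 1) * ½ *_) (2^*½^ l)) refl)

opaque
  unfolding Near

  Near-multiple⇒divisible : ∀ {x} m a → Near x (pow2 m ℤ.* a) 0 m → DivisibleBy2^ m x
  Near-multiple⇒divisible {mkℚ₂ l c} m a h = ∼-trans h (congruent a
    (trans (sym (ℤ.*-assoc (pow2 l) (pow2 m) a)) (trans (cong (ℤ._* a) (sym (pow2-+ l m)))
      (trans (ℤ.*-comm (pow2 (l ℕ.+ m)) a) (trans (sym (ℤ.+-identityˡ _))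
          (cong (ℤ._+ a ℤ.* pow2 (l ℕ.+ m)) (sym (ℤ.*-zeroʳ (pow2 l)))))))))

  -- The first l + m digits vanish, which bounds `leading` by ½^(l+m) at every stage; the factor 2^l
  -- of the norm cancels the shift.
  divisible⇒norm≤ : ∀ {x m} → DivisibleBy2^ m x → ∣ x ∣₂ ≤ᴿ fromℚ (½ ^ m)
  divisible⇒norm≤ {mkℚ₂ l c} {m} h ε 0<ε = 0 , λ n _ → ℚ.≤-<-trans
    (begin
      (+ 2 ℚ./ 1) ^ l * leading c n ≤⟨ ℚ.*-monoˡ-≤-nonNeg ((+ 2 ℚ./ 1) ^ l)
        {{ℚ.nonNegative (^-nonneg l (0≤/ 2 0))}} (leading≤½^ c (l ℕ.+ m) n zeros) ⟩
      (+ 2 ℚ./ 1) ^ l * ½ ^ (l ℕ.+ m) ≡⟨ cong ((+ 2 ℚ./ 1) ^ l *_) (ℚ-Exp.^-homo-* ½ l m) ⟩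
      (+ 2 ℚ./ 1) ^ l * (½ ^ l * ½ ^ m) ≡⟨ sym (ℚ.*-assoc ((+ 2 ℚ./ 1) ^ l) (½ ^ l) (½ ^ m)) ⟩
      (+ 2 ℚ./ 1) ^ l * ½ ^ l * ½ ^ m ≡⟨ cong (_* ½ ^ m) (2^*½^ l) ⟩
      1ℚ * ½ ^ m ≡⟨ ℚ.*-identityˡ _ ⟩
      ½ ^ m ∎)
    (subst (_< ½ ^ m + ε) (ℚ.+-identityʳ (½ ^ m)) (ℚ.+-monoʳ-< (½ ^ m) 0<ε))
    where
    open ℚ.≤-Reasoning
    zeros : ∀ i → i ℕ.< l ℕ.+ m → c i ≡ 0F
    zeros = truncate-zero c (l ℕ.+ m) (∼0⇒≡0 {n = l ℕ.+ m} (truncate<2^ c (l ℕ.+ m))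
        (divisible-trunc {l} {c} {m} 0 h))

  Near-0₂ : ∀ k m → Near 0₂ 0ℤ k m
  Near-0₂ k m = ∼-reflexive (trans (cong (λ z → pow2 k ℤ.* + z) (zeros (k ℕ.+ m))) (ℤ.*-zeroʳ (pow2 k)))
    where
    zeros : ∀ n → truncate (λ _ → 0F) n ≡ 0
    zeros zero = refl
    zeros (suc n) = trans (ℕ.+-identityʳ _) (zeros n)

  Near-1₂ : ∀ m → Near 1₂ 1ℤ 0 m
  Near-1₂ m = ∼-trans (∼-reflexive (ℤ.*-identityˡ _)) (ones m)
    where
    ones : ∀ n → trunc (ℚ₂.digits 1₂) n ∼ 1ℤ mod2^ n
    ones zero = congruent -[1+ 0 ] refl
    ones (suc n) = ∼-reflexive (cong +_ (go n))
      where
      go : ∀ n → truncate (ℚ₂.digits 1₂) (suc n) ≡ 1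
      go zero = refl
      go (suc n) = trans (ℕ.+-identityʳ _) (go n)

-- Integers inside the rationals

2ℚ : ℚ
2ℚ = + 2 ℚ./ 1

opaque
  fromℤ : ℤ → ℚ
  fromℤ i = i ℚ./ 1

  fromℤ-def : ∀ i → i ℚ./ 1 ≡ fromℤ i
  fromℤ-def i = refl

  private
    toℚᵘ-fromℤ : ∀ i → ℚ.toℚᵘ (fromℤ i) ℚᵘ.≃ ℚᵘ.mkℚᵘ i 0
    toℚᵘ-fromℤ i = ℚ.toℚᵘ-fromℚᵘ (ℚᵘ.mkℚᵘ i 0)

  fromℤ-+ : ∀ i j → fromℤ (i ℤ.+ j) ≡ fromℤ i + fromℤ j
  fromℤ-+ i j = ℚ.toℚᵘ-injective (begin
    ℚ.toℚᵘ (fromℤ (i ℤ.+ j)) ≈⟨ toℚᵘ-fromℤ (i ℤ.+ j) ⟩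
    ℚᵘ.mkℚᵘ (i ℤ.+ j) 0 ≈⟨ ℚᵘ.*≡* (solve 2 (λ i j → (i :+ j) :* con 1ℤ := (i :* con 1ℤ :+ j :* con 1ℤ) :*
        con 1ℤ) refl i j) ⟩
    ℚᵘ.mkℚᵘ i 0 ℚᵘ.+ ℚᵘ.mkℚᵘ j 0 ≈⟨ ℚᵘ.≃-sym (ℚᵘ.+-cong (toℚᵘ-fromℤ i) (toℚᵘ-fromℤ j)) ⟩
    ℚ.toℚᵘ (fromℤ i) ℚᵘ.+ ℚ.toℚᵘ (fromℤ j) ≈⟨ ℚᵘ.≃-sym (ℚ.toℚᵘ-homo-+ (fromℤ i) (fromℤ j)) ⟩
    ℚ.toℚᵘ (fromℤ i + fromℤ j) ∎)
    where
    open ℚᵘ.≃-Reasoning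
    open ℤS

  fromℤ-* : ∀ i j → fromℤ (i ℤ.* j) ≡ fromℤ i * fromℤ j
  fromℤ-* i j = ℚ.toℚᵘ-injective (begin
    ℚ.toℚᵘ (fromℤ (i ℤ.* j)) ≈⟨ toℚᵘ-fromℤ (i ℤ.* j) ⟩
    ℚᵘ.mkℚᵘ (i ℤ.* j) 0 ≈⟨ ℚᵘ.*≡* refl ⟩
    ℚᵘ.mkℚᵘ i 0 ℚᵘ.* ℚᵘ.mkℚᵘ j 0 ≈⟨ ℚᵘ.≃-sym (ℚᵘ.*-cong (toℚᵘ-fromℤ i) (toℚᵘ-fromℤ j)) ⟩
    ℚ.toℚᵘ (fromℤ i) ℚᵘ.* ℚ.toℚᵘ (fromℤ j) ≈⟨ ℚᵘ.≃-sym (ℚ.toℚᵘ-homo-* (fromℤ i) (fromℤ j)) ⟩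
    ℚ.toℚᵘ (fromℤ i * fromℤ j) ∎)
    where open ℚᵘ.≃-Reasoning

  fromℤ-injective : ∀ {i j} → fromℤ i ≡ fromℤ j → i ≡ j
  fromℤ-injective {i} {j} eq = trans (sym (ℤ.*-identityʳ i)) (trans
    (ℚᵘ.drop-*≡* (ℚᵘ.≃-trans (ℚᵘ.≃-sym (toℚᵘ-fromℤ i))
        (ℚᵘ.≃-trans (ℚᵘ.≃-reflexive (cong ℚ.toℚᵘ eq)) (toℚᵘ-fromℤ j))))
    (ℤ.*-identityʳ j))

  fromℤ-mono-≤ : ∀ {i j} → i ℤ.≤ j → fromℤ i ≤ fromℤ j
  fromℤ-mono-≤ {i} {j} i≤j = ℚ.toℚᵘ-cancel-≤ (ℚᵘ.≤-respˡ-≃ (ℚᵘ.≃-sym (toℚᵘ-fromℤ i))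
      (ℚᵘ.≤-respʳ-≃ (ℚᵘ.≃-sym (toℚᵘ-fromℤ j))
    (ℚᵘ.*≤* (subst₂ ℤ._≤_ (sym (ℤ.*-identityʳ i)) (sym (ℤ.*-identityʳ j)) i≤j))))

  fromℤ-cancel-≤ : ∀ {i j} → fromℤ i ≤ fromℤ j → i ℤ.≤ j
  fromℤ-cancel-≤ {i} {j} h = subst₂ ℤ._≤_ (ℤ.*-identityʳ i) (ℤ.*-identityʳ j)
    (ℚᵘ.drop-*≤* (ℚᵘ.≤-respˡ-≃ (toℚᵘ-fromℤ i) (ℚᵘ.≤-respʳ-≃ (toℚᵘ-fromℤ j) (ℚ.toℚᵘ-mono-≤ h))))

  fromℤ-1 : fromℤ 1ℤ ≡ 1ℚ
  fromℤ-1 = refl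

  fromℤ-0 : fromℤ 0ℤ ≡ 0ℚ
  fromℤ-0 = refl

  fromℤ-2 : fromℤ (+ 2) ≡ 2ℚ
  fromℤ-2 = refl

  /*fromℤ : ∀ i n .{{_ : ℕ.NonZero n}} → (i ℚ./ n) * fromℤ (+ n) ≡ fromℤ i
  /*fromℤ i n@(suc m) = ℚ.toℚᵘ-injective (begin
    ℚ.toℚᵘ ((i ℚ./ n) * fromℤ (+ n)) ≈⟨ ℚ.toℚᵘ-homo-* (i ℚ./ n) (fromℤ (+ n)) ⟩
    ℚ.toℚᵘ (i ℚ./ n) ℚᵘ.* ℚ.toℚᵘ (fromℤ (+ n)) ≈⟨ ℚᵘ.*-cong (ℚ.toℚᵘ-fromℚᵘ (ℚᵘ.mkℚᵘ i m))
        (toℚᵘ-fromℤ (+ n)) ⟩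
    ℚᵘ.mkℚᵘ i m ℚᵘ.* ℚᵘ.mkℚᵘ (+ n) 0 ≈⟨ ℚᵘ.*≡*
        (trans (ℤ.*-identityʳ _) (cong (i ℤ.*_) (cong +_ (sym (ℕ.*-identityʳ n))))) ⟩
    ℚᵘ.mkℚᵘ i 0 ≈⟨ ℚᵘ.≃-sym (toℚᵘ-fromℤ i) ⟩
    ℚ.toℚᵘ (fromℤ i) ∎)
    where open ℚᵘ.≃-Reasoning

fromℤ-neg : ∀ i → fromℤ (ℤ.- i) ≡ - fromℤ i
fromℤ-neg i = begin
  fromℤ (ℤ.- i) ≡⟨ solve 2 (λ x y → y := (y :+ x) :- x) refl (fromℤ i) (fromℤ (ℤ.- i)) ⟩
  fromℤ (ℤ.- i) + fromℤ i - fromℤ i ≡⟨ cong (_- fromℤ i)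
      (trans (sym (fromℤ-+ (ℤ.- i) i)) (trans (cong fromℤ (ℤ.+-inverseˡ i)) fromℤ-0)) ⟩
  0ℚ - fromℤ i ≡⟨ ℚ.+-identityˡ _ ⟩
  - fromℤ i ∎
  where
  open ≡-Reasoning
  open ℚS

↥-fromℤ : ∀ r → r * fromℤ (+ ↧ₙ r) ≡ fromℤ (↥ r)
↥-fromℤ r@record{} = trans (cong (_* fromℤ (+ ↧ₙ r)) (sym (ℚ.↥p/↧p≡p r))) (/*fromℤ (↥ r) (↧ₙ r))

fromℤ-pow2 : ∀ n → fromℤ (pow2 n) ≡ 2ℚ ^ n
fromℤ-pow2 zero = fromℤ-1
fromℤ-pow2 (suc n) = trans (cong fromℤ (pow2-suc n))
    (trans (fromℤ-* (+ 2) (pow2 n)) (cong₂ _*_ fromℤ-2 (fromℤ-pow2 n)))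

1≤2ℚ : 1ℚ ≤ 2ℚ
1≤2ℚ = ℚ.<⇒≤ (ℚ.*<* (ℤ.+<+ (ℕ.s≤s (ℕ.s≤s ℕ.z≤n))))

0<2^ : ∀ n → 0ℚ < 2ℚ ^ n
0<2^ n = ^-pos n (ℚ.<-≤-trans 0<1 1≤2ℚ)

*-monoˡ-≤ : ∀ {r x y} → 0ℚ ≤ r → x ≤ y → r * x ≤ r * y
*-monoˡ-≤ {r} 0≤r = ℚ.*-monoˡ-≤-nonNeg r {{nn 0≤r}}

*-monoʳ-≤ : ∀ {r x y} → 0ℚ ≤ r → x ≤ y → x * r ≤ y * r
*-monoʳ-≤ {r} 0≤r = ℚ.*-monoʳ-≤-nonNeg r {{nn 0≤r}}

*-cancelˡ : ∀ {r x y} → 0ℚ < r → r * x ≡ r * y → x ≡ y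
*-cancelˡ {r} {x} {y} 0<r eq = begin
  x ≡⟨ sym (ℚ.*-identityˡ x) ⟩
  1ℚ * x ≡⟨ cong (_* x) (sym inv) ⟩
  r⁻¹ * r * x ≡⟨ ℚ.*-assoc r⁻¹ r x ⟩
  r⁻¹ * (r * x) ≡⟨ cong (r⁻¹ *_) eq ⟩
  r⁻¹ * (r * y) ≡⟨ sym (ℚ.*-assoc r⁻¹ r y) ⟩
  r⁻¹ * r * y ≡⟨ cong (_* y) inv ⟩
  1ℚ * y ≡⟨ ℚ.*-identityˡ y ⟩
  y ∎
  where
  open ≡-Reasoning
  r⁻¹ = (ℚ.1/ r) {{ℚ.>-nonZero 0<r}}
  inv = ℚ.*-inverseˡ r {{ℚ.>-nonZero 0<r}}

⌊⌋₂-scaled : ∀ k c → 2ℚ ^ k * ⌊ mkℚ₂ k c ⌋₂ ≡ fromℤ (trunc c (suc k))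
⌊⌋₂-scaled k c = trans (ℚ.*-comm (2ℚ ^ k) _) (trans (cong (⌊ mkℚ₂ k c ⌋₂ *_) (sym (fromℤ-pow2 k)))
  (/*fromℤ (trunc c (suc k)) (2 ℕ.^ k) {{ℕ.m^n≢0 2 k}}))

⌊⌋₂-cong : ∀ {x y} → x ≈₂ y → ⌊ x ⌋₂ ≡ ⌊ y ⌋₂
⌊⌋₂-cong {x@(mkℚ₂ k c)} {y@(mkℚ₂ l d)} x≈y = *-cancelˡ (*-pos (0<2^ l) (0<2^ k)) (begin
  2ℚ ^ l * 2ℚ ^ k * ⌊ x ⌋₂ ≡⟨ ℚ.*-assoc (2ℚ ^ l) (2ℚ ^ k) _ ⟩
  2ℚ ^ l * (2ℚ ^ k * ⌊ x ⌋₂) ≡⟨ cong₂ _*_ (sym (fromℤ-pow2 l)) (⌊⌋₂-scaled k c) ⟩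
  fromℤ (pow2 l) * fromℤ (trunc c (suc k)) ≡⟨ sym (fromℤ-* (pow2 l) _) ⟩
  fromℤ (pow2 l ℤ.* trunc c (suc k)) ≡⟨ cong fromℤ
      (subst₂ (λ i j → pow2 l ℤ.* trunc c i ≡ pow2 k ℤ.* trunc d j)
     (ℕ.+-comm k 1) (ℕ.+-comm l 1) (≈₂⇒trunc {k} {c} {l} {d} x≈y 1)) ⟩
  fromℤ (pow2 k ℤ.* trunc d (suc l)) ≡⟨ fromℤ-* (pow2 k) _ ⟩
  fromℤ (pow2 k) * fromℤ (trunc d (suc l)) ≡⟨ cong₂ _*_ (fromℤ-pow2 k) (sym (⌊⌋₂-scaled l d)) ⟩
  2ℚ ^ k * (2ℚ ^ l * ⌊ y ⌋₂) ≡⟨ ℚS.solve 3 (λ a b c → a ⊗ (b ⊗ c) ⊜ b ⊗ a ⊗ c) refl (2ℚ ^ k)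
      (2ℚ ^ l) ⌊ y ⌋₂ ⟩
  2ℚ ^ l * 2ℚ ^ k * ⌊ y ⌋₂ ∎)
  where open ≡-Reasoning

Odd : ℤ → Set
Odd i = i ∼ 1ℤ mod2^ 1

private
  parity⁺ : ∀ n → (∃[ j ] + n ≡ + 2 ℤ.* j) ⊎ Odd (+ n)
  parity⁺ zero = inj₁ (0ℤ , refl)
  parity⁺ (suc n) with parity⁺ n
  ... | inj₁ (j , eq) = inj₂ (congruent j (cong (λ z → 1ℤ ℤ.+ z) (trans eq (ℤ.*-comm (+ 2) j))))
  ... | inj₂ (congruent t eq) = inj₁ (1ℤ ℤ.+ t , trans (cong (λ z → 1ℤ ℤ.+ z) eq)
      (solve 1 (λ t → con 1ℤ :+ (con 1ℤ :+ t :* con (+ 2)) := con (+ 2) :* (con 1ℤ :+ t)) refl t))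
    where open ℤS

parity : ∀ i → (∃[ j ] i ≡ + 2 ℤ.* j) ⊎ Odd i
parity (+ n) = parity⁺ n
parity -[1+ n ] with parity⁺ (suc n)
... | inj₁ (j , eq) = inj₁ (ℤ.- j , trans (cong ℤ.-_ eq) (ℤ.neg-distribʳ-* (+ 2) j))
... | inj₂ h = inj₂ (∼-trans (∼-neg h) (congruent -[1+ 0 ] refl))

-- Factors of 2 are removed one at a time: an odd d would make the product odd, so d is even, and
-- cancelling its 2 lowers e by one.
odd-cancel : ∀ e {o d} → Odd o → o ℤ.* d ∼ 0ℤ mod2^ e → d ∼ 0ℤ mod2^ e
odd-cancel zero {o} {d} odd h = congruent d (solve 1 (λ d → d := con 0ℤ :+ d :* con 1ℤ) refl d)
  where open ℤS
odd-cancel (suc e) {o} {d} odd h with parity d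
... | inj₂ d-odd = ⊥-elim (1≁0 (∼-trans (∼-sym (∼-* odd d-odd))
    (∼-weaken e (subst (o ℤ.* d ∼ 0ℤ mod2^_) (ℕ.+-comm 1 e) h))))
... | inj₁ (j , refl) = ∼-resp refl (ℤ.*-zeroʳ (pow2 1)) refl (∼-scale 1 (odd-cancel e {o} {j} odd
    (∼-cancel 1 (∼-resp (solve 2 (λ o j → o :* (con (+ 2) :* j) := con (+ 2) :* (o :* j)) refl o j)
        (sym (ℤ.*-zeroʳ (pow2 1))) refl h))))
  where open ℤS

∼0⇒∣ : ∀ {i} n → i ∼ 0ℤ mod2^ n → 2 ℕ.^ n ℕ.∣ ℤ.∣ i ∣
∼0⇒∣ n (congruent t refl) = ℕ.divides ℤ.∣ t ∣ (trans (cong ℤ.∣_∣ (ℤ.+-identityˡ (t ℤ.* pow2 n)))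
    (ℤ.abs-* t (pow2 n)))

n<2^n : ∀ n → n ℕ.< 2 ℕ.^ n
n<2^n zero = ℕ.s≤s ℕ.z≤n
n<2^n (suc n) = ℕ.≤-trans (ℕ.s≤s (n<2^n n)) (ℕ.+-mono-≤ (ℕ.m^n>0 2 n)
    (ℕ.≤-reflexive (sym (ℕ.+-identityʳ (2 ℕ.^ n)))))

exponent₂-odd : ∀ f n → ¬ 2 ℕ.∣ n → exponent₂ f n ≡ 0
exponent₂-odd zero n h = refl
exponent₂-odd (suc f) n h with 2 ℕ.∣? n
... | yes p = ⊥-elim (h p)
... | no _ = refl

exponent₂-2^ : ∀ f e → e ℕ.≤ f → exponent₂ f (2 ℕ.^ e) ≡ e
exponent₂-2^ f zero _ = exponent₂-odd f 1 λ { (ℕ.divides (suc q) ()) }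
exponent₂-2^ (suc f) (suc e) (ℕ.s≤s e≤f) with 2 ℕ.∣? (2 ℕ.^ suc e)
... | no h = ⊥-elim (h (ℕ.m∣m*n (2 ℕ.^ e)))
... | yes (ℕ.divides q eq) = cong suc (trans (cong (exponent₂ f)
    (sym (ℕ.*-cancelˡ-≡ (2 ℕ.^ e) q 2 (trans eq (ℕ.*-comm q 2)))))
    (exponent₂-2^ f e e≤f))

even-abs : ∀ i → 2 ℕ.∣ ℤ.∣ i ∣ → i ∼ 0ℤ mod2^ 1
even-abs i (ℕ.divides q eq) with ℤ.+∣i∣≡i⊎+∣i∣≡-i i
... | inj₁ e = congruent (+ q) (trans (sym e)
    (trans (cong +_ eq) (trans (ℤ.pos-* q 2) (sym (ℤ.+-identityˡ (+ q ℤ.* + 2))))))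
... | inj₂ e = ∼-trans (∼-reflexive (sym (ℤ.neg-involutive i))) (∼-neg {y = 0ℤ} (congruent (+ q)
    (trans (sym e) (trans (cong +_ eq) (trans (ℤ.pos-* q 2) (sym (ℤ.+-identityˡ (+ q ℤ.* + 2))))))))

-- For b = a/d in lowest terms the hypothesis reads o d = 2^e a. Oddness of o gives 2^e ∣ d and
-- coprimality gives d ∣ 2^e, so d = 2^e and a = o.
v₂-odd : ∀ e o b → Odd o → 2ℚ ^ e * b ≡ fromℤ o → v₂ b ≡ [ ℤ.- (+ e) ]
v₂-odd e o b@(ℚ.mkℚ a d-1 cop) odd eq with a ℤ.≟ 0ℤ
... | yes refl = ⊥-elim (1≁0 (∼-trans (∼-sym odd) (∼-reflexive (fromℤ-injective (trans (sym eq)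
    (trans (cong (2ℚ ^ e *_) (ℚ.≃⇒≡ {b} {0ℚ} (ℚ.*≡* refl))) (trans (ℚ.*-zeroʳ (2ℚ ^ e)) (sym fromℤ-0))))))))
... | no a≢0 = cong [_] (begin
    + exponent₂ ℤ.∣ a ∣ ℤ.∣ a ∣ ℤ.- + exponent₂ d d ≡⟨ cong₂ (λ x y → + x ℤ.- + y)
       (exponent₂-odd ℤ.∣ a ∣ ℤ.∣ a ∣ (λ h → 1≁0
           (∼-trans (∼-sym odd) (∼-trans (∼-reflexive o≡a) (even-abs a h)))))
       (trans (cong (λ z → exponent₂ z z) d≡2^e) (exponent₂-2^ (2 ℕ.^ e) e (ℕ.<⇒≤ (n<2^n e)))) ⟩
    0ℤ ℤ.- + e ≡⟨ ℤ.+-identityˡ _ ⟩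
    ℤ.- + e ∎)
  where
  open ≡-Reasoning
  d = suc d-1
  od : o ℤ.* + d ≡ pow2 e ℤ.* a
  od = fromℤ-injective (begin
    fromℤ (o ℤ.* + d) ≡⟨ fromℤ-* o (+ d) ⟩
    fromℤ o * fromℤ (+ d) ≡⟨ cong (_* fromℤ (+ d)) (sym eq) ⟩
    2ℚ ^ e * b * fromℤ (+ d) ≡⟨ ℚ.*-assoc (2ℚ ^ e) b _ ⟩
    2ℚ ^ e * (b * fromℤ (+ d)) ≡⟨ cong₂ _*_ (sym (fromℤ-pow2 e)) (↥-fromℤ b) ⟩
    fromℤ (pow2 e) * fromℤ a ≡⟨ sym (fromℤ-* (pow2 e) a) ⟩
    fromℤ (pow2 e ℤ.* a) ∎)
  2^e∣d : 2 ℕ.^ e ℕ.∣ d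
  2^e∣d = ∼0⇒∣ {+ d} e (odd-cancel e {o} {+ d} odd
      (congruent a (trans od (trans (ℤ.*-comm (pow2 e) a) (sym (ℤ.+-identityˡ _))))))
  d∣2^e : d ℕ.∣ 2 ℕ.^ e
  d∣2^e = ℕ.coprime-divisor {d} {ℤ.∣ a ∣} (ℕ.sym (ℕ.recompute cop))
    (ℕ.divides ℤ.∣ o ∣ (trans (ℕ.*-comm ℤ.∣ a ∣ (2 ℕ.^ e))
        (trans (sym (ℤ.abs-* (pow2 e) a)) (trans (cong ℤ.∣_∣ (sym od)) (ℤ.abs-* o (+ d))))))
  d≡2^e : d ≡ 2 ℕ.^ e
  d≡2^e = ℕ.∣-antisym d∣2^e 2^e∣d
  o≡a : o ≡ a
  o≡a = ℤ.*-cancelʳ-≡ o a (+ d) (trans od (trans (ℤ.*-comm (pow2 e) a)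
      (cong (λ z → a ℤ.* + z) (sym d≡2^e))))

-- The two places of the quadratic field

-- The numerator is halved as long as it is even. The alternatives separate the dyadic rationals
-- that are integral at 2 from those that are not.
dyadic-cases : ∀ k b a → 2ℚ ^ k * b ≡ fromℤ a →
  (∃[ i ] b ≡ fromℤ i) ⊎ (∃[ e ] ∃[ o ] Odd o × 2ℚ ^ suc e * b ≡ fromℤ o)
dyadic-cases zero b a eq = inj₁ (a , trans (sym (ℚ.*-identityˡ b)) eq)
dyadic-cases (suc k) b a eq with parity a
... | inj₂ odd = inj₂ (k , a , odd , eq)
... | inj₁ (j , refl) = dyadic-cases k b j (*-cancelˡ {2ℚ} (0<2^ 1)
      (trans (sym (ℚ.*-assoc 2ℚ (2ℚ ^ k) b)) (trans eq
          (trans (fromℤ-* (+ 2) j) (cong (_* fromℤ j) fromℤ-2)))))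

module FieldLemmas {c ℓ} (K : QuadraticField c ℓ) where
  open QuadraticField K public
  open CommutativeRing commutativeRing public
    using (+-cong; *-cong; *-assoc; *-comm; *-identityˡ; *-identityʳ; zeroˡ; +-identityˡ;
        +-identityʳ; -‿cong; setoid)
    renaming (refl to ≈-refl; sym to ≈-sym; trans to ≈-trans; reflexive to ≈-reflexive; -_ to -ᴷ_)
  module ι = RingMorphisms.IsRingHomomorphism ι-isRingHomomorphism
  open import Algebra.Properties.CommutativeSemiring.Exp
      (CommutativeRing.commutativeSemiring commutativeRing) public
    using () renaming (_^_ to _^ᴷ_; ^-distrib-* to ^ᴷ-distrib-*; ^-assocʳ to
        ^ᴷ-assocʳ; ^-congˡ to ^ᴷ-congˡ)

  private
    morphism : ℚ.+-*-rawRing ACR.-Raw-AlmostCommutative⟶ ACR.fromCommutativeRing commutativeRing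
    morphism = record
      { ⟦_⟧ = ι ; +-homo = ι.+-homo ; *-homo = ι.*-homo ; -‿homo = ι.-‿homo
      ; 0-homo = ι.0#-homo ; 1-homo = ι.1#-homo }

    ι-≟ : ∀ x y → Maybe (ι x ≈ ι y)
    ι-≟ x y with x ℚ.≟ y
    ... | yes eq = just (ι.⟦⟧-cong eq)
    ... | no _   = nothing

  open Algebra.Solver.Ring ℚ.+-*-rawRing (ACR.fromCommutativeRing commutativeRing) morphism ι-≟ public
    using (con; _:*_; _:+_; _:-_; :-_; _:=_) renaming (solve to solveᴷ)

  ι-inverse : ∀ {r s} → r * s ≡ 1ℚ → ι r *ᴷ ι s ≈ 1#
  ι-inverse {r} {s} eq = ≈-trans (≈-sym (ι.*-homo r s)) (≈-trans (ι.⟦⟧-cong eq) ι.1#-homo)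

  *ᴷ-cancelˡ : ∀ {x x⁻¹ y z} → x *ᴷ x⁻¹ ≈ 1# → x *ᴷ y ≈ x *ᴷ z → y ≈ z
  *ᴷ-cancelˡ {x} {x⁻¹} {y} {z} inv eq = ≈-trans (side y) (≈-trans (*-cong ≈-refl eq) (≈-sym (side z)))
    where
    side : ∀ y → y ≈ x⁻¹ *ᴷ (x *ᴷ y)
    side y = ≈-trans (≈-sym (*-identityˡ y)) (≈-trans (*-cong (≈-sym inv) ≈-refl)
      (solveᴷ 3 (λ x x⁻¹ y → x :* x⁻¹ :* y := x⁻¹ :* (x :* y)) ≈-refl x x⁻¹ y))

  inverse-unique : ∀ {x y z} → x *ᴷ y ≈ 1# → x *ᴷ z ≈ 1# → y ≈ z
  inverse-unique h k = *ᴷ-cancelˡ h (≈-trans h (≈-sym k))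

  module TwoAdic (σ₂ : Carrier → ℚ₂) (σ₂-hom : RingMorphisms.IsRingHomomorphism rawRing ℚ₂-rawRing σ₂) where
    private module σ₂ = RingMorphisms.IsRingHomomorphism σ₂-hom

    -- x ∈ 2ᵐ O for the valuation ring O = {x : σ₂ x ∈ ℤ₂} of K
    In : ℕ → Carrier → Set
    In m x = DivisibleBy2^ m (σ₂ x)

    near-≈ : ∀ {x y a k m} → x ≈ y → Near (σ₂ x) a k m → Near (σ₂ y) a k m
    near-≈ {x} {y} x≈y = Near-≈ {σ₂ x} {σ₂ y} (σ₂.⟦⟧-cong x≈y)

    near-+ : ∀ {x y a b k m} → Near (σ₂ x) a k m → Near (σ₂ y) b k m → Near (σ₂ (x +ᴷ y)) (a ℤ.+ b) k m
    near-+ {x} {y} h h′ = Near-≈ {σ₂ x +₂ σ₂ y} {σ₂ (x +ᴷ y)} (λ n → sym (σ₂.+-homo x y n))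
        (Near-+ {σ₂ x} {σ₂ y} h h′)

    near-neg : ∀ {x a k m} → Near (σ₂ x) a k m → Near (σ₂ (-ᴷ x)) (ℤ.- a) k m
    near-neg {x} h = Near-≈ { -₂ σ₂ x} {σ₂ (-ᴷ x)} (λ n → sym (σ₂.-‿homo x n)) (Near-neg {σ₂ x} h)

    near-halve : ∀ {x a k m} → Near (σ₂ (x +ᴷ x)) a k (suc m) → Near (σ₂ x) a (suc k) m
    near-halve {x} h = Near-halve {σ₂ x} (Near-≈ {σ₂ (x +ᴷ x)} {σ₂ x +₂ σ₂ x} (σ₂.+-homo x x) h)

    near-ℤ : ∀ a m → Near (σ₂ (ι (fromℤ a))) a 0 m
    near-ℤ a m = go a
      where
      nat : ∀ n → Near (σ₂ (ι (fromℤ (+ n)))) (+ n) 0 m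
      nat zero = near-≈ (≈-trans (≈-sym ι.0#-homo) (ι.⟦⟧-cong (sym fromℤ-0)))
        (Near-≈ {0₂} {σ₂ 0#} (λ n → sym (σ₂.0#-homo n)) (Near-0₂ 0 m))
      nat (suc n) = near-≈ (≈-sym (≈-trans (ι.⟦⟧-cong
          (trans (fromℤ-+ 1ℤ (+ n)) (cong (_+ fromℤ (+ n)) fromℤ-1)))
          (≈-trans (ι.+-homo 1ℚ (fromℤ (+ n))) (+-cong ι.1#-homo ≈-refl))))
        (near-+ (Near-≈ {1₂} {σ₂ 1#} (λ n → sym (σ₂.1#-homo n)) (Near-1₂ m)) (nat n))
      go : ∀ a → Near (σ₂ (ι (fromℤ a))) a 0 m
      go (+ n) = nat n
      go -[1+ n ] = near-≈ (≈-sym (≈-trans (ι.⟦⟧-cong (fromℤ-neg (+ suc n))) (ι.-‿homo (fromℤ (+ suc n)))))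
          (near-neg (nat (suc n)))

    -- An embedding is only known to be a ring homomorphism, so its value at r is obtained from its
    -- value at r + r, whose denominator is smaller. Halving costs one digit of precision, hence
    -- `suc m` in the recursive call.
    near-dyadic : ∀ k {r a} m → 2ℚ ^ k * r ≡ fromℤ a → Near (σ₂ (ι r)) a k m
    near-dyadic zero {r} {a} m eq = near-≈ (ι.⟦⟧-cong (trans (sym eq) (ℚ.*-identityˡ r))) (near-ℤ a m)
    near-dyadic (suc k) {r} {a} m eq = near-halve (near-≈ (ι.+-homo r r) (near-dyadic k {r + r} {a} (suc m)
      (trans (ℚS.solve 2 (λ p r → p ⊗ (r ⊞ r) ⊜ ℚS.con 2ℚ ⊗ p ⊗ r) refl (2ℚ ^ k) r) eq)))

    In-≈ : ∀ {m x y} → x ≈ y → In m x → In m y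
    In-≈ = near-≈

    In-+ : ∀ {m x y} → In m x → In m y → In m (x +ᴷ y)
    In-+ = near-+

    In-neg : ∀ {m x} → In m x → In m (-ᴷ x)
    In-neg = near-neg

    In-- : ∀ {m x y} → In m x → In m y → In m (x -ᴷ y)
    In-- h h′ = In-+ h (In-neg h′)

    In-* : ∀ {m n x y} → In m x → In n y → In (m ℕ.+ n) (x *ᴷ y)
    In-* {x = x} {y} h h′ = Near-≈ {σ₂ x *₂ σ₂ y} {σ₂ (x *ᴷ y)} (λ n → sym (σ₂.*-homo x y n))
        (divisible-* {σ₂ x} {σ₂ y} h h′)

    In-pow2 : ∀ m a → In m (ι (fromℤ (pow2 m ℤ.* a)))
    In-pow2 m a = Near-multiple⇒divisible {σ₂ (ι (fromℤ (pow2 m ℤ.* a)))} m a (near-ℤ (pow2 m ℤ.* a) m)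

    In-ℤ : ∀ a → In 0 (ι (fromℤ a))
    In-ℤ a = In-≈ (ι.⟦⟧-cong (cong fromℤ (ℤ.*-identityˡ a))) (In-pow2 0 a)

    In-2^ : ∀ m → In m (ι (2ℚ ^ m))
    In-2^ m = In-≈ (ι.⟦⟧-cong (trans (cong fromℤ (ℤ.*-identityʳ (pow2 m))) (fromℤ-pow2 m))) (In-pow2 m 1ℤ)

    In-1 : In 0 1#
    In-1 = In-≈ ι.1#-homo (In-2^ 0)

    In-halve : ∀ {m x} → In (suc m) (x +ᴷ x) → In m x
    In-halve {m} {x} h = Near-0⇒divisible {σ₂ x} 1 (near-halve h)

    In-weaken : ∀ m {n x} → In (m ℕ.+ n) x → In n x
    In-weaken zero h = h
    In-weaken (suc m) {n} {x} h = In-weaken m (In-halve (In-≈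
      (≈-trans (solveᴷ 1 (λ x → con 2ℚ :* x := x :+ x) ≈-refl x) ≈-refl)
      (In-* {0} (In-≈ (ι.⟦⟧-cong fromℤ-2) (In-ℤ (+ 2))) h)))

    In-unscale : ∀ k {m x} → In (k ℕ.+ m) (ι (2ℚ ^ k) *ᴷ x) → In m x
    In-unscale zero {m} {x} h = In-≈ (solveᴷ 1 (λ x → con 1ℚ :* x := x) ≈-refl x) h
    In-unscale (suc k) {m} {x} h = In-unscale k (In-halve (In-≈
      (≈-trans (*-cong (ι.*-homo 2ℚ (2ℚ ^ k)) ≈-refl)
        (solveᴷ 2 (λ p x → con 2ℚ :* p :* x := p :* x :+ p :* x) ≈-refl (ι (2ℚ ^ k)) x)) h))

    private
      -- Dividing by 2^(m+1) would put ½ into O. But ½ is near 1/2 and an element of O is near 0/2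
      -- up to a multiple of 1, which would force 1 to be even.
      two-one : ∀ m → ¬ In (suc m) (ι (2ℚ ^ m))
      two-one m h = ½∉ (In-unscale (suc m) {0}
          (In-≈ eq (subst (λ z → In z (ι (2ℚ ^ m))) (cong suc (sym (ℕ.+-identityʳ m))) h)))
        where
        ½∉ : ¬ In 0 (ι ½)
        ½∉ h = 1≁0 (∼-trans (Near-unique {σ₂ (ι ½)} {1ℤ} {0ℤ} {1} {0} (near-dyadic 1 0 (sym fromℤ-1))
          (Near-rescale {σ₂ (ι ½)} {0ℤ} {0} 1 h)) ∼-refl)
        eq : ι (2ℚ ^ m) ≈ ι (2ℚ ^ suc m) *ᴷ ι ½
        eq = ≈-trans (ι.⟦⟧-cong (ℚS.solve 1 (λ p → p ⊜ ℚS.con 2ℚ ⊗ p ⊗ ℚS.con ½) refl (2ℚ ^ m)))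
            (ι.*-homo (2ℚ ^ suc m) ½)

    1∉2O : ¬ In 1 1#
    1∉2O h = two-one 0 (In-≈ (≈-sym ι.1#-homo) h)

    private
      near-self : ∀ z m → ∃[ a ] ∃[ k ] Near z a k m
      near-self (mkℚ₂ k c) m = trunc c (k ℕ.+ m) , k , Near-self k c m

    near-difference : ∀ {x y a k m} → Near (σ₂ x) a k m → Near (σ₂ y) a k m → In m (x -ᴷ y)
    near-difference {x} {y} {a} {k} {m} h h′ = Near-0⇒divisible {σ₂ (x -ᴷ y)} k
      (subst (λ z → Near (σ₂ (x -ᴷ y)) z k m) (ℤ.+-inverseʳ a) (near-+ h (near-neg h′)))

    dyadic-approximation : ∀ x m → ∃[ r ] ∃[ k ] ∃[ a ] 2ℚ ^ k * r ≡ fromℤ a × In m (x -ᴷ ι r)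
    dyadic-approximation x m with near-self (σ₂ x) m
    ... | a , k , h = r , k , a , eq , near-difference h (near-dyadic k m eq)
      where
      r = ½ ^ k * fromℤ a
      eq : 2ℚ ^ k * r ≡ fromℤ a
      eq = trans (sym (ℚ.*-assoc (2ℚ ^ k) (½ ^ k) _))
          (trans (cong (_* fromℤ a) (2^*½^ k)) (ℚ.*-identityˡ _))

    -- Some dyadic r differs from x by an element of O, so the denominator of r also clears x.
    In-scaled : ∀ x → ∃[ k ] In 0 (ι (2ℚ ^ k) *ᴷ x)
    In-scaled x with dyadic-approximation x 0
    ... | r , k , a , eq , h = k , In-≈
      (≈-trans (+-cong ≈-refl (≈-trans (ι.⟦⟧-cong (sym eq)) (ι.*-homo (2ℚ ^ k) r)))
        (solveᴷ 3 (λ p x r → p :* (x :- r) :+ p :* r := p :* x) ≈-refl (ι (2ℚ ^ k)) x (ι r)))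
      (In-+ (In-* {0} (In-weaken k (subst (λ z → In z (ι (2ℚ ^ k))) (sym (ℕ.+-identityʳ k)) (In-2^ k))) h)
          (In-ℤ a))

    -- The floor keeps the digit of 2^0 as well, so the remaining expansion starts at 2^1.
    In-⌊⌋ : ∀ x → In 1 (x -ᴷ ι ⌊ σ₂ x ⌋₂)
    In-⌊⌋ x = near-difference (near x) (near-dyadic (ℚ₂.shift (σ₂ x)) 1
        (⌊⌋₂-scaled (ℚ₂.shift (σ₂ x)) (ℚ₂.digits (σ₂ x))))
      where
      near : ∀ x → Near (σ₂ x) (trunc (ℚ₂.digits (σ₂ x)) (suc (ℚ₂.shift (σ₂ x)))) (ℚ₂.shift (σ₂ x)) 1
      near x = subst (λ z → Near (σ₂ x) (trunc (ℚ₂.digits (σ₂ x)) z) (ℚ₂.shift (σ₂ x)) 1) (ℕ.+-comm _ 1)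
        (Near-self (ℚ₂.shift (σ₂ x)) (ℚ₂.digits (σ₂ x)) 1)

    -- If 2ᵏ⁺¹y ∈ O then 2ᵏy = 2ᵏ - 2ᵏ⁺¹y (z - 1)/2 ∈ O, so powers of 2 can be removed one by one.
    In-unit : ∀ {y z} → y *ᴷ z ≈ 1# → In 1 (z -ᴷ 1#) → In 0 y
    In-unit {y} {z} yz h = go (proj₁ (In-scaled y)) (proj₂ (In-scaled y))
      where
      w = ι ½ *ᴷ (z -ᴷ 1#)
      w∈ : In 0 w
      w∈ = In-halve (In-≈ (solveᴷ 1 (λ x → x := con ½ :* x :+ con ½ :* x) ≈-refl (z -ᴷ 1#)) h)
      go : ∀ k → In 0 (ι (2ℚ ^ k) *ᴷ y) → In 0 y
      go zero hk = In-≈ (solveᴷ 1 (λ x → con 1ℚ :* x := x) ≈-refl y) hk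
      go (suc k) hk = go k (In-≈ (identity′ (ι.*-homo 2ℚ (2ℚ ^ k))) (In-- 2^k∈ (In-* {0} {0} hk w∈)))
        where
        2^k∈ : In 0 (ι (2ℚ ^ k))
        2^k∈ = In-weaken k (subst (λ z → In z (ι (2ℚ ^ k))) (sym (ℕ.+-identityʳ k)) (In-2^ k))
        identity′ : ∀ {p q} → q ≈ ι 2ℚ *ᴷ p → p -ᴷ q *ᴷ y *ᴷ w ≈ p *ᴷ y
        identity : ∀ p → p -ᴷ ι 2ℚ *ᴷ p *ᴷ y *ᴷ w ≈ p *ᴷ y
        identity′ {p} eq = ≈-trans (+-cong ≈-refl (-‿cong (*-cong (*-cong eq ≈-refl) ≈-refl))) (identity p)
        identity p = ≈-trans (+-cong (≈-sym (≈-trans (*-cong ≈-refl yz) (*-identityʳ p))) ≈-refl) (≈-trans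
          (solveᴷ 4 (λ p y z v → p :* (y :* z) :- con 2ℚ :* p :* y :* (con ½ :* (z :- v))
            := p :* y :* v) ≈-refl p y z 1#) (*-identityʳ _))

    odd-1∈2O : ∀ {o} → Odd o → In 1 (ι (fromℤ o) -ᴷ 1#)
    odd-1∈2O {o} (congruent t eq) = In-≈ o-1 (In-pow2 1 t)
      where
      o-1 : ι (fromℤ (pow2 1 ℤ.* t)) ≈ ι (fromℤ o) -ᴷ 1#
      o-1 = ≈-trans (ι.⟦⟧-cong (trans (cong fromℤ (trans (ℤ.*-comm (pow2 1) t)
            (trans (ℤS.solve 1 (λ s → s ℤS.:= ℤS.con 1ℤ ℤS.:+ s ℤS.:- ℤS.con 1ℤ) refl (t ℤ.* pow2 1))
              (cong (ℤ._- 1ℤ) (sym eq)))))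
          (trans (fromℤ-+ o (ℤ.- 1ℤ)) (cong (λ z → fromℤ o + z) (trans (fromℤ-neg 1ℤ) (cong -_ fromℤ-1))))))
        (≈-trans (ι.+-homo (fromℤ o) (- 1ℚ)) (+-cong ≈-refl (≈-trans (ι.-‿homo 1ℚ) (-‿cong ι.1#-homo))))

    In-odd-inverse : ∀ {y o} → Odd o → y *ᴷ ι (fromℤ o) ≈ 1# → In 0 y
    In-odd-inverse odd yo = In-unit yo (odd-1∈2O odd)

    odd∉2O : ∀ {o} → Odd o → ¬ In 1 (ι (fromℤ o))
    odd∉2O {o} odd h = 1∉2O (In-≈ (solveᴷ 2 (λ x y → x :- (x :- y) := y) ≈-refl (ι (fromℤ o)) 1#)
        (In-- h (odd-1∈2O odd)))
    -- A residue of `σ₂ y` read off from its digits is, by hypothesis, also a residue of `σ₂ x`. In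
    -- the difference, which is taken in ℚ₂ and not in K, the two cancel.
    In⇒norm≤ : ∀ {x y m} → In m (x -ᴷ y) → ∣ σ₂ x -₂ σ₂ y ∣₂ ≤ᴿ fromℚ (½ ^ m)
    In⇒norm≤ {x} {y} {m} h with near-self (σ₂ y) m
    ... | a , k , near-y = divisible⇒norm≤ {σ₂ x -₂ σ₂ y} {m} (Near-0⇒divisible {σ₂ x -₂ σ₂ y} k
      (subst (λ z → Near (σ₂ x -₂ σ₂ y) z k m) (ℤ.+-inverseʳ a)
        (Near-+ {σ₂ x} { -₂ σ₂ y} near-x (Near-neg {σ₂ y} near-y))))
      where
      near-x : Near (σ₂ x) a k m
      near-x = subst (λ z → Near (σ₂ x) z k m)
          (trans (cong (ℤ._+ a) (ℤ.*-zeroʳ (pow2 k))) (ℤ.+-identityˡ a))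
        (near-≈ (solveᴷ 2 (λ x y → x :- y :+ y := x) ≈-refl x y)
          (near-+ (Near-rescale {σ₂ (x -ᴷ y)} {0ℤ} k h) near-y))

-- Bounds and limits of Cauchy reals

Eventually : (ℕ → Set) → Set
Eventually P = ∃[ N ] ∀ n → N ℕ.≤ n → P n

ev-map : ∀ {P Q : ℕ → Set} → (∀ n → P n → Q n) → Eventually P → Eventually Q
ev-map f (N , p) = N , λ n le → f n (p n le)

ev-zip : ∀ {P Q R : ℕ → Set} → (∀ n → P n → Q n → R n) → Eventually P → Eventually Q → Eventually R
ev-zip f (N , p) (M , q) = N ℕ.⊔ M , λ n le → f n (p n (ℕ.m⊔n≤o⇒m≤o N M le)) (q n (ℕ.m⊔n≤o⇒n≤o N M le))

ev-const : ∀ {A : Set} → Eventually (λ _ → A) → A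
ev-const (N , p) = p N ℕ.≤-refl

<-+ : ∀ x {ε} → 0ℚ < ε → x < x + ε
<-+ x {ε} 0<ε = subst (_< x + ε) (ℚ.+-identityʳ x) (ℚ.+-monoʳ-< x 0<ε)

≤-byε : ∀ {x y} → (∀ ε → 0ℚ < ε → x < y + ε) → x ≤ y
≤-byε {x} {y} h = ℚ.≮⇒≥ λ y<x → ℚ.<-irrefl refl (subst (x <_)
    (ℚS.solve 2 (λ x y → y ⊞ (x ⊟ y) ⊜ x) refl x y)
  (h (x - y) (subst (_< x - y) (ℚ.+-inverseʳ y) (ℚ.+-monoˡ-< (- y) y<x))))

*-cancelˡ-< : ∀ {r x y} → 0ℚ ≤ r → r * x < r * y → x < y
*-cancelˡ-< {r} {x} {y} 0≤r lt = ℚ.≰⇒> λ y≤x → ℚ.<-irrefl refl (ℚ.<-≤-trans lt (*-monoˡ-≤ 0≤r y≤x))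

0≤½ε : ∀ {ε} → 0ℚ < ε → 0ℚ < ½ * ε
0≤½ε = *-pos 0<½

+½+½ : ∀ r ε → r + ½ * ε + ½ * ε ≡ r + ε
+½+½ = ℚS.solve 2 (λ r ε → r ⊞ ℚS.con ½ ⊗ ε ⊞ ℚS.con ½ ⊗ ε ⊜ r ⊞ ε) refl

-- The same statement as `∣ x ∣ᴿ ≤ᴿ fromℚ r`; wrapping it in a record lets x and r be inferred.
record Bounded (x : ℝ) (r : ℚ) : Set where
  constructor bounded
  field ∣∣< : ∀ ε → 0ℚ < ε → Eventually λ n → ∣ seq x n ∣ < r + ε

record Away (x : ℝ) (r : ℚ) : Set where
  constructor away
  field <∣∣ : ∀ ε → 0ℚ < ε → Eventually λ n → r < ∣ seq x n ∣ + ε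

bounded⇒≤ᴿ : ∀ {x r} → Bounded x r → ∣ x ∣ᴿ ≤ᴿ fromℚ r
bounded⇒≤ᴿ (bounded h) = h

bounded-nonneg : ∀ {x r} → Bounded x r → 0ℚ ≤ r
bounded-nonneg (bounded h) = ≤-byε λ ε 0<ε → ev-const
    (ev-map (λ n lt → ℚ.≤-<-trans (ℚ.0≤∣p∣ _) lt) (h ε 0<ε))

bounded-≈ : ∀ {x y r} → x ≈ᴿ y → Bounded x r → Bounded y r
bounded-≈ {x} {y} {r} x≈y (bounded h) = bounded λ ε 0<ε → ev-zip
  (λ n p q → subst (∣ seq y n ∣ <_) (+½+½ r ε) (ℚ.<-trans
    (∣∣<⇒< (∣∣p∣-∣q∣∣≤∣p-q∣ (seq y n) (seq x n) (subst (_< ½ * ε) (∣p-q∣-sym (seq x n) (seq y n)) q)))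
    (ℚ.+-monoˡ-< (½ * ε) p)))
  (h (½ * ε) (0≤½ε 0<ε)) (x≈y (½ * ε) (0≤½ε 0<ε))

bounded-mono : ∀ {x r s} → r ≤ s → Bounded x r → Bounded x s
bounded-mono r≤s (bounded h) = bounded λ ε 0<ε → ev-map (λ n p → ℚ.<-≤-trans p (ℚ.+-monoˡ-≤ ε r≤s))
    (h ε 0<ε)

bounded-+ : ∀ {x y r s} → Bounded x r → Bounded y s → Bounded (x +ᴿ y) (r + s)
bounded-+ {x} {y} {r} {s} (bounded h) (bounded k) = bounded λ ε 0<ε → ev-zip
  (λ n p q → ℚ.≤-<-trans (ℚ.∣p+q∣≤∣p∣+∣q∣ (seq x n) (seq y n)) (subst (∣ seq x n ∣ + ∣ seq y n ∣ <_)
    (ℚS.solve 3 (λ r s ε → r ⊞ ℚS.con ½ ⊗ ε ⊞ (s ⊞ ℚS.con ½ ⊗ ε) ⊜ r ⊞ s ⊞ ε) refl r s ε)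
    (ℚ.+-mono-< p q)))
  (h (½ * ε) (0≤½ε 0<ε)) (k (½ * ε) (0≤½ε 0<ε))

bounded-neg : ∀ {x r} → Bounded x r → Bounded (-ᴿ x) r
bounded-neg {x} {r} (bounded h) = bounded λ ε 0<ε →
    ev-map (λ n → subst (_< r + ε) (sym (ℚ.∣-p∣≡∣p∣ (seq x n)))) (h ε 0<ε)

private
  -- δ = ε / (r + s + 1 + ε) gives (r + δ) (s + δ) < r s + ε
  module Slack (r s ε : ℚ) (0≤r : 0ℚ ≤ r) (0≤s : 0ℚ ≤ s) (0<ε : 0ℚ < ε) where
    M : ℚ
    M = r + s + 1ℚ + ε
    0<1+ε : 0ℚ < 1ℚ + ε
    0<1+ε = ℚ.+-mono-< 0<1 0<ε
    0<M : 0ℚ < M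
    0<M = subst (0ℚ <_) (sym (ℚ.+-assoc (r + s) 1ℚ ε)) (ℚ.+-mono-≤-< (ℚ.+-mono-≤ 0≤r 0≤s) 0<1+ε)
    δ : ℚ
    δ = quot ε M 0<ε 0<M
    0<δ : 0ℚ < δ
    0<δ = quot>0 ε M 0<ε 0<M
    ε<M : ε < M
    ε<M = subst (_< M) (ℚ.+-identityˡ ε) (ℚ.+-monoˡ-< ε (ℚ.+-mono-≤-< (ℚ.+-mono-≤ 0≤r 0≤s) 0<1))
    δ<1+ε : δ < 1ℚ + ε
    δ<1+ε = *-cancelˡ-< (ℚ.<⇒≤ 0<M) (begin-strict
      M * δ ≡⟨ M*quot ε M 0<ε 0<M ⟩
      ε ≡⟨ sym (ℚ.*-identityʳ ε) ⟩
      ε * 1ℚ <⟨ *-mono-<-pos (ℚ.<⇒≤ 0<ε) 0<1+ε ε<M (ℚ.<⇒≤ (<-+ 1ℚ 0<ε)) ⟩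
      M * (1ℚ + ε) ∎)
      where open ℚ.≤-Reasoning
    product : (r + δ) * (s + δ) < r * s + ε
    product = begin-strict
      (r + δ) * (s + δ) ≡⟨ ℚS.solve 3 (λ r s d → (r ⊞ d) ⊗ (s ⊞ d) ⊜ r ⊗ s ⊞ d ⊗ (r ⊞ s ⊞ d)) refl r s δ ⟩
      r * s + δ * (r + s + δ) <⟨ ℚ.+-monoʳ-< (r * s)
          (ℚ.*-monoʳ-<-pos δ {{ℚ.positive 0<δ}} (ℚ.+-monoʳ-< (r + s) δ<1+ε)) ⟩
      r * s + δ * (r + s + (1ℚ + ε)) ≡⟨ cong (λ z → r * s + z) (trans (ℚ.*-comm δ (r + s + (1ℚ + ε)))
        (trans (cong (_* δ) (sym (ℚ.+-assoc (r + s) 1ℚ ε))) (M*quot ε M 0<ε 0<M))) ⟩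
      r * s + ε ∎
      where open ℚ.≤-Reasoning

bounded-* : ∀ {x y r s} → Bounded x r → Bounded y s → Bounded (x *ᴿ y) (r * s)
bounded-* {x} {y} {r} {s} (bounded h) (bounded k) = bounded go
  where
  go : ∀ ε → 0ℚ < ε → Eventually λ n → ∣ seq x n * seq y n ∣ < r * s + ε
  go ε 0<ε = ev-zip
    (λ n p q → subst (_< r * s + ε) (sym (ℚ.∣p*q∣≡∣p∣*∣q∣ (seq x n) (seq y n)))
      (ℚ.≤-<-trans (*-mono-≤ (ℚ.0≤∣p∣ (seq x n)) (ℚ.0≤∣p∣ (seq y n)) (ℚ.<⇒≤ p) (ℚ.<⇒≤ q)) S.product))
    (h S.δ S.0<δ) (k S.δ S.0<δ)
    where module S = Slack r s ε (bounded-nonneg {x} (bounded h)) (bounded-nonneg {y} (bounded k)) 0<ε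

bounded-const : ∀ r → Bounded (fromℚ r) ∣ r ∣
bounded-const r = bounded λ ε 0<ε → 0 , λ n _ → <-+ ∣ r ∣ 0<ε

bounded-const⁻¹ : ∀ {r s} → Bounded (fromℚ r) s → ∣ r ∣ ≤ s
bounded-const⁻¹ (bounded h) = ≤-byε λ ε 0<ε → ev-const (h ε 0<ε)

bounded-exists : ∀ x → ∃[ r ] 0ℚ < r × Bounded x r
bounded-exists x = B , proj₁ (proj₂ b) , bounded λ ε 0<ε → ev-map (λ n le → ℚ.≤-<-trans le (<-+ B 0<ε))
    (proj₂ (proj₂ b))
  where
  b = CauchyLemmas.bounded (seq x) (cauchy x)
  B = proj₁ b

-- Up to errors ∣y∣ = ∣xy∣ / ∣x∣. As ∣x∣ is only known to exceed r - δ, an arbitrary bound M of y is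
-- used first: δ is chosen with δ (M + 1) = rε/2, so that the loss δ ∣y∣ is harmless.
away⇒inverse-bounded : ∀ {x y r s} → 0ℚ < r → r * s ≡ 1ℚ → x *ᴿ y ≈ᴿ 1ᴿ → Away x r → Bounded y s
away⇒inverse-bounded {x} {y} {r} {s} 0<r rs xy (away h) = bounded λ ε 0<ε → At.go ε 0<ε (bounded-exists y)
  where
  module At (ε : ℚ) (0<ε : 0ℚ < ε) where
    0<η = 0≤½ε {r * ε} (*-pos 0<r 0<ε)
    η = ½ * (r * ε)
    go : (∃[ M ] 0ℚ < M × Bounded y M) → Eventually λ n → ∣ seq y n ∣ < s + ε
    go (M , 0<M , bounded bd) = ev-zip (λ n p f → f p) (h δ 0<δ)
        (ev-zip (λ n q t p → *-cancelˡ-< (ℚ.<⇒≤ 0<r) (begin-strict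
        r * ∣ seq y n ∣ ≤⟨ *-monoʳ-≤ (ℚ.0≤∣p∣ (seq y n)) (ℚ.<⇒≤ p) ⟩
        (∣ seq x n ∣ + δ) * ∣ seq y n ∣ ≡⟨ ℚ.*-distribʳ-+ ∣ seq y n ∣ ∣ seq x n ∣ δ ⟩
        ∣ seq x n ∣ * ∣ seq y n ∣ + δ * ∣ seq y n ∣ ≡⟨ cong (_+ δ * ∣ seq y n ∣)
            (sym (ℚ.∣p*q∣≡∣p∣*∣q∣ (seq x n) (seq y n))) ⟩
        ∣ seq x n * seq y n ∣ + δ * ∣ seq y n ∣ ≤⟨ ℚ.+-monoʳ-≤ ∣ seq x n * seq y
            n ∣ (*-monoˡ-≤ (ℚ.<⇒≤ 0<δ) (ℚ.<⇒≤ t)) ⟩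
        ∣ seq x n * seq y n ∣ + δ * (M + 1ℚ) ≡⟨ cong (λ z → ∣ seq x n * seq y n ∣ + z)
            (trans (ℚ.*-comm δ (M + 1ℚ)) (M*quot η (M + 1ℚ) 0<η 0<M+1)) ⟩
        ∣ seq x n * seq y n ∣ + η <⟨ ℚ.+-monoˡ-< η
            (∣∣<⇒< {∣ seq x n * seq y n ∣} {∣ 1ℚ ∣} (∣∣p∣-∣q∣∣≤∣p-q∣ (seq x n * seq y n) 1ℚ q)) ⟩
        ∣ 1ℚ ∣ + η + η ≡⟨ +½+½ 1ℚ (r * ε) ⟩
        1ℚ + r * ε ≡⟨ cong (_+ r * ε) (sym rs) ⟩
        r * s + r * ε ≡⟨ sym (ℚ.*-distribˡ-+ r s ε) ⟩
        r * (s + ε) ∎)) (xy η 0<η) (bd 1ℚ 0<1))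
      where
      open ℚ.≤-Reasoning
      0<M+1 = ℚ.+-mono-< 0<M 0<1
      δ = quot η (M + 1ℚ) 0<η 0<M+1
      0<δ = quot>0 η (M + 1ℚ) 0<η 0<M+1

-- A decidable substitute for comparing ∣x∣ with r. A single term, accurate to within r/2, is
-- compared with 3r/2; either answer is then safe, because the alternatives ∣x∣ ≤ 2r and ∣x∣ ≥ r
-- overlap.
bounded-or-inverse-bounded : ∀ {x y r s} → 0ℚ < r → r * s ≡ 1ℚ → x *ᴿ y ≈ᴿ 1ᴿ →
  Bounded x (r + r) ⊎ Bounded y s
bounded-or-inverse-bounded {x} {y} {r} {s} 0<r rs xy = go (cauchy x (½ * r) (0≤½ε 0<r))
  where
  go : (∃[ N ] ∀ m n → N ℕ.≤ m → N ℕ.≤ n → ∣ seq x m - seq x n ∣ < ½ * r) → Bounded x (r + r) ⊎ Bounded y s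
  go (N , f) = split (ℚ.≤-total ∣ seq x N ∣ (r + ½ * r))
   where
   split : ∣ seq x N ∣ ≤ r + ½ * r ⊎ r + ½ * r ≤ ∣ seq x N ∣ → Bounded x (r + r) ⊎ Bounded y s
   split (inj₁ le) = inj₁ (bounded λ ε 0<ε → N , λ n N≤n → (begin-strict
      ∣ seq x n ∣ <⟨ ∣∣<⇒< (∣∣p∣-∣q∣∣≤∣p-q∣ (seq x n) (seq x N) (f n N N≤n ℕ.≤-refl)) ⟩
      ∣ seq x N ∣ + ½ * r ≤⟨ ℚ.+-monoˡ-≤ (½ * r) le ⟩
      r + ½ * r + ½ * r ≡⟨ +½+½ r r ⟩
      r + r <⟨ <-+ (r + r) 0<ε ⟩
      r + r + ε ∎))
    where open ℚ.≤-Reasoning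
   split (inj₂ ge) = inj₂ (away⇒inverse-bounded {x} {y} 0<r rs xy (away λ ε 0<ε → N , λ n N≤n → ℚ.<-trans
      (subst₂ _<_ (cancel r (½ * r)) (cancel ∣ seq x n ∣ (½ * r)) (ℚ.+-monoˡ-< (- (½ * r)) (ℚ.≤-<-trans ge
        (∣∣<⇒< (∣∣p∣-∣q∣∣≤∣p-q∣ (seq x N) (seq x n) (f N n ℕ.≤-refl N≤n))))))
      (<-+ ∣ seq x n ∣ 0<ε)))
    where
    cancel : ∀ a b → a + b - b ≡ a
    cancel = ℚS.solve 2 (λ a b → a ⊞ b ⊟ b ⊜ a) refl

complement-away : ∀ {x z θ} → z +ᴿ x ≈ᴿ 1ᴿ → Bounded x θ → Away z (1ℚ - θ)
complement-away {x} {z} {θ} eq (bounded h) = away λ ε 0<ε → ev-zip (λ n p q → (begin-strict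
    1ℚ - θ <⟨ ℚ.+-monoˡ-< (- θ) (∣∣<⇒< {∣ 1ℚ ∣} {∣ seq z n + seq x n ∣}
        (∣∣p∣-∣q∣∣≤∣p-q∣ 1ℚ (seq z n + seq x n)
      (subst (_< ½ * ε) (∣p-q∣-sym (seq z n + seq x n) 1ℚ) q))) ⟩
    ∣ seq z n + seq x n ∣ + ½ * ε - θ ≤⟨ ℚ.+-monoˡ-≤ (- θ)
        (ℚ.+-monoˡ-≤ (½ * ε) (ℚ.∣p+q∣≤∣p∣+∣q∣ (seq z n) (seq x n))) ⟩
    ∣ seq z n ∣ + ∣ seq x n ∣ + ½ * ε - θ <⟨ ℚ.+-monoˡ-< (- θ)
        (ℚ.+-monoˡ-< (½ * ε) (ℚ.+-monoʳ-< ∣ seq z n ∣ p)) ⟩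
    ∣ seq z n ∣ + (θ + ½ * ε) + ½ * ε - θ ≡⟨ ℚS.solve 3
        (λ z t e → z ⊞ (t ⊞ ℚS.con ½ ⊗ e) ⊞ ℚS.con ½ ⊗ e ⊟ t ⊜ z ⊞ e) refl ∣ seq z n ∣ θ ε ⟩
    ∣ seq z n ∣ + ε ∎))
  (h (½ * ε) (0≤½ε 0<ε)) (eq (½ * ε) (0≤½ε 0<ε))
  where open ℚ.≤-Reasoning

-- If ∣x∣ > 1 - h with ∣x∣ < 1 + h then ∣1 - x²∣ ≤ 3h, too small for its inverse to be bounded by M.
bounded-below-1 : ∀ {x y z} → z +ᴿ x *ᴿ x ≈ᴿ 1ᴿ → z *ᴿ y ≈ᴿ 1ᴿ → Bounded x 1ℚ →
  ∃[ κ ] 0ℚ ≤ κ × κ < 1ℚ × Bounded x κ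
bounded-below-1 {x} {y} {z} zx zy (bounded hx) = go (bounded-exists y)
  where
  go : (∃[ M ] 0ℚ < M × Bounded y M) → ∃[ κ ] 0ℚ ≤ κ × κ < 1ℚ × Bounded x κ
  go (M , 0<M , bounded hy) = 1ℚ - h , 0≤1-h , 1-h<1 ,
    bounded λ ε 0<ε → ev-map (λ n le → ℚ.≤-<-trans le (<-+ (1ℚ - h) 0<ε))
      (ev-zip (λ n p f → f p) (hx h 0<h) (ev-zip (λ n p f → f p) (hy 1ℚ 0<1)
          (ev-zip (λ n p q r s → close n s r p q) (zx h 0<h) (zy ½ 0<½))))
    where
    open ℚ.≤-Reasoning
    -- The choice 8h (M + 1) = 1 turns ∣z∣ ≤ 4h (3h from 1 - x² and h from the error in z + x² ≈ 1)
    -- into ∣zy∣ ≤ 1/2, against ∣zy - 1∣ < 1/2.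
    eight W : ℚ
    eight = 2ℚ * (2ℚ * 2ℚ)
    W = eight * (M + 1ℚ)
    0<8 : 0ℚ < eight
    0<8 = *-pos (0<2^ 1) (*-pos (0<2^ 1) (0<2^ 1))
    0<W : 0ℚ < W
    0<W = *-pos 0<8 (ℚ.+-mono-< 0<M 0<1)
    h : ℚ
    h = quot 1ℚ W 0<1 0<W
    0<h : 0ℚ < h
    0<h = quot>0 1ℚ W 0<1 0<W
    8hM≤1 : (eight * h) * (M + 1ℚ) ≡ 1ℚ
    8hM≤1 = trans (ℚS.solve 3 (λ e h m → e ⊗ h ⊗ m ⊜ e ⊗ m ⊗ h) refl (eight) h (M + 1ℚ))
        (M*quot 1ℚ W 0<1 0<W)
    1-h<1 : 1ℚ - h < 1ℚ
    1-h<1 = subst (1ℚ - h <_) (ℚS.solve 1 (λ h → ℚS.con 1ℚ ⊟ h ⊞ h ⊜ ℚS.con 1ℚ) refl h) (<-+ (1ℚ - h) 0<h)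
    8h : eight * h ≡ h + h + h + h + (h + h + h + h)
    8h = ℚS.solve 1 (λ h → (ℚS.con 2ℚ ⊗ (ℚS.con 2ℚ ⊗ ℚS.con 2ℚ)) ⊗ h ⊜ h ⊞ h ⊞ h ⊞ h ⊞ (h ⊞ h ⊞ h ⊞ h))
        refl h
    0≤4h : 0ℚ ≤ h + h + h + h
    0≤4h = ℚ.<⇒≤ (ℚ.+-mono-< (ℚ.+-mono-< (ℚ.+-mono-< 0<h 0<h) 0<h) 0<h)
    h≤1 : h ≤ 1ℚ
    h≤1 = begin
      h ≤⟨ subst (_≤ h + h) (ℚ.+-identityʳ h) (ℚ.+-monoʳ-≤ h (ℚ.<⇒≤ 0<h)) ⟩
      h + h ≡⟨ sym (ℚ.+-identityʳ (h + h)) ⟩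
      h + h + 0ℚ ≤⟨ ℚ.+-monoʳ-≤ (h + h) (ℚ.+-mono-≤ (ℚ.<⇒≤ 0<h) (ℚ.+-mono-≤ (ℚ.<⇒≤ 0<h) 0≤4h)) ⟩
      h + h + (h + (h + (h + h + h + h))) ≡⟨ ℚS.solve 1
          (λ h → h ⊞ h ⊞ (h ⊞ (h ⊞ (h ⊞ h ⊞ h ⊞ h))) ⊜ h ⊞ h ⊞ h ⊞ h ⊞ (h ⊞ h ⊞ h ⊞ h)) refl h ⟩
      h + h + h + h + (h + h + h + h) ≡⟨ sym 8h ⟩
      eight * h ≡⟨ sym (ℚ.*-identityʳ _) ⟩
      eight * h * 1ℚ ≤⟨ *-monoˡ-≤ (ℚ.<⇒≤ (*-pos 0<8 0<h))
         (subst (_≤ M + 1ℚ) (ℚ.+-identityˡ 1ℚ) (ℚ.+-monoˡ-≤ 1ℚ (ℚ.<⇒≤ 0<M))) ⟩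
      eight * h * (M + 1ℚ) ≡⟨ 8hM≤1 ⟩
      1ℚ ∎
    0≤1-h : 0ℚ ≤ 1ℚ - h
    0≤1-h = subst (_≤ 1ℚ - h) (ℚ.+-inverseʳ h) (ℚ.+-monoˡ-≤ (- h) h≤1)
    close : ∀ n → ∣ seq x n ∣ < 1ℚ + h → ∣ seq y n ∣ < M + 1ℚ → ∣ seq z n + seq x n * seq x n - 1ℚ ∣ < h →
      ∣ seq z n * seq y n - 1ℚ ∣ < ½ → ∣ seq x n ∣ ≤ 1ℚ - h
    close n px py pz pzy = ℚ.≮⇒≥ λ lt → ℚ.<-irrefl refl (begin-strict
      ½ + ½ ≡⟨ refl ⟩
      ∣ 1ℚ ∣ <⟨ ∣∣<⇒< {∣ 1ℚ ∣} {∣ zn * yn ∣} (∣∣p∣-∣q∣∣≤∣p-q∣ 1ℚ (zn * yn)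
          (subst (_< ½) (∣p-q∣-sym (zn * yn) 1ℚ) pzy)) ⟩
      ∣ zn * yn ∣ + ½ ≡⟨ cong (_+ ½) (ℚ.∣p*q∣≡∣p∣*∣q∣ zn yn) ⟩
      ∣ zn ∣ * ∣ yn ∣ + ½ ≤⟨ ℚ.+-monoˡ-≤ ½ (*-mono-≤ (ℚ.0≤∣p∣ zn) (ℚ.0≤∣p∣ yn) (∣z∣≤ lt) (ℚ.<⇒≤ py)) ⟩
      (h + h + h + h) * (M + 1ℚ) + ½ ≡⟨ cong (_+ ½) (trans (ℚS.solve 2 (λ h m → (h ⊞ h ⊞ h ⊞ h) ⊗ m ⊜
            ℚS.con ½ ⊗ ((h ⊞ h ⊞ h ⊞ h ⊞ (h ⊞ h ⊞ h ⊞ h)) ⊗ m)) refl h (M + 1ℚ))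
          (trans (cong (λ t → ½ * (t * (M + 1ℚ))) (sym 8h))
              (trans (cong (½ *_) 8hM≤1) (ℚ.*-identityʳ ½)))) ⟩
      ½ + ½ ∎)
      where
      zn = seq z n
      yn = seq y n
      a = ∣ seq x n ∣
      aa : a * a ≡ seq x n * seq x n
      aa = trans (sym (ℚ.∣p*q∣≡∣p∣*∣q∣ (seq x n) (seq x n))) (square (ℚ.∣p∣≡p∨∣p∣≡-p (seq x n)))
        where
        square : ∀ {t} → ∣ t ∣ ≡ t ⊎ ∣ t ∣ ≡ - t → ∣ t * t ∣ ≡ t * t
        square {t} (inj₁ e) = trans (ℚ.∣p*q∣≡∣p∣*∣q∣ t t) (cong₂ _*_ e e)
        square {t} (inj₂ e) = trans (ℚ.∣p*q∣≡∣p∣*∣q∣ t t)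
            (trans (cong₂ _*_ e e) (ℚS.solve 1 (λ t → (⊖ t) ⊗ (⊖ t) ⊜ t ⊗ t) refl t))
      ∣z∣≤ : 1ℚ - h < a → ∣ zn ∣ ≤ h + h + h + h
      ∣z∣≤ lt = begin
        ∣ zn ∣ ≡⟨ cong ∣_∣ (ℚS.solve 2 (λ z x → z ⊜ (z ⊞ x ⊟ ℚS.con 1ℚ) ⊞ (ℚS.con 1ℚ ⊟ x)) refl zn
            (seq x n * seq x n)) ⟩
        ∣ (zn + seq x n * seq x n - 1ℚ) + (1ℚ - seq x n * seq x n) ∣ ≤⟨ ℚ.∣p+q∣≤∣p∣+∣q∣
            (zn + seq x n * seq x n - 1ℚ) (1ℚ - seq x n * seq x n) ⟩
        ∣ zn + seq x n * seq x n - 1ℚ ∣ + ∣ 1ℚ - seq x n * seq x n ∣ ≤⟨ ℚ.+-mono-≤ (ℚ.<⇒≤ pz)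
            (ℚ.≤-reflexive (cong ∣_∣
            (trans (cong (λ t → 1ℚ - t) (sym aa))
                (ℚS.solve 1 (λ a → ℚS.con 1ℚ ⊟ a ⊗ a ⊜ (ℚS.con 1ℚ ⊟ a) ⊗ (ℚS.con 1ℚ ⊞ a)) refl a)))) ⟩
        h + ∣ (1ℚ - a) * (1ℚ + a) ∣ ≡⟨ cong (λ t → h + t) (ℚ.∣p*q∣≡∣p∣*∣q∣ (1ℚ - a) (1ℚ + a)) ⟩
        h + ∣ 1ℚ - a ∣ * ∣ 1ℚ + a ∣ ≤⟨ ℚ.+-monoʳ-≤ h
            (*-mono-≤ (ℚ.0≤∣p∣ (1ℚ - a)) (ℚ.0≤∣p∣ (1ℚ + a)) (ℚ.<⇒≤ (<⇒∣∣< {1ℚ} {a} {h} 1<a+h px))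
             (ℚ.≤-trans (ℚ.≤-reflexive (ℚ.0≤p⇒∣p∣≡p (ℚ.+-mono-≤ 0≤1 (ℚ.0≤∣p∣ (seq x n)))))
                 (ℚ.+-monoʳ-≤ 1ℚ (ℚ.≤-trans (ℚ.<⇒≤ px) (ℚ.+-monoʳ-≤ 1ℚ h≤1))))) ⟩
        h + h * (1ℚ + (1ℚ + 1ℚ)) ≡⟨ ℚS.solve 1
            (λ h → h ⊞ h ⊗ (ℚS.con 1ℚ ⊞ (ℚS.con 1ℚ ⊞ ℚS.con 1ℚ)) ⊜ h ⊞ h ⊞ h ⊞ h) refl h ⟩
        h + h + h + h ∎
        where
        1<a+h : 1ℚ < a + h
        1<a+h = subst (_< a + h) (ℚS.solve 1 (λ h → ℚS.con 1ℚ ⊟ h ⊞ h ⊜ ℚS.con 1ℚ) refl h)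
            (ℚ.+-monoˡ-< h lt)

-- For t = ∣z∣ the relevant neighbour, chosen termwise by the sign of z, gives t ≤ ∣t - s∣ + ε. If t
-- ≥ s this fails as soon as ε ≤ s, and otherwise it says 2t ≤ s + ε. Larger ε are reduced to ε = s.
nearest⇒bounded : ∀ {z s} → 0ℚ < s → ∣ z ∣ᴿ ≤ᴿ ∣ z -ᴿ fromℚ s ∣ᴿ → ∣ z ∣ᴿ ≤ᴿ ∣ z +ᴿ fromℚ s ∣ᴿ →
    Bounded z (½ * s)
nearest⇒bounded {z} {s} 0<s h⁻ h⁺ = bounded λ ε 0<ε → split ε 0<ε (ℚ.≤-total ε s)
  where
  one-side : ∀ {t ε} → 0ℚ < ε → ε ≤ s → t < ∣ t - s ∣ + ε → t < ½ * s + ε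
  one-side {t} {ε} 0<ε ε≤s lt = side (ℚ.∣p∣≡p∨∣p∣≡-p (t - s))
    where
    side : ∣ t - s ∣ ≡ t - s ⊎ ∣ t - s ∣ ≡ - (t - s) → t < ½ * s + ε
    side (inj₁ e) = ⊥-elim (ℚ.<-irrefl refl (ℚ.<-≤-trans lt (ℚ.≤-trans
      (ℚ.+-mono-≤ (ℚ.≤-reflexive e) ε≤s) (ℚ.≤-reflexive (ℚS.solve 2 (λ t s → t ⊟ s ⊞ s ⊜ t) refl t s)))))
    side (inj₂ e) = *-cancelˡ-< {2ℚ} (ℚ.≤-trans 0≤1 1≤2ℚ) (begin-strict
      2ℚ * t ≡⟨ ℚS.solve 1 (λ t → ℚS.con 2ℚ ⊗ t ⊜ t ⊞ t) refl t ⟩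
      t + t <⟨ ℚ.+-monoʳ-< t lt ⟩
      t + (∣ t - s ∣ + ε) ≡⟨ cong (λ w → t + (w + ε)) e ⟩
      t + (- (t - s) + ε) ≡⟨ ℚS.solve 3 (λ t s e → t ⊞ (⊖ (t ⊟ s) ⊞ e) ⊜ s ⊞ e) refl t s ε ⟩
      s + ε <⟨ ℚ.+-monoʳ-< s (<-+ ε 0<ε) ⟩
      s + (ε + ε) ≡⟨ ℚS.solve 2 (λ s e → s ⊞ (e ⊞ e) ⊜ ℚS.con 2ℚ ⊗ (ℚS.con ½ ⊗ s ⊞ e)) refl s ε ⟩
      2ℚ * (½ * s + ε) ∎)
      where open ℚ.≤-Reasoning
  main : ∀ ε → 0ℚ < ε → ε ≤ s → Eventually λ n → ∣ seq z n ∣ < ½ * s + ε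
  main ε 0<ε ε≤s = ev-zip at (h⁻ ε 0<ε) (h⁺ ε 0<ε)
    where
    at : ∀ n → ∣ seq z n ∣ < ∣ seq z n - s ∣ + ε → ∣ seq z n ∣ < ∣ seq z n + s ∣ + ε → ∣ seq z n ∣ < ½ * s
        + ε
    at n p q = sign (ℚ.∣p∣≡p∨∣p∣≡-p (seq z n))
      where
      sign : ∣ seq z n ∣ ≡ seq z n ⊎ ∣ seq z n ∣ ≡ - seq z n → ∣ seq z n ∣ < ½ * s + ε
      sign (inj₁ e) = subst (_< ½ * s + ε) (sym e) (one-side 0<ε ε≤s (subst (_< ∣ seq z n - s ∣ + ε) e p))
      sign (inj₂ e) = subst (_< ½ * s + ε) (sym e) (one-side 0<ε ε≤s (subst₂ (λ u v → u < v + ε) e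
        (trans (sym (ℚ.∣-p∣≡∣p∣ (seq z n + s)))
            (cong ∣_∣ (ℚS.solve 2 (λ z s → ⊖ (z ⊞ s) ⊜ (⊖ z) ⊟ s) refl (seq z n) s))) q))
  split : ∀ ε → 0ℚ < ε → ε ≤ s ⊎ s ≤ ε → Eventually λ n → ∣ seq z n ∣ < ½ * s + ε
  split ε 0<ε (inj₁ ε≤s) = main ε 0<ε ε≤s
  split ε 0<ε (inj₂ s≤ε) = ev-map (λ n p → ℚ.<-≤-trans p (ℚ.+-monoʳ-≤ (½ * s) s≤ε)) (main s 0<s ℚ.≤-refl)

≈ᴿ-sym : ∀ {x y} → x ≈ᴿ y → y ≈ᴿ x
≈ᴿ-sym {x} {y} h ε 0<ε = ev-map (λ n → subst (_< ε) (∣p-q∣-sym (seq x n) (seq y n))) (h ε 0<ε)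

∣-∣-triangle : ∀ a b c → ∣ a - c ∣ ≤ ∣ a - b ∣ + ∣ b - c ∣
∣-∣-triangle a b c = subst (λ z → ∣ z ∣ ≤ ∣ a - b ∣ + ∣ b - c ∣)
  (ℚS.solve 3 (λ a b c → (a ⊟ b) ⊞ (b ⊟ c) ⊜ a ⊟ c) refl a b c) (ℚ.∣p+q∣≤∣p∣+∣q∣ (a - b) (b - c))

≈ᴿ-trans : ∀ {x y z} → x ≈ᴿ y → y ≈ᴿ z → x ≈ᴿ z
≈ᴿ-trans {x} {y} {z} h k ε 0<ε = ev-zip
  (λ n p q → ℚ.≤-<-trans (∣-∣-triangle (seq x n) (seq y n) (seq z n))
      (subst (∣ seq x n - seq y n ∣ + ∣ seq y n - seq z n ∣ <_) (half+half ε) (ℚ.+-mono-< p q)))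
  (h (½ * ε) (0≤½ε 0<ε)) (k (½ * ε) (0≤½ε 0<ε))

+ᴿ-cong : ∀ {x y x′ y′} → x ≈ᴿ x′ → y ≈ᴿ y′ → x +ᴿ y ≈ᴿ x′ +ᴿ y′
+ᴿ-cong {x} {y} {x′} {y′} h k ε 0<ε = ev-zip
  (λ n p q → ℚ.≤-<-trans (subst (λ z → ∣ z ∣ ≤ ∣ seq x n - seq x′ n ∣ + ∣ seq y n - seq y′ n ∣)
      (ℚS.solve 4 (λ a b c d → (a ⊟ c) ⊞ (b ⊟ d) ⊜ a ⊞ b ⊟ (c ⊞ d)) refl (seq x n) (seq y n) (seq x′ n)
          (seq y′ n))
      (ℚ.∣p+q∣≤∣p∣+∣q∣ (seq x n - seq x′ n) (seq y n - seq y′ n)))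
    (subst (∣ seq x n - seq x′ n ∣ + ∣ seq y n - seq y′ n ∣ <_) (half+half ε) (ℚ.+-mono-< p q)))
  (h (½ * ε) (0≤½ε 0<ε)) (k (½ * ε) (0≤½ε 0<ε))

-ᴿ-cong : ∀ {x y} → x ≈ᴿ y → -ᴿ x ≈ᴿ -ᴿ y
-ᴿ-cong {x} {y} h ε 0<ε = ev-map (λ n → subst (_< ε) (trans (sym (ℚ.∣-p∣≡∣p∣ (seq x n - seq y n)))
  (cong ∣_∣ (ℚS.solve 2 (λ a b → ⊖ (a ⊟ b) ⊜ (⊖ a) ⊟ (⊖ b)) refl (seq x n) (seq y n))))) (h ε 0<ε)

≈ᴿ-pointwise : ∀ {x y} → (∀ n → seq x n ≡ seq y n) → x ≈ᴿ y
≈ᴿ-pointwise {x} {y} h ε 0<ε = 0 , λ n _ → subst (λ z → ∣ z ∣ < ε)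
    (sym (trans (cong (_- seq y n) (h n)) (ℚ.+-inverseʳ (seq y n)))) 0<ε

≤ᴿ-resp-≈ᴿ : ∀ {x y x′ y′} → x ≈ᴿ x′ → y ≈ᴿ y′ → ∣ x ∣ᴿ ≤ᴿ ∣ y ∣ᴿ → ∣ x′ ∣ᴿ ≤ᴿ ∣ y′ ∣ᴿ
≤ᴿ-resp-≈ᴿ {x} {y} {x′} {y′} hx hy h ε 0<ε = ev-zip (λ n p f → f p) (hx δ 0<δ)
    (ev-zip (λ n q r p → (begin-strict
    ∣ seq x′ n ∣ <⟨ ∣∣<⇒< {∣ seq x′ n ∣} {∣ seq x n ∣}
        (∣∣p∣-∣q∣∣≤∣p-q∣ (seq x′ n) (seq x n) (subst (_< δ) (∣p-q∣-sym (seq x n) (seq x′ n)) p)) ⟩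
    ∣ seq x n ∣ + δ <⟨ ℚ.+-monoˡ-< δ r ⟩
    ∣ seq y n ∣ + ½ * ε + δ <⟨ ℚ.+-monoˡ-< δ (ℚ.+-monoˡ-< (½ * ε)
        (∣∣<⇒< {∣ seq y n ∣} {∣ seq y′ n ∣} (∣∣p∣-∣q∣∣≤∣p-q∣ (seq y n) (seq y′ n) q))) ⟩
    ∣ seq y′ n ∣ + δ + ½ * ε + δ ≡⟨ ℚS.solve 2
        (λ y e → y ⊞ ℚS.con ½ ⊗ (ℚS.con ½ ⊗ e) ⊞ ℚS.con ½ ⊗ e ⊞ ℚS.con ½ ⊗ (ℚS.con ½ ⊗ e) ⊜ y ⊞ e)
        refl ∣ seq y′ n ∣ ε ⟩
    ∣ seq y′ n ∣ + ε ∎)) (hy δ 0<δ) (h (½ * ε) (0≤½ε 0<ε)))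
  where
  open ℚ.≤-Reasoning
  δ = ½ * (½ * ε)
  0<δ = 0≤½ε (0≤½ε 0<ε)

≈ᴿ⇒bounded-0 : ∀ {x y} → x ≈ᴿ y → Bounded (x -ᴿ y) 0ℚ
≈ᴿ⇒bounded-0 {x} {y} h = bounded λ ε 0<ε → ev-map
    (λ n → subst (∣ seq x n - seq y n ∣ <_) (sym (ℚ.+-identityˡ ε))) (h ε 0<ε)

bounded-0⇒≈ᴿ : ∀ {x y} → Bounded (x -ᴿ y) 0ℚ → x ≈ᴿ y
bounded-0⇒≈ᴿ {x} {y} (bounded h) ε 0<ε = ev-map (λ n → subst (∣ seq x n - seq y n ∣ <_) (ℚ.+-identityˡ ε))
    (h ε 0<ε)

1≤fromℤ-suc : ∀ n → 1ℚ ≤ fromℤ (+ suc n)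
1≤fromℤ-suc n = subst (_≤ fromℤ (+ suc n)) fromℤ-1 (fromℤ-mono-≤ (ℤ.+≤+ (ℕ.s≤s ℕ.z≤n)))

module RealLemmas {c ℓ} (K : QuadraticField c ℓ)
  (σ∞ : QuadraticField.Carrier K → ℝ) (σ∞-hom : RingMorphisms.IsRingHomomorphism (QuadraticField.rawRing K)
      ℝ-rawRing σ∞) where
  open FieldLemmas K
  private module σ∞ = RingMorphisms.IsRingHomomorphism σ∞-hom

  -- ∣x∣ ≤ r at the real place
  Abs : Carrier → ℚ → Set
  Abs x r = Bounded (σ∞ x) r

  abs-≈ : ∀ {x y r} → x ≈ y → Abs x r → Abs y r
  abs-≈ x≈y = bounded-≈ (σ∞.⟦⟧-cong x≈y)

  abs-mono : ∀ {x r s} → r ≤ s → Abs x r → Abs x s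
  abs-mono = bounded-mono

  abs-+ : ∀ {x y r s} → Abs x r → Abs y s → Abs (x +ᴷ y) (r + s)
  abs-+ {x} {y} h k = bounded-≈ (≈ᴿ-sym {σ∞ (x +ᴷ y)} {σ∞ x +ᴿ σ∞ y} (σ∞.+-homo x y)) (bounded-+ h k)

  abs-* : ∀ {x y r s} → Abs x r → Abs y s → Abs (x *ᴷ y) (r * s)
  abs-* {x} {y} h k = bounded-≈ (≈ᴿ-sym {σ∞ (x *ᴷ y)} {σ∞ x *ᴿ σ∞ y} (σ∞.*-homo x y)) (bounded-* h k)

  abs-neg : ∀ {x r} → Abs x r → Abs (-ᴷ x) r
  abs-neg {x} h = bounded-≈ (≈ᴿ-sym {σ∞ (-ᴷ x)} { -ᴿ σ∞ x} (σ∞.-‿homo x)) (bounded-neg h)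

  abs-- : ∀ {x y r s} → Abs x r → Abs y s → Abs (x -ᴷ y) (r + s)
  abs-- h k = abs-+ h (abs-neg k)

  abs-exists : ∀ x → ∃[ r ] 0ℚ < r × Abs x r
  abs-exists x = bounded-exists (σ∞ x)

  private
    σ∞-ℤ : ∀ i → σ∞ (ι (fromℤ i)) ≈ᴿ fromℚ (fromℤ i)
    σ∞-ℤ i = go i
      where
      const : ∀ {r s} → r ≡ s → fromℚ r ≈ᴿ fromℚ s
      const {r} {s} e = ≈ᴿ-pointwise {fromℚ r} {fromℚ s} (λ _ → e)
      nat : ∀ n → σ∞ (ι (fromℤ (+ n))) ≈ᴿ fromℚ (fromℤ (+ n))
      nat zero = ≈ᴿ-trans {σ∞ (ι (fromℤ 0ℤ))} {σ∞ 0#} {fromℚ (fromℤ 0ℤ)}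
          (σ∞.⟦⟧-cong (≈-trans (ι.⟦⟧-cong fromℤ-0) ι.0#-homo))
        (≈ᴿ-trans {σ∞ 0#} {0ᴿ} {fromℚ (fromℤ 0ℤ)} σ∞.0#-homo (const (sym fromℤ-0)))
      nat (suc n) = ≈ᴿ-trans {σ∞ (ι (fromℤ (+ suc n)))} {σ∞ (1# +ᴷ ι (fromℤ (+ n)))}
          {fromℚ (fromℤ (+ suc n))}
        (σ∞.⟦⟧-cong (≈-trans (ι.⟦⟧-cong (trans (fromℤ-+ 1ℤ (+ n)) (cong (_+ fromℤ (+ n)) fromℤ-1)))
          (≈-trans (ι.+-homo 1ℚ (fromℤ (+ n))) (+-cong ι.1#-homo ≈-refl))))
        (≈ᴿ-trans {σ∞ (1# +ᴷ ι (fromℤ (+ n)))} {σ∞ 1# +ᴿ σ∞ (ι (fromℤ (+ n)))} {fromℚ (fromℤ (+ suc n))}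
            (σ∞.+-homo 1# (ι (fromℤ (+ n))))
        (≈ᴿ-trans {σ∞ 1# +ᴿ σ∞ (ι (fromℤ (+ n)))} {1ᴿ +ᴿ fromℚ (fromℤ (+ n))} {fromℚ (fromℤ (+ suc n))}
          (+ᴿ-cong {σ∞ 1#} {σ∞ (ι (fromℤ (+ n)))} {1ᴿ} {fromℚ (fromℤ (+ n))} σ∞.1#-homo (nat n))
          (≈ᴿ-pointwise {1ᴿ +ᴿ fromℚ (fromℤ (+ n))} {fromℚ (fromℤ (+ suc n))}
              (λ _ → sym (trans (fromℤ-+ 1ℤ (+ n)) (cong (_+ fromℤ (+ n)) fromℤ-1))))))
      go : ∀ i → σ∞ (ι (fromℤ i)) ≈ᴿ fromℚ (fromℤ i)
      go (+ n) = nat n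
      go -[1+ n ] = ≈ᴿ-trans {σ∞ (ι (fromℤ -[1+ n ]))} {σ∞ (-ᴷ ι (fromℤ (+ suc n)))}
          {fromℚ (fromℤ -[1+ n ])}
        (σ∞.⟦⟧-cong (≈-trans (ι.⟦⟧-cong (fromℤ-neg (+ suc n))) (ι.-‿homo (fromℤ (+ suc n)))))
        (≈ᴿ-trans {σ∞ (-ᴷ ι (fromℤ (+ suc n)))} { -ᴿ σ∞ (ι (fromℤ (+ suc n)))} {fromℚ (fromℤ -[1+ n ])}
            (σ∞.-‿homo (ι (fromℤ (+ suc n))))
        (≈ᴿ-trans { -ᴿ σ∞ (ι (fromℤ (+ suc n)))} { -ᴿ fromℚ (fromℤ (+ suc n))} {fromℚ (fromℤ -[1+ n ])}
          (-ᴿ-cong {σ∞ (ι (fromℤ (+ suc n)))} {fromℚ (fromℤ (+ suc n))} (nat (suc n)))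
          (≈ᴿ-pointwise { -ᴿ fromℚ (fromℤ (+ suc n))} {fromℚ (fromℤ -[1+ n ])}
              (λ _ → sym (fromℤ-neg (+ suc n))))))

  -- for r = a/d, d (σ∞ r - r) = (d - σ∞ d) σ∞ r + (σ∞ a - a)
  σ∞-ι : ∀ r → σ∞ (ι r) ≈ᴿ fromℚ r
  σ∞-ι r = go (bounded-exists (σ∞ (ι r)))
    where
    d a i : ℚ
    d = fromℤ (+ ↧ₙ r)
    a = fromℤ (↥ r)
    D R A : ℝ
    D = σ∞ (ι d)
    R = σ∞ (ι r)
    A = σ∞ (ι a)
    0<d : 0ℚ < d
    0<d = ℚ.<-≤-trans 0<1 (positive r)
      where
      positive : ∀ r → 1ℚ ≤ fromℤ (+ ↧ₙ r)
      positive (ℚ.mkℚ _ d-1 _) = 1≤fromℤ-suc d-1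
    i = (ℚ.1/ d) {{ℚ.>-nonZero 0<d}}
    DR≈a : D *ᴿ R ≈ᴿ fromℚ a
    DR≈a = ≈ᴿ-trans {D *ᴿ R} {σ∞ (ι d *ᴷ ι r)} {fromℚ a}
        (≈ᴿ-sym {σ∞ (ι d *ᴷ ι r)} {D *ᴿ R} (σ∞.*-homo (ι d) (ι r)))
      (≈ᴿ-trans {σ∞ (ι d *ᴷ ι r)} {A} {fromℚ a}
          (σ∞.⟦⟧-cong (≈-trans (≈-sym (ι.*-homo d r)) (ι.⟦⟧-cong (trans (ℚ.*-comm d r) (↥-fromℤ r)))))
        (σ∞-ℤ (↥ r)))
    go : (∃[ M ] 0ℚ < M × Bounded R M) → R ≈ᴿ fromℚ r
    go (M , _ , bd) = bounded-0⇒≈ᴿ {R} {fromℚ r} (subst (Bounded (R -ᴿ fromℚ r)) zero-bound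
      (bounded-≈ (≈ᴿ-pointwise {E} {R -ᴿ fromℚ r} pointwise)
        (bounded-* (bounded-+ (bounded-* (≈ᴿ⇒bounded-0 {fromℚ d} {D} (≈ᴿ-sym {D} {fromℚ d} (σ∞-ℤ (+ ↧ₙ r))))
            bd) (≈ᴿ⇒bounded-0 {D *ᴿ R} {fromℚ a} DR≈a)) (bounded-const i))))
      where
      E : ℝ
      E = ((fromℚ d -ᴿ D) *ᴿ R +ᴿ (D *ᴿ R -ᴿ fromℚ a)) *ᴿ fromℚ i
      zero-bound : (0ℚ * M + 0ℚ) * ∣ i ∣ ≡ 0ℚ
      zero-bound = ℚS.solve 2 (λ m i → (ℚS.con 0ℚ ⊗ m ⊞ ℚS.con 0ℚ) ⊗ i ⊜ ℚS.con 0ℚ) refl M ∣ i ∣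
      pointwise : ∀ n → ((d - seq D n) * seq R n + (seq D n * seq R n - a)) * i ≡ seq R n - r
      pointwise n = begin
        ((d - seq D n) * seq R n + (seq D n * seq R n - a)) * i ≡⟨ cong
            (λ z → ((d - seq D n) * seq R n + (seq D n * seq R n - z)) * i) (sym (↥-fromℤ r)) ⟩
        ((d - seq D n) * seq R n + (seq D n * seq R n - r * d)) * i
          ≡⟨ ℚS.solve 5 (λ d D R r i → ((d ⊟ D) ⊗ R ⊞ (D ⊗ R ⊟ r ⊗ d)) ⊗ i ⊜ (R ⊟ r) ⊗ (d ⊗ i)) refl d
              (seq D n) (seq R n) r i ⟩
        (seq R n - r) * (d * i) ≡⟨ cong ((seq R n - r) *_) (ℚ.*-inverseʳ d {{ℚ.>-nonZero 0<d}}) ⟩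
        (seq R n - r) * 1ℚ ≡⟨ ℚ.*-identityʳ _ ⟩
        seq R n - r ∎
        where open ≡-Reasoning

  abs-ι : ∀ r → Abs (ι r) ∣ r ∣
  abs-ι r = bounded-≈ (≈ᴿ-sym {σ∞ (ι r)} {fromℚ r} (σ∞-ι r)) (bounded-const r)

  abs-ι⁻¹ : ∀ {r s} → Abs (ι r) s → ∣ r ∣ ≤ s
  abs-ι⁻¹ {r} h = bounded-const⁻¹ (bounded-≈ (σ∞-ι r) h)

  abs-ι-nonneg : ∀ {r} → 0ℚ ≤ r → Abs (ι r) r
  abs-ι-nonneg {r} 0≤r = subst (Abs (ι r)) (ℚ.0≤p⇒∣p∣≡p 0≤r) (abs-ι r)

  abs-1 : Abs 1# 1ℚ
  abs-1 = abs-≈ ι.1#-homo (abs-ι-nonneg 0≤1)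

  abs-nonneg : ∀ {x r} → Abs x r → 0ℚ ≤ r
  abs-nonneg = bounded-nonneg

  abs-^ : ∀ {x r} n → Abs x r → Abs (x ^ᴷ n) (r ^ n)
  abs-^ zero h = abs-1
  abs-^ (suc n) h = abs-* h (abs-^ n h)

  private
    σ∞-inverse : ∀ {x y} → x *ᴷ y ≈ 1# → σ∞ x *ᴿ σ∞ y ≈ᴿ 1ᴿ
    σ∞-inverse {x} {y} xy = ≈ᴿ-trans {σ∞ x *ᴿ σ∞ y} {σ∞ (x *ᴷ y)} {1ᴿ}
        (≈ᴿ-sym {σ∞ (x *ᴷ y)} {σ∞ x *ᴿ σ∞ y} (σ∞.*-homo x y))
      (≈ᴿ-trans {σ∞ (x *ᴷ y)} {σ∞ 1#} {1ᴿ} (σ∞.⟦⟧-cong xy) σ∞.1#-homo)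

  abs-or-inverse : ∀ {x y r s} → 0ℚ < r → r * s ≡ 1ℚ → x *ᴷ y ≈ 1# → Abs x (r + r) ⊎ Abs y s
  abs-or-inverse 0<r rs xy = bounded-or-inverse-bounded 0<r rs (σ∞-inverse xy)

  -- The constant 1/(1 - θ) is chosen before x, y and z, so that it serves all indices n at once.
  abs-complement-inverse : ∀ {θ} → θ < 1ℚ → ∃[ s ] (∀ {x y z} → z +ᴷ x ≈ 1# → z *ᴷ y ≈ 1# → Abs x θ →
      Abs y s)
  abs-complement-inverse {θ} θ<1 = i , λ {x} {y} {z} zx zy h →
    away⇒inverse-bounded {σ∞ z} {σ∞ y} 0<1-θ (ℚ.*-inverseʳ (1ℚ - θ) {{ℚ.>-nonZero 0<1-θ}})
        (σ∞-inverse {z} {y} zy)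
    (complement-away {σ∞ x} {σ∞ z} (≈ᴿ-trans {σ∞ z +ᴿ σ∞ x} {σ∞ (z +ᴷ x)} {1ᴿ}
        (≈ᴿ-sym {σ∞ (z +ᴷ x)} {σ∞ z +ᴿ σ∞ x} (σ∞.+-homo z x))
      (≈ᴿ-trans {σ∞ (z +ᴷ x)} {σ∞ 1#} {1ᴿ} (σ∞.⟦⟧-cong zx) σ∞.1#-homo)) h)
    where
    0<1-θ : 0ℚ < 1ℚ - θ
    0<1-θ = subst (_< 1ℚ - θ) (ℚ.+-inverseʳ θ) (ℚ.+-monoˡ-< (- θ) θ<1)
    i : ℚ
    i = (ℚ.1/ (1ℚ - θ)) {{ℚ.>-nonZero 0<1-θ}}

  abs-below-1 : ∀ {x y z} → z +ᴷ x *ᴷ x ≈ 1# → z *ᴷ y ≈ 1# → Abs x 1ℚ → ∃[ κ ] 0ℚ ≤ κ × κ < 1ℚ × Abs x κ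
  abs-below-1 {x} {y} {z} zx zy = bounded-below-1 {σ∞ x} {σ∞ y} {σ∞ z}
    (≈ᴿ-trans {σ∞ z +ᴿ σ∞ x *ᴿ σ∞ x} {σ∞ z +ᴿ σ∞ (x *ᴷ x)} {1ᴿ}
      (+ᴿ-cong {σ∞ z} {σ∞ x *ᴿ σ∞ x} {σ∞ z} {σ∞ (x *ᴷ x)} (≈ᴿ-pointwise {σ∞ z} {σ∞ z} (λ _ → refl))
          (≈ᴿ-sym {σ∞ (x *ᴷ x)} {σ∞ x *ᴿ σ∞ x} (σ∞.*-homo x x)))
      (≈ᴿ-trans {σ∞ z +ᴿ σ∞ (x *ᴷ x)} {σ∞ (z +ᴷ x *ᴷ x)} {1ᴿ}
          (≈ᴿ-sym {σ∞ (z +ᴷ x *ᴷ x)} {σ∞ z +ᴿ σ∞ (x *ᴷ x)} (σ∞.+-homo z (x *ᴷ x)))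
        (≈ᴿ-trans {σ∞ (z +ᴷ x *ᴷ x)} {σ∞ 1#} {1ᴿ} (σ∞.⟦⟧-cong zx) σ∞.1#-homo)))
    (σ∞-inverse {z} {y} zy)

  -- An integer a with 2^a ≤ ∣x∣ ≤ 2^(a+2), the lower bound being stated through the inverse y. The
  -- search descends from a crude upper bound, with ∣y∣ ≤ 1 as the floor at a = 0. The overlap in
  -- `abs-or-inverse` costs a factor 2, hence a + 2 rather than a + 1.
  abs-log₂ : ∀ {x y} → x *ᴷ y ≈ 1# → Abs y 1ℚ → ∃[ a ] Abs x (2ℚ ^ (2 ℕ.+ a)) × Abs y (½ ^ a)
  abs-log₂ {x} {y} xy y≤1 = start (abs-exists x)
    where
    search : ∀ N → Abs x (2ℚ ^ (2 ℕ.+ N)) → ∃[ a ] Abs x (2ℚ ^ (2 ℕ.+ a)) × Abs y (½ ^ a)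
    search zero h = 0 , h , y≤1
    search (suc N) h = decide (abs-or-inverse (0<2^ (suc N)) (2^*½^ (suc N)) xy)
      where
      decide : Abs x (2ℚ ^ suc N + 2ℚ ^ suc N) ⊎ Abs y (½ ^ suc N) → ∃[ a ] Abs x (2ℚ ^ (2 ℕ.+ a)) × Abs y
          (½ ^ a)
      decide (inj₁ h′) = search N (subst (Abs x)
          (ℚS.solve 1 (λ p → p ⊞ p ⊜ ℚS.con 2ℚ ⊗ p) refl (2ℚ ^ suc N)) h′)
      decide (inj₂ k) = suc N , h , k
    start : (∃[ r ] 0ℚ < r × Abs x r) → ∃[ a ] Abs x (2ℚ ^ (2 ℕ.+ a)) × Abs y (½ ^ a)
    start (r , _ , h) = search N (abs-mono (≤2^ r) h)
      where
      N = ℤ.∣ ↥ r ∣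
      ≤2^ : ∀ r → r ≤ 2ℚ ^ (2 ℕ.+ ℤ.∣ ↥ r ∣)
      ≤2^ r = begin
        r ≤⟨ ≤numerator r ⟩
        + ℤ.∣ ↥ r ∣ ℚ./ 1 ≡⟨ fromℤ-def (+ ℤ.∣ ↥ r ∣) ⟩
        fromℤ (+ ℤ.∣ ↥ r ∣) ≤⟨ fromℤ-mono-≤ (ℤ.+≤+ (ℕ.<⇒≤ (n<2^n ℤ.∣ ↥ r ∣))) ⟩
        fromℤ (pow2 ℤ.∣ ↥ r ∣) ≡⟨ fromℤ-pow2 ℤ.∣ ↥ r ∣ ⟩
        2ℚ ^ ℤ.∣ ↥ r ∣ ≤⟨ ^-monoʳ-≤ {2ℚ} {ℤ.∣ ↥ r ∣} {2 ℕ.+ ℤ.∣ ↥ r ∣} 1≤2ℚ (ℕ.m≤n+m ℤ.∣ ↥ r ∣ 2) ⟩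
        2ℚ ^ (2 ℕ.+ ℤ.∣ ↥ r ∣) ∎
        where open ℚ.≤-Reasoning

  σ∞-difference : ∀ x r → σ∞ (x -ᴷ ι r) ≈ᴿ σ∞ x -ᴿ fromℚ r
  σ∞-difference x r = ≈ᴿ-trans {σ∞ (x -ᴷ ι r)} {σ∞ x +ᴿ σ∞ (-ᴷ ι r)} {σ∞ x -ᴿ fromℚ r}
      (σ∞.+-homo x (-ᴷ ι r))
    (+ᴿ-cong {σ∞ x} {σ∞ (-ᴷ ι r)} {σ∞ x} { -ᴿ fromℚ r} (≈ᴿ-pointwise {σ∞ x} {σ∞ x} (λ _ → refl))
      (≈ᴿ-trans {σ∞ (-ᴷ ι r)} { -ᴿ σ∞ (ι r)} { -ᴿ fromℚ r} (σ∞.-‿homo (ι r))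
          (-ᴿ-cong {σ∞ (ι r)} {fromℚ r} (σ∞-ι r))))

  abs⇒≤ᴿ : ∀ {x r s} → Abs (x -ᴷ ι r) s → ∣ σ∞ x -ᴿ fromℚ r ∣ᴿ ≤ᴿ fromℚ s
  abs⇒≤ᴿ {x} {r} {s} h = bounded⇒≤ᴿ {σ∞ x -ᴿ fromℚ r} (bounded-≈ (σ∞-difference x r) h)

module PartialQuotients {c ℓ} (K : QuadraticField c ℓ)
  (σ∞ : QuadraticField.Carrier K → ℝ) (σ∞-hom : RingMorphisms.IsRingHomomorphism (QuadraticField.rawRing K)
      ℝ-rawRing σ∞)
  (σ₂ : QuadraticField.Carrier K → ℚ₂) (σ₂-hom : RingMorphisms.IsRingHomomorphism (QuadraticField.rawRing K)
      ℚ₂-rawRing σ₂) where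
  open FieldLemmas K
  open RealLemmas K σ∞ σ∞-hom
  open TwoAdic σ₂ σ₂-hom
  open Algorithm K σ∞ σ₂
  private
    module σ∞ = RingMorphisms.IsRingHomomorphism σ∞-hom
    module σ₂ = RingMorphisms.IsRingHomomorphism σ₂-hom

  quotient-dyadic : ∀ ε {x b} → IsPartialQuotient ε x b → ∃[ k ] ∃[ a ] 2ℚ ^ k * b ≡ fromℤ a
  quotient-dyadic ε {x} {b} (m , _ , eq) = k , a , (begin
      2ℚ ^ k * b ≡⟨ cong (2ℚ ^ k *_) (trans eq (cong (_+ ⌊ σ₂ x ⌋₂) (fromℤ-def (spacing ε ℤ.* m)))) ⟩
      2ℚ ^ k * (fromℤ (spacing ε ℤ.* m) + ⌊ σ₂ x ⌋₂) ≡⟨ ℚ.*-distribˡ-+ (2ℚ ^ k) (fromℤ (spacing ε ℤ.* m)) ⌊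
          σ₂ x ⌋₂ ⟩
      2ℚ ^ k * fromℤ (spacing ε ℤ.* m) + 2ℚ ^ k * ⌊ σ₂ x ⌋₂ ≡⟨ cong₂ _+_
          (trans (cong (_* fromℤ (spacing ε ℤ.* m)) (sym (fromℤ-pow2 k)))
          (sym (fromℤ-* (pow2 k) (spacing ε ℤ.* m))))
         (⌊⌋₂-scaled k (ℚ₂.digits (σ₂ x))) ⟩
      fromℤ (pow2 k ℤ.* (spacing ε ℤ.* m)) + fromℤ (trunc (ℚ₂.digits (σ₂ x)) (suc k)) ≡⟨ sym
          (fromℤ-+ (pow2 k ℤ.* (spacing ε ℤ.* m)) (trunc (ℚ₂.digits (σ₂ x)) (suc k))) ⟩
      fromℤ a ∎)
    where
    open ≡-Reasoning
    k : ℕ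
    k = ℚ₂.shift (σ₂ x)
    a : ℤ
    a = pow2 k ℤ.* (spacing ε ℤ.* m) ℤ.+ trunc (ℚ₂.digits (σ₂ x)) (suc k)

  private
    remainder-split : ∀ ε {x b} m → b ≡ (spacing ε ℤ.* m) ℚ./ 1 + ⌊ σ₂ x ⌋₂ →
      (x -ᴷ ι ⌊ σ₂ x ⌋₂) -ᴷ ι (fromℤ (spacing ε ℤ.* m)) ≈ x -ᴷ ι b
    remainder-split ε {x} {b} m eq = ≈-trans
      (solveᴷ 3 (λ x f s → x :- f :- s := x :- (s :+ f)) ≈-refl x (ι ⌊ σ₂ x ⌋₂)
          (ι (fromℤ (spacing ε ℤ.* m))))
      (+-cong ≈-refl (-‿cong (≈-trans (≈-sym (ι.+-homo (fromℤ (spacing ε ℤ.* m)) ⌊ σ₂ x ⌋₂))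
        (ι.⟦⟧-cong (sym (trans eq (cong (_+ ⌊ σ₂ x ⌋₂) (fromℤ-def (spacing ε ℤ.* m)))))))))

  -- For even index the integer subtracted after the floor is 2m, which does not disturb membership
  -- in 2O; for spacing 1 only O is left.
  remainder-∈2O : ∀ {x b} → IsPartialQuotient 0F x b → In 1 (x -ᴷ ι b)
  remainder-∈2O {x} (m , _ , eq) = In-≈ (remainder-split 0F m eq) (In-- (In-⌊⌋ x) (In-pow2 1 m))

  remainder-∈O : ∀ ε {x b} → IsPartialQuotient ε x b → In 0 (x -ᴷ ι b)
  remainder-∈O ε {x} (m , _ , eq) = In-≈ (remainder-split ε m eq)
      (In-- (In-weaken 1 (In-⌊⌋ x)) (In-ℤ (spacing ε ℤ.* m)))

  0<spacing : ∀ ε → 0ℚ < fromℤ (spacing ε)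
  0<spacing 0F = subst (0ℚ <_) (sym fromℤ-2) (0<2^ 1)
  0<spacing (sucF 0F) = subst (0ℚ <_) (sym fromℤ-1) 0<1

  -- Only the competitors m + 1 and m - 1 matter: they move the remainder by one spacing in either
  -- direction.
  remainder-abs : ∀ ε {x b} → IsPartialQuotient ε x b → Abs (x -ᴷ ι b) (½ * fromℤ (spacing ε))
  remainder-abs ε {x} {b} (m , (minimal , _) , eq) = bounded-≈ z≈
    (nearest⇒bounded {z} {s} (0<spacing ε)
      (≤ᴿ-resp-≈ᴿ {z} {shifted (ℤ.+ 1)} {z} {z -ᴿ fromℚ s} (≈ᴿ-pointwise {z} {z} λ _ → refl)
          (≈ᴿ-pointwise {shifted (ℤ.+ 1)} {z -ᴿ fromℚ s} up) (minimal (m ℤ.+ (ℤ.+ 1))))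
      (≤ᴿ-resp-≈ᴿ {z} {shifted -[1+ 0 ]} {z} {z +ᴿ fromℚ s} (≈ᴿ-pointwise {z} {z} λ _ → refl)
          (≈ᴿ-pointwise {shifted -[1+ 0 ]} {z +ᴿ fromℚ s} down) (minimal (m ℤ.+ -[1+ 0 ]))))
    where
    s f : ℚ
    s = fromℤ (spacing ε)
    f = ⌊ σ₂ x ⌋₂
    shifted : ℤ → ℝ
    shifted i = σ∞ x -ᴿ fromℚ ((spacing ε ℤ.* (m ℤ.+ i)) ℚ./ 1) -ᴿ fromℚ f
    z : ℝ
    z = σ∞ x -ᴿ fromℚ ((spacing ε ℤ.* m) ℚ./ 1) -ᴿ fromℚ f
    sm : ℚ
    sm = fromℤ (spacing ε ℤ.* m)
    move : ∀ i → (spacing ε ℤ.* (m ℤ.+ i)) ℚ./ 1 ≡ sm + s * fromℤ i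
    move i = trans (fromℤ-def _) (trans (cong fromℤ (ℤ.*-distribˡ-+ (spacing ε) m i))
      (trans (fromℤ-+ (spacing ε ℤ.* m) (spacing ε ℤ.* i)) (cong (λ w → sm + w) (fromℤ-* (spacing ε) i))))
    up : ∀ n → seq (σ∞ x) n - (spacing ε ℤ.* (m ℤ.+ (ℤ.+ 1))) ℚ./ 1 - f ≡ seq (σ∞ x) n - (spacing ε ℤ.* m)
        ℚ./ 1 - f - s
    up n = trans (cong (λ w → seq (σ∞ x) n - w - f)
        (trans (move (ℤ.+ 1)) (cong (λ w → sm + s * w) fromℤ-1)))
      (trans (ℚS.solve 4 (λ x a s f → x ⊟ (a ⊞ s ⊗ ℚS.con 1ℚ) ⊟ f ⊜ x ⊟ a ⊟ f ⊟ s) refl (seq (σ∞ x) n) sm s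
          f)
        (cong (λ w → seq (σ∞ x) n - w - f - s) (sym (fromℤ-def (spacing ε ℤ.* m)))))
    down : ∀ n → seq (σ∞ x) n - (spacing ε ℤ.* (m ℤ.+ -[1+ 0 ])) ℚ./ 1 - f ≡ seq (σ∞ x) n -
        (spacing ε ℤ.* m) ℚ./ 1 - f + s
    down n = trans (cong (λ w → seq (σ∞ x) n - w - f)
        (trans (move -[1+ 0 ]) (cong (λ w → sm + s * w) (trans (fromℤ-neg (ℤ.+ 1)) (cong -_ fromℤ-1)))))
      (trans (ℚS.solve 4 (λ x a s f → x ⊟ (a ⊞ s ⊗ (⊖ ℚS.con 1ℚ)) ⊟ f ⊜ x ⊟ a ⊟ f ⊞ s) refl (seq (σ∞ x) n)
          sm s f)
        (cong (λ w → seq (σ∞ x) n - w - f + s) (sym (fromℤ-def (spacing ε ℤ.* m)))))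
    z≈ : z ≈ᴿ σ∞ (x -ᴷ ι b)
    z≈ = ≈ᴿ-trans {z} {σ∞ x -ᴿ fromℚ b} {σ∞ (x -ᴷ ι b)}
      (≈ᴿ-pointwise {z} {σ∞ x -ᴿ fromℚ b} λ n → trans
        (ℚS.solve 3 (λ x a f → x ⊟ a ⊟ f ⊜ x ⊟ (a ⊞ f)) refl (seq (σ∞ x) n) ((spacing ε ℤ.* m) ℚ./ 1) f)
        (cong (λ w → seq (σ∞ x) n - w) (sym eq)))
      (≈ᴿ-sym {σ∞ (x -ᴷ ι b)} {σ∞ x -ᴿ fromℚ b} (σ∞-difference x b))

  -- Minimizers transfer along x ≈ y, so each of the two least ones bounds the other. Through this
  -- the expansion, given only by relations, depends on the value of αₙ alone, which periodicity
  -- requires.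
  quotient-unique : ∀ ε {x y b b′} → x ≈ y → IsPartialQuotient ε x b → IsPartialQuotient ε y b′ → b ≡ b′
  quotient-unique ε {x} {y} x≈y (m , (minimal , least) , eq) (m′ , (minimal′ , least′) , eq′) =
      trans eq (trans
    (cong₂ (λ i f → (spacing ε ℤ.* i) ℚ./ 1 + f)
      (ℤ.≤-antisym (least m′ (transfer (≈-sym x≈y) m′ minimal′)) (least′ m (transfer x≈y m minimal)))
      (⌊⌋₂-cong {σ₂ x} {σ₂ y} (σ₂.⟦⟧-cong x≈y)))
    (sym eq′))
    where
    offset : Carrier → ℤ → ℝ
    offset x i = σ∞ x -ᴿ fromℚ ((spacing ε ℤ.* i) ℚ./ 1) -ᴿ fromℚ ⌊ σ₂ x ⌋₂
    offset-cong : ∀ {x y} → x ≈ y → ∀ i → offset x i ≈ᴿ offset y i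
    offset-cong {x} {y} x≈y i = +ᴿ-cong {σ∞ x -ᴿ fromℚ s} { -ᴿ fromℚ ⌊ σ₂ x ⌋₂} {σ∞ y -ᴿ fromℚ s}
        { -ᴿ fromℚ ⌊ σ₂ y ⌋₂}
      (+ᴿ-cong {σ∞ x} { -ᴿ fromℚ s} {σ∞ y} { -ᴿ fromℚ s} (σ∞.⟦⟧-cong x≈y)
          (≈ᴿ-pointwise { -ᴿ fromℚ s} { -ᴿ fromℚ s} λ _ → refl))
      (≈ᴿ-pointwise { -ᴿ fromℚ ⌊ σ₂ x ⌋₂} { -ᴿ fromℚ ⌊ σ₂ y ⌋₂} λ _ →
          cong -_ (⌊⌋₂-cong {σ₂ x} {σ₂ y} (σ₂.⟦⟧-cong x≈y)))
      where
      s : ℚ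
      s = (spacing ε ℤ.* i) ℚ./ 1
    transfer : ∀ {x y} → x ≈ y → ∀ m → IsMinimizer (distance ε x) m → IsMinimizer (distance ε y) m
    transfer {x} {y} x≈y m minimal j = ≤ᴿ-resp-≈ᴿ {offset x m} {offset x j} {offset y m} {offset y j}
      (offset-cong x≈y m) (offset-cong x≈y j) (minimal j)

-- Dyadic rationals, pigeonhole and induction along a period

Dyadic : ℚ → Set
Dyadic r = ∃[ k ] ∃[ a ] 2ℚ ^ k * r ≡ fromℤ a

dyadic-+ : ∀ {r s} → Dyadic r → Dyadic s → Dyadic (r + s)
dyadic-+ {r} {s} (k , a , eq) (l , b , eq′) = k ℕ.+ l , pow2 l ℤ.* a ℤ.+ pow2 k ℤ.* b , (begin
  2ℚ ^ (k ℕ.+ l) * (r + s) ≡⟨ cong (_* (r + s)) (^-homo-* 2ℚ k l) ⟩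
  2ℚ ^ k * 2ℚ ^ l * (r + s) ≡⟨ ℚS.solve 4 (λ p q r s → p ⊗ q ⊗ (r ⊞ s) ⊜ q ⊗ (p ⊗ r) ⊞ p ⊗ (q ⊗ s))
      refl (2ℚ ^ k) (2ℚ ^ l) r s ⟩
  2ℚ ^ l * (2ℚ ^ k * r) + 2ℚ ^ k * (2ℚ ^ l * s) ≡⟨ cong₂ _+_ (cong₂ _*_ (sym (fromℤ-pow2 l)) eq)
      (cong₂ _*_ (sym (fromℤ-pow2 k)) eq′) ⟩
  fromℤ (pow2 l) * fromℤ a + fromℤ (pow2 k) * fromℤ b ≡⟨ cong₂ _+_ (sym (fromℤ-* (pow2 l) a))
      (sym (fromℤ-* (pow2 k) b)) ⟩
  fromℤ (pow2 l ℤ.* a) + fromℤ (pow2 k ℤ.* b) ≡⟨ sym (fromℤ-+ (pow2 l ℤ.* a) (pow2 k ℤ.* b)) ⟩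
  fromℤ (pow2 l ℤ.* a ℤ.+ pow2 k ℤ.* b) ∎)
  where open ≡-Reasoning

dyadic-* : ∀ {r s} → Dyadic r → Dyadic s → Dyadic (r * s)
dyadic-* {r} {s} (k , a , eq) (l , b , eq′) = k ℕ.+ l , a ℤ.* b , (begin
  2ℚ ^ (k ℕ.+ l) * (r * s) ≡⟨ cong (_* (r * s)) (^-homo-* 2ℚ k l) ⟩
  2ℚ ^ k * 2ℚ ^ l * (r * s) ≡⟨ ℚS.solve 4 (λ p q r s → p ⊗ q ⊗ (r ⊗ s) ⊜ (p ⊗ r) ⊗ (q ⊗ s)) refl (2ℚ ^ k)
      (2ℚ ^ l) r s ⟩
  2ℚ ^ k * r * (2ℚ ^ l * s) ≡⟨ cong₂ _*_ eq eq′ ⟩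
  fromℤ a * fromℤ b ≡⟨ sym (fromℤ-* a b) ⟩
  fromℤ (a ℤ.* b) ∎)
  where open ≡-Reasoning

dyadic-neg : ∀ {r} → Dyadic r → Dyadic (- r)
dyadic-neg {r} (k , a , eq) = k , ℤ.- a , trans (sym (ℚ.neg-distribʳ-* (2ℚ ^ k) r))
    (trans (cong -_ eq) (sym (fromℤ-neg a)))

dyadic-ℤ : ∀ a → Dyadic (fromℤ a)
dyadic-ℤ a = 0 , a , ℚ.*-identityˡ _

pigeonhole-ℤ² : ∀ X (f g : ℕ → ℤ) → (∀ n → ℤ.∣ f n ∣ ℕ.≤ X) → (∀ n → ℤ.∣ g n ∣ ℕ.≤ X) →
  ∃[ i ] ∃[ j ] i ℕ.< j × f i ≡ f j × g i ≡ g j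
pigeonhole-ℤ² X f g hf hg = go (pigeonhole {size ℕ.* size} {suc (size ℕ.* size)} ℕ.≤-refl
    (λ i → combine (code f hf (toℕ i)) (code g hg (toℕ i))))
  where
  size : ℕ
  size = suc (X ℕ.+ X)
  shifted : ∀ i → ℤ.∣ i ∣ ℕ.≤ X → + ℤ.∣ i ℤ.+ + X ∣ ≡ i ℤ.+ + X
  shifted i h = ℤ.0≤i⇒+∣i∣≡i (ℤ.≤-trans (ℤ.≤-reflexive (sym (ℤ.+-inverseˡ (+ X))))
      (ℤ.+-monoˡ-≤ (+ X) (lower i h)))
    where
    lower : ∀ i → ℤ.∣ i ∣ ℕ.≤ X → ℤ.- (+ X) ℤ.≤ i
    lower (+ n) h = ℤ.≤-trans (ℤ.neg-mono-≤ {0ℤ} (ℤ.+≤+ ℕ.z≤n)) (ℤ.+≤+ ℕ.z≤n)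
    lower -[1+ n ] h = ℤ.neg-mono-≤ (ℤ.+≤+ h)
  code : (f : ℕ → ℤ) → (∀ n → ℤ.∣ f n ∣ ℕ.≤ X) → ℕ → Fin size
  code f hf n = fromℕ< {ℤ.∣ f n ℤ.+ + X ∣} (ℕ.s≤s
      (ℕ.≤-trans (ℤ.∣i+j∣≤∣i∣+∣j∣ (f n) (+ X)) (ℕ.+-monoˡ-≤ X (hf n))))
  code-injective : ∀ f hf i j → code f hf i ≡ code f hf j → f i ≡ f j
  code-injective f hf i j eq = begin
    f i ≡⟨ cancel (f i) ⟩
    f i ℤ.+ + X ℤ.- + X ≡⟨ cong (ℤ._- + X) (trans (sym (shifted (f i) (hf i)))
        (trans (cong +_ (fromℕ<-injective _ _ _ _ eq)) (shifted (f j) (hf j)))) ⟩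
    f j ℤ.+ + X ℤ.- + X ≡⟨ sym (cancel (f j)) ⟩
    f j ∎
    where
    open ≡-Reasoning
    cancel : ∀ x → x ≡ x ℤ.+ + X ℤ.- + X
    cancel x = solve 2 (λ x y → x := x :+ y :- y) refl x (+ X)
      where open ℤS
  go : ∃[ i ] ∃[ j ] i Fin.< j × combine (code f hf (toℕ i)) (code g hg (toℕ i)) ≡ combine
      (code f hf (toℕ j)) (code g hg (toℕ j)) →
    ∃[ i ] ∃[ j ] i ℕ.< j × f i ≡ f j × g i ≡ g j
  go (i , j , i<j , eq) = toℕ i , toℕ j , i<j , code-injective f hf _ _ (proj₁ both) ,
      code-injective g hg _ _ (proj₂ both)
    where both = combine-injective (code f hf (toℕ i)) (code g hg (toℕ i)) (code f hf (toℕ j))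
            (code g hg (toℕ j)) eq

-- Recursive rather than a product with 2, so that `twice (suc m)` shows two successors and `mod 2`
-- reduces.
twice : ℕ → ℕ
twice zero    = zero
twice (suc n) = suc (suc (twice n))

data HalfView : ℕ → Set where
  even : ∀ m → HalfView (twice m)
  odd  : ∀ m → HalfView (suc (twice m))

halfView : ∀ n → HalfView n
halfView zero = even 0
halfView (suc n) = next (halfView n)
  where
  next : ∀ {n} → HalfView n → HalfView (suc n)
  next (even m) = odd m
  next (odd m)  = even (suc m)

even-mod : ∀ m → twice m mod 2 ≡ 0F
even-mod zero = refl
even-mod (suc m) = even-mod m

odd-mod : ∀ m → suc (twice m) mod 2 ≡ sucF 0F
odd-mod zero = refl
odd-mod (suc m) = odd-mod m

+twice-mod : ∀ m n → (twice m ℕ.+ n) mod 2 ≡ n mod 2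
+twice-mod zero n = refl
+twice-mod (suc m) n = +twice-mod m n

∣fromℤ∣≤ : ∀ {i X} → ∣ fromℤ i ∣ ≤ fromℤ (+ X) → ℤ.∣ i ∣ ℕ.≤ X
∣fromℤ∣≤ {i} {X} h = go (ℤ.+∣i∣≡i⊎+∣i∣≡-i i)
  where
  go : + ℤ.∣ i ∣ ≡ i ⊎ + ℤ.∣ i ∣ ≡ ℤ.- i → ℤ.∣ i ∣ ℕ.≤ X
  go (inj₁ e) = ℤ.drop‿+≤+ (subst (ℤ._≤ + X) (sym e) (fromℤ-cancel-≤ (ℚ.≤-trans (p≤∣p∣ (fromℤ i)) h)))
  go (inj₂ e) = ℤ.drop‿+≤+ (subst (ℤ._≤ + X) (sym e)
      (fromℤ-cancel-≤ (subst (_≤ fromℤ (+ X)) (sym (fromℤ-neg i))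
    (ℚ.≤-trans (p≤∣p∣ (- fromℤ i)) (subst (_≤ fromℤ (+ X)) (sym (ℚ.∣-p∣≡∣p∣ (fromℤ i))) h)))))

≤-integer : ∀ r → ∃[ X ] r ≤ fromℤ (+ X)
≤-integer r = ℤ.∣ ↥ r ∣ , subst (r ≤_) (fromℤ-def (+ ℤ.∣ ↥ r ∣)) (≤numerator r)

0<↧ : ∀ r → 0ℚ < fromℤ (+ ↧ₙ r)
0<↧ (ℚ.mkℚ _ d-1 _) = ℚ.<-≤-trans 0<1 (1≤fromℤ-suc d-1)

module _ {P : ℕ → ℚ → Set} {Ok : ℚ → Set} (mono : ∀ n {r s} → r ≤ s → P n r → P n s)
    (each : ∀ n → ∃[ r ] Ok r × P n r) where

  -- The result is always one of the given constants, the larger of two at each step, so any side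
  -- condition `Ok` survives. It is applied with κ < 1 as well as with C ≥ 1.
  uniform-below : ∀ N → ∃[ r ] Ok r × (∀ n → n ℕ.< N → P n r)
  uniform-below zero = proj₁ (each 0) , proj₁ (proj₂ (each 0)) , λ _ ()
  uniform-below (suc N) = larger (uniform-below N) (each N)
    where
    larger : ∃[ r ] Ok r × (∀ n → n ℕ.< N → P n r) → ∃[ r ] Ok r × P N r →
        ∃[ r ] Ok r × (∀ n → n ℕ.< suc N → P n r)
    larger (r , okr , h) (s , oks , k) = go (ℚ.≤-total r s)
      where
      go : r ≤ s ⊎ s ≤ r → ∃[ r ] Ok r × (∀ n → n ℕ.< suc N → P n r)
      go (inj₁ r≤s) = s , oks , λ n lt → at n (ℕ.m≤n⇒m<n∨m≡n (ℕ.s≤s⁻¹ lt))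
        where
        at : ∀ n → n ℕ.< N ⊎ n ≡ N → P n s
        at n (inj₁ n<N) = mono n r≤s (h n n<N)
        at n (inj₂ refl) = k
      go (inj₂ s≤r) = r , okr , λ n lt → at n (ℕ.m≤n⇒m<n∨m≡n (ℕ.s≤s⁻¹ lt))
        where
        at : ∀ n → n ℕ.< N ⊎ n ≡ N → P n r
        at n (inj₁ n<N) = h n n<N
        at n (inj₂ refl) = mono n s≤r k

periodic-induction : ∀ (P : ℕ → Set) s l → (∀ n → n ℕ.< suc l ℕ.+ s → P n) →
    (∀ n → s ℕ.≤ n → P n → P (suc l ℕ.+ n)) → ∀ n → P n
periodic-induction P s l base next n = go n n ℕ.≤-refl
  where
  go : ∀ fuel n → n ℕ.≤ fuel → P n
  split : ∀ fuel n → n ℕ.≤ fuel → n ℕ.< suc l ℕ.+ s ⊎ suc l ℕ.+ s ℕ.≤ n → P n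
  go fuel n n≤ = split fuel n n≤ (ℕ.<-≤-connex n (suc l ℕ.+ s))
  split fuel n n≤ (inj₁ lt) = base n lt
  split zero .zero ℕ.z≤n (inj₂ ())
  split (suc fuel) n n≤ (inj₂ ge) = subst P (ℕ.m+[n∸m]≡n (ℕ.m+n≤o⇒m≤o (suc l) ge))
    (next (n ℕ.∸ suc l) s≤ (go fuel (n ℕ.∸ suc l) (ℕ.≤-trans (ℕ.∸-monoˡ-≤ (suc l) n≤) (ℕ.m∸n≤m fuel l))))
    where
    s≤ : s ℕ.≤ n ℕ.∸ suc l
    s≤ = subst (ℕ._≤ n ℕ.∸ suc l) (ℕ.m+n∸m≡n (suc l) s) (ℕ.∸-monoˡ-≤ (suc l) ge)

1<2ℚ : 1ℚ < 2ℚ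
1<2ℚ = <-+ 1ℚ 0<1

2^-cancel-≤ : ∀ {m n} → 2ℚ ^ m ≤ 2ℚ ^ n → m ℕ.≤ n
2^-cancel-≤ {m} {n} h = ℕ.≮⇒≥ λ n<m → ℚ.<-irrefl refl (begin-strict
  2ℚ ^ n ≡⟨ sym (ℚ.*-identityˡ _) ⟩
  1ℚ * 2ℚ ^ n <⟨ ℚ.*-monoˡ-<-pos (2ℚ ^ n) {{ℚ.positive (0<2^ n)}} 1<2ℚ ⟩
  2ℚ ^ suc n ≤⟨ ^-monoʳ-≤ {2ℚ} {suc n} {m} 1≤2ℚ n<m ⟩
  2ℚ ^ m ≤⟨ h ⟩
  2ℚ ^ n ∎)
  where open ℚ.≤-Reasoning

1≤½^*2^⇒≤ : ∀ m n → 1ℚ ≤ ½ ^ m * 2ℚ ^ n → m ℕ.≤ n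
1≤½^*2^⇒≤ m n h = 2^-cancel-≤ {m} {n} (begin
  2ℚ ^ m ≡⟨ sym (ℚ.*-identityʳ (2ℚ ^ m)) ⟩
  2ℚ ^ m * 1ℚ ≤⟨ *-monoˡ-≤ (ℚ.<⇒≤ (0<2^ m)) h ⟩
  2ℚ ^ m * (½ ^ m * 2ℚ ^ n) ≡⟨ sym (ℚ.*-assoc (2ℚ ^ m) (½ ^ m) (2ℚ ^ n)) ⟩
  2ℚ ^ m * ½ ^ m * 2ℚ ^ n ≡⟨ cong (_* 2ℚ ^ n) (2^*½^ m) ⟩
  1ℚ * 2ℚ ^ n ≡⟨ ℚ.*-identityˡ _ ⟩
  2ℚ ^ n ∎)
  where open ℚ.≤-Reasoning

½^≤1 : ∀ n → ½ ^ n ≤ 1ℚ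
½^≤1 zero = ℚ.≤-refl
½^≤1 (suc n) = *-mono-≤ {½} {1ℚ} {½ ^ n} {1ℚ} (ℚ.<⇒≤ 0<½) (^-nonneg n (ℚ.<⇒≤ 0<½)) (ℚ.<⇒≤ (<-+ ½ 0<½))
    (½^≤1 n)

square-nonneg : ∀ x → 0ℚ ≤ x * x
square-nonneg x = go (ℚ.∣p∣≡p∨∣p∣≡-p x)
  where
  go : ∣ x ∣ ≡ x ⊎ ∣ x ∣ ≡ - x → 0ℚ ≤ x * x
  go (inj₁ e) = subst (0ℚ ≤_) (cong₂ _*_ e e) (*-nonneg (ℚ.0≤∣p∣ x) (ℚ.0≤∣p∣ x))
  go (inj₂ e) = subst (0ℚ ≤_) (trans (cong₂ _*_ e e) (ℚS.solve 1 (λ x → (⊖ x) ⊗ (⊖ x) ⊜ x ⊗ x) refl x))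
      (*-nonneg (ℚ.0≤∣p∣ x) (ℚ.0≤∣p∣ x))

-- Up to constants, 2^Sₙ is 2^(e k) and ∣qₙ∣ is Λᵏ for a real Λ with 2^aᵢ ≤ Λⁱ ≤ 2^(2 + aᵢ), where k depends on n.
record PowerLaw (q : ℕ → ℚ) (S : ℕ → ℕ) : Set where
  field
    e K : ℕ
    a : ℕ → ℕ
    C : ℚ
    1≤e : 1 ℕ.≤ e
    1≤C : 1ℚ ≤ C
    a-compare : ∀ i j → a i ℕ.* j ℕ.≤ (2 ℕ.+ a j) ℕ.* i
    a-lower : ∀ i → i ℕ.≤ 2 ℕ.+ a i
    a-upper : ∀ i → a i ℕ.≤ K ℕ.* i
    index : ℕ → ℕ
    q-upper : ∀ n i → ∣ q n ^ i ∣ ≤ C ^ i * 2ℚ ^ ((2 ℕ.+ a i) ℕ.* index n)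
    q-lower : ∀ n i → 2ℚ ^ (a i ℕ.* index n) ≤ C ^ i * ∣ q n ^ i ∣
    S-upper : ∀ n → 2ℚ ^ S n ≤ C * 2ℚ ^ (e ℕ.* index n)
    S-lower : ∀ n → 2ℚ ^ (e ℕ.* index n) ≤ C * 2ℚ ^ S n

-- Real powers

^ᴿ-seq : ∀ q .{{_ : ℚ.Positive q}} → 1ℚ ≤ q → ∀ s m → seq (q ^ᴿ s) m ≡ root q (seq s m) m
^ᴿ-seq q 1≤q s m with 1ℚ ℚ.≤? q
... | yes _   = refl
... | no 1≰q = ⊥-elim (1≰q 1≤q)

-- `Below` reads r in lowest terms, while exponents arise as unreduced fractions (p - n)/w. This is
-- the cross-multiplied equality of the two, arranged without subtraction.
fraction-exponents : ∀ r w p n → r * fromℤ (+ w) ≡ fromℤ (+ p) - fromℤ (+ n) →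
  pos-part (↥ r) ℕ.* w ℕ.+ n ℕ.* ↧ₙ r ≡ p ℕ.* ↧ₙ r ℕ.+ neg-part (↥ r) ℕ.* w
fraction-exponents r w p n eq = ℤ.+-injective (begin
  + (P ℕ.* w ℕ.+ n ℕ.* d) ≡⟨ cong₂ ℤ._+_ (ℤ.pos-* P w) (ℤ.pos-* n d) ⟩
  + P ℤ.* + w ℤ.+ + n ℤ.* + d
    ≡⟨ Z.solve 5 (λ P M w n d → P Z.:* w Z.:+ n Z.:* d Z.:= (P Z.:- M) Z.:* w Z.:+ (n Z.:* d Z.:+ M Z.:* w))
        refl (+ P) (+ M) (+ w) (+ n) (+ d) ⟩
  (+ P ℤ.- + M) ℤ.* + w ℤ.+ (+ n ℤ.* + d ℤ.+ + M ℤ.* + w) ≡⟨ cong (ℤ._+ (+ n ℤ.* + d ℤ.+ + M ℤ.* + w))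
      (trans (cong (ℤ._* + w) (parts (↥ r))) integers) ⟩
  (+ p ℤ.- + n) ℤ.* + d ℤ.+ (+ n ℤ.* + d ℤ.+ + M ℤ.* + w)
    ≡⟨ Z.solve 5 (λ p n d M w → (p Z.:- n) Z.:* d Z.:+ (n Z.:* d Z.:+ M Z.:* w) Z.:= p Z.:* d Z.:+ M Z.:* w)
        refl (+ p) (+ n) (+ d) (+ M) (+ w) ⟩
  + p ℤ.* + d ℤ.+ + M ℤ.* + w ≡⟨ sym (cong₂ ℤ._+_ (ℤ.pos-* p d) (ℤ.pos-* M w)) ⟩
  + (p ℕ.* d ℕ.+ M ℕ.* w) ∎)
  where
  open ≡-Reasoning
  module Z = ℤS
  P M d : ℕ
  P = pos-part (↥ r)
  M = neg-part (↥ r)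
  d = ↧ₙ r
  parts : ∀ a → + pos-part a ℤ.- + neg-part a ≡ a
  parts (+ n) = ℤ.+-identityʳ (+ n)
  parts -[1+ n ] = refl
  integers : ↥ r ℤ.* + w ≡ (+ p ℤ.- + n) ℤ.* + d
  integers = fromℤ-injective (begin
    fromℤ (↥ r ℤ.* + w) ≡⟨ fromℤ-* (↥ r) (+ w) ⟩
    fromℤ (↥ r) * fromℤ (+ w) ≡⟨ cong (_* fromℤ (+ w)) (sym (↥-fromℤ r)) ⟩
    r * fromℤ (+ d) * fromℤ (+ w) ≡⟨ ℚS.solve 3 (λ r d w → r ⊗ d ⊗ w ⊜ r ⊗ w ⊗ d) refl r (fromℤ (+ d))
        (fromℤ (+ w)) ⟩
    r * fromℤ (+ w) * fromℤ (+ d) ≡⟨ cong (_* fromℤ (+ d))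
        (trans eq (trans (cong (λ z → fromℤ (+ p) + z) (sym (fromℤ-neg (+ n))))
        (sym (fromℤ-+ (+ p) (ℤ.- + n))))) ⟩
    fromℤ (+ p ℤ.- + n) * fromℤ (+ d) ≡⟨ sym (fromℤ-* (+ p ℤ.- + n) (+ d)) ⟩
    fromℤ ((+ p ℤ.- + n) ℤ.* + d) ∎)

-- If `Below` failed, the w-th power of its negation and the d-th power of the given bound would
-- combine to a strict inequality between two powers of q whose exponents agree by
-- `fraction-exponents`.
below-from-fraction : ∀ {q r c} w p n → 0ℚ < q → 0ℚ ≤ c → 1 ℕ.≤ w → r * fromℤ (+ w) ≡ fromℤ (+ p) - fromℤ
    (+ n) →
  c ^ w * q ^ n ≤ q ^ p → Below q r c
below-from-fraction {q} {r} {c} w p n 0<q 0≤c 1≤w eq h = ℚ.≮⇒≥ λ lt → ℚ.<-irrefl refl (begin-strict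
  q ^ (P ℕ.* w ℕ.+ n ℕ.* d) ≡⟨ trans (^-homo-* q (P ℕ.* w) (n ℕ.* d))
      (cong (_* q ^ (n ℕ.* d)) (sym (^-assocʳ q P w))) ⟩
  (q ^ P) ^ w * q ^ (n ℕ.* d) <⟨ ℚ.*-monoˡ-<-pos (q ^ (n ℕ.* d)) {{ℚ.positive (^-pos (n ℕ.* d) 0<q)}}
     (^-mono-< w 1≤w (^-nonneg P (ℚ.<⇒≤ 0<q)) lt) ⟩
  (c ^ d * q ^ M) ^ w * q ^ (n ℕ.* d) ≡⟨ cong (_* q ^ (n ℕ.* d))
      (trans (^-distrib-* (c ^ d) (q ^ M) w) (cong₂ _*_
      (trans (^-assocʳ c d w) (trans (cong (c ^_) (ℕ.*-comm d w)) (sym (^-assocʳ c w d))))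
      (^-assocʳ q M w))) ⟩
  (c ^ w) ^ d * q ^ (M ℕ.* w) * q ^ (n ℕ.* d) ≡⟨ ℚS.solve 3 (λ x y z → x ⊗ y ⊗ z ⊜ x ⊗ z ⊗ y)
      refl ((c ^ w) ^ d) (q ^ (M ℕ.* w)) (q ^ (n ℕ.* d)) ⟩
  (c ^ w) ^ d * q ^ (n ℕ.* d) * q ^ (M ℕ.* w) ≡⟨ cong (_* q ^ (M ℕ.* w))
      (trans (cong ((c ^ w) ^ d *_) (sym (^-assocʳ q n d))) (sym (^-distrib-* (c ^ w) (q ^ n) d))) ⟩
  (c ^ w * q ^ n) ^ d * q ^ (M ℕ.* w) ≤⟨ *-monoʳ-≤ (^-nonneg (M ℕ.* w) (ℚ.<⇒≤ 0<q))
     (^-mono-≤ d (*-nonneg (^-nonneg w 0≤c) (^-nonneg n (ℚ.<⇒≤ 0<q))) h) ⟩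
  (q ^ p) ^ d * q ^ (M ℕ.* w) ≡⟨ trans (cong (_* q ^ (M ℕ.* w)) (^-assocʳ q p d))
      (sym (^-homo-* q (p ℕ.* d) (M ℕ.* w))) ⟩
  q ^ (p ℕ.* d ℕ.+ M ℕ.* w) ≡⟨ cong (q ^_) (sym (fraction-exponents r w p n eq)) ⟩
  q ^ (P ℕ.* w ℕ.+ n ℕ.* d) ∎)
  where
  open ℚ.≤-Reasoning
  P M d : ℕ
  P = pos-part (↥ r)
  M = neg-part (↥ r)
  d = ↧ₙ r

below-mono : ∀ {q r x y} → 0ℚ < q → 0ℚ ≤ x → x ≤ y → Below q r y → Below q r x
below-mono {q} {r} 0<q 0≤x x≤y h = ℚ.≤-trans
  (*-monoʳ-≤ (^-nonneg (neg-part (↥ r)) (ℚ.<⇒≤ 0<q)) (^-mono-≤ (↧ₙ r) 0≤x x≤y)) h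

-- c ≤ q ^ r, cleared of denominators for r = (p - n)/w
record LowerBoundAt (q c r : ℚ) : Set where
  constructor lowerBoundAt
  field
    w p n : ℕ
    1≤w : 1 ℕ.≤ w
    fraction : r * fromℤ (+ w) ≡ fromℤ (+ p) - fromℤ (+ n)
    bound : c ^ w * q ^ n ≤ q ^ p

-- Otherwise `root` plus one grid step would lie under c and hence satisfy `Below`, against the
-- maximality of `root`.
≤-root : ∀ {q c r} m → 1ℚ ≤ q → 0ℚ ≤ c → LowerBoundAt q c r → c ≤ root q r m + (+ 1 ℚ./ suc m)
≤-root {q} {c} {r} m 1≤q 0≤c (lowerBoundAt w p n 1≤w eq h) = ℚ.≮⇒≥ λ lt → root-above q r m 1≤q
  (below-mono {r = r} 0<q (ℚ.+-mono-≤ (root-nonneg q r m) (0≤/ 1 m)) (ℚ.<⇒≤ lt)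
      (below-from-fraction {r = r} w p n 0<q 0≤c 1≤w eq h))
  where
  0<q : 0ℚ < q
  0<q = ℚ.<-≤-trans 0<1 1≤q

≤-power : ∀ q .{{_ : ℚ.Positive q}} s {c D} → 1ℚ ≤ q → 0ℚ ≤ c → 0ℚ ≤ D →
    Eventually (λ m → LowerBoundAt q c (seq s m)) →
  fromℚ (D * c) ≤ᴿ fromℚ D *ᴿ (q ^ᴿ s)
≤-power q s {c} {D} 1≤q 0≤c 0≤D h ε 0<ε = ev-zip step h
    (arch (quot ε (D + 1ℚ) 0<ε 0<D+1) (quot>0 ε (D + 1ℚ) 0<ε 0<D+1))
  where
  0<D+1 : 0ℚ < D + 1ℚ
  0<D+1 = ℚ.+-mono-≤-< 0≤D 0<1
  step : ∀ m → LowerBoundAt q c (seq s m) → + 1 ℚ./ suc m < quot ε (D + 1ℚ) 0<ε 0<D+1 →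
      D * c < D * seq (q ^ᴿ s) m + ε
  step m lb small = begin-strict
    D * c ≤⟨ *-monoˡ-≤ 0≤D (≤-root m 1≤q 0≤c lb) ⟩
    D * (root q (seq s m) m + (+ 1 ℚ./ suc m)) ≡⟨ ℚ.*-distribˡ-+ D (root q (seq s m) m) (+ 1 ℚ./ suc m) ⟩
    D * root q (seq s m) m + D * (+ 1 ℚ./ suc m) <⟨ ℚ.+-monoʳ-< (D * root q (seq s m) m) D/ ⟩
    D * root q (seq s m) m + ε ≡⟨ cong (λ z → D * z + ε) (sym (^ᴿ-seq q 1≤q s m)) ⟩
    D * seq (q ^ᴿ s) m + ε ∎
    where
    open ℚ.≤-Reasoning
    D/ : D * (+ 1 ℚ./ suc m) < ε
    D/ = begin-strict
      D * (+ 1 ℚ./ suc m) ≤⟨ *-monoʳ-≤ (0≤/ 1 m) (subst (_≤ D + 1ℚ) (ℚ.+-identityʳ D) (ℚ.+-monoʳ-≤ D 0≤1)) ⟩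
      (D + 1ℚ) * (+ 1 ℚ./ suc m) <⟨ ℚ.*-monoʳ-<-pos (D + 1ℚ) {{ℚ.positive 0<D+1}} small ⟩
      (D + 1ℚ) * quot ε (D + 1ℚ) 0<ε 0<D+1 ≡⟨ M*quot ε (D + 1ℚ) 0<ε 0<D+1 ⟩
      ε ∎

fromℤ-mono-< : ∀ {m n} → m ℕ.< n → fromℤ (+ m) < fromℤ (+ n)
fromℤ-mono-< {m} m<n = ℚ.<-≤-trans (subst (fromℤ (+ m) <_)
    (sym (trans (cong fromℤ (ℤ.+-comm 1ℤ (+ m)))
    (trans (fromℤ-+ (+ m) 1ℤ) (cong (λ z → fromℤ (+ m) + z) fromℤ-1)))) (<-+ (fromℤ (+ m)) 0<1))
  (fromℤ-mono-≤ (ℤ.+≤+ m<n))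

fromℕ-* : ∀ m n → fromℤ (+ (m ℕ.* n)) ≡ fromℤ (+ m) * fromℤ (+ n)
fromℕ-* m n = trans (cong fromℤ (ℤ.pos-* m n)) (fromℤ-* (+ m) (+ n))

0≤fromℕ : ∀ n → 0ℚ ≤ fromℤ (+ n)
0≤fromℕ n = subst (_≤ fromℤ (+ n)) fromℤ-0 (fromℤ-mono-≤ (ℤ.+≤+ ℕ.z≤n))

-- γ = lim e i / (e i + aᵢ) = log 2ᵉ / log (2ᵉ Λ)
module Exponent {q : ℕ → ℚ} {S : ℕ → ℕ} (law : PowerLaw q S) where
  open PowerLaw law

  i u w : ℕ → ℕ
  -- From 4 on, i ≤ 2 + aᵢ implies i ≤ 2 aᵢ, which keeps the limit γ away from 1.
  i m = 4 ℕ.+ m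
  u m = e ℕ.* i m
  w m = u m ℕ.+ a (i m)

  i≤u : ∀ m → i m ℕ.≤ u m
  i≤u m = subst (ℕ._≤ u m) (ℕ.*-identityˡ (i m)) (ℕ.*-monoˡ-≤ (i m) 1≤e)

  u≤w : ∀ m → u m ℕ.≤ w m
  u≤w m = ℕ.m≤m+n (u m) (a (i m))

  i≤w : ∀ m → i m ℕ.≤ w m
  i≤w m = ℕ.≤-trans (i≤u m) (u≤w m)

  1≤w : ∀ m → 1 ℕ.≤ w m
  1≤w m = ℕ.≤-trans (ℕ.s≤s ℕ.z≤n) (i≤w m)

  w≤ : ∀ m → w m ℕ.≤ (e ℕ.+ K) ℕ.* i m
  w≤ m = subst (w m ℕ.≤_) (sym (ℕ.*-distribʳ-+ (i m) e K)) (ℕ.+-monoʳ-≤ (u m) (a-upper (i m)))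

  i≤a+a : ∀ m → i m ℕ.≤ a (i m) ℕ.+ a (i m)
  i≤a+a m = ℕ.+-cancelˡ-≤ 4 _ _ (begin
    4 ℕ.+ i m ≤⟨ ℕ.+-monoˡ-≤ (i m) (ℕ.m≤m+n 4 m) ⟩
    i m ℕ.+ i m ≤⟨ ℕ.+-mono-≤ (a-lower (i m)) (a-lower (i m)) ⟩
    (2 ℕ.+ a (i m)) ℕ.+ (2 ℕ.+ a (i m)) ≡⟨ ℕS.solve 1
        (λ a → (ℕS.con 2 ℕS.:+ a) ℕS.:+ (ℕS.con 2 ℕS.:+ a) ℕS.:= ℕS.con 4 ℕS.:+ (a ℕS.:+ a))
        refl (a (i m)) ⟩
    4 ℕ.+ (a (i m) ℕ.+ a (i m)) ∎)
    where open ℕ.≤-Reasoning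

  opaque
    g : ℕ → ℚ
    g m = ((+ u m) ℚ./ w m) {{ℕ.>-nonZero (1≤w m)}}

    g*w : ∀ m → g m * fromℤ (+ w m) ≡ fromℤ (+ u m)
    g*w m = /*fromℤ (+ u m) (w m) {{ℕ.>-nonZero (1≤w m)}}

    unit : ℕ → ℚ
    unit m = + 1 ℚ./ suc m

    unit-def : ∀ m → + 1 ℚ./ suc m ≡ unit m
    unit-def m = refl

    unit*suc : ∀ m → unit m * fromℤ (+ suc m) ≡ 1ℚ
    unit*suc m = trans (/*fromℤ (+ 1) (suc m)) fromℤ-1

    0<unit : ∀ m → 0ℚ < unit m
    0<unit m = 0</ 0 m

  0<w : ∀ m → 0ℚ < fromℤ (+ w m)
  0<w m = ℚ.<-≤-trans 0<1 (subst (_≤ fromℤ (+ w m)) fromℤ-1 (fromℤ-mono-≤ (ℤ.+≤+ (1≤w m))))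

  -- After clearing denominators, `a-compare` leaves an excess of 2 `u n`. Divided by `w m * w n`
  -- this is at most 2 / `w m`, because u ≤ w, and `w m` ≥ m + 1.
  g-close : ∀ m n → g m ≤ g n + (unit m + unit m)
  g-close m n = ℚ.≮⇒≥ λ lt → ℚ.<-irrefl refl (begin-strict
    (g n + (c + c)) * (x * y) <⟨ ℚ.*-monoˡ-<-pos (x * y) {{ℚ.positive (*-pos (0<w m) (0<w n))}} lt ⟩
    g m * (x * y) ≡⟨ trans (sym (ℚ.*-assoc (g m) x y)) (cong (_* y) (g*w m)) ⟩
    fromℤ (+ u m) * y ≡⟨ sym (fromℕ-* (u m) (w n)) ⟩
    fromℤ (+ (u m ℕ.* w n)) ≤⟨ fromℤ-mono-≤ (ℤ.+≤+ cross) ⟩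
    fromℤ (+ (u n ℕ.* w m ℕ.+ (u n ℕ.+ u n))) ≡⟨ trans (fromℤ-+ (+ (u n ℕ.* w m)) (+ (u n ℕ.+ u n)))
        (cong₂ _+_ (fromℕ-* (u n) (w m)) (fromℤ-+ (+ u n) (+ u n))) ⟩
    fromℤ (+ u n) * x + (fromℤ (+ u n) + fromℤ (+ u n)) ≤⟨ ℚ.+-monoʳ-≤ (fromℤ (+ u n) * x)
        (ℚ.+-mono-≤ u≤cxy u≤cxy) ⟩
    fromℤ (+ u n) * x + (c * x * y + c * x * y) ≡⟨ cong (λ z → z * x + (c * x * y + c * x * y))
        (sym (g*w n)) ⟩
    g n * y * x + (c * x * y + c * x * y) ≡⟨ ℚS.solve 4
        (λ g c x y → g ⊗ y ⊗ x ⊞ (c ⊗ x ⊗ y ⊞ c ⊗ x ⊗ y) ⊜ (g ⊞ (c ⊞ c)) ⊗ (x ⊗ y)) refl (g n) c x y ⟩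
    (g n + (c + c)) * (x * y) ∎)
    where
    open ℚ.≤-Reasoning
    c x y : ℚ
    c = unit m
    x = fromℤ (+ w m)
    y = fromℤ (+ w n)
    1≤cx : 1ℚ ≤ c * x
    1≤cx = subst (_≤ c * x) (unit*suc m) (*-monoˡ-≤ (ℚ.<⇒≤ (0<unit m))
        (fromℤ-mono-≤ (ℤ.+≤+ (ℕ.≤-trans (ℕ.s≤s (ℕ.m≤n+m m 3)) (i≤w m)))))
    u≤cxy : fromℤ (+ u n) ≤ c * x * y
    u≤cxy = ℚ.≤-trans (fromℤ-mono-≤ (ℤ.+≤+ (u≤w n)))
        (subst (_≤ c * x * y) (ℚ.*-identityˡ y) (*-monoʳ-≤ (ℚ.<⇒≤ (0<w n)) 1≤cx))
    cross : u m ℕ.* w n ℕ.≤ u n ℕ.* w m ℕ.+ (u n ℕ.+ u n)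
    cross = subst₂ ℕ._≤_
      (ℕS.solve 4 (λ e i j b → e ℕS.:* i ℕS.:* (e ℕS.:* j) ℕS.:+ e ℕS.:* (b ℕS.:* i) ℕS.:= e ℕS.:* i ℕS.:*
          (e ℕS.:* j ℕS.:+ b)) refl e (i m) (i n) (a (i n)))
      (ℕS.solve 4 (λ e i j b → e ℕS.:* i ℕS.:* (e ℕS.:* j) ℕS.:+ e ℕS.:* ((ℕS.con 2 ℕS.:+ b) ℕS.:* j) ℕS.:=
          e ℕS.:* j ℕS.:* (e ℕS.:* i ℕS.:+ b) ℕS.:+ (e ℕS.:* j ℕS.:+ e ℕS.:* j)) refl e (i m) (i n)
          (a (i m)))
      (ℕ.+-monoʳ-≤ (e ℕ.* i m ℕ.* (e ℕ.* i n)) (ℕ.*-monoʳ-≤ e (a-compare (i n) (i m))))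

  g-cauchy : IsCauchy g
  g-cauchy ε 0<ε = go (arch (½ * ε) (0≤½ε 0<ε))
    where
    go : (∃[ N ] ∀ n → N ℕ.≤ n → + 1 ℚ./ suc n < ½ * ε) → ∃[ N ] ∀ m n → N ℕ.≤ m →
        N ℕ.≤ n → ∣ g m - g n ∣ < ε
    go (N , small) = N , λ m n N≤m N≤n → <⇒∣∣< (side m n N≤m) (side n m N≤n)
      where
      side : ∀ m n → N ℕ.≤ m → g m < g n + ε
      side m n N≤m = ℚ.≤-<-trans (g-close m n)
          (ℚ.+-monoʳ-< (g n) (subst (unit m + unit m <_) (half+half ε) (ℚ.+-mono-< lt lt)))
        where
        lt : unit m < ½ * ε
        lt = subst (_< ½ * ε) (unit-def m) (small m N≤m)

  cancel-w : ∀ m {x y} → x * fromℤ (+ w m) < y * fromℤ (+ w m) → x < y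
  cancel-w m {x} {y} h = *-cancelˡ-< (ℚ.<⇒≤ (0<w m))
      (subst₂ _<_ (ℚ.*-comm x (fromℤ (+ w m))) (ℚ.*-comm y (fromℤ (+ w m))) h)

  unit*w< : ∀ L m x → w m ℕ.< suc L ℕ.* x → unit L * fromℤ (+ w m) < fromℤ (+ x)
  unit*w< L m x lt = *-cancelˡ-< (0≤fromℕ (suc L)) (subst₂ _<_
    (trans (sym (ℚ.*-identityˡ _)) (trans (cong (_* fromℤ (+ w m))
        (sym (trans (ℚ.*-comm (fromℤ (+ suc L)) (unit L)) (unit*suc L))))
        (ℚ.*-assoc (fromℤ (+ suc L)) (unit L) (fromℤ (+ w m)))))
    (fromℕ-* (suc L) x) (fromℤ-mono-< lt))

  -- Strict order on ℝ needs a uniform gap. From w ≤ (e + K) i and i ≤ u one gets u/w ≥ 1/(e + K),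
  -- strictly more than 1/(e + K + 1).
  0<g : 0ℚ < unit (e ℕ.+ K) × (∀ m → 0ℚ + unit (e ℕ.+ K) < g m)
  0<g = 0<unit (e ℕ.+ K) , λ m → subst (_< g m) (sym (ℚ.+-identityˡ (unit (e ℕ.+ K))))
      (cancel-w m {unit (e ℕ.+ K)} {g m} (subst (unit (e ℕ.+ K) * fromℤ (+ w m) <_) (sym (g*w m))
    (unit*w< (e ℕ.+ K) m (u m) (ℕ.≤-<-trans (w≤ m)
        (ℕ.≤-<-trans (ℕ.*-monoʳ-≤ (e ℕ.+ K) (i≤u m)) (ℕ.m<n+m _ (ℕ.≤-trans (ℕ.s≤s ℕ.z≤n) (i≤u m))))))))

  -- Here 1 - g = a/w, and w ≤ (e + K) i ≤ 2 (e + K) a bounds it from below.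
  g<1 : 0ℚ < unit ((e ℕ.+ K) ℕ.* 2) × (∀ m → g m + unit ((e ℕ.+ K) ℕ.* 2) < 1ℚ)
  g<1 = 0<unit L , λ m → cancel-w m {g m + unit L} {1ℚ} (begin-strict
      (g m + unit L) * fromℤ (+ w m) ≡⟨ ℚ.*-distribʳ-+ (fromℤ (+ w m)) (g m) (unit L) ⟩
      g m * fromℤ (+ w m) + unit L * fromℤ (+ w m) ≡⟨ cong (_+ unit L * fromℤ (+ w m)) (g*w m) ⟩
      fromℤ (+ u m) + unit L * fromℤ (+ w m) <⟨ ℚ.+-monoʳ-< (fromℤ (+ u m))
          (unit*w< L m (a (i m)) (w<  m)) ⟩
      fromℤ (+ u m) + fromℤ (+ a (i m)) ≡⟨ sym (fromℤ-+ (+ u m) (+ a (i m))) ⟩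
      fromℤ (+ w m) ≡⟨ sym (ℚ.*-identityˡ _) ⟩
      1ℚ * fromℤ (+ w m) ∎)
    where
    open ℚ.≤-Reasoning
    L : ℕ
    L = (e ℕ.+ K) ℕ.* 2
    1≤a : ∀ m → 1 ℕ.≤ a (i m)
    1≤a m = ℕ.+-cancelˡ-≤ 2 _ _ (ℕ.≤-trans (ℕ.s≤s (ℕ.s≤s (ℕ.s≤s ℕ.z≤n))) (a-lower (i m)))
    w< : ∀ m → w m ℕ.< suc L ℕ.* a (i m)
    w< m = ℕ.≤-<-trans (w≤ m) (ℕ.≤-<-trans (ℕ.≤-trans (ℕ.*-monoʳ-≤ (e ℕ.+ K) (i≤a+a m))
        (ℕ.≤-reflexive (ℕS.solve 2 (λ c a → c ℕS.:* (a ℕS.:+ a) ℕS.:= c ℕS.:* ℕS.con 2 ℕS.:* a)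
        refl (e ℕ.+ K) (a (i m)))))
      (ℕ.m<n+m _ (1≤a m)))

  module _ (γ : ℝ) (γ-seq : ∀ m → seq γ m ≡ g m) where
    0<γ : 0ᴿ <ᴿ γ
    0<γ = unit (e ℕ.+ K) , proj₁ 0<g , 0 , λ m _ → subst (0ℚ + unit (e ℕ.+ K) <_) (sym (γ-seq m))
        (proj₂ 0<g m)

    γ<1 : γ <ᴿ 1ᴿ
    γ<1 = unit ((e ℕ.+ K) ℕ.* 2) , proj₁ g<1 , 0 , λ m _ → subst (λ z → z + unit ((e ℕ.+ K) ℕ.* 2) < 1ℚ)
        (sym (γ-seq m)) (proj₂ g<1 m)

  -- j is the exponent of the power of 2 by which q′ₙ / qₙ exceeds 2^Sₙ
  module Compare (j n : ℕ) where
    B s : ℚ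
    B = 2ℚ ^ (j ℕ.+ S n) * ∣ q n ∣
    s = 2ℚ ^ S n

    0≤s : 0ℚ ≤ s
    0≤s = ℚ.<⇒≤ (0<2^ (S n))

    C₁ : ℚ
    C₁ = 2ℚ ^ j * (C * C) * 2ℚ

    0≤C : 0ℚ ≤ C
    0≤C = ℚ.≤-trans 0≤1 1≤C

    ∣∣-^ : ∀ x m → ∣ x ^ m ∣ ≡ ∣ x ∣ ^ m
    ∣∣-^ x zero = refl
    ∣∣-^ x (suc m) = trans (ℚ.∣p*q∣≡∣p∣*∣q∣ x (x ^ m)) (cong (∣ x ∣ *_) (∣∣-^ x m))

    q^u : ∀ m → ∣ q n ^ i m ∣ ^ e ≡ ∣ q n ∣ ^ u m
    q^u m = trans (cong (_^ e) (∣∣-^ (q n) (i m)))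
        (trans (^-assocʳ ∣ q n ∣ (i m) e) (cong (∣ q n ∣ ^_) (ℕ.*-comm (i m) e)))

    -- Heuristically B is of order (2ᵉ Λ)ᵏ and s of order 2^(ek), so B^γ is at most a constant times
    -- s. The e-th power of `q-upper` yields 2^(eka), which `S-lower` turns into s^a. The surplus
    -- 2^(2ke), caused by the slack 2 in 2 + aᵢ, is at most 2^w once m ≥ 2k; hence the condition on
    -- m.
    upper : ∀ m → index n ℕ.+ index n ℕ.≤ m → B ^ u m ≤ (C₁ * s) ^ w m
    upper m 2k≤m = begin
      B ^ u m ≡⟨ trans (^-distrib-* (2ℚ ^ (j ℕ.+ S n)) ∣ q n ∣ (u m))
          (cong₂ _*_ (trans (cong (_^ u m) (^-homo-* 2ℚ j (S n))) (^-distrib-* (2ℚ ^ j) s (u m)))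
          (sym (q^u m))) ⟩
      (2ℚ ^ j) ^ u m * s ^ u m * ∣ q n ^ i m ∣ ^ e ≤⟨ *-monoˡ-≤ 0≤JS
          (^-mono-≤ e (ℚ.0≤∣p∣ (q n ^ i m)) (q-upper n (i m))) ⟩
      (2ℚ ^ j) ^ u m * s ^ u m * (C ^ i m * 2ℚ ^ ((2 ℕ.+ a′) ℕ.* k)) ^ e ≡⟨ cong
          ((2ℚ ^ j) ^ u m * s ^ u m *_) powers ⟩
      (2ℚ ^ j) ^ u m * s ^ u m * (C ^ u m * (2ℚ ^ (2 ℕ.* k ℕ.* e) * (2ℚ ^ (e ℕ.* k)) ^ a′)) ≤⟨ *-mono-≤ 0≤JS
          (*-nonneg (nonneg C (u m) 0≤C) (*-nonneg 0≤2ke (nonneg _ a′ 0≤2ek)))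
          (*-mono-≤ (nonneg _ (u m) 0≤J) (nonneg s (u m) 0≤s)
              (^-monoʳ-≤ {2ℚ ^ j} {u m} {w m} (1≤^ j 1≤2ℚ) (u≤w m)) ℚ.≤-refl)
          (*-mono-≤ (nonneg C (u m) 0≤C) (*-nonneg 0≤2ke (nonneg _ a′ 0≤2ek))
              (^-monoʳ-≤ {C} {u m} {w m} 1≤C (u≤w m))
            (*-mono-≤ 0≤2ke (nonneg _ a′ 0≤2ek) (^-monoʳ-≤ {2ℚ} {2 ℕ.* k ℕ.* e} {w m} 1≤2ℚ 2ke≤w)
              (ℚ.≤-trans (^-mono-≤ a′ 0≤2ek (S-lower n)) (ℚ.≤-trans (ℚ.≤-reflexive (^-distrib-* C s a′))
                (*-monoʳ-≤ (nonneg s a′ 0≤s) (^-monoʳ-≤ {C} {a′} {w m} 1≤C (ℕ.m≤n+m a′ (u m)))))))) ⟩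
      (2ℚ ^ j) ^ w m * s ^ u m * (C ^ w m * (2ℚ ^ w m * (C ^ w m * s ^ a′))) ≡⟨ ℚS.solve 5
          (λ J su c t sa → J ⊗ su ⊗ (c ⊗ (t ⊗ (c ⊗ sa))) ⊜ (J ⊗ (c ⊗ c) ⊗ t) ⊗ (su ⊗ sa))
          refl ((2ℚ ^ j) ^ w m) (s ^ u m) (C ^ w m) (2ℚ ^ w m) (s ^ a′) ⟩
      ((2ℚ ^ j) ^ w m * (C ^ w m * C ^ w m) * 2ℚ ^ w m) * (s ^ u m * s ^ a′) ≡⟨ cong₂ _*_
          (sym (trans (^-distrib-* (2ℚ ^ j * (C * C)) 2ℚ (w m))
              (cong (_* 2ℚ ^ w m) (trans (^-distrib-* (2ℚ ^ j) (C * C) (w m))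
              (cong ((2ℚ ^ j) ^ w m *_) (^-distrib-* C C (w m)))))))
          (sym (^-homo-* s (u m) a′)) ⟩
      C₁ ^ w m * s ^ w m ≡⟨ sym (^-distrib-* C₁ s (w m)) ⟩
      (C₁ * s) ^ w m ∎
      where
      open ℚ.≤-Reasoning
      k a′ : ℕ
      k = index n
      a′ = a (i m)
      nonneg : ∀ x m → 0ℚ ≤ x → 0ℚ ≤ x ^ m
      nonneg x m = ^-nonneg m
      0≤J : 0ℚ ≤ 2ℚ ^ j
      0≤J = ℚ.<⇒≤ (0<2^ j)
      0≤2ek : 0ℚ ≤ 2ℚ ^ (e ℕ.* k)
      0≤2ek = ℚ.<⇒≤ (0<2^ (e ℕ.* k))
      0≤2ke : 0ℚ ≤ 2ℚ ^ (2 ℕ.* k ℕ.* e)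
      0≤2ke = ℚ.<⇒≤ (0<2^ (2 ℕ.* k ℕ.* e))
      0≤JS : 0ℚ ≤ (2ℚ ^ j) ^ u m * s ^ u m
      0≤JS = *-nonneg (nonneg _ (u m) 0≤J) (nonneg s (u m) 0≤s)
      2ke≤w : 2 ℕ.* k ℕ.* e ℕ.≤ w m
      2ke≤w = ℕ.≤-trans (ℕ.≤-trans (ℕ.≤-reflexive (ℕ.*-comm (2 ℕ.* k) e))
          (ℕ.*-monoʳ-≤ e (ℕ.≤-trans (ℕ.≤-reflexive (cong (k ℕ.+_) (ℕ.+-identityʳ k)))
          (ℕ.≤-trans 2k≤m (ℕ.m≤n+m m 4))))) (u≤w m)
      powers : (C ^ i m * 2ℚ ^ ((2 ℕ.+ a′) ℕ.* k)) ^ e ≡ C ^ u m *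
          (2ℚ ^ (2 ℕ.* k ℕ.* e) * (2ℚ ^ (e ℕ.* k)) ^ a′)
      powers = trans (^-distrib-* (C ^ i m) (2ℚ ^ ((2 ℕ.+ a′) ℕ.* k)) e)
          (cong₂ _*_ (trans (^-assocʳ C (i m) e) (cong (C ^_) (ℕ.*-comm (i m) e)))
        (trans (^-assocʳ 2ℚ ((2 ℕ.+ a′) ℕ.* k) e)
            (trans (cong (2ℚ ^_) (ℕS.solve 3 (λ a k e → (ℕS.con 2 ℕS.:+ a) ℕS.:* k ℕS.:* e ℕS.:= ℕS.con 2
            ℕS.:* k ℕS.:* e ℕS.:+ e ℕS.:* k ℕS.:* a) refl a′ k e))
          (trans (^-homo-* 2ℚ (2 ℕ.* k ℕ.* e) (e ℕ.* k ℕ.* a′))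
              (cong (2ℚ ^ (2 ℕ.* k ℕ.* e) *_) (sym (^-assocʳ 2ℚ (e ℕ.* k) a′)))))))

    -- `S-upper` replaces s^a by 2^(eka), the e-th power of the quantity 2^(ak) bounded in
    -- `q-lower`. That estimate carries no slack, so every m is allowed.
    lower : ∀ m → s ^ w m ≤ C ^ w m * B ^ u m
    lower m = begin
      s ^ w m ≡⟨ ^-homo-* s (u m) a′ ⟩
      s ^ u m * s ^ a′ ≤⟨ *-monoˡ-≤ 0≤su (begin
          s ^ a′ ≤⟨ ^-mono-≤ a′ 0≤s (S-upper n) ⟩
          (C * 2ℚ ^ (e ℕ.* k)) ^ a′ ≡⟨ trans (^-distrib-* C (2ℚ ^ (e ℕ.* k)) a′) (cong (C ^ a′ *_) powers) ⟩
          C ^ a′ * (2ℚ ^ (a′ ℕ.* k)) ^ e ≤⟨ *-monoˡ-≤ (^-nonneg a′ 0≤C)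
              (^-mono-≤ e (ℚ.<⇒≤ (0<2^ (a′ ℕ.* k))) (q-lower n (i m))) ⟩
          C ^ a′ * (C ^ i m * ∣ q n ^ i m ∣) ^ e ≡⟨ cong (C ^ a′ *_)
              (trans (^-distrib-* (C ^ i m) ∣ q n ^ i m ∣ e)
              (cong₂ _*_ (trans (^-assocʳ C (i m) e) (cong (C ^_) (ℕ.*-comm (i m) e))) (q^u m))) ⟩
          C ^ a′ * (C ^ u m * ∣ q n ∣ ^ u m) ≡⟨ trans
              (ℚS.solve 3 (λ x y z → x ⊗ (y ⊗ z) ⊜ y ⊗ x ⊗ z) refl (C ^ a′) (C ^ u m) (∣ q n ∣ ^ u m))
              (cong (_* ∣ q n ∣ ^ u m) (sym (^-homo-* C (u m) a′))) ⟩
          C ^ w m * ∣ q n ∣ ^ u m ∎) ⟩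
      s ^ u m * (C ^ w m * ∣ q n ∣ ^ u m) ≡⟨ trans
          (ℚS.solve 3 (λ s c q → s ⊗ (c ⊗ q) ⊜ c ⊗ (s ⊗ q)) refl (s ^ u m) (C ^ w m) (∣ q n ∣ ^ u m))
          (cong (C ^ w m *_) (sym (^-distrib-* s ∣ q n ∣ (u m)))) ⟩
      C ^ w m * (s * ∣ q n ∣) ^ u m ≤⟨ *-monoˡ-≤ (^-nonneg (w m) 0≤C)
          (^-mono-≤ (u m) (*-nonneg 0≤s (ℚ.0≤∣p∣ (q n)))
          (*-monoʳ-≤ (ℚ.0≤∣p∣ (q n)) (^-monoʳ-≤ {2ℚ} {S n} {j ℕ.+ S n} 1≤2ℚ (ℕ.m≤n+m (S n) j)))) ⟩
      C ^ w m * B ^ u m ∎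
      where
      open ℚ.≤-Reasoning
      k a′ : ℕ
      k = index n
      a′ = a (i m)
      0≤su : 0ℚ ≤ s ^ u m
      0≤su = ^-nonneg (u m) 0≤s
      powers : (2ℚ ^ (e ℕ.* k)) ^ a′ ≡ (2ℚ ^ (a′ ℕ.* k)) ^ e
      powers = trans (^-assocʳ 2ℚ (e ℕ.* k) a′)
          (trans (cong (2ℚ ^_) (ℕS.solve 3 (λ e k a → e ℕS.:* k ℕS.:* a ℕS.:= a ℕS.:* k ℕS.:* e) refl e k
          a′)) (sym (^-assocʳ 2ℚ (a′ ℕ.* k) e)))

≤ᴿ-trans : ∀ {x y z} → x ≤ᴿ y → y ≤ᴿ z → x ≤ᴿ z
≤ᴿ-trans {x} {y} {z} h k ε 0<ε = ev-zip (λ n p q → subst (seq x n <_) (+½+½ (seq z n) ε)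
    (ℚ.<-trans p (ℚ.+-monoˡ-< (½ * ε) q)))
  (h (½ * ε) (0≤½ε 0<ε)) (k (½ * ε) (0≤½ε 0<ε))

0<ᴿfromℚ : ∀ {r} → 0ℚ < r → 0ᴿ <ᴿ fromℚ r
0<ᴿfromℚ {r} 0<r = ½ * r , 0≤½ε 0<r , 0 , λ _ _ → subst₂ _<_ (sym (ℚ.+-identityˡ (½ * r))) (half+half r)
    (<-+ (½ * r) (0≤½ε 0<r))

^-one : ∀ n → 1ℚ ^ n ≡ 1ℚ
^-one zero = refl
^-one (suc n) = trans (ℚ.*-identityˡ _) (^-one n)

0<∣∣ : ∀ {x} → x ≢ 0ℚ → 0ℚ < ∣ x ∣
0<∣∣ {x} x≢0 = ℚ.≰⇒> λ h → x≢0 (ℚ.∣p∣≡0⇒p≡0 x (ℚ.≤-antisym h (ℚ.0≤∣p∣ x)))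

1≤∣fromℤ∣ : ∀ i → i ≢ 0ℤ → 1ℚ ≤ ∣ fromℤ i ∣
1≤∣fromℤ∣ (+ zero) i≢0 = ⊥-elim (i≢0 refl)
1≤∣fromℤ∣ (+ suc n) _ = ℚ.≤-trans (1≤fromℤ-suc n) (p≤∣p∣ (fromℤ (+ suc n)))
1≤∣fromℤ∣ -[1+ n ] _ = ℚ.≤-trans (1≤fromℤ-suc n)
    (ℚ.≤-trans (ℚ.≤-reflexive (fromℤ-neg -[1+ n ]))
    (ℚ.≤-trans (p≤∣p∣ (- fromℤ -[1+ n ])) (ℚ.≤-reflexive (ℚ.∣-p∣≡∣p∣ (fromℤ -[1+ n ])))))

∣∣-square : ∀ x → ∣ x ∣ * ∣ x ∣ ≡ x * x
∣∣-square x = trans (sym (ℚ.∣p*q∣≡∣p∣*∣q∣ x x)) (ℚ.0≤p⇒∣p∣≡p (square-nonneg x))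

-- a data type rather than a synonym, so that the power is not unfolded when such types are compared
data PowerBound (q : ℚ) .{{q>0 : ℚ.Positive q}} (s : ℝ) (D v : ℚ) : Set where
  powerBound : fromℚ v ≤ᴿ fromℚ D *ᴿ (q ^ᴿ s) → PowerBound q s D v

powerBound-intro : ∀ q .{{_ : ℚ.Positive q}} s {c D v} → D * c ≡ v → 1ℚ ≤ q → 0ℚ ≤ c → 0ℚ ≤ D →
  Eventually (λ m → LowerBoundAt q c (seq s m)) → PowerBound q s D v
powerBound-intro q s {c} {D} refl 1≤q 0≤c 0≤D h = powerBound (≤-power q s {c} {D} 1≤q 0≤c 0≤D h)

≤-quotient : ∀ x q .{{_ : NonZero q}} s D v → x ≤ᴿ fromℚ v → PowerBound ∣ q ∣ {{∣∣-positive q}} (-ᴿ s) D v →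
    x ≤ᴿ fromℚ D /∣ q ∣^ s
≤-quotient x q s D v x≤v (powerBound h) = ≤ᴿ-trans {x} {fromℚ v} {fromℚ D /∣ q ∣^ s} x≤v h

2-adic-exponent : ∀ (x : ℝ) (f : ℕ → ℚ) → (∀ m → seq x m ≡ f m) → ∀ m → seq (-ᴿ (2ᴿ *ᴿ x)) m ≡ - (2ℚ * f m)
2-adic-exponent x f h m = cong (λ z → - (2ℚ * z)) (h m)

real-exponent : ∀ (x : ℝ) (f : ℕ → ℚ) → (∀ m → seq x m ≡ f m) → ∀ m → seq (-ᴿ (2ᴿ -ᴿ 2ᴿ *ᴿ x)) m ≡ -
    (2ℚ - 2ℚ * f m)
real-exponent x f h m = cong (λ z → - (2ℚ - 2ℚ * z)) (h m)

module PowerBounds {q : ℕ → ℚ} {S : ℕ → ℕ} (law : PowerLaw q S) (j : ℕ) where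
  open PowerLaw law using (C; 1≤C; index)
  open Exponent law

  opaque
    -- Squares, because the errors to be matched are 2/qₙ² and 4^(-Sₙ): `D₂` is the square of the
    -- constant in `upper`, and `D₁` is 2 (2^j C)² with the C of `lower`.
    D₁ D₂ : ℚ
    D₁ = 2ℚ * ((2ℚ ^ j * C) * (2ℚ ^ j * C))
    D₂ = (2ℚ ^ j * (C * C) * 2ℚ) * (2ℚ ^ j * (C * C) * 2ℚ)

    D₁≡ : D₁ ≡ 2ℚ * ((2ℚ ^ j * C) * (2ℚ ^ j * C))
    D₁≡ = refl

    D₂≡ : D₂ ≡ (2ℚ ^ j * (C * C) * 2ℚ) * (2ℚ ^ j * (C * C) * 2ℚ)
    D₂≡ = refl

  0<C : 0ℚ < C
  0<C = ℚ.<-≤-trans 0<1 1≤C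

  0<D₁ : 0ℚ < D₁
  0<D₁ = subst (0ℚ <_) (sym D₁≡) (*-pos (0<2^ 1) (*-pos 0<JC 0<JC))
    where
    0<JC : 0ℚ < 2ℚ ^ j * C
    0<JC = *-pos (0<2^ j) 0<C

  0<C₁ : 0ℚ < 2ℚ ^ j * (C * C) * 2ℚ
  0<C₁ = *-pos (*-pos (0<2^ j) (*-pos 0<C 0<C)) (0<2^ 1)

  0<D₂ : 0ℚ < D₂
  0<D₂ = subst (0ℚ <_) (sym D₂≡) (*-pos 0<C₁ 0<C₁)

  module _ (n : ℕ) (q≢0 : q n ≢ 0ℚ) (b : ℚ) .{{b-positive : ℚ.Positive b}}
      (b≡ : b ≡ 2ℚ ^ (j ℕ.+ S n) * ∣ q n ∣) (1≤b : 1ℚ ≤ b) where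
    open Compare j n

    private
      double-fraction : ∀ m → 2ℚ * g m * fromℤ (+ w m) ≡ fromℤ (+ (u m ℕ.+ u m))
      double-fraction m = trans (ℚ.*-assoc 2ℚ (g m) (fromℤ (+ w m))) (trans (cong (2ℚ *_) (g*w m))
        (trans (ℚS.solve 1 (λ x → ℚS.con 2ℚ ⊗ x ⊜ x ⊞ x) refl (fromℤ (+ u m)))
            (sym (fromℤ-+ (+ u m) (+ u m)))))

      ^-square : ∀ x m → (x * x) ^ m ≡ x ^ m * x ^ m
      ^-square x m = ^-distrib-* x x m

      ^-double : ∀ x m → x ^ (m ℕ.+ m) ≡ x ^ m * x ^ m
      ^-double x m = ^-homo-* x m m

      0<B : 0ℚ < B
      0<B = *-pos (0<2^ (j ℕ.+ S n)) (0<∣∣ q≢0)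

      0<s : 0ℚ < s
      0<s = 0<2^ (S n)

      inverse-of : ∀ {r} → 0ℚ < r → ∃[ x ] 0ℚ ≤ x × x * r ≡ 1ℚ
      inverse-of {r} 0<r = (ℚ.1/ r) {{ℚ.>-nonZero 0<r}} ,
          ℚ.<⇒≤ (ℚ.positive⁻¹ _ {{ℚ.1/pos⇒pos r {{ℚ.positive 0<r}}}}) , ℚ.*-inverseˡ r {{ℚ.>-nonZero 0<r}}

    -- For x = 1/(C₁ s), `upper` says x^w B^u ≤ 1, that is x ≤ B^(-u/w). The square of this has the
    -- exponent -2u/w, and C₁² x² is exactly 4^(-Sₙ).
    2-adic-bound : ∀ s′ → (∀ m → seq s′ m ≡ - (2ℚ * g m)) → PowerBound b s′ D₂ (½ ^ (S n ℕ.+ S n))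
    2-adic-bound s′ s′≡ = go (inverse-of (*-pos 0<C₁ 0<s))
      where
      go : ∃[ x ] 0ℚ ≤ x × x * (C₁ * s) ≡ 1ℚ → PowerBound b s′ D₂ (½ ^ (S n ℕ.+ S n))
      go (x , 0≤x , inv) = powerBound-intro b s′ value 1≤b (*-nonneg 0≤x 0≤x) (ℚ.<⇒≤ 0<D₂)
          (index n ℕ.+ index n , at)
        where
        at : ∀ m → index n ℕ.+ index n ℕ.≤ m → LowerBoundAt b (x * x) (seq s′ m)
        open ℚ.≤-Reasoning
        C₁x : C₁ * x ≡ ½ ^ S n
        C₁x = *-cancelˡ 0<s (begin-equality
          s * (C₁ * x) ≡⟨ ℚS.solve 3 (λ s c x → s ⊗ (c ⊗ x) ⊜ x ⊗ (c ⊗ s)) refl s C₁ x ⟩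
          x * (C₁ * s) ≡⟨ inv ⟩
          1ℚ ≡⟨ sym (2^*½^ (S n)) ⟩
          s * ½ ^ S n ∎)
        value : D₂ * (x * x) ≡ ½ ^ (S n ℕ.+ S n)
        value = trans (cong (_* (x * x)) D₂≡)
            (trans (ℚS.solve 2 (λ c x → (c ⊗ c) ⊗ (x ⊗ x) ⊜ (c ⊗ x) ⊗ (c ⊗ x)) refl C₁ x)
          (trans (cong₂ _*_ C₁x C₁x) (sym (^-double ½ (S n)))))
        fraction : ∀ m → - (2ℚ * g m) * fromℤ (+ w m) ≡ fromℤ (+ 0) - fromℤ (+ (u m ℕ.+ u m))
        fraction m = trans (sym (ℚ.neg-distribˡ-* (2ℚ * g m) (fromℤ (+ w m))))
            (trans (cong -_ (double-fraction m))
          (trans (sym (ℚ.+-identityˡ _)) (cong (_- fromℤ (+ (u m ℕ.+ u m))) (sym fromℤ-0))))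
        half : ∀ m → index n ℕ.+ index n ℕ.≤ m → x ^ w m * B ^ u m ≤ 1ℚ
        half m le = begin
          x ^ w m * B ^ u m ≤⟨ *-monoˡ-≤ (^-nonneg (w m) 0≤x) (upper m le) ⟩
          x ^ w m * (C₁ * s) ^ w m ≡⟨ sym (^-distrib-* x (C₁ * s) (w m)) ⟩
          (x * (C₁ * s)) ^ w m ≡⟨ trans (cong (_^ w m) inv) (^-one (w m)) ⟩
          1ℚ ∎
        bound : ∀ m → index n ℕ.+ index n ℕ.≤ m → (x * x) ^ w m * B ^ (u m ℕ.+ u m) ≤ B ^ 0
        at m le = subst₂ (λ z r → LowerBoundAt z (x * x) r) (sym b≡) (sym (s′≡ m))
            (lowerBoundAt (w m) 0 (u m ℕ.+ u m) (1≤w m) (fraction m) (bound m le))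
        bound m le = begin
          (x * x) ^ w m * B ^ (u m ℕ.+ u m) ≡⟨ cong₂ _*_ (^-square x (w m)) (^-double B (u m)) ⟩
          x ^ w m * x ^ w m * (B ^ u m * B ^ u m) ≡⟨ ℚS.solve 2
              (λ x y → x ⊗ x ⊗ (y ⊗ y) ⊜ (x ⊗ y) ⊗ (x ⊗ y)) refl (x ^ w m) (B ^ u m) ⟩
          x ^ w m * B ^ u m * (x ^ w m * B ^ u m) ≤⟨ *-mono-≤ 0≤xB 0≤xB (half m le) (half m le) ⟩
          1ℚ * 1ℚ ≡⟨ ℚ.*-identityˡ 1ℚ ⟩
          1ℚ ∎
          where
          0≤xB : 0ℚ ≤ x ^ w m * B ^ u m
          0≤xB = *-nonneg (^-nonneg (w m) 0≤x) (^-nonneg (u m) (ℚ.<⇒≤ 0<B))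

    -- For x = s/(C B), `lower` says x^w B^w ≤ B^u, that is x ≤ B^(u/w - 1). Since B = 2^j s ∣q∣,
    -- the product 2^j C x equals 1/∣q∣, so squaring gives the claim.
    real-bound : ∀ s′ → (∀ m → seq s′ m ≡ - (2ℚ - 2ℚ * g m)) → ∀ {z} → q n * z ≡ 1ℚ →
        PowerBound b s′ D₁ (2ℚ * (z * z))
    real-bound s′ s′≡ {z} qz = go (inverse-of (*-pos 0<C 0<B))
      where
      go : ∃[ y ] 0ℚ ≤ y × y * (C * B) ≡ 1ℚ → PowerBound b s′ D₁ (2ℚ * (z * z))
      go (y , 0≤y , inv) = powerBound-intro b s′ {x * x} {D₁} value 1≤b (*-nonneg 0≤x 0≤x) (ℚ.<⇒≤ 0<D₁)
          (0 , λ m _ → at m)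
        where
        open ℚ.≤-Reasoning
        x : ℚ
        x = s * y
        0≤x : 0ℚ ≤ x
        0≤x = *-nonneg 0≤s 0≤y
        root≡ : 2ℚ ^ j * C * x ≡ ∣ z ∣
        root≡ = *-cancelˡ (0<∣∣ q≢0) (begin-equality
          ∣ q n ∣ * (2ℚ ^ j * C * (s * y)) ≡⟨ ℚS.solve 5
              (λ q j c s y → q ⊗ (j ⊗ c ⊗ (s ⊗ y)) ⊜ y ⊗ (c ⊗ (j ⊗ s ⊗ q))) refl ∣ q n ∣ (2ℚ ^ j) C s y ⟩
          y * (C * (2ℚ ^ j * s * ∣ q n ∣)) ≡⟨ cong (λ t → y * (C * (t * ∣ q n ∣)))
              (sym (^-homo-* 2ℚ j (S n))) ⟩
          y * (C * B) ≡⟨ inv ⟩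
          ∣ 1ℚ ∣ ≡⟨ cong ∣_∣ (sym qz) ⟩
          ∣ q n * z ∣ ≡⟨ ℚ.∣p*q∣≡∣p∣*∣q∣ (q n) z ⟩
          ∣ q n ∣ * ∣ z ∣ ∎)
        value : D₁ * (x * x) ≡ 2ℚ * (z * z)
        value = trans (cong (_* (x * x)) D₁≡)
            (trans (ℚS.solve 3 (λ t c x → t ⊗ (c ⊗ c) ⊗ (x ⊗ x) ⊜ t ⊗ ((c ⊗ x) ⊗ (c ⊗ x))) refl 2ℚ
            (2ℚ ^ j * C) x)
          (cong (2ℚ *_) (trans (cong₂ _*_ root≡ root≡) (∣∣-square z))))
        fraction : ∀ m → - (2ℚ - 2ℚ * g m) * fromℤ (+ w m) ≡ fromℤ (+ (u m ℕ.+ u m)) - fromℤ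
            (+ (w m ℕ.+ w m))
        fraction m = trans (ℚS.solve 2 (λ a w → ⊖ (ℚS.con 2ℚ ⊟ a) ⊗ w ⊜ a ⊗ w ⊟ (w ⊞ w)) refl (2ℚ * g m)
            (fromℤ (+ w m)))
          (cong₂ _-_ (double-fraction m) (sym (fromℤ-+ (+ w m) (+ w m))))
        half : ∀ m → x ^ w m * B ^ w m ≤ B ^ u m
        half m = begin
          x ^ w m * B ^ w m ≡⟨ cong (_* B ^ w m) (^-distrib-* s y (w m)) ⟩
          s ^ w m * y ^ w m * B ^ w m ≤⟨ *-monoʳ-≤ (^-nonneg (w m) (ℚ.<⇒≤ 0<B))
             (*-monoʳ-≤ (^-nonneg (w m) 0≤y) (lower m)) ⟩
          C ^ w m * B ^ u m * y ^ w m * B ^ w m ≡⟨ ℚS.solve 4 (λ c u y w → c ⊗ u ⊗ y ⊗ w ⊜ y ⊗ (c ⊗ w) ⊗ u)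
              refl (C ^ w m) (B ^ u m) (y ^ w m) (B ^ w m) ⟩
          y ^ w m * (C ^ w m * B ^ w m) * B ^ u m ≡⟨ cong (_* B ^ u m)
              (trans (cong (y ^ w m *_) (sym (^-distrib-* C B (w m))))
              (trans (sym (^-distrib-* y (C * B) (w m))) (trans (cong (_^ w m) inv) (^-one (w m))))) ⟩
          1ℚ * B ^ u m ≡⟨ ℚ.*-identityˡ _ ⟩
          B ^ u m ∎
        at : ∀ m → LowerBoundAt b (x * x) (seq s′ m)
        bound : ∀ m → (x * x) ^ w m * B ^ (w m ℕ.+ w m) ≤ B ^ (u m ℕ.+ u m)
        bound m = begin
          (x * x) ^ w m * B ^ (w m ℕ.+ w m) ≡⟨ cong₂ _*_ (^-square x (w m)) (^-double B (w m)) ⟩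
          x ^ w m * x ^ w m * (B ^ w m * B ^ w m) ≡⟨ ℚS.solve 2
              (λ x y → x ⊗ x ⊗ (y ⊗ y) ⊜ (x ⊗ y) ⊗ (x ⊗ y)) refl (x ^ w m) (B ^ w m) ⟩
          x ^ w m * B ^ w m * (x ^ w m * B ^ w m) ≤⟨ *-mono-≤ 0≤xB 0≤xB (half m) (half m) ⟩
          B ^ u m * B ^ u m ≡⟨ sym (^-double B (u m)) ⟩
          B ^ (u m ℕ.+ u m) ∎
          where
          0≤xB : 0ℚ ≤ x ^ w m * B ^ w m
          0≤xB = *-nonneg (^-nonneg (w m) 0≤x) (^-nonneg (w m) (ℚ.<⇒≤ 0<B))

        at m = subst₂ (λ v r → LowerBoundAt v (x * x) r) (sym b≡) (sym (s′≡ m))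
          (lowerBoundAt (w m) (u m ℕ.+ u m) (w m ℕ.+ w m) (1≤w m) (fraction m) (bound m))

-- γ is a variable given by its terms: types mentioning the limit itself are too slow to compare
module ApproximationExponents {q S} (law : PowerLaw q S) (j : ℕ) (q′ : ℕ → ℚ)
    (X Y : ∀ n → .(NonZero (q′ n)) → ℝ) (z : ℕ → ℚ)
  (qz : ∀ n → q n * z n ≡ 1ℚ) (∣q′∣≡ : ∀ n → ∣ q′ n ∣ ≡ 2ℚ ^ (j ℕ.+ S n) * ∣ q n ∣)
      (1≤∣q′∣ : ∀ n → 1ℚ ≤ ∣ q′ n ∣)
  (X≤ : ∀ n .(nz : NonZero (q′ n)) → X n nz ≤ᴿ fromℚ (2ℚ * (z n * z n)))
  (Y≤ : ∀ n .(nz : NonZero (q′ n)) → Y n nz ≤ᴿ fromℚ (½ ^ (S n ℕ.+ S n))) where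
  open Exponent law
  open PowerBounds law j

  nonZero : ∀ n → NonZero (q′ n)
  nonZero n = ℚ.≢-nonZero λ q′≡0 → ℚ.<-irrefl (cong ∣_∣ (sym q′≡0)) (ℚ.<-≤-trans 0<1 (1≤∣q′∣ n))

  q≢0 : ∀ n → q n ≢ 0ℚ
  q≢0 n q≡0 = ℚ.<-irrefl (trans (sym (ℚ.*-zeroˡ (z n))) (trans (cong (_* z n) (sym q≡0)) (qz n))) 0<1

  Conclusion : Set
  Conclusion = ∃[ γ ] ∃[ C ] ∃[ C′ ] 0ᴿ <ᴿ γ × γ <ᴿ 1ᴿ × 0ᴿ <ᴿ C × 0ᴿ <ᴿ C′ ×
    ∀ n → n > 0 → Σ[ nz ∈ NonZero (q′ n) ] let instance _ = nz in
      X n nz ≤ᴿ C /∣ q′ n ∣^ (2ᴿ -ᴿ 2ᴿ *ᴿ γ) × Y n nz ≤ᴿ C′ /∣ q′ n ∣^ (2ᴿ *ᴿ γ)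

  conclude : ∀ γ → (∀ m → seq γ m ≡ g m) → Conclusion
  conclude γ γ-seq = γ , fromℚ D₁ , fromℚ D₂ , 0<γ γ γ-seq , γ<1 γ γ-seq , 0<ᴿfromℚ 0<D₁ , 0<ᴿfromℚ 0<D₂ ,
      λ n _ → nonZero n , real n (nonZero n) , 2-adic n (nonZero n)
    where
    real : ∀ n .(nz : NonZero (q′ n)) → X n nz ≤ᴿ _/∣_∣^_ (fromℚ D₁) (q′ n) {{nz}} (2ᴿ -ᴿ 2ᴿ *ᴿ γ)
    real n nz = ≤-quotient (X n nz) (q′ n) {{nz}} (2ᴿ -ᴿ 2ᴿ *ᴿ γ) D₁ (2ℚ * (z n * z n)) (X≤ n nz)
      (real-bound n (q≢0 n) ∣ q′ n ∣ {{∣∣-positive (q′ n) {{nz}}}} (∣q′∣≡ n) (1≤∣q′∣ n) (-ᴿ (2ᴿ -ᴿ 2ᴿ *ᴿ γ))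
          (real-exponent γ g γ-seq) {z n} (qz n))
    2-adic : ∀ n .(nz : NonZero (q′ n)) → Y n nz ≤ᴿ _/∣_∣^_ (fromℚ D₂) (q′ n) {{nz}} (2ᴿ *ᴿ γ)
    2-adic n nz = ≤-quotient (Y n nz) (q′ n) {{nz}} (2ᴿ *ᴿ γ) D₂ (½ ^ (S n ℕ.+ S n)) (Y≤ n nz)
      (2-adic-bound n (q≢0 n) ∣ q′ n ∣ {{∣∣-positive (q′ n) {{nz}}}} (∣q′∣≡ n) (1≤∣q′∣ n) (-ᴿ (2ᴿ *ᴿ γ))
          (2-adic-exponent γ g γ-seq))

  approximation-exponents : Conclusion
  approximation-exponents = conclude (mkℝ g g-cauchy) (λ _ → refl)

module ValuationSum (b : ℕ → ℚ) (ex : ℕ → ℕ) (v₂-b : ∀ n → v₂ (b (suc n)) ≡ [ ℤ.- (+ ex n) ])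
  (S : ℕ → ℕ) (S-zero : S 0 ≡ 0) (S-suc : ∀ n → S (suc n) ≡ S n ℕ.+ ex n) where
  open Convergents b using (s₀; valuation-sum)

  [-+-] : ∀ x y → [ ℤ.- (+ x) ] +⁺ [ ℤ.- (+ y) ] ≡ [ ℤ.- (+ (x ℕ.+ y)) ]
  [-+-] x y = cong [_] (sym (trans (cong ℤ.-_ (ℤ.pos-+ x y)) (ℤ.neg-distrib-+ (+ x) (+ y))))

  tail-sum : ∀ n → foldr _+⁺_ [ 0ℤ ] (applyUpTo (λ i → v₂ (b (suc i))) n) ≡ [ ℤ.- (+ S n) ]
  tail-sum n = finish (go n 0 (λ i → v₂ (b (suc i))) v₂-b)
    where
    go : ∀ n k f → (∀ i → f i ≡ [ ℤ.- (+ ex (k ℕ.+ i)) ]) → ∃[ z ] foldr _+⁺_ [ 0ℤ ] (applyUpTo f n) ≡ [ ℤ.-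
        (+ z) ] × S k ℕ.+ z ≡ S (k ℕ.+ n)
    go zero k f h = 0 , refl , trans (ℕ.+-identityʳ (S k)) (cong S (sym (ℕ.+-identityʳ k)))
    go (suc n) k f h = cons (go n (suc k) (λ i → f (suc i))
        (λ i → trans (h (suc i)) (cong (λ z → [ ℤ.- (+ ex z) ]) (ℕ.+-suc k i))))
      where
      cons : ∃[ z ] foldr _+⁺_ [ 0ℤ ] (applyUpTo (λ i → f (suc i)) n) ≡ [ ℤ.- (+ z) ] × S (suc k) ℕ.+ z ≡ S
          (suc k ℕ.+ n) →
        ∃[ z ] foldr _+⁺_ [ 0ℤ ] (applyUpTo f (suc n)) ≡ [ ℤ.- (+ z) ] × S k ℕ.+ z ≡ S (k ℕ.+ suc n)
      cons (z , eq , sum) = ex k ℕ.+ z ,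
        trans (cong₂ _+⁺_ (trans (h 0) (cong (λ t → [ ℤ.- (+ ex t) ]) (ℕ.+-identityʳ k))) eq)
            ([-+-] (ex k) z) ,
        trans (sym (ℕ.+-assoc (S k) (ex k) z))
            (trans (cong (ℕ._+ z) (sym (S-suc k))) (trans sum (cong S (sym (ℕ.+-suc k n)))))
    finish : ∃[ z ] foldr _+⁺_ [ 0ℤ ] (applyUpTo (λ i → v₂ (b (suc i))) n) ≡ [ ℤ.- (+ z) ] × S 0 ℕ.+ z ≡ S
        n →
      foldr _+⁺_ [ 0ℤ ] (applyUpTo (λ i → v₂ (b (suc i))) n) ≡ [ ℤ.- (+ S n) ]
    finish (z , eq , sum) = trans eq (cong (λ t → [ ℤ.- (+ t) ]) (trans (cong (ℕ._+ z) (sym S-zero)) sum))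

  -- The term of b₀ enters only when its valuation is not positive, so j is 0 or -v₂ b₀; in each
  -- case it is nonnegative and the same for all n.
  valuation-sum≡ : ∃[ j ] (∀ n → valuation-sum n ≡ [ ℤ.- (+ (j ℕ.+ S n)) ])
  valuation-sum≡ with v₂ (b 0)
  ... | ⊤⁺ = 0 , tail-sum
  ... | [ v ] with 0ℤ ℤ.<? v
  ...   | yes _ = 0 , tail-sum
  ...   | no v≤0 = ℤ.∣ v ∣ , λ n → trans (cong₂ _+⁺_ (cong [_] (nonpos v v≤0)) (tail-sum n))
      ([-+-] ℤ.∣ v ∣ (S n))
    where
    nonpos : ∀ v → ¬ 0ℤ ℤ.< v → v ≡ ℤ.- (+ ℤ.∣ v ∣)
    nonpos (+ zero) _ = refl
    nonpos (+ suc n) h = ⊥-elim (h (ℤ.+<+ (ℕ.s≤s ℕ.z≤n)))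
    nonpos -[1+ n ] _ = refl

2^-neg : ∀ n → 2^- [ ℤ.- (+ n) ] ≡ 2ℚ ^ n
2^-neg zero = refl
2^-neg (suc n) = refl

-- The expansion

module ExpansionLemmas {c ℓ} (K : QuadraticField c ℓ)
  (σ∞ : QuadraticField.Carrier K → ℝ) (σ∞-hom : RingMorphisms.IsRingHomomorphism (QuadraticField.rawRing K)
      ℝ-rawRing σ∞)
  (σ₂ : QuadraticField.Carrier K → ℚ₂) (σ₂-hom : RingMorphisms.IsRingHomomorphism (QuadraticField.rawRing K)
      ℚ₂-rawRing σ₂)
  (α : QuadraticField.Carrier K) (α∉ℚ : ∀ r → ¬ QuadraticField._≈_ K α (QuadraticField.ι K r))
  (E : Algorithm.Expansion K σ∞ σ₂ α) where
  open FieldLemmas K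
  open RealLemmas K σ∞ σ∞-hom
  open TwoAdic σ₂ σ₂-hom
  open PartialQuotients K σ∞ σ∞-hom σ₂ σ₂-hom
  open Algorithm K σ∞ σ₂
  open Algorithm.Expansion E

  β : ℕ → Carrier
  β n = complete n -ᴷ ι (partial n)

  βα≈1 : ∀ n → β n *ᴷ complete (suc n) ≈ 1#
  βα≈1 n = ≈-trans (*-comm _ _) (step n)

  quotient-even : ∀ m → IsPartialQuotient 0F (complete (twice m)) (partial (twice m))
  quotient-even m = subst (λ ε → IsPartialQuotient ε (complete (twice m)) (partial (twice m))) (even-mod m)
      (quotient (twice m))

  quotient-odd : ∀ m → IsPartialQuotient (sucF 0F) (complete (suc (twice m))) (partial (suc (twice m)))
  quotient-odd m = subst (λ ε → IsPartialQuotient ε (complete (suc (twice m))) (partial (suc (twice m))))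
      (odd-mod m) (quotient (suc (twice m)))

  β-even∈2O : ∀ m → In 1 (β (twice m))
  β-even∈2O m = remainder-∈2O (quotient-even m)

  β∈O : ∀ n → In 0 (β n)
  β∈O n = remainder-∈O (n mod 2) (quotient n)

  β-odd-abs : ∀ m → Abs (β (suc (twice m))) ½
  β-odd-abs m = abs-mono (ℚ.≤-reflexive (trans (cong (½ *_) fromℤ-1) (ℚ.*-identityʳ ½)))
      (remainder-abs (sucF 0F) (quotient-odd m))

  β-even-abs : ∀ m → Abs (β (twice m)) 1ℚ
  β-even-abs m = abs-mono (ℚ.≤-reflexive (trans (cong (½ *_) fromℤ-2) refl))
      (remainder-abs 0F (quotient-even m))

  ½≤1 : ½ ≤ 1ℚ
  ½≤1 = ℚ.≤-trans (ℚ.<⇒≤ (<-+ ½ 0<½)) ℚ.≤-refl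

  β-abs : ∀ n → Abs (β n) 1ℚ
  β-abs n = go (halfView n)
    where
    go : ∀ {n} → HalfView n → Abs (β n) 1ℚ
    go (even m) = β-even-abs m
    go (odd m) = abs-mono ½≤1 (β-odd-abs m)

  partial-dyadic : ∀ n → Dyadic (partial n)
  partial-dyadic n = quotient-dyadic (n mod 2) (quotient n)

  ι-neg-zero : ∀ {x r} → x +ᴷ ι r ≈ 0# → x ≈ ι (- r)
  ι-neg-zero {x} {r} h = ≈-trans (solveᴷ 2 (λ x r → x := (x :+ r) :- r) ≈-refl x (ι r))
    (≈-trans (+-cong h ≈-refl) (≈-trans (+-identityˡ _) (≈-sym (ι.-‿homo r))))

  opaque
    -- In α = a + b θ the coefficient b is nonzero because α is irrational, so θ can be eliminated
    -- from α² = c + d θ; this gives t = d/b.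
    quadratic-equation : ∃[ t ] ∃[ N ] α *ᴷ α ≈ ι t *ᴷ α -ᴷ ι N
    quadratic-equation = go (spanning α) (spanning (α *ᴷ α))
      where
      go : ∃[ a ] ∃[ b ] α ≈ ι a +ᴷ ι b *ᴷ θ → ∃[ c ] ∃[ d ] α *ᴷ α ≈ ι c +ᴷ ι d *ᴷ θ →
          ∃[ t ] ∃[ N ] α *ᴷ α ≈ ι t *ᴷ α -ᴷ ι N
      go (a , b , α≈) (c , d , α²≈) = split (b ℚ.≟ 0ℚ)
        where
        split : Dec (b ≡ 0ℚ) → ∃[ t ] ∃[ N ] α *ᴷ α ≈ ι t *ᴷ α -ᴷ ι N
        split (yes b≡0) = ⊥-elim (α∉ℚ a (≈-trans α≈
            (≈-trans (+-cong ≈-refl (≈-trans (*-cong (≈-trans (ι.⟦⟧-cong b≡0) ι.0#-homo) ≈-refl) (zeroˡ θ)))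
            (+-identityʳ _))))
        split (no b≢0) = t , t * a - c , ≈-sym (begin
          ι t *ᴷ α -ᴷ ι (t * a - c) ≈⟨ +-cong (*-cong ≈-refl α≈)
              (-‿cong (≈-trans (ι.+-homo (t * a) (- c)) (+-cong (ι.*-homo t a) (ι.-‿homo c)))) ⟩
          ι t *ᴷ (ι a +ᴷ ι b *ᴷ θ) -ᴷ (ι t *ᴷ ι a -ᴷ ι c) ≈⟨ solveᴷ 5
              (λ t a b c θ → t :* (a :+ b :* θ) :- (t :* a :- c) := c :+ (t :* b) :* θ) ≈-refl (ι t) (ι a)
              (ι b) (ι c) θ ⟩
          ι c +ᴷ ι t *ᴷ ι b *ᴷ θ ≈⟨ +-cong ≈-refl
              (*-cong (≈-trans (≈-sym (ι.*-homo t b)) (ι.⟦⟧-cong tb)) ≈-refl) ⟩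
          ι c +ᴷ ι d *ᴷ θ ≈⟨ ≈-sym α²≈ ⟩
          α *ᴷ α ∎)
          where
          open import Relation.Binary.Reasoning.Setoid setoid
          b-nonZero : ℚ.NonZero b
          b-nonZero = ℚ.≢-nonZero b≢0
          t b⁻¹ : ℚ
          b⁻¹ = (ℚ.1/ b) {{b-nonZero}}
          t = d * b⁻¹
          tb : t * b ≡ d
          tb = trans (ℚ.*-assoc d b⁻¹ b) (trans (cong (d *_) (ℚ.*-inverseˡ b {{b-nonZero}}))
              (ℚ.*-identityʳ d))

  t N : ℚ
  t = proj₁ quadratic-equation
  N = proj₁ (proj₂ quadratic-equation)

  α²≈ : α *ᴷ α ≈ ι t *ᴷ α -ᴷ ι N
  α²≈ = proj₂ (proj₂ quadratic-equation)

  -- αₙ = (α + Pₙ) / Qₙ, and Q⁻ₙ = Qₙ₋₁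
  P Q Q⁻ : ℕ → ℚ
  P zero    = 0ℚ
  P (suc n) = partial n * Q n - P n - t
  Q zero    = 1ℚ
  Q (suc n) = Q⁻ n + partial n * (P n - P (suc n))
  Q⁻ zero    = - N
  Q⁻ (suc n) = Q n

  -- The right side is minus the norm of α + Pₙ, the conjugate of α being t - α. So Qₙ₊₁, which is
  -- defined without division, is the denominator that appears when 1/βₙ is rationalised.
  QQ⁻ : ∀ n → Q n * Q⁻ n ≡ - (P n * P n + t * P n + N)
  QQ⁻ zero = ℚS.solve 2 (λ t N → ℚS.con 1ℚ ⊗ (⊖ N) ⊜ ⊖ (ℚS.con 0ℚ ⊗ ℚS.con 0ℚ ⊞ t ⊗ ℚS.con 0ℚ ⊞ N)) refl t N
  QQ⁻ (suc n) = begin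
    (Q⁻ n + b * (P n - P′)) * Q n ≡⟨ ℚS.solve 5 (λ q q⁻ p b p′ → (q⁻ ⊞ b ⊗ (p ⊟ p′)) ⊗ q ⊜ q ⊗ q⁻ ⊞ b ⊗ q ⊗
        (p ⊟ p′)) refl (Q n) (Q⁻ n) (P n) b P′ ⟩
    Q n * Q⁻ n + b * Q n * (P n - P′) ≡⟨ cong (_+ b * Q n * (P n - P′)) (QQ⁻ n) ⟩
    - (P n * P n + t * P n + N) + b * Q n * (P n - P′)
      ≡⟨ ℚS.solve 4 (λ p t N bq → ⊖ (p ⊗ p ⊞ t ⊗ p ⊞ N) ⊞ bq ⊗ (p ⊟ (bq ⊟ p ⊟ t))
           ⊜ ⊖ ((bq ⊟ p ⊟ t) ⊗ (bq ⊟ p ⊟ t) ⊞ t ⊗ (bq ⊟ p ⊟ t) ⊞ N)) refl (P n) t N (b * Q n) ⟩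
    - (P′ * P′ + t * P′ + N) ∎
    where
    open ≡-Reasoning
    b P′ : ℚ
    b = partial n
    P′ = P (suc n)

  private
    module At (n : ℕ) (I : ι (Q n) *ᴷ complete n ≈ α +ᴷ ι (P n)) where
      open import Relation.Binary.Reasoning.Setoid setoid

      Q≢0 : Q n ≢ 0ℚ
      Q≢0 Q≡0 = α∉ℚ (- P n) (ι-neg-zero (≈-trans (≈-sym I)
          (≈-trans (*-cong (≈-trans (ι.⟦⟧-cong Q≡0) ι.0#-homo) ≈-refl) (zeroˡ _))))

      ιP′ : ι (P (suc n)) ≈ ι (partial n) *ᴷ ι (Q n) -ᴷ ι (P n) -ᴷ ι t
      ιP′ = ≈-trans (ι.+-homo _ _) (+-cong (≈-trans (ι.+-homo _ _) (+-cong (ι.*-homo _ _) (ι.-‿homo _)))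
          (ι.-‿homo _))

      Qβ : ι (Q n) *ᴷ β n ≈ α -ᴷ ι t -ᴷ ι (P (suc n))
      Qβ = begin
        ι (Q n) *ᴷ β n ≈⟨ solveᴷ 3 (λ q a b → q :* (a :- b) := q :* a :- b :* q) ≈-refl (ι (Q n))
            (complete n) (ι (partial n)) ⟩
        ι (Q n) *ᴷ complete n -ᴷ ι (partial n) *ᴷ ι (Q n) ≈⟨ +-cong I ≈-refl ⟩
        α +ᴷ ι (P n) -ᴷ ι (partial n) *ᴷ ι (Q n)
          ≈⟨ solveᴷ 4 (λ a p bq t → a :+ p :- bq := a :- t :- (bq :- p :- t)) ≈-refl α (ι (P n))
              (ι (partial n) *ᴷ ι (Q n)) (ι t) ⟩
        α -ᴷ ι t -ᴷ (ι (partial n) *ᴷ ι (Q n) -ᴷ ι (P n) -ᴷ ι t) ≈⟨ +-cong ≈-refl (-‿cong (≈-sym ιP′)) ⟩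
        α -ᴷ ι t -ᴷ ι (P (suc n)) ∎

      norm : (α -ᴷ ι t -ᴷ ι (P (suc n))) *ᴷ (α +ᴷ ι (P (suc n))) ≈ ι (Q n) *ᴷ ι (Q (suc n))
      norm = begin
        (α -ᴷ ι t -ᴷ z) *ᴷ (α +ᴷ z) ≈⟨ solveᴷ 3 (λ a t p → (a :- t :- p) :* (a :+ p) := a :* a :- t :* a :-
            (p :* p :+ t :* p)) ≈-refl α (ι t) z ⟩
        α *ᴷ α -ᴷ ι t *ᴷ α -ᴷ (z *ᴷ z +ᴷ ι t *ᴷ z) ≈⟨ +-cong (+-cong α²≈ ≈-refl) ≈-refl ⟩
        ι t *ᴷ α -ᴷ ι N -ᴷ ι t *ᴷ α -ᴷ (z *ᴷ z +ᴷ ι t *ᴷ z) ≈⟨ solveᴷ 4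
            (λ ta N pp tp → ta :- N :- ta :- (pp :+ tp) := :- (pp :+ tp :+ N)) ≈-refl (ι t *ᴷ α) (ι N)
            (z *ᴷ z) (ι t *ᴷ z) ⟩
        -ᴷ (z *ᴷ z +ᴷ ι t *ᴷ z +ᴷ ι N) ≈⟨ -‿cong
            (≈-trans (ι.+-homo _ _) (+-cong (≈-trans (ι.+-homo _ _) (+-cong (ι.*-homo _ _) (ι.*-homo _ _)))
            ≈-refl)) ⟨
        -ᴷ ι (P (suc n) * P (suc n) + t * P (suc n) + N) ≈⟨ ι.-‿homo _ ⟨
        ι (- (P (suc n) * P (suc n) + t * P (suc n) + N)) ≈⟨ ι.⟦⟧-cong (sym (QQ⁻ (suc n))) ⟩
        ι (Q (suc n) * Q n) ≈⟨ ι.⟦⟧-cong (ℚ.*-comm (Q (suc n)) (Q n)) ⟩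
        ι (Q n * Q (suc n)) ≈⟨ ι.*-homo _ _ ⟩
        ι (Q n) *ᴷ ι (Q (suc n)) ∎
        where z = ι (P (suc n))

      ιQ⁻¹ : ι (Q n) *ᴷ ι ((ℚ.1/ Q n) {{ℚ.≢-nonZero Q≢0}}) ≈ 1#
      ιQ⁻¹ = ι-inverse (ℚ.*-inverseʳ (Q n) {{ℚ.≢-nonZero Q≢0}})

      Q′ : β n *ᴷ (α +ᴷ ι (P (suc n))) ≈ ι (Q (suc n))
      Q′ = *ᴷ-cancelˡ ιQ⁻¹ (≈-trans (≈-sym (*-assoc _ _ _)) (≈-trans (*-cong Qβ ≈-refl) norm))

      I′ : ι (Q (suc n)) *ᴷ complete (suc n) ≈ α +ᴷ ι (P (suc n))
      I′ = ≈-trans (*-cong (≈-sym Q′) ≈-refl)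
          (≈-trans (solveᴷ 3 (λ b x a → b :* x :* a := (a :* b) :* x) ≈-refl (β n) (α +ᴷ ι (P (suc n)))
          (complete (suc n)))
        (≈-trans (*-cong (step n) ≈-refl) (*-identityˡ _)))

  Q-complete : ∀ n → ι (Q n) *ᴷ complete n ≈ α +ᴷ ι (P n)
  Q-complete zero = ≈-trans (*-cong ι.1#-homo start)
      (≈-trans (*-identityˡ _) (≈-trans (≈-sym (+-identityʳ _)) (+-cong ≈-refl (≈-sym ι.0#-homo))))
  Q-complete (suc n) = At.I′ n (Q-complete n)

  Q≢0 : ∀ n → Q n ≢ 0ℚ
  Q≢0 n = At.Q≢0 n (Q-complete n)

  P-suc : ∀ n → ι (P (suc n)) ≈ (α -ᴷ ι t) -ᴷ β n *ᴷ ι (Q n)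
  P-suc n = ≈-trans (solveᴷ 2 (λ x p → p := x :- (x :- p)) ≈-refl (α -ᴷ ι t) (ι (P (suc n))))
    (+-cong ≈-refl (-‿cong (≈-trans (≈-sym (At.Qβ n (Q-complete n))) (*-comm _ _))))

  -- The recursion is rewritten through βₙ, which is small at both places, instead of bₙ, which may
  -- be large. The new Q depends on the old one through the factor βₙ², and the inhomogeneous part
  -- comes from the fixed element 2α - t.
  Q-suc : ∀ n → ι (Q (suc n)) ≈ β n *ᴷ ((α +ᴷ (α -ᴷ ι t)) -ᴷ β n *ᴷ ι (Q n))
  Q-suc n = ≈-trans (≈-sym (At.Q′ n (Q-complete n))) (*-cong ≈-refl (≈-trans (+-cong ≈-refl (P-suc n))
    (solveᴷ 3 (λ a x y → a :+ (x :- y) := (a :+ x) :- y) ≈-refl α (α -ᴷ ι t) (β n *ᴷ ι (Q n)))))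

  complete-determined : ∀ m n → P m ≡ P n → Q m ≡ Q n → complete m ≈ complete n
  complete-determined m n P≡ Q≡ = *ᴷ-cancelˡ (At.ιQ⁻¹ m (Q-complete m))
      (≈-trans (Q-complete m) (≈-trans (+-cong ≈-refl (ι.⟦⟧-cong P≡))
    (≈-trans (≈-sym (Q-complete n)) (*-cong (ι.⟦⟧-cong (sym Q≡)) ≈-refl))))

  complete∉ℚ : ∀ n r → ¬ complete n ≈ ι r
  complete∉ℚ n r h = α∉ℚ (Q n * r - P n) (≈-trans (solveᴷ 2 (λ a p → a := (a :+ p) :- p) ≈-refl α (ι (P n)))
    (≈-trans (+-cong (≈-trans (≈-sym (Q-complete n)) (*-cong ≈-refl h)) ≈-refl)
      (≈-sym (≈-trans (ι.+-homo _ _) (+-cong (ι.*-homo _ _) (ι.-‿homo _))))))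

  -- Finitely many complete quotients and eventual periodicity

  module Periodicity where

    private
      x₁ x₂ : Carrier
      x₁ = α +ᴷ (α -ᴷ ι t)
      x₂ = α -ᴷ ι t

      c₁ c₂ G H : ℚ
      c₁ = proj₁ (abs-exists x₁)
      c₂ = proj₁ (abs-exists x₂)
      -- Preserved by two steps, as ½ (c₁ + ½ (c₁ + G)) = c₁ + 1/4; the summand 1 accommodates Q₀ =
      -- 1.
      G = 1ℚ + c₁
      H = c₂ + ½ * (1ℚ * (c₁ + 1ℚ * G))

      0≤c₁ : 0ℚ ≤ c₁
      0≤c₁ = ℚ.<⇒≤ (proj₁ (proj₂ (abs-exists x₁)))

      Q-odd-bound : ∀ m → Abs (ι (Q (twice m))) G → Abs (ι (Q (suc (twice m)))) (1ℚ * (c₁ + 1ℚ * G))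
      Q-odd-bound m h = abs-≈ (≈-sym (Q-suc (twice m)))
          (abs-* (β-even-abs m) (abs-- (proj₂ (proj₂ (abs-exists x₁))) (abs-* (β-even-abs m) h)))

      Q-bound : ∀ m → Abs (ι (Q (twice m))) G
      Q-bound zero = abs-mono (ℚ.≤-trans (ℚ.≤-reflexive (sym (ℚ.+-identityʳ 1ℚ))) (ℚ.+-monoʳ-≤ 1ℚ 0≤c₁))
          (abs-ι-nonneg 0≤1)
      Q-bound (suc m) = abs-mono contraction (abs-≈ (≈-sym (Q-suc (suc (twice m))))
        (abs-* (β-odd-abs m) (abs-- (proj₂ (proj₂ (abs-exists x₁)))
            (abs-* (β-odd-abs m) (Q-odd-bound m (Q-bound m))))))
        where
        contraction : ½ * (c₁ + ½ * (1ℚ * (c₁ + 1ℚ * G))) ≤ G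
        contraction = begin
          ½ * (c₁ + ½ * (1ℚ * (c₁ + 1ℚ * (1ℚ + c₁)))) ≡⟨ ℚS.solve 1
              (λ c → ℚS.con ½ ⊗ (c ⊞ ℚS.con ½ ⊗ (ℚS.con 1ℚ ⊗ (c ⊞ ℚS.con 1ℚ ⊗ (ℚS.con 1ℚ ⊞ c))))
               ⊜ ℚS.con (½ * ½) ⊞ c) refl c₁ ⟩
          ½ * ½ + c₁ ≤⟨ ℚ.+-monoˡ-≤ c₁ (*-mono-≤ {½} {1ℚ} {½} {1ℚ} (ℚ.<⇒≤ 0<½) (ℚ.<⇒≤ 0<½) ½≤1 ½≤1) ⟩
          1ℚ + c₁ ∎
          where open ℚ.≤-Reasoning

      0≤H : 0ℚ ≤ H
      0≤H = ℚ.+-mono-≤ (ℚ.<⇒≤ (proj₁ (proj₂ (abs-exists x₂))))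
        (*-nonneg (ℚ.<⇒≤ 0<½) (*-nonneg 0≤1 (ℚ.+-mono-≤ 0≤c₁ (*-nonneg 0≤1 (ℚ.+-mono-≤ 0≤1 0≤c₁)))))

      P-bound : ∀ m → Abs (ι (P (twice m))) H
      P-bound zero = abs-mono 0≤H (abs-ι-nonneg ℚ.≤-refl)
      P-bound (suc m) = abs-≈ (≈-sym (P-suc (suc (twice m))))
          (abs-- (proj₂ (proj₂ (abs-exists x₂))) (abs-* (β-odd-abs m) (Q-odd-bound m (Q-bound m))))

      scaled-more : ∀ h l {x} → In 0 (ι (2ℚ ^ l) *ᴷ x) → In 0 (ι (2ℚ ^ (h ℕ.+ l)) *ᴷ x)
      scaled-more h l {x} hx = In-≈ (≈-trans (≈-sym (*-assoc _ _ _))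
          (*-cong (≈-trans (≈-sym (ι.*-homo _ _)) (ι.⟦⟧-cong (sym (^-homo-* 2ℚ h l)))) ≈-refl))
        (In-* {0} {0} (In-2^∈O h) hx)
        where
        In-2^∈O : ∀ k → In 0 (ι (2ℚ ^ k))
        In-2^∈O k = In-weaken k (subst (λ z → In z (ι (2ℚ ^ k))) (sym (ℕ.+-identityʳ k)) (In-2^ k))

      h : ℕ
      h = proj₁ (In-scaled x₁) ℕ.+ proj₁ (In-scaled x₂)

      h-x₁ : In 0 (ι (2ℚ ^ h) *ᴷ x₁)
      h-x₁ = subst (λ z → In 0 (ι (2ℚ ^ z) *ᴷ x₁)) (ℕ.+-comm (proj₁ (In-scaled x₂)) (proj₁ (In-scaled x₁)))
        (scaled-more (proj₁ (In-scaled x₂)) (proj₁ (In-scaled x₁)) (proj₂ (In-scaled x₁)))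

      h-x₂ : In 0 (ι (2ℚ ^ h) *ᴷ x₂)
      h-x₂ = scaled-more (proj₁ (In-scaled x₁)) (proj₁ (In-scaled x₂)) (proj₂ (In-scaled x₂))

      -- The same recursion read at the prime 2: multiplying by βₙ ∈ O creates no denominators, so
      -- the power 2^h that clears 2α - t suffices for every n.
      Q∈ : ∀ n → In 0 (ι (2ℚ ^ h) *ᴷ ι (Q n))
      Q∈ zero = In-≈ (≈-trans (ι.⟦⟧-cong (trans (fromℤ-pow2 h) (sym (ℚ.*-identityʳ _)))) (ι.*-homo _ _))
          (In-ℤ (pow2 h))
      Q∈ (suc n) = In-≈ (≈-trans
          (solveᴷ 4 (λ p b x q → b :* (p :* x :- b :* (p :* q)) := p :* (b :* (x :- b :* q))) ≈-refl
              (ι (2ℚ ^ h)) (β n) x₁ (ι (Q n)))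
          (*-cong ≈-refl (≈-sym (Q-suc n))))
        (In-* {0} {0} (β∈O n) (In-- h-x₁ (In-* {0} {0} (β∈O n) (Q∈ n))))

      P∈ : ∀ n → In 0 (ι (2ℚ ^ h) *ᴷ ι (P n))
      P∈ zero = In-≈ (≈-trans (ι.⟦⟧-cong (trans fromℤ-0 (sym (ℚ.*-zeroʳ (2ℚ ^ h))))) (ι.*-homo _ _))
          (In-ℤ 0ℤ)
      P∈ (suc n) = In-≈ (≈-trans
          (solveᴷ 4 (λ p b x q → p :* x :- b :* (p :* q) := p :* (x :- b :* q)) ≈-refl (ι (2ℚ ^ h)) (β n) x₂
              (ι (Q n)))
          (*-cong ≈-refl (≈-sym (P-suc n))))
        (In-- h-x₂ (In-* {0} {0} (β∈O n) (Q∈ n)))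

      -- The recursion multiplies only by dyadic bₙ, so the denominators of t and N account for all
      -- odd factors and are cleared by `M`. The remaining powers of 2 are cleared by 2^h, whence
      -- `W * P n` and `W * Q n` are integers.
      M W : ℚ
      M = fromℤ (+ ↧ₙ t) * fromℤ (+ ↧ₙ N)
      W = M * 2ℚ ^ h

      dyadic-M : Dyadic M
      dyadic-M = dyadic-* (dyadic-ℤ (+ ↧ₙ t)) (dyadic-ℤ (+ ↧ₙ N))

      dyadic-Mt : Dyadic (M * t)
      dyadic-Mt = subst Dyadic (trans (cong (_* fromℤ (+ ↧ₙ N)) (sym (↥-fromℤ t)))
          (ℚS.solve 3 (λ t a b → t ⊗ a ⊗ b ⊜ a ⊗ b ⊗ t) refl t (fromℤ (+ ↧ₙ t)) (fromℤ (+ ↧ₙ N))))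
        (dyadic-* (dyadic-ℤ (↥ t)) (dyadic-ℤ (+ ↧ₙ N)))

      dyadic-MN : Dyadic (M * N)
      dyadic-MN = subst Dyadic (trans (cong (fromℤ (+ ↧ₙ t) *_) (trans (sym (↥-fromℤ N)) (ℚ.*-comm N _)))
          (sym (ℚ.*-assoc (fromℤ (+ ↧ₙ t)) (fromℤ (+ ↧ₙ N)) N)))
        (dyadic-* (dyadic-ℤ (+ ↧ₙ t)) (dyadic-ℤ (↥ N)))

      dyadic-PQ : ∀ n → Dyadic (M * P n) × Dyadic (M * Q n) × Dyadic (M * Q⁻ n)
      dyadic-PQ zero = subst Dyadic (trans fromℤ-0 (sym (ℚ.*-zeroʳ M))) (dyadic-ℤ 0ℤ) ,
          subst Dyadic (sym (ℚ.*-identityʳ M)) dyadic-M ,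
        subst Dyadic (ℚ.neg-distribʳ-* M N) (dyadic-neg dyadic-MN)
      dyadic-PQ (suc n) = MP′ , MQ′ , proj₁ (proj₂ (dyadic-PQ n))
        where
        MP = proj₁ (dyadic-PQ n)
        MQ = proj₁ (proj₂ (dyadic-PQ n))
        MP′ : Dyadic (M * P (suc n))
        MP′ = subst Dyadic (ℚS.solve 5 (λ m b q p t → b ⊗ (m ⊗ q) ⊞ ⊖ (m ⊗ p) ⊞ ⊖ (m ⊗ t) ⊜ m ⊗
            (b ⊗ q ⊟ p ⊟ t)) refl M (partial n) (Q n) (P n) t)
          (dyadic-+ (dyadic-+ (dyadic-* (partial-dyadic n) MQ) (dyadic-neg MP)) (dyadic-neg dyadic-Mt))
        MQ′ : Dyadic (M * Q (suc n))
        MQ′ = subst Dyadic (ℚS.solve 5 (λ m b q p p′ → m ⊗ q ⊞ b ⊗ (m ⊗ p ⊞ ⊖ (m ⊗ p′)) ⊜ m ⊗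
            (q ⊞ b ⊗ (p ⊟ p′))) refl M (partial n) (Q⁻ n) (P n) (P (suc n)))
          (dyadic-+ (proj₂ (proj₂ (dyadic-PQ n)))
              (dyadic-* (partial-dyadic n) (dyadic-+ MP (dyadic-neg MP′))))

      integral : ∀ {r} → Dyadic (M * r) → In 0 (ι (2ℚ ^ h) *ᴷ ι r) → ∃[ i ] W * r ≡ fromℤ i
      integral {r} d h∈ = dyadic∧∈O⇒integer
        (subst Dyadic (trans (cong (_* (M * r)) (fromℤ-pow2 h))
            (ℚS.solve 3 (λ p m r → p ⊗ (m ⊗ r) ⊜ m ⊗ p ⊗ r) refl (2ℚ ^ h) M r))
            (dyadic-* (dyadic-ℤ (pow2 h)) d))
        (In-≈ (≈-trans (≈-sym (*-assoc _ _ _))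
            (≈-trans (*-cong (≈-trans (*-cong (≈-sym (ι.*-homo _ _)) ≈-refl) (≈-sym (ι.*-homo _ _))) ≈-refl)
            (≈-sym (ι.*-homo _ _))))
          (In-* {0} {0} (In-* {0} {0} (In-ℤ (+ ↧ₙ t)) (In-ℤ (+ ↧ₙ N))) h∈))
        where
        dyadic∧∈O⇒integer : ∀ {x} → Dyadic x → In 0 (ι x) → ∃[ i ] x ≡ fromℤ i
        dyadic∧∈O⇒integer {x} (k , a , eq) x∈ = go (dyadic-cases k x a eq)
          where
          go : (∃[ i ] x ≡ fromℤ i) ⊎ (∃[ e ] ∃[ o ] Odd o × 2ℚ ^ suc e * x ≡ fromℤ o) → ∃[ i ] x ≡ fromℤ i
          go (inj₁ r) = r
          go (inj₂ (e , o , odd-o , eq′)) = ⊥-elim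
              (odd∉2O odd-o (In-≈ (≈-trans (≈-sym (ι.*-homo _ _)) (ι.⟦⟧-cong eq′))
            (In-weaken e (subst (λ z → In z (ι (2ℚ ^ suc e) *ᴷ ι x))
                (trans (ℕ.+-identityʳ (suc e)) (ℕ.+-comm 1 e)) (In-* {suc e} {0} (In-2^ (suc e)) x∈)))))

      0<W : 0ℚ < W
      0<W = *-pos (*-pos (0<↧ t) (0<↧ N)) (0<2^ h)

      X : ℕ
      X = proj₁ (≤-integer (W * (G + H)))

      bounded-integer : ∀ {r i B} → B ≤ G + H → Abs (ι r) B → W * r ≡ fromℤ i → ℤ.∣ i ∣ ℕ.≤ X
      bounded-integer {r} {i} {B} B≤ r≤ eq = ∣fromℤ∣≤ (ℚ.≤-trans (subst (λ z → ∣ z ∣ ≤ W * B) eq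
          (abs-ι⁻¹ (abs-≈ (≈-sym (ι.*-homo W r)) (abs-* (abs-ι-nonneg (ℚ.<⇒≤ 0<W)) r≤))))
        (ℚ.≤-trans (*-monoˡ-≤ (ℚ.<⇒≤ 0<W) B≤) (proj₂ (≤-integer (W * (G + H))))))

      iP iQ : ℕ → ℤ
      iP m = proj₁ (integral (proj₁ (dyadic-PQ (twice m))) (P∈ (twice m)))
      iQ m = proj₁ (integral (proj₁ (proj₂ (dyadic-PQ (twice m)))) (Q∈ (twice m)))

      iP-eq : ∀ m → W * P (twice m) ≡ fromℤ (iP m)
      iP-eq m = proj₂ (integral (proj₁ (dyadic-PQ (twice m))) (P∈ (twice m)))

      iQ-eq : ∀ m → W * Q (twice m) ≡ fromℤ (iQ m)
      iQ-eq m = proj₂ (integral (proj₁ (proj₂ (dyadic-PQ (twice m)))) (Q∈ (twice m)))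

    opaque
      complete-repeats : ∃[ i ] ∃[ j ] i ℕ.< j × complete (twice i) ≈ complete (twice j)
      complete-repeats = go (pigeonhole-ℤ² X iP iQ
          (λ m → bounded-integer H≤ (P-bound m) (iP-eq m)) (λ m → bounded-integer G≤ (Q-bound m) (iQ-eq m)))
        where
        H≤ : H ≤ G + H
        H≤ = subst (_≤ G + H) (ℚ.+-identityˡ H) (ℚ.+-monoˡ-≤ H (ℚ.+-mono-≤ 0≤1 0≤c₁))
        G≤ : G ≤ G + H
        G≤ = subst (_≤ G + H) (ℚ.+-identityʳ G) (ℚ.+-monoʳ-≤ G 0≤H)
        go : ∃[ i ] ∃[ j ] i ℕ.< j × iP i ≡ iP j × iQ i ≡ iQ j → ∃[ i ] ∃[ j ] i ℕ.< j × complete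
            (twice i) ≈ complete (twice j)
        go (i , j , i<j , P≡ , Q≡) = i , j , i<j , complete-determined (twice i) (twice j)
          (*-cancelˡ 0<W (trans (iP-eq i) (trans (cong fromℤ P≡) (sym (iP-eq j)))))
          (*-cancelˡ 0<W (trans (iQ-eq i) (trans (cong fromℤ Q≡) (sym (iQ-eq j)))))

    -- The value of αₙ alone does not determine its successor, since the rule for bₙ depends on the
    -- parity of n. For this reason the repetition is sought among even indices and the period is
    -- even.
    complete-cong : ∀ {m n} → complete m ≈ complete n → m mod 2 ≡ n mod 2 → partial m ≡ partial n × complete
        (suc m) ≈ complete (suc n)
    complete-cong {m} {n} h parity = b≡ , inverse-unique {β m} (βα≈1 m)
        (≈-trans (*-cong (+-cong h (-‿cong (ι.⟦⟧-cong b≡))) ≈-refl) (βα≈1 n))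
      where
      b≡ : partial m ≡ partial n
      b≡ = quotient-unique (n mod 2) h (subst (λ ε → IsPartialQuotient ε (complete m) (partial m)) parity
          (quotient m)) (quotient n)

    private
      twice-+ : ∀ m n → twice (m ℕ.+ n) ≡ twice m ℕ.+ twice n
      twice-+ zero n = refl
      twice-+ (suc m) n = cong (λ z → suc (suc z)) (twice-+ m n)

    opaque
      eventually-periodic : ∃[ s ] ∃[ l ] ∀ n → s ℕ.≤ n → complete (twice (suc l) ℕ.+ n) ≈ complete n
      eventually-periodic = go complete-repeats
        where
        go : ∃[ i ] ∃[ j ] i ℕ.< j × complete (twice i) ≈ complete (twice j) → ∃[ s ] ∃[ l ] ∀ n → s ℕ.≤ n →
            complete (twice (suc l) ℕ.+ n) ≈ complete n
        go (i , j , i<j , h) = twice i , l , λ n le →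
            subst (λ n → complete (twice (suc l) ℕ.+ n) ≈ complete n) (ℕ.m∸n+n≡m le) (shift (n ℕ.∸ twice i))
          where
          l : ℕ
          l = j ℕ.∸ suc i
          j≡ : twice j ≡ twice (suc l) ℕ.+ twice i
          j≡ = trans (cong twice (trans (sym (ℕ.m∸n+n≡m i<j)) (ℕ.+-suc l i))) (twice-+ (suc l) i)
          shift : ∀ k → complete (twice (suc l) ℕ.+ (k ℕ.+ twice i)) ≈ complete (k ℕ.+ twice i)
          shift zero = subst (λ z → complete z ≈ complete (twice i)) j≡ (≈-sym h)
          shift (suc k) = subst (λ z → complete z ≈ complete (suc (k ℕ.+ twice i)))
              (sym (ℕ.+-suc (twice (suc l)) (k ℕ.+ twice i)))
            (proj₂ (complete-cong (shift k) (+twice-mod (suc l) (k ℕ.+ twice i))))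

  open Periodicity

  -- Valuations of partial quotients, convergents and the 2-adic error

  module Approximation where

    -- index shift: ex n and odd-part n describe b_{n+1}
    private
      Exponent : ℕ → Set
      Exponent n = ∃[ e ] ∃[ o ] Odd o × 2ℚ ^ e * partial (suc n) ≡ fromℤ o

      complete≈ : ∀ n → ι (partial n) +ᴷ β n ≈ complete n
      complete≈ n = solveᴷ 2 (λ b a → b :+ (a :- b) := a) ≈-refl (ι (partial n)) (complete n)

      -- If bₙ₊₁ lay in 2^l O, so would αₙ₊₁ = bₙ₊₁ + βₙ₊₁, and 1 = βₙ αₙ₊₁ would lie in 2^(k+l) O
      -- with k + l positive.
      b∉ : ∀ n {k l m} → k ℕ.+ l ≡ suc m → In k (β n) → In l (β (suc n)) → ¬ In l (ι (partial (suc n)))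
      b∉ n {k} {l} {m} eq β∈ β′∈ b∈ = 1∉2O (In-weaken m (subst (λ z → In z 1#) (trans eq (ℕ.+-comm 1 m))
        (In-≈ (βα≈1 n) (In-* β∈ (In-≈ (complete≈ (suc n)) (In-+ b∈ β′∈))))))

      partial-cases : ∀ n → (∃[ i ] partial n ≡ fromℤ i) ⊎
          (∃[ e ] ∃[ o ] Odd o × 2ℚ ^ suc e * partial n ≡ fromℤ o)
      partial-cases n = dyadic-cases (proj₁ (partial-dyadic n)) (partial n)
          (proj₁ (proj₂ (partial-dyadic n))) (proj₂ (proj₂ (partial-dyadic n)))

      -- Because βₙ ∈ 2O for even n, its inverse αₙ₊₁ is not integral at 2, and bₙ₊₁ cannot be an
      -- integer. So the exponent is at least 1, as `suc e` records.
      exponent-even : ∀ m → ∃[ e ] ∃[ o ] Odd o × 2ℚ ^ suc e * partial (suc (twice m)) ≡ fromℤ o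
      exponent-even m = go (partial-cases (suc (twice m)))
        where
        go : (∃[ i ] partial (suc (twice m)) ≡ fromℤ i) ⊎
            (∃[ e ] ∃[ o ] Odd o × 2ℚ ^ suc e * partial (suc (twice m)) ≡ fromℤ o) → _
        go (inj₁ (i , eq)) = ⊥-elim (b∉ (twice m) {1} {0} refl (β-even∈2O m) (β∈O (suc (twice m)))
            (In-≈ (ι.⟦⟧-cong (sym eq)) (In-ℤ i)))
        go (inj₂ r) = r

      -- Now βₙ₊₁ is the one in 2O, which rules out only even integers bₙ₊₁; an odd integer gives
      -- exponent 0.
      exponent-odd : ∀ m → Exponent (suc (twice m))
      exponent-odd m = go (partial-cases (twice (suc m)))
        where
        go : (∃[ i ] partial (twice (suc m)) ≡ fromℤ i) ⊎
            (∃[ e ] ∃[ o ] Odd o × 2ℚ ^ suc e * partial (twice (suc m)) ≡ fromℤ o) →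
            Exponent (suc (twice m))
        go (inj₁ (i , eq)) = at (parity i)
          where
          at : (∃[ j ] i ≡ + 2 ℤ.* j) ⊎ Odd i → Exponent (suc (twice m))
          at (inj₁ (j , i≡)) = ⊥-elim (b∉ (suc (twice m)) {0} {1} refl (β∈O (suc (twice m)))
              (β-even∈2O (suc m))
            (In-≈ (ι.⟦⟧-cong (sym (trans eq (cong fromℤ i≡)))) (In-pow2 1 j)))
          at (inj₂ odd-i) = 0 , i , odd-i , trans (ℚ.*-identityˡ _) eq
        go (inj₂ (e , o , h)) = suc e , o , h

      exponent-data : ∀ {n} → HalfView n → Exponent n
      exponent-data (even m) = suc (proj₁ (exponent-even m)) , proj₂ (exponent-even m)
      exponent-data (odd m)  = exponent-odd m

    ex : ℕ → ℕ
    ex n = proj₁ (exponent-data (halfView n))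

    odd-part : ∀ n → ∃[ o ] Odd o × 2ℚ ^ ex n * partial (suc n) ≡ fromℤ o
    odd-part n = proj₂ (exponent-data (halfView n))

    v₂-partial : ∀ n → v₂ (partial (suc n)) ≡ [ ℤ.- (+ ex n) ]
    v₂-partial n = v₂-odd (ex n) (proj₁ (odd-part n)) (partial (suc n)) (proj₁ (proj₂ (odd-part n)))
        (proj₂ (proj₂ (odd-part n)))

    -- One of the two indices is even and has a positive exponent by construction. This makes Sₙ
    -- grow over each period and supplies the even term in the recursion for 2^Sₙ qₙ.
    ex-adjacent : ∀ n → 1 ℕ.≤ ex n ℕ.+ ex (suc n)
    ex-adjacent n = go (halfView n)
      where
      go : ∀ {n} (v : HalfView n) → 1 ℕ.≤ proj₁ (exponent-data v) ℕ.+ ex (suc n)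
      go (even m) = ℕ.s≤s ℕ.z≤n
      go (odd m) = ℕ.≤-trans (at (halfView (twice (suc m))) refl)
          (ℕ.m≤n+m (ex (twice (suc m))) (proj₁ (exponent-odd m)))
        where
        at : ∀ {n} (v : HalfView n) → n ≡ twice (suc m) → 1 ℕ.≤ proj₁ (exponent-data v)
        at (even k) _ = ℕ.s≤s ℕ.z≤n
        at (odd k) eq = ⊥-elim (parity-clash (trans (sym (odd-mod k))
            (trans (cong (_mod 2) eq) (even-mod (suc m)))))
          where
          parity-clash : ¬ sucF 0F ≡ 0F {1}
          parity-clash ()

    S : ℕ → ℕ
    S zero    = 0
    S (suc n) = S n ℕ.+ ex n

    q⁻ p⁻ : ℕ → ℚ
    q⁻ n = Matrix₂.e₂₂ (matrix n)
    p⁻ n = Matrix₂.e₁₂ (matrix n)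

    q-suc : ∀ n → q (suc n) ≡ partial (suc n) * q n + q⁻ n
    q-suc n = cong₂ _+_ (ℚ.*-comm (q n) (partial (suc n))) (ℚ.*-identityʳ (q⁻ n))

    p-suc : ∀ n → p (suc n) ≡ partial (suc n) * p n + p⁻ n
    p-suc n = cong₂ _+_ (ℚ.*-comm (p n) (partial (suc n))) (ℚ.*-identityʳ (p⁻ n))

    q⁻-suc : ∀ n → q⁻ (suc n) ≡ q n
    q⁻-suc n = trans (cong₂ _+_ (ℚ.*-identityʳ (q n)) (ℚ.*-zeroʳ (q⁻ n))) (ℚ.+-identityʳ (q n))

    p⁻-suc : ∀ n → p⁻ (suc n) ≡ p n
    p⁻-suc n = trans (cong₂ _+_ (ℚ.*-identityʳ (p n)) (ℚ.*-zeroʳ (p⁻ n))) (ℚ.+-identityʳ (p n))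

    private
      -- The recursion splits 2^Sₙ₊₁ qₙ₊₁ into odd times odd plus a term in qₙ₋₁. That second term
      -- must be known to be even: it is a power of 2 with exponent a sum of two adjacent `ex`,
      -- times an odd integer.
      OddPart : ℕ → Set
      OddPart n = (∃[ o ] Odd o × 2ℚ ^ S n * q n ≡ fromℤ o) ×
          (∃[ j ] 2ℚ ^ ex n * (2ℚ ^ S n * q⁻ n) ≡ fromℤ (+ 2 ℤ.* j))

      q-odd-parts : ∀ n → OddPart n
      q-odd-parts zero = (1ℤ , ∼-refl , trans (ℚ.*-identityˡ _) (sym fromℤ-1)) ,
        (0ℤ , trans (cong (2ℚ ^ ex 0 *_) (ℚ.*-zeroʳ 1ℚ)) (trans (ℚ.*-zeroʳ (2ℚ ^ ex 0)) (sym fromℤ-0)))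
      q-odd-parts (suc n) = next (q-odd-parts n) (odd-part n) (ℕ.m≤n⇒∃[o]m+o≡n (ex-adjacent n))
        where
        next : OddPart n → ∃[ o ] Odd o × 2ℚ ^ ex n * partial (suc n) ≡ fromℤ o →
            ∃[ k ] 1 ℕ.+ k ≡ ex n ℕ.+ ex (suc n) → OddPart (suc n)
        next ((o , odd-o , eq-o) , (j , eq-j)) (o′ , odd-o′ , eq-o′) (k , eq-k) =
          (o′ ℤ.* o ℤ.+ + 2 ℤ.* j , ∼-trans (∼-+ {y′ = 0ℤ} (∼-* odd-o′ odd-o)
              (congruent j (trans (ℤ.*-comm (+ 2) j) (sym (ℤ.+-identityˡ (j ℤ.* + 2)))))) ∼-refl ,
            (begin
              2ℚ ^ (S n ℕ.+ ex n) * q (suc n) ≡⟨ cong₂ _*_ (^-homo-* 2ℚ (S n) (ex n)) (q-suc n) ⟩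
              2ℚ ^ S n * 2ℚ ^ ex n * (partial (suc n) * q n + q⁻ n)
                ≡⟨ ℚS.solve 5 (λ s e b q q⁻ → s ⊗ e ⊗ (b ⊗ q ⊞ q⁻) ⊜ (e ⊗ b) ⊗ (s ⊗ q) ⊞ e ⊗ (s ⊗ q⁻))
                    refl (2ℚ ^ S n) (2ℚ ^ ex n) (partial (suc n)) (q n) (q⁻ n) ⟩
              2ℚ ^ ex n * partial (suc n) * (2ℚ ^ S n * q n) + 2ℚ ^ ex n * (2ℚ ^ S n * q⁻ n) ≡⟨ cong₂ _+_
                  (trans (cong₂ _*_ eq-o′ eq-o) (sym (fromℤ-* o′ o))) eq-j ⟩
              fromℤ (o′ ℤ.* o) + fromℤ (+ 2 ℤ.* j) ≡⟨ sym (fromℤ-+ (o′ ℤ.* o) (+ 2 ℤ.* j)) ⟩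
              fromℤ (o′ ℤ.* o ℤ.+ + 2 ℤ.* j) ∎)) ,
          (pow2 k ℤ.* o , (begin
              2ℚ ^ ex (suc n) * (2ℚ ^ (S n ℕ.+ ex n) * q⁻ (suc n)) ≡⟨ cong (2ℚ ^ ex (suc n) *_)
                  (cong₂ _*_ (^-homo-* 2ℚ (S n) (ex n)) (q⁻-suc n)) ⟩
              2ℚ ^ ex (suc n) * (2ℚ ^ S n * 2ℚ ^ ex n * q n) ≡⟨ ℚS.solve 4
                  (λ e s f q → e ⊗ (s ⊗ f ⊗ q) ⊜ (f ⊗ e) ⊗ (s ⊗ q)) refl (2ℚ ^ ex (suc n)) (2ℚ ^ S n)
                  (2ℚ ^ ex n) (q n) ⟩
              2ℚ ^ ex n * 2ℚ ^ ex (suc n) * (2ℚ ^ S n * q n) ≡⟨ cong₂ _*_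
                  (trans (sym (^-homo-* 2ℚ (ex n) (ex (suc n))))
                  (trans (cong (2ℚ ^_) (sym eq-k)) (sym (fromℤ-pow2 (suc k))))) eq-o ⟩
              fromℤ (pow2 (suc k)) * fromℤ o ≡⟨ sym (fromℤ-* (pow2 (suc k)) o) ⟩
              fromℤ (pow2 (suc k) ℤ.* o) ≡⟨ cong fromℤ
                  (trans (cong (ℤ._* o) (pow2-suc k)) (ℤ.*-assoc (+ 2) (pow2 k) o)) ⟩
              fromℤ (+ 2 ℤ.* (pow2 k ℤ.* o)) ∎))
          where open ≡-Reasoning

    q-odd : ∀ n → ∃[ o ] Odd o × 2ℚ ^ S n * q n ≡ fromℤ o
    q-odd n = proj₁ (q-odd-parts n)

    odd≢0 : ∀ {o} → Odd o → o ≢ 0ℤ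
    odd≢0 odd-o refl = 1≁0 (∼-sym odd-o)

    q≢0 : ∀ n → q n ≢ 0ℚ
    q≢0 n q≡0 = odd≢0 (proj₁ (proj₂ (q-odd n))) (fromℤ-injective (trans (sym (proj₂ (proj₂ (q-odd n))))
      (trans (cong (2ℚ ^ S n *_) q≡0) (trans (ℚ.*-zeroʳ (2ℚ ^ S n)) (sym fromℤ-0)))))

    Π A : ℕ → Carrier
    Π zero    = 1#
    Π (suc n) = Π n *ᴷ β n
    A zero    = 1#
    A (suc n) = A n *ᴷ complete (suc n)

    ΠA≈1 : ∀ n → Π n *ᴷ A n ≈ 1#
    ΠA≈1 zero = *-identityˡ 1#
    ΠA≈1 (suc n) = ≈-trans (solveᴷ 4 (λ a b c d → (a :* b) :* (c :* d) := (a :* c) :* (b :* d)) ≈-refl (Π n)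
        (β n) (A n) (complete (suc n)))
      (≈-trans (*-cong (ΠA≈1 n) (βα≈1 n)) (*-identityˡ 1#))

    sign : ℕ → Carrier
    sign zero    = 1#
    sign (suc n) = -ᴷ sign n

    sign-abs : ∀ n → Abs (sign n) 1ℚ
    sign-abs zero = abs-1
    sign-abs (suc n) = abs-neg (sign-abs n)

    D : ℕ → Carrier
    D n = ι (q n) *ᴷ α -ᴷ ι (p n)

    private
      D⁻ : ℕ → Carrier
      D⁻ n = ι (q⁻ n) *ᴷ α -ᴷ ι (p⁻ n)

      D-zero : D 0 ≈ β 0
      D-zero = +-cong (≈-trans (*-cong ι.1#-homo (≈-sym start)) (*-identityˡ _)) ≈-refl

      D⁻-zero : D⁻ 0 ≈ -ᴷ 1#
      D⁻-zero = ≈-trans (+-cong (≈-trans (*-cong ι.0#-homo ≈-refl) (zeroˡ α)) (-‿cong ι.1#-homo))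
          (+-identityˡ _)

      D-expand : ∀ n → D (suc n) ≈ ι (partial (suc n)) *ᴷ D n +ᴷ D⁻ n
      D-expand n = ≈-trans (+-cong (*-cong (≈-trans (ι.⟦⟧-cong (q-suc n))
          (≈-trans (ι.+-homo _ _) (+-cong (ι.*-homo _ _) ≈-refl))) ≈-refl)
          (-‿cong (≈-trans (ι.⟦⟧-cong (p-suc n)) (≈-trans (ι.+-homo _ _) (+-cong (ι.*-homo _ _) ≈-refl)))))
        (solveᴷ 6 (λ b q q⁻ p p⁻ a → (b :* q :+ q⁻) :* a :- (b :* p :+ p⁻) := b :* (q :* a :- p) :+
            (q⁻ :* a :- p⁻)) ≈-refl
          (ι (partial (suc n))) (ι (q n)) (ι (q⁻ n)) (ι (p n)) (ι (p⁻ n)) α)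

      -- Equivalently αₙ₊₁ = - D⁻ₙ / Dₙ. The two statements are proved together: this one at n + 1
      -- is `D-suc′` at n, since D⁻ₙ₊₁ = Dₙ, and `D-suc′` uses this one at n after inserting 1 =
      -- αₙ₊₁ βₙ.
      D-D⁻ : ∀ n → D n ≈ -ᴷ (β n *ᴷ D⁻ n)
      D-suc′ : ∀ n → D (suc n) ≈ -ᴷ (β (suc n) *ᴷ D n)

      D-D⁻ zero = ≈-trans D-zero (≈-trans (solveᴷ 1 (λ b → b := :- (b :* (:- con 1ℚ))) ≈-refl (β 0))
        (-‿cong (*-cong ≈-refl (≈-trans (-‿cong ι.1#-homo) (≈-sym D⁻-zero)))))
      D-D⁻ (suc n) = ≈-trans (D-suc′ n) (-‿cong
          (*-cong ≈-refl (+-cong (*-cong (ι.⟦⟧-cong (sym (q⁻-suc n))) ≈-refl)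
          (-‿cong (ι.⟦⟧-cong (sym (p⁻-suc n)))))))

      D-suc′ n = begin
        D (suc n) ≈⟨ D-expand n ⟩
        ι (partial (suc n)) *ᴷ D n +ᴷ D⁻ n ≈⟨ +-cong ≈-refl
            (≈-trans (≈-sym (*-identityˡ _)) (*-cong (≈-sym (step n)) ≈-refl)) ⟩
        ι (partial (suc n)) *ᴷ D n +ᴷ (complete (suc n) *ᴷ β n) *ᴷ D⁻ n
          ≈⟨ solveᴷ 5 (λ b d a c e → b :* d :+ (a :* c) :* e := b :* d :- a :* (:- (c :* e))) ≈-refl
              (ι (partial (suc n))) (D n) (complete (suc n)) (β n) (D⁻ n) ⟩
        ι (partial (suc n)) *ᴷ D n -ᴷ complete (suc n) *ᴷ (-ᴷ (β n *ᴷ D⁻ n)) ≈⟨ +-cong ≈-refl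
            (-‿cong (*-cong ≈-refl (≈-sym (D-D⁻ n)))) ⟩
        ι (partial (suc n)) *ᴷ D n -ᴷ complete (suc n) *ᴷ D n
          ≈⟨ solveᴷ 3 (λ b d a → b :* d :- a :* d := :- ((a :- b) :* d)) ≈-refl (ι (partial (suc n))) (D n)
              (complete (suc n)) ⟩
        -ᴷ (β (suc n) *ᴷ D n) ∎
        where open import Relation.Binary.Reasoning.Setoid setoid

    D-suc : ∀ n → D (suc n) ≈ -ᴷ (β (suc n) *ᴷ D n)
    D-suc = D-suc′

    D≈±Π : ∀ n → D n ≈ sign n *ᴷ Π (suc n)
    D≈±Π zero = ≈-trans D-zero (≈-trans (≈-sym (*-identityˡ _)) (≈-sym (*-cong ≈-refl (*-identityˡ _))))
    D≈±Π (suc n) = ≈-trans (D-suc n) (≈-trans (-‿cong (*-cong ≈-refl (D≈±Π n)))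
      (solveᴷ 3 (λ b s x → :- (b :* (s :* x)) := (:- s) :* (x :* b)) ≈-refl (β (suc n)) (sign n)
          (Π (suc n))))

    -- 2ᵉ α_{n+1} ∈ 1 + 2O for the exponent e of b_{n+1}
    β∈2^ex : ∀ n → In (ex n) (β n)
    β∈2^ex n = In-≈ rescale (subst (λ z → In z (ι (2ℚ ^ e) *ᴷ y)) (ℕ.+-identityʳ e)
        (In-* (In-2^ e) (In-unit yz z-1∈)))
      where
      e : ℕ
      e = ex n
      y z : Carrier
      y = ι (½ ^ e) *ᴷ β n
      z = ι (2ℚ ^ e) *ᴷ complete (suc n)
      2^½ : ι (2ℚ ^ e) *ᴷ ι (½ ^ e) ≈ 1#
      2^½ = ι-inverse (2^*½^ e)
      rescale : ι (2ℚ ^ e) *ᴷ y ≈ β n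
      rescale = ≈-trans (≈-sym (*-assoc _ _ _)) (≈-trans (*-cong 2^½ ≈-refl) (*-identityˡ _))
      yz : y *ᴷ z ≈ 1#
      yz = ≈-trans (solveᴷ 4 (λ h b t a → (h :* b) :* (t :* a) := (t :* h) :* (b :* a)) ≈-refl (ι (½ ^ e))
          (β n) (ι (2ℚ ^ e)) (complete (suc n)))
        (≈-trans (*-cong 2^½ (βα≈1 n)) (*-identityˡ _))
      o : ℤ
      o = proj₁ (odd-part n)
      -- For even n the exponent is positive; for odd n the remainder βₙ₊₁ has even index and lies
      -- in 2O itself.
      2^β∈ : ∀ {n} (v : HalfView n) → In 1 (ι (2ℚ ^ proj₁ (exponent-data v)) *ᴷ β (suc n))
      2^β∈ (even m) = In-weaken (proj₁ (exponent-even m))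
          (subst (λ z → In z (ι (2ℚ ^ suc (proj₁ (exponent-even m))) *ᴷ β (suc (twice m))))
        (trans (ℕ.+-identityʳ _) (ℕ.+-comm 1 (proj₁ (exponent-even m))))
            (In-* {suc (proj₁ (exponent-even m))} {0} (In-2^ _) (β∈O (suc (twice m)))))
      2^β∈ (odd m) = In-weaken (proj₁ (exponent-odd m))
          (In-* (In-2^ (proj₁ (exponent-odd m))) (β-even∈2O (suc m)))
      z-1∈ : In 1 (z -ᴷ 1#)
      z-1∈ = In-≈ (≈-trans (solveᴷ 3 (λ o x u → (o :- u) :+ x := (o :+ x) :- u) ≈-refl (ι (fromℤ o))
          (ι (2ℚ ^ e) *ᴷ β (suc n)) 1#)
          (+-cong (≈-trans (+-cong (≈-trans (ι.⟦⟧-cong (sym (proj₂ (proj₂ (odd-part n))))) (ι.*-homo _ _))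
              ≈-refl)
            (solveᴷ 3 (λ t b a → t :* b :+ t :* (a :- b) := t :* a) ≈-refl (ι (2ℚ ^ e))
                (ι (partial (suc n))) (complete (suc n)))) ≈-refl))
        (In-+ (odd-1∈2O (proj₁ (proj₂ (odd-part n)))) (2^β∈ (halfView n)))

    Π∈ : ∀ n → In (S n) (Π n)
    Π∈ zero = In-1
    Π∈ (suc n) = In-* (Π∈ n) (β∈2^ex n)

    1/q : ℕ → ℚ
    1/q n = (ℚ.1/ q n) {{ℚ.≢-nonZero (q≢0 n)}}

    q*1/q : ∀ n → q n * 1/q n ≡ 1ℚ
    q*1/q n = ℚ.*-inverseʳ (q n) {{ℚ.≢-nonZero (q≢0 n)}}

    error≈ : ∀ n → α -ᴷ ι (p n * 1/q n) ≈ D n *ᴷ ι (1/q n)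
    error≈ n = ≈-sym (≈-trans (solveᴷ 4 (λ q a p i → (q :* a :- p) :* i := (q :* i) :* a :- p :* i) ≈-refl
        (ι (q n)) α (ι (p n)) (ι (1/q n)))
      (+-cong (≈-trans (*-cong (ι-inverse (q*1/q n)) ≈-refl) (*-identityˡ α))
          (-‿cong (≈-sym (ι.*-homo _ _)))))

    -- One factor 2^Sₙ comes from Dₙ = ± β₀ ⋯ βₙ, the other from 1/qₙ, as 2^Sₙ qₙ is an odd integer
    -- and so a unit at 2.
    error∈ : ∀ n → In (S n ℕ.+ S n) (α -ᴷ ι (p n * 1/q n))
    error∈ n = In-≈ (≈-sym (error≈ n)) (In-* D∈ 1/q∈)
      where
      sign∈ : ∀ n → In 0 (sign n)
      sign∈ zero = In-1
      sign∈ (suc n) = In-neg (sign∈ n)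
      D∈ : In (S n) (D n)
      D∈ = In-≈ (≈-sym (D≈±Π n)) (In-* (sign∈ n)
          (subst (λ z → In z (Π (suc n))) (ℕ.+-identityʳ (S n)) (In-* (Π∈ n) (β∈O n))))
      o : ℤ
      o = proj₁ (q-odd n)
      y : Carrier
      y = ι (½ ^ S n) *ᴷ ι (1/q n)
      y∈ : In 0 y
      y∈ = In-odd-inverse (proj₁ (proj₂ (q-odd n)))
          (≈-trans (*-cong ≈-refl (≈-trans (ι.⟦⟧-cong (sym (proj₂ (proj₂ (q-odd n))))) (ι.*-homo _ _)))
        (≈-trans (solveᴷ 4 (λ h i t q → (h :* i) :* (t :* q) := (t :* h) :* (q :* i)) ≈-refl (ι (½ ^ S n))
            (ι (1/q n)) (ι (2ℚ ^ S n)) (ι (q n)))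
          (≈-trans (*-cong (ι-inverse (2^*½^ (S n))) (ι-inverse (q*1/q n))) (*-identityˡ _))))
      1/q∈ : In (S n) (ι (1/q n))
      1/q∈ = In-≈ (≈-trans (≈-sym (*-assoc _ _ _))
          (≈-trans (*-cong (ι-inverse (2^*½^ (S n))) ≈-refl) (*-identityˡ _)))
        (subst (λ z → In z (ι (2ℚ ^ S n) *ᴷ y)) (ℕ.+-identityʳ (S n)) (In-* (In-2^ (S n)) y∈))

  open Approximation

  -- Growth at the real place along the period

  module Growth where

    private
      s l pred-period : ℕ
      s = proj₁ eventually-periodic
      l = proj₁ (proj₂ eventually-periodic)
      pred-period = suc (twice l)

      period : ℕ
      period = suc pred-period

      partial-periodic : ∀ n → s ℕ.≤ n → partial (period ℕ.+ n) ≡ partial n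
      partial-periodic n s≤n = proj₁ (complete-cong (proj₂ (proj₂ eventually-periodic) n s≤n)
          (+twice-mod (suc l) n))

      β-periodic : ∀ n → s ℕ.≤ n → β (period ℕ.+ n) ≈ β n
      β-periodic n s≤n = +-cong (proj₂ (proj₂ eventually-periodic) n s≤n)
          (-‿cong (ι.⟦⟧-cong (partial-periodic n s≤n)))

      Contracting : ℚ → Set
      Contracting κ = 0ℚ ≤ κ × κ < 1ℚ

      -- The factors of 1 - βₙ² = (1 - βₙ)(1 + βₙ) are invertible, since βₙ = ±1 would make αₙ
      -- rational. An invertible 1 - βₙ² keeps ∣βₙ∣ at a positive distance from 1.
      β-contracting : ∀ n → ∃[ κ ] Contracting κ × Abs (β n) κ
      β-contracting n = reassoc (abs-below-1 {β n} {w₁ *ᴷ w₂} {1# -ᴷ β n *ᴷ β n}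
          (solveᴷ 2 (λ u b → (u :- b) :+ b := u) ≈-refl 1# (β n *ᴷ β n))
          (≈-trans (*-cong factored ≈-refl) (≈-trans
              (solveᴷ 4 (λ x y v w → (x :* y) :* (v :* w) := (x :* v) :* (y :* w)) ≈-refl (1# -ᴷ β n)
              (1# +ᴷ β n) w₁ w₂)
            (≈-trans (*-cong (proj₂ (inverse _ -≢0)) (proj₂ (inverse _ +≢0))) (*-identityˡ 1#))))
          (β-abs n))
        where
        reassoc : ∃[ κ ] 0ℚ ≤ κ × κ < 1ℚ × Abs (β n) κ → ∃[ κ ] Contracting κ × Abs (β n) κ
        reassoc (κ , x , y , z) = κ , (x , y) , z
        -≢0 : ¬ 1# -ᴷ β n ≈ 0#
        -≢0 h = complete∉ℚ n (1ℚ + partial n)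
            (≈-trans (solveᴷ 3 (λ u a b → a := (u :+ b) :- (u :- (a :- b))) ≈-refl 1# (complete n)
            (ι (partial n)))
          (≈-trans (+-cong (≈-trans (+-cong (≈-sym ι.1#-homo) ≈-refl) (≈-sym (ι.+-homo _ _))) (-‿cong h))
              (≈-trans (+-cong ≈-refl (-‿cong (≈-sym ι.0#-homo)))
            (solveᴷ 1 (λ x → x :- con 0ℚ := x) ≈-refl (ι (1ℚ + partial n))))))
        +≢0 : ¬ 1# +ᴷ β n ≈ 0#
        +≢0 h = complete∉ℚ n (partial n - 1ℚ)
            (≈-trans (solveᴷ 3 (λ u a b → a := (b :- u) :+ (u :+ (a :- b))) ≈-refl 1# (complete n)
            (ι (partial n)))
          (≈-trans (+-cong (≈-trans (+-cong ≈-refl (-‿cong (≈-sym ι.1#-homo)))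
              (≈-sym (≈-trans (ι.+-homo _ _) (+-cong ≈-refl (ι.-‿homo _))))) h) (+-identityʳ _)))
        w₁ w₂ : Carrier
        w₁ = proj₁ (inverse _ -≢0)
        w₂ = proj₁ (inverse _ +≢0)
        factored : 1# -ᴷ β n *ᴷ β n ≈ (1# -ᴷ β n) *ᴷ (1# +ᴷ β n)
        factored = ≈-trans (+-cong (≈-sym (*-identityˡ 1#)) ≈-refl)
          (solveᴷ 2 (λ u b → u :* u :- b :* b := (u :- b) :* (u :+ b)) ≈-refl 1# (β n))

      opaque
        -- Up to periodicity there are only finitely many βₙ, so the largest of their bounds serves
        -- for all.
        β-contracting-uniformly : ∃[ κ ] Contracting κ × (∀ n → Abs (β n) κ)
        β-contracting-uniformly = go (uniform-below {λ n κ → Abs (β n) κ} {Contracting}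
            (λ n → abs-mono) β-contracting (period ℕ.+ s))
          where
          go : ∃[ κ ] Contracting κ × (∀ n → n ℕ.< period ℕ.+ s → Abs (β n) κ) →
              ∃[ κ ] Contracting κ × (∀ n → Abs (β n) κ)
          go (κ , ok , h) = κ , ok , periodic-induction (λ n → Abs (β n) κ) s pred-period h
              (λ n s≤n → abs-≈ (≈-sym (β-periodic n s≤n)))

      κ : ℚ
      κ = proj₁ β-contracting-uniformly

      κ<1 : κ < 1ℚ
      κ<1 = proj₂ (proj₁ (proj₂ β-contracting-uniformly))

      β≤κ : ∀ n → Abs (β n) κ
      β≤κ = proj₂ (proj₂ β-contracting-uniformly)

      ββ : ∀ n → Abs (β n *ᴷ β (suc n)) (½ * κ)
      ββ n = go (halfView n)
        where
        go : ∀ {n} → HalfView n → Abs (β n *ᴷ β (suc n)) (½ * κ)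
        go (even m) = abs-mono (ℚ.≤-reflexive (ℚ.*-comm κ ½)) (abs-* (β≤κ (twice m)) (β-odd-abs m))
        go (odd m) = abs-* (β-odd-abs m) (β≤κ (suc (suc (twice m))))

      r y : ℕ → Carrier
      r n = ι (q n) *ᴷ Π n
      y n = A n *ᴷ ι (1/q n)

      ry≈1 : ∀ n → r n *ᴷ y n ≈ 1#
      ry≈1 n = ≈-trans (solveᴷ 4 (λ q p a i → (q :* p) :* (a :* i) := (q :* i) :* (p :* a)) ≈-refl (ι (q n))
          (Π n) (A n) (ι (1/q n)))
        (≈-trans (*-cong (ι-inverse (q*1/q n)) (ΠA≈1 n)) (*-identityˡ 1#))

      -- Multiplied by α₁ ⋯ αₙ₊₁ this is the classical identity qₙ αₙ₊₁ + qₙ₋₁ = α₁ ⋯ αₙ₊₁. In the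
      -- induction bₙ₊₁ is replaced by αₙ₊₁ - βₙ₊₁, and the terms with βₙ₊₁ cancel.
      r-q⁻ : ∀ n → r n +ᴷ ι (q⁻ n) *ᴷ Π (suc n) ≈ 1#
      r-q⁻ zero = ≈-trans (+-cong (≈-trans (*-identityʳ _) ι.1#-homo)
          (≈-trans (*-cong ι.0#-homo ≈-refl) (zeroˡ _))) (+-identityʳ 1#)
      r-q⁻ (suc n) = begin
        ι (q (suc n)) *ᴷ Π (suc n) +ᴷ ι (q⁻ (suc n)) *ᴷ Π (suc (suc n))
          ≈⟨ +-cong (*-cong (≈-trans (ι.⟦⟧-cong (q-suc n))
              (≈-trans (ι.+-homo _ _) (+-cong (ι.*-homo _ _) ≈-refl))) ≈-refl)
              (*-cong (ι.⟦⟧-cong (q⁻-suc n)) ≈-refl) ⟩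
        (ι (partial (suc n)) *ᴷ ι (q n) +ᴷ ι (q⁻ n)) *ᴷ (Π n *ᴷ β n) +ᴷ ι (q n) *ᴷ
            ((Π n *ᴷ β n) *ᴷ β (suc n))
          ≈⟨ solveᴷ 6 (λ b q q⁻ x c a → (b :* q :+ q⁻) :* (x :* c) :+ q :* ((x :* c) :* (a :- b)) := q :* x
              :* (a :* c) :+ q⁻ :* (x :* c)) ≈-refl
               (ι (partial (suc n))) (ι (q n)) (ι (q⁻ n)) (Π n) (β n) (complete (suc n)) ⟩
        ι (q n) *ᴷ Π n *ᴷ (complete (suc n) *ᴷ β n) +ᴷ ι (q⁻ n) *ᴷ Π (suc n) ≈⟨ +-cong
            (≈-trans (*-cong ≈-refl (step n)) (*-identityʳ _)) ≈-refl ⟩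
        r n +ᴷ ι (q⁻ n) *ᴷ Π (suc n) ≈⟨ r-q⁻ n ⟩
        1# ∎
        where open import Relation.Binary.Reasoning.Setoid setoid

      r-suc : ∀ n → r (suc n) +ᴷ r n *ᴷ (β n *ᴷ β (suc n)) ≈ 1#
      r-suc n = ≈-trans (+-cong ≈-refl (≈-trans
          (solveᴷ 4 (λ q x b c → q :* x :* (b :* c) := q :* (x :* b :* c)) ≈-refl (ι (q n)) (Π n) (β n)
          (β (suc n)))
        (*-cong (ι.⟦⟧-cong (sym (q⁻-suc n))) ≈-refl))) (r-q⁻ (suc n))

      2*½κ : 2ℚ * (½ * κ) ≡ κ
      2*½κ = ℚS.solve 1 (λ k → ℚS.con 2ℚ ⊗ (ℚS.con ½ ⊗ k) ⊜ k) refl κ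

      r≤2 : ∀ n → Abs (r n) 2ℚ
      r≤2 zero = abs-mono 1≤2ℚ (abs-≈ (≈-sym (≈-trans (*-identityʳ _) ι.1#-homo)) abs-1)
      r≤2 (suc n) = abs-mono (ℚ.+-monoʳ-≤ 1ℚ (ℚ.≤-trans (ℚ.≤-reflexive 2*½κ) (ℚ.<⇒≤ κ<1)))
        (abs-≈ (≈-trans (+-cong (≈-sym (r-suc n)) ≈-refl)
            (solveᴷ 2 (λ x y → x :+ y :- y := x) ≈-refl (r (suc n)) (r n *ᴷ (β n *ᴷ β (suc n)))))
          (abs-- abs-1 (abs-* (r≤2 n) (ββ n))))

      R : ℚ
      R = ∣ proj₁ (abs-complement-inverse κ<1) ∣ + proj₁ (abs-exists (y 0))

      -- By `r-suc`, rₙ₊₁ differs from 1 by at most 2 (κ/2) = κ < 1, so its inverse is bounded by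
      -- 1/(1 - κ). The index 0 is not reached by this recursion and adds its own summand to `R`.
      y≤R : ∀ n → Abs (y n) R
      y≤R zero = abs-mono (subst (_≤ R) (ℚ.+-identityˡ _)
          (ℚ.+-monoˡ-≤ (proj₁ (abs-exists (y 0))) (ℚ.0≤∣p∣ (proj₁ (abs-complement-inverse κ<1)))))
          (proj₂ (proj₂ (abs-exists (y 0))))
      y≤R (suc n) = abs-mono (ℚ.≤-trans (p≤∣p∣ _)
          (subst (_≤ R) (ℚ.+-identityʳ _) (ℚ.+-monoʳ-≤ ∣ proj₁
          (abs-complement-inverse κ<1) ∣ (ℚ.<⇒≤ (proj₁ (proj₂ (abs-exists (y 0))))))))
        (proj₂ (abs-complement-inverse κ<1) (r-suc n) (ry≈1 (suc n))
            (subst (Abs (r n *ᴷ (β n *ᴷ β (suc n)))) 2*½κ (abs-* (r≤2 n) (ββ n))))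

    error-abs : ∀ n → Abs (α -ᴷ ι (p n * 1/q n)) (2ℚ * (1/q n * 1/q n))
    error-abs n = abs-mono (ℚ.≤-reflexive (ℚS.solve 1
        (λ z → ℚS.con 1ℚ ⊗ ℚS.con 1ℚ ⊗ (ℚS.con 2ℚ ⊗ z) ⊜ ℚS.con 2ℚ ⊗ z) refl (1/q n * 1/q n)))
      (abs-≈ (≈-sym expanded) (abs-* (abs-* (sign-abs n) (β-abs n))
          (abs-* (r≤2 n) (abs-ι-nonneg (square-nonneg (1/q n))))))
      where
      expanded : α -ᴷ ι (p n * 1/q n) ≈ (sign n *ᴷ β n) *ᴷ (r n *ᴷ ι (1/q n * 1/q n))
      expanded = ≈-trans (error≈ n) (≈-trans (*-cong (D≈±Π n) ≈-refl) (≈-trans (≈-sym (*-identityˡ _))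
        (≈-trans (*-cong (≈-sym (ι-inverse (q*1/q n))) ≈-refl)
          (≈-trans (solveᴷ 5 (λ q i s x b → (q :* i) :* ((s :* (x :* b)) :* i) := (s :* b) :*
              ((q :* x) :* (i :* i))) ≈-refl (ι (q n)) (ι (1/q n)) (sign n) (Π n) (β n))
            (*-cong ≈-refl (*-cong ≈-refl (≈-sym (ι.*-homo _ _))))))))

    private
      -- `π` is the product of βₙ over the period that starts at `s`, and `η` is its inverse; ∣η∣ is
      -- Λ.
      π η : Carrier
      π = Π (period ℕ.+ s) *ᴷ A s
      η = A (period ℕ.+ s) *ᴷ Π s

      πη≈1 : π *ᴷ η ≈ 1#
      πη≈1 = ≈-trans (solveᴷ 4 (λ a b c d → (a :* b) :* (c :* d) := (a :* c) :* (d :* b)) ≈-refl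
          (Π (period ℕ.+ s)) (A s) (A (period ℕ.+ s)) (Π s))
        (≈-trans (*-cong (ΠA≈1 (period ℕ.+ s)) (ΠA≈1 s)) (*-identityˡ 1#))

      from-s : ∀ (T : ℕ → Set ℓ) → (∀ k → T (k ℕ.+ s)) → ∀ n → s ℕ.≤ n → T n
      from-s T h n s≤n = subst T (ℕ.m∸n+n≡m s≤n) (h (n ℕ.∸ s))

      Π-periodic : ∀ n → s ℕ.≤ n → Π (period ℕ.+ n) ≈ Π n *ᴷ π
      Π-periodic = from-s (λ n → Π (period ℕ.+ n) ≈ Π n *ᴷ π) go
        where
        go : ∀ k → Π (period ℕ.+ (k ℕ.+ s)) ≈ Π (k ℕ.+ s) *ᴷ π
        go zero = ≈-trans (≈-sym (*-identityʳ _))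
            (≈-trans (*-cong ≈-refl (≈-sym (ΠA≈1 s)))
            (solveᴷ 3 (λ x y z → x :* (y :* z) := y :* (x :* z)) ≈-refl (Π (period ℕ.+ s)) (Π s) (A s)))
        go (suc k) = subst (λ z → Π z ≈ Π (suc (k ℕ.+ s)) *ᴷ π) (sym (ℕ.+-suc period (k ℕ.+ s)))
          (≈-trans (*-cong (go k) (β-periodic (k ℕ.+ s) (ℕ.m≤n+m s k)))
              (solveᴷ 3 (λ x y z → (x :* y) :* z := (x :* z) :* y) ≈-refl (Π (k ℕ.+ s)) π (β (k ℕ.+ s))))

      A-periodic : ∀ n → s ℕ.≤ n → A (period ℕ.+ n) ≈ A n *ᴷ η
      A-periodic n s≤n = inverse-unique (ΠA≈1 (period ℕ.+ n)) (≈-trans (*-cong (Π-periodic n s≤n) ≈-refl)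
        (≈-trans (solveᴷ 4 (λ a b c d → (a :* b) :* (c :* d) := (a :* c) :* (b :* d)) ≈-refl (Π n) π
            (A n) η) (≈-trans (*-cong (ΠA≈1 n) πη≈1) (*-identityˡ 1#))))

      segment-abs : ∀ k → Abs (Π (k ℕ.+ s) *ᴷ A s) 1ℚ
      segment-abs zero = abs-≈ (≈-sym (ΠA≈1 s)) abs-1
      segment-abs (suc k) = abs-mono (ℚ.≤-reflexive (ℚ.*-identityˡ 1ℚ))
          (abs-≈ (solveᴷ 3 (λ x a b → (x :* a) :* b := (x :* b) :* a) ≈-refl (Π (k ℕ.+ s)) (A s)
          (β (k ℕ.+ s)))
        (abs-* (segment-abs k) (β-abs (k ℕ.+ s))))

      π≤½ : Abs π ½
      π≤½ = abs-mono bound (abs-≈ (solveᴷ 4 (λ x a b c → (x :* a) :* (b :* c) := ((x :* b) :* c) :* a)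
          ≈-refl (Π (twice l ℕ.+ s)) (A s) (β (twice l ℕ.+ s)) (β (suc (twice l ℕ.+ s))))
        (abs-* (segment-abs (twice l)) (ββ (twice l ℕ.+ s))))
        where
        bound : 1ℚ * (½ * κ) ≤ ½
        bound = ℚ.≤-trans (ℚ.≤-reflexive (ℚ.*-identityˡ (½ * κ)))
            (ℚ.≤-trans (ℚ.*-monoˡ-≤-nonNeg ½ (ℚ.<⇒≤ κ<1)) (ℚ.≤-reflexive (ℚ.*-identityʳ ½)))

      S-mono : ∀ k → S s ℕ.≤ S (k ℕ.+ s)
      S-mono zero = ℕ.≤-refl
      S-mono (suc k) = ℕ.≤-trans (S-mono k) (ℕ.m≤m+n _ _)

      e : ℕ
      e = S (period ℕ.+ s) ℕ.∸ S s

      1≤e : 1 ℕ.≤ e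
      1≤e = subst (ℕ._≤ e) (ℕ.m+n∸n≡m 1 (S s))
          (ℕ.∸-monoˡ-≤ (S s) (ℕ.≤-trans (ℕ.+-mono-≤ (ex-adjacent (twice l ℕ.+ s)) (S-mono (twice l)))
        (ℕ.≤-reflexive (trans (ℕ.+-comm _ (S (twice l ℕ.+ s))) (sym (ℕ.+-assoc (S (twice l ℕ.+ s)) _ _))))))

      ex-periodic : ∀ n → s ℕ.≤ n → ex (period ℕ.+ n) ≡ ex n
      ex-periodic n s≤n = exponent-injective (trans (sym (v₂-partial (period ℕ.+ n)))
          (trans (cong v₂ (subst (λ z → partial z ≡ partial (suc n)) (ℕ.+-suc period n)
        (partial-periodic (suc n) (ℕ.≤-trans s≤n (ℕ.n≤1+n n))))) (v₂-partial n)))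
        where
        exponent-injective : ∀ {a b} → _≡_ {A = ℤ ⁺} [ ℤ.- (+ a) ] [ ℤ.- (+ b) ] → a ≡ b
        exponent-injective eq = ℤ.+-injective (ℤ.neg-injective (unbox eq))
          where
          unbox : ∀ {x y : ℤ} → _≡_ {A = ℤ ⁺} [ x ] [ y ] → x ≡ y
          unbox refl = refl

      S-periodic : ∀ n → s ℕ.≤ n → S (period ℕ.+ n) ≡ e ℕ.+ S n
      S-periodic n s≤n = subst (λ n → S (period ℕ.+ n) ≡ e ℕ.+ S n) (ℕ.m∸n+n≡m s≤n) (go (n ℕ.∸ s))
        where
        go : ∀ k → S (period ℕ.+ (k ℕ.+ s)) ≡ e ℕ.+ S (k ℕ.+ s)
        go zero = sym (ℕ.m∸n+n≡m (S-mono period))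
        go (suc k) = subst (λ z → S z ≡ e ℕ.+ S (suc (k ℕ.+ s))) (sym (ℕ.+-suc period (k ℕ.+ s)))
          (trans (cong₂ ℕ._+_ (go k) (ex-periodic (k ℕ.+ s) (ℕ.m≤n+m s k)))
              (ℕ.+-assoc e (S (k ℕ.+ s)) (ex (k ℕ.+ s))))

      -- `k` counts periods. As `Abs` bounds only from above, the two-sided comparison of Πₙ with πᵏ
      -- is expressed by bounds on Πₙ ηᵏ and on its inverse Aₙ πᵏ.
      record Comparable (n : ℕ) (C : ℚ) : Set where
        constructor comparable
        field
          k : ℕ
          Π≤ : Abs (Π n *ᴷ η ^ᴷ k) C
          A≤ : Abs (A n *ᴷ π ^ᴷ k) C
          S≤ : 2ℚ ^ S n ≤ C * 2ℚ ^ (e ℕ.* k)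
          S≥ : 2ℚ ^ (e ℕ.* k) ≤ C * 2ℚ ^ S n

      comparable-mono : ∀ n {C C′} → C ≤ C′ → Comparable n C → Comparable n C′
      comparable-mono n C≤C′ (comparable k a b c d) = comparable k (abs-mono C≤C′ a) (abs-mono C≤C′ b)
        (ℚ.≤-trans c (*-monoʳ-≤ (ℚ.<⇒≤ (0<2^ (e ℕ.* k))) C≤C′))
        (ℚ.≤-trans d (*-monoʳ-≤ (ℚ.<⇒≤ (0<2^ (S n))) C≤C′))

      comparable-each : ∀ n → ∃[ C ] 1ℚ ≤ C × Comparable n C
      comparable-each n = C , ℚ.≤-trans 1≤2^S 2^S≤C , comparable 0
          (abs-mono cΠ≤C (abs-≈ (≈-sym (*-identityʳ _)) (proj₂ (proj₂ (abs-exists (Π n))))))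
          (abs-mono cA≤C (abs-≈ (≈-sym (*-identityʳ _)) (proj₂ (proj₂ (abs-exists (A n))))))
          (subst (2ℚ ^ S n ≤_) (sym (trans (cong (λ z → C * 2ℚ ^ z) (ℕ.*-zeroʳ e)) (ℚ.*-identityʳ C)))
              2^S≤C)
          (subst (λ z → 2ℚ ^ z ≤ C * 2ℚ ^ S n) (sym (ℕ.*-zeroʳ e))
              (*-mono-≤ 0≤1 0≤1 (ℚ.≤-trans 1≤2^S 2^S≤C) 1≤2^S))
        where
        cΠ cA C : ℚ
        cΠ = proj₁ (abs-exists (Π n))
        cA = proj₁ (abs-exists (A n))
        0≤cΠ = ℚ.<⇒≤ (proj₁ (proj₂ (abs-exists (Π n))))
        0≤cA = ℚ.<⇒≤ (proj₁ (proj₂ (abs-exists (A n))))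
        C = cΠ + cA + 2ℚ ^ S n
        1≤2^S : 1ℚ ≤ 2ℚ ^ S n
        1≤2^S = 1≤^ (S n) 1≤2ℚ
        0≤2^S = ℚ.<⇒≤ (0<2^ (S n))
        2^S≤C : 2ℚ ^ S n ≤ C
        2^S≤C = subst (_≤ C) (ℚ.+-identityˡ (2ℚ ^ S n)) (ℚ.+-monoˡ-≤ (2ℚ ^ S n) (ℚ.+-mono-≤ 0≤cΠ 0≤cA))
        cΠ≤C : cΠ ≤ C
        cΠ≤C = subst (_≤ C) (trans (ℚ.+-identityʳ (cΠ + 0ℚ)) (ℚ.+-identityʳ cΠ))
            (ℚ.+-mono-≤ (ℚ.+-monoʳ-≤ cΠ 0≤cA) 0≤2^S)
        cA≤C : cA ≤ C
        cA≤C = subst (_≤ C) (trans (ℚ.+-identityʳ (0ℚ + cA)) (ℚ.+-identityˡ cA))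
            (ℚ.+-mono-≤ (ℚ.+-monoˡ-≤ cA 0≤cΠ) 0≤2^S)

      -- A period multiplies Πₙ, Aₙ and 2^Sₙ by exactly π, η and 2ᵉ. Raising `k` by one cancels
      -- these factors, so `C` does not grow.
      comparable-next : ∀ C n → s ℕ.≤ n → Comparable n C → Comparable (period ℕ.+ n) C
      comparable-next C n s≤n (comparable k a b c d) = comparable (suc k)
          (abs-≈ (≈-sym (≈-trans (*-cong (Π-periodic n s≤n) ≈-refl) (shift (Π n) π η (η ^ᴷ k) πη≈1))) a)
          (abs-≈ (≈-sym (≈-trans (*-cong (A-periodic n s≤n) ≈-refl)
              (shift (A n) η π (π ^ᴷ k) (≈-trans (*-comm _ _) πη≈1)))) b)
          (subst₂ (λ x y → x ≤ C * y) (sym 2^S) (sym 2^ek)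
              (subst (2ℚ ^ e * 2ℚ ^ S n ≤_) (swap (2ℚ ^ e) C (2ℚ ^ (e ℕ.* k)))
              (*-monoˡ-≤ (ℚ.<⇒≤ (0<2^ e)) c)))
          (subst₂ (λ x y → x ≤ C * y) (sym 2^ek) (sym 2^S)
              (subst (2ℚ ^ e * 2ℚ ^ (e ℕ.* k) ≤_) (swap (2ℚ ^ e) C (2ℚ ^ S n))
              (*-monoˡ-≤ (ℚ.<⇒≤ (0<2^ e)) d)))
        where
        shift : ∀ w x x⁻ z → x *ᴷ x⁻ ≈ 1# → (w *ᴷ x) *ᴷ (x⁻ *ᴷ z) ≈ w *ᴷ z
        shift w x x⁻ z inv = ≈-trans (solveᴷ 4 (λ w x v z → (w :* x) :* (v :* z) := (x :* v) :* (w :* z))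
            ≈-refl w x x⁻ z) (≈-trans (*-cong inv ≈-refl) (*-identityˡ _))
        swap : ∀ x C y → x * (C * y) ≡ C * (x * y)
        swap = ℚS.solve 3 (λ x C y → x ⊗ (C ⊗ y) ⊜ C ⊗ (x ⊗ y)) refl
        2^S : 2ℚ ^ S (period ℕ.+ n) ≡ 2ℚ ^ e * 2ℚ ^ S n
        2^S = trans (cong (2ℚ ^_) (S-periodic n s≤n)) (^-homo-* 2ℚ e (S n))
        2^ek : 2ℚ ^ (e ℕ.* suc k) ≡ 2ℚ ^ e * 2ℚ ^ (e ℕ.* k)
        2^ek = trans (cong (2ℚ ^_) (ℕ.*-suc e k)) (^-homo-* 2ℚ e (e ℕ.* k))

      opaque
        comparison : ∃[ C ] 1ℚ ≤ C × (∀ n → Comparable n C)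
        comparison = go (uniform-below {Comparable} {1ℚ ≤_} comparable-mono comparable-each (period ℕ.+ s))
          where
          go : ∃[ C ] 1ℚ ≤ C × (∀ n → n ℕ.< period ℕ.+ s → Comparable n C) →
              ∃[ C ] 1ℚ ≤ C × (∀ n → Comparable n C)
          go (C , ok , h) = C , ok , periodic-induction (λ n → Comparable n C) s pred-period h
              (comparable-next C)

      ^-inverse : ∀ {x z} n → x *ᴷ z ≈ 1# → x ^ᴷ n *ᴷ z ^ᴷ n ≈ 1#
      ^-inverse zero inv = *-identityˡ 1#
      ^-inverse {x} {z} (suc n) inv = ≈-trans
          (solveᴷ 4 (λ a b c d → (a :* b) :* (c :* d) := (a :* c) :* (b :* d)) ≈-refl x (x ^ᴷ n) z (z ^ᴷ n))
        (≈-trans (*-cong inv (^-inverse n inv)) (*-identityˡ 1#))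

      abs-1⁻¹ : ∀ {x r} → x ≈ 1# → Abs x r → 1ℚ ≤ r
      abs-1⁻¹ x≈1 h = abs-ι⁻¹ (abs-≈ (≈-trans x≈1 (≈-sym ι.1#-homo)) h)

      -- From 1 = ∣xz∣ ≤ 2^(n-m). Every comparison of logarithms is obtained in this way, from upper
      -- bounds on an element and on its inverse.
      exponent-≤ : ∀ {x z} m n → x *ᴷ z ≈ 1# → Abs x (½ ^ m) → Abs z (2ℚ ^ n) → m ℕ.≤ n
      exponent-≤ m n inv x≤ z≤ = 1≤½^*2^⇒≤ m n (abs-1⁻¹ inv (abs-* x≤ z≤))

      opaque
        log : ∀ i → ∃[ a ] Abs (η ^ᴷ i) (2ℚ ^ (2 ℕ.+ a)) × Abs (π ^ᴷ i) (½ ^ a)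
        log i = abs-log₂ (≈-trans (*-comm _ _) (^-inverse i πη≈1)) (abs-mono (½^≤1 i) (abs-^ i π≤½))

      a : ℕ → ℕ
      a i = proj₁ (log i)

      η^≤ : ∀ i j → Abs ((η ^ᴷ i) ^ᴷ j) (2ℚ ^ ((2 ℕ.+ a i) ℕ.* j))
      η^≤ i j = subst (Abs _) (^-assocʳ 2ℚ (2 ℕ.+ a i) j) (abs-^ j (proj₁ (proj₂ (log i))))

      π^≤ : ∀ i j → Abs ((π ^ᴷ i) ^ᴷ j) (½ ^ (a i ℕ.* j))
      π^≤ i j = subst (Abs _) (^-assocʳ ½ (a i) j) (abs-^ j (proj₂ (proj₂ (log i))))

      ^-swap : ∀ x i j → (x ^ᴷ i) ^ᴷ j ≈ (x ^ᴷ j) ^ᴷ i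
      ^-swap x i j = ≈-trans (^ᴷ-assocʳ x i j)
          (≈-trans (≈-reflexive (cong (x ^ᴷ_) (ℕ.*-comm i j))) (≈-sym (^ᴷ-assocʳ x j i)))

      -- From Λ ≤ 2^(2 + a 1): the integer aᵢ is at most log₂ Λⁱ, hence at most i (2 + a 1).
      K₀ : ℕ
      K₀ = 2 ℕ.+ a 1

      C : ℚ
      C = proj₁ comparison

      1≤C : 1ℚ ≤ C
      1≤C = proj₁ (proj₂ comparison)

      0≤C : 0ℚ ≤ C
      0≤C = ℚ.≤-trans 0≤1 1≤C

      0≤R : 0ℚ ≤ R
      0≤R = abs-nonneg (y≤R 0)

      -- One constant for all estimates: 2 bounds ∣rₙ∣ in the upper bound for qₙ, and `R` bounds
      -- 1/∣rₙ∣ in the lower one.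
      C′ : ℚ
      C′ = C * (2ℚ + R)

      C≤C′ : C ≤ C′
      C≤C′ = subst (_≤ C′) (ℚ.*-identityʳ C) (*-monoˡ-≤ 0≤C
          (subst (_≤ 2ℚ + R) (ℚ.+-identityʳ 1ℚ) (ℚ.+-mono-≤ 1≤2ℚ 0≤R)))

      C*2≤C′ : C * 2ℚ ≤ C′
      C*2≤C′ = *-monoˡ-≤ 0≤C (subst (_≤ 2ℚ + R) (ℚ.+-identityʳ 2ℚ) (ℚ.+-monoʳ-≤ 2ℚ 0≤R))

      C*R≤C′ : C * R ≤ C′
      C*R≤C′ = *-monoˡ-≤ 0≤C (subst (_≤ 2ℚ + R) (ℚ.+-identityˡ R) (ℚ.+-monoˡ-≤ R (ℚ.<⇒≤ (0<2^ 1))))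

      ι-^ : ∀ r i → ι (r ^ i) ≈ ι r ^ᴷ i
      ι-^ r zero = ι.1#-homo
      ι-^ r (suc i) = ≈-trans (ι.*-homo _ _) (*-cong ≈-refl (ι-^ r i))

      module PowersOf (n : ℕ) where
        open Comparable (proj₂ (proj₂ comparison) n) public

        -- q = (A πᵏ) ηᵏ r
        upper : ∀ i → ∣ q n ^ i ∣ ≤ C′ ^ i * 2ℚ ^ ((2 ℕ.+ a i) ℕ.* k)
        upper i = ℚ.≤-trans (abs-ι⁻¹ (abs-≈ (≈-sym q^) (abs-* (abs-^ i (abs-* A≤ (r≤2 n))) (η^≤ i k))))
          (*-monoʳ-≤ (ℚ.<⇒≤ (0<2^ ((2 ℕ.+ a i) ℕ.* k))) (^-mono-≤ i (*-nonneg 0≤C (ℚ.<⇒≤ (0<2^ 1))) C*2≤C′))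
          where
          q≈ : ι (q n) ≈ ((A n *ᴷ π ^ᴷ k) *ᴷ r n) *ᴷ η ^ᴷ k
          q≈ = ≈-sym (≈-trans (solveᴷ 5 (λ a x q z h → ((a :* x) :* (q :* z)) :* h := ((z :* a) :* (x :* h))
              :* q) ≈-refl (A n) (π ^ᴷ k) (ι (q n)) (Π n) (η ^ᴷ k))
            (≈-trans (*-cong (≈-trans (*-cong (ΠA≈1 n) (^-inverse k πη≈1)) (*-identityˡ 1#)) ≈-refl)
                (*-identityˡ _)))
          q^ : ι (q n ^ i) ≈ ((A n *ᴷ π ^ᴷ k) *ᴷ r n) ^ᴷ i *ᴷ (η ^ᴷ i) ^ᴷ k
          q^ = ≈-trans (ι-^ (q n) i) (≈-trans (^ᴷ-congˡ i q≈)
              (≈-trans (^ᴷ-distrib-* _ _ i) (*-cong ≈-refl (^-swap η k i))))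

        -- 1 = q (Π ηᵏ) y πᵏ
        lower : ∀ i → 2ℚ ^ (a i ℕ.* k) ≤ C′ ^ i * ∣ q n ^ i ∣
        lower i = begin
          2ℚ ^ m ≡⟨ sym (ℚ.*-identityʳ (2ℚ ^ m)) ⟩
          2ℚ ^ m * 1ℚ ≤⟨ *-monoˡ-≤ (ℚ.<⇒≤ (0<2^ m))
            (abs-1⁻¹ one (abs-* (abs-* (abs-ι (q n ^ i)) (abs-^ i (abs-* Π≤ (y≤R n)))) (π^≤ i k))) ⟩
          2ℚ ^ m * (∣ q n ^ i ∣ * (C * R) ^ i * ½ ^ m)
            ≡⟨ ℚS.solve 4 (λ t h u v → t ⊗ (u ⊗ v ⊗ h) ⊜ (t ⊗ h) ⊗ (v ⊗ u)) refl (2ℚ ^ m)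
                (½ ^ m) ∣ q n ^ i ∣ ((C * R) ^ i) ⟩
          2ℚ ^ m * ½ ^ m * ((C * R) ^ i * ∣ q n ^ i ∣) ≡⟨ trans
              (cong (_* ((C * R) ^ i * ∣ q n ^ i ∣)) (2^*½^ m)) (ℚ.*-identityˡ _) ⟩
          (C * R) ^ i * ∣ q n ^ i ∣ ≤⟨ *-monoʳ-≤ (ℚ.0≤∣p∣ (q n ^ i))
              (^-mono-≤ i (*-nonneg 0≤C 0≤R) C*R≤C′) ⟩
          C′ ^ i * ∣ q n ^ i ∣ ∎
          where
          open ℚ.≤-Reasoning
          m : ℕ
          m = a i ℕ.* k
          one : (ι (q n ^ i) *ᴷ ((Π n *ᴷ η ^ᴷ k) *ᴷ y n) ^ᴷ i) *ᴷ (π ^ᴷ i) ^ᴷ k ≈ 1#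
          one = ≈-trans (*-cong (*-cong (ι-^ (q n) i) ≈-refl) (^-swap π i k))
              (≈-trans (*-cong (≈-sym (^ᴷ-distrib-* _ _ i)) ≈-refl) (≈-trans (≈-sym (^ᴷ-distrib-* _ _ i))
            (≈-trans (^ᴷ-congˡ i base) (unit i))))
            where
            base : (ι (q n) *ᴷ ((Π n *ᴷ η ^ᴷ k) *ᴷ y n)) *ᴷ π ^ᴷ k ≈ 1#
            base = ≈-trans (solveᴷ 5 (λ q x h y p → (q :* ((x :* h) :* y)) :* p := (p :* h) :*
                ((q :* x) :* y)) ≈-refl (ι (q n)) (Π n) (η ^ᴷ k) (y n) (π ^ᴷ k))
              (≈-trans (*-cong (^-inverse k πη≈1) (ry≈1 n)) (*-identityˡ 1#))
            unit : ∀ i → 1# ^ᴷ i ≈ 1#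
            unit zero = ≈-refl
            unit (suc i) = ≈-trans (*-identityˡ _) (unit i)

    opaque
      powerLaw : PowerLaw q S
      powerLaw = record
        { e = e ; K = K₀ ; a = a ; C = C′ ; 1≤e = 1≤e ; 1≤C = ℚ.≤-trans 1≤C C≤C′
        -- Both exponents approximate log₂ Λ^(ij), from below through π^(ij) and from above through
        -- its inverse.
        ; a-compare = λ i j → exponent-≤ (a i ℕ.* j) ((2 ℕ.+ a j) ℕ.* i)
            (≈-trans (*-cong (^-swap π i j) ≈-refl) (^-inverse i (^-inverse j πη≈1))) (π^≤ i j) (η^≤ j i)
        ; a-lower = λ i → exponent-≤ i (2 ℕ.+ a i) (^-inverse i πη≈1) (abs-^ i π≤½) (proj₁ (proj₂ (log i)))
        ; a-upper = λ i → exponent-≤ (a i) (K₀ ℕ.* i) (^-inverse i πη≈1) (proj₂ (proj₂ (log i)))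
            (abs-≈ (^ᴷ-congˡ i (*-identityʳ η)) (η^≤ 1 i))
        ; index = λ n → PowersOf.k n
        ; q-upper = PowersOf.upper
        ; q-lower = PowersOf.lower
        ; S-upper = λ n → ℚ.≤-trans (PowersOf.S≤ n) (*-monoʳ-≤ (ℚ.<⇒≤ (0<2^ (e ℕ.* PowersOf.k n))) C≤C′)
        ; S-lower = λ n → ℚ.≤-trans (PowersOf.S≥ n) (*-monoʳ-≤ (ℚ.<⇒≤ (0<2^ (S n))) C≤C′)
        }

  open Growth

  -- Normalised convergents and the conclusion

  module Approximability where
    open ValuationSum partial ex v₂-partial S refl (λ _ → refl) using (valuation-sum≡)

    private
      opaque
        exponents : ∃[ j ] (∀ n → valuation-sum n ≡ [ ℤ.- (+ (j ℕ.+ S n)) ])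
        exponents = valuation-sum≡

      j : ℕ
      j = proj₁ exponents

      2^-valuation : ∀ n → 2^- valuation-sum n ≡ 2ℚ ^ (j ℕ.+ S n)
      2^-valuation n = trans (cong 2^-_ (proj₂ exponents n)) (2^-neg (j ℕ.+ S n))

      q′≡ : ∀ n → q′ n ≡ 2ℚ ^ (j ℕ.+ S n) * q n
      q′≡ n = cong (_* q n) (2^-valuation n)

      ∣q′∣≡ : ∀ n → ∣ q′ n ∣ ≡ 2ℚ ^ (j ℕ.+ S n) * ∣ q n ∣
      ∣q′∣≡ n = trans (cong ∣_∣ (q′≡ n)) (trans (ℚ.∣p*q∣≡∣p∣*∣q∣ (2ℚ ^ (j ℕ.+ S n)) (q n))
          (cong (_* ∣ q n ∣) (ℚ.0≤p⇒∣p∣≡p (ℚ.<⇒≤ (0<2^ (j ℕ.+ S n))))))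

      -- q′ₙ is 2^j times the odd integer 2^Sₙ qₙ. Besides q′ₙ ≠ 0 this ensures that real powers of
      -- ∣q′ₙ∣ are formed without inverting the base.
      1≤∣q′∣ : ∀ n → 1ℚ ≤ ∣ q′ n ∣
      1≤∣q′∣ n = subst (1ℚ ≤_) (sym expand) (ℚ.≤-trans (ℚ.≤-reflexive (sym (ℚ.*-identityˡ 1ℚ)))
        (*-mono-≤ 0≤1 0≤1 (1≤^ j 1≤2ℚ) (1≤∣fromℤ∣ o (odd≢0 (proj₁ (proj₂ (q-odd n)))))))
        where
        o : ℤ
        o = proj₁ (q-odd n)
        expand : ∣ q′ n ∣ ≡ 2ℚ ^ j * ∣ fromℤ o ∣
        expand = trans (cong ∣_∣ (trans (q′≡ n)
            (trans (cong (_* q n) (^-homo-* 2ℚ j (S n)))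
            (trans (ℚ.*-assoc (2ℚ ^ j) (2ℚ ^ S n) (q n)) (cong (2ℚ ^ j *_) (proj₂ (proj₂ (q-odd n))))))))
          (trans (ℚ.∣p*q∣≡∣p∣*∣q∣ (2ℚ ^ j) (fromℤ o))
              (cong (_* ∣ fromℤ o ∣) (ℚ.0≤p⇒∣p∣≡p (ℚ.<⇒≤ (0<2^ j)))))

      quotient≡ : ∀ n .{{_ : ℚ.NonZero (q′ n)}} → p′ n ÷ q′ n ≡ p n * 1/q n
      quotient≡ n = begin
        X ≡⟨ sym (ℚ.*-identityʳ X) ⟩
        X * 1ℚ ≡⟨ cong (X *_) (sym (q*1/q n)) ⟩
        X * (q n * 1/q n) ≡⟨ sym (ℚ.*-assoc X (q n) (1/q n)) ⟩
        X * q n * 1/q n ≡⟨ cong (_* 1/q n) (*-cancelˡ (0<2^ (j ℕ.+ S n)) (begin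
          2ℚ ^ (j ℕ.+ S n) * (X * q n) ≡⟨ ℚS.solve 3 (λ s x q → s ⊗ (x ⊗ q) ⊜ x ⊗ (s ⊗ q))
              refl (2ℚ ^ (j ℕ.+ S n)) X (q n) ⟩
          X * (2ℚ ^ (j ℕ.+ S n) * q n) ≡⟨ cong (X *_) (sym (q′≡ n)) ⟩
          X * q′ n ≡⟨ trans (ℚ.*-assoc (p′ n) (ℚ.1/ q′ n) (q′ n))
              (trans (cong (p′ n *_) (ℚ.*-inverseˡ (q′ n))) (ℚ.*-identityʳ (p′ n))) ⟩
          p′ n ≡⟨ cong (_* p n) (2^-valuation n) ⟩
          2ℚ ^ (j ℕ.+ S n) * p n ∎)) ⟩
        p n * 1/q n ∎
        where
        open ≡-Reasoning
        X : ℚ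
        X = p′ n ÷ q′ n

    exponents-exist : ∃[ γ ] ∃[ C ] ∃[ C′ ]
        0ᴿ <ᴿ γ × γ <ᴿ 1ᴿ × 0ᴿ <ᴿ C × 0ᴿ <ᴿ C′ ×
        ∀ n → n > 0 → Σ[ nz ∈ NonZero (q′ n) ] let instance _ = nz in
          ∣ σ∞ α -ᴿ fromℚ (p′ n ÷ q′ n) ∣ᴿ ≤ᴿ C /∣ q′ n ∣^ (2ᴿ -ᴿ 2ᴿ *ᴿ γ) ×
          ∣ σ₂ α -₂ σ₂ (ι (p′ n ÷ q′ n)) ∣₂ ≤ᴿ C′ /∣ q′ n ∣^ (2ᴿ *ᴿ γ)
    exponents-exist = ApproximationExponents.approximation-exponents powerLaw j q′
      (λ n nz → ∣ σ∞ α -ᴿ fromℚ ((p′ n ÷ q′ n) {{nz}}) ∣ᴿ)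
          (λ n nz → ∣ σ₂ α -₂ σ₂ (ι ((p′ n ÷ q′ n) {{nz}})) ∣₂) 1/q q*1/q ∣q′∣≡ 1≤∣q′∣ real-error
          2-adic-error
      where
      real-error : ∀ n .(nz : NonZero (q′ n)) → ∣ σ∞ α -ᴿ fromℚ ((p′ n ÷ q′ n) {{nz}}) ∣ᴿ ≤ᴿ fromℚ
          (2ℚ * (1/q n * 1/q n))
      real-error n nz = subst (λ z → ∣ σ∞ α -ᴿ fromℚ z ∣ᴿ ≤ᴿ fromℚ (2ℚ * (1/q n * 1/q n)))
          (sym (quotient≡ n {{nz}})) (abs⇒≤ᴿ {α} {p n * 1/q n} (error-abs n))
      2-adic-error : ∀ n .(nz : NonZero (q′ n)) → ∣ σ₂ α -₂ σ₂ (ι ((p′ n ÷ q′ n) {{nz}})) ∣₂ ≤ᴿ fromℚ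
          (½ ^ (S n ℕ.+ S n))
      2-adic-error n nz = subst (λ z → ∣ σ₂ α -₂ σ₂ (ι z) ∣₂ ≤ᴿ fromℚ (½ ^ (S n ℕ.+ S n)))
          (sym (quotient≡ n {{nz}})) (In⇒norm≤ {α} {ι (p n * 1/q n)} (error∈ n))

corollary3p25 : ∀ {c ℓ} (K : QuadraticField c ℓ) → let open QuadraticField K in
  (σ∞ : Carrier → ℝ) → RingMorphisms.IsRingHomomorphism rawRing ℝ-rawRing σ∞ →
  (σ₂ : Carrier → ℚ₂) → RingMorphisms.IsRingHomomorphism rawRing ℚ₂-rawRing σ₂ →
  (α : Carrier) → (∀ r → ¬ α ≈ ι r) →
  (E : Algorithm.Expansion K σ∞ σ₂ α) → let open Algorithm.Expansion E in
  ∃[ γ ] ∃[ C ] ∃[ C′ ]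
    0ᴿ <ᴿ γ × γ <ᴿ 1ᴿ × 0ᴿ <ᴿ C × 0ᴿ <ᴿ C′ ×
    ∀ n → n > 0 → Σ[ nz ∈ NonZero (q′ n) ] let instance _ = nz in
      ∣ σ∞ α -ᴿ fromℚ (p′ n ÷ q′ n) ∣ᴿ ≤ᴿ C /∣ q′ n ∣^ (2ᴿ -ᴿ 2ᴿ *ᴿ γ) ×
      ∣ σ₂ α -₂ σ₂ (ι (p′ n ÷ q′ n)) ∣₂ ≤ᴿ C′ /∣ q′ n ∣^ (2ᴿ *ᴿ γ)
corollary3p25 K σ∞ σ∞-hom σ₂ σ₂-hom α α∉ℚ E = ExpansionLemmas.Approximability.exponents-exist K σ∞ σ∞-hom σ₂ σ₂-hom α α∉ℚ E
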